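{- For $n$ a positive integer and $N=2n+1$, \begin{equation*} \sum_{\boldsymbol{m}\in\mathbb N^{N-1}} \frac{q^{\frac{1}{2}\boldsymbol{m} C \boldsymbol{m}^t+|\boldsymbol{m}|_{ - }}}{(q)_{\boldsymbol{m}}} =\frac{1}{(q)_{\infty}^{2n^2+n}} \sum \chi(\boldsymbol{v}/\boldsymbol{\rho}^{\ast}) q^{\tfrac{||\boldsymbol{v}||^2-||\boldsymbol{\rho}^{\ast}+1||^2}{4(n+2)}}, \end{equation*} where the sum on the right is over $\boldsymbol{v}\in \mathbb Z^n$ such that $v_i\equiv \rho_i^{\ast}+1\pmod{2n+4}$.
   Context: Notation: $(a)_m=(a;q)_m=\prod_{i=1}^m(1-aq^{i-1})$ for $m\in\mathbb N\cup\{\infty\}$, $\mathbb N=\{0,1,2,\dots\}$; $(q)_{\boldsymbol{m}}=(q)_{m_1}\cdots(q)_{m_{N-1}}$. $C$ is the Cartan matrix of $\textup{A}_{N-1}$, so $\frac{1}{2}\boldsymbol{m} C\boldsymbol{m}^t=\sum_{i=1}^{N-1}m_i^2-\sum_{i=1}^{N-2}m_im_{i+1}$, and $|\boldsymbol{m}|_{ - }=\sum_{i=1}^{N-1}(-1)^{i-1}m_i$. $\boldsymbol{\rho}^{\ast}=(1,2,\dots,n)$, $\boldsymbol{\rho}^{\ast}+1=(2,3,\dots,n+1)$, $||\boldsymbol{v}||^2=v_1^2+\cdots+v_n^2$, and $\chi(\boldsymbol{v}/\boldsymbol{w})=\prod_{i=1}^n \frac{v_i}{w_i}\prod_{1\leq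 i<j\leq n} \frac{v_i^2-v_j^2}{w_i^2-w_j^2}$. -}

module Defs where

open import Data.Nat as ℕ using (ℕ; zero; suc; _∸_; _≤_)
open import Data.Nat.Divisibility using (_∣?_)
open import Data.Integer as ℤ using (ℤ; +_; -[1+_])
open import Data.Integer.DivMod using (_/ℕ_)
open import Data.Rational as ℚ using (ℚ; _/_)
open import Data.List using (List; []; _∷_; [_]; map; concatMap; foldr; upTo; zip)
open import Data.Vec using (Vec; toList) renaming ([] to []ᵥ; _∷_ to _∷ᵥ_)
open import Data.Bool using (if_then_else_)
open import Data.Product using (_×_; _,_; ∃-syntax)
open import Relation.Nullary.Decidable using (⌊_⌋)
open import Relation.Binary.PropositionalEquality using (_≡_)

-- Formal power series in q (coefficients in ℚ): PS = ℕ → ℚ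
-- Formal Laurent series in q: LS = ℤ → ℚ   (coefficient of q^k)

PS : Set
PS = ℕ → ℚ

LS : Set
LS = ℤ → ℚ

sumℚ : List ℚ → ℚ
sumℚ = foldr ℚ._+_ ℚ.0ℚ

prodℚ : List ℚ → ℚ
prodℚ = foldr ℚ._*_ ℚ.1ℚ

one : PS
one zero    = ℚ.1ℚ
one (suc _) = ℚ.0ℚ

_⊛_ : PS → PS → PS
(f ⊛ g) k = sumℚ (map (λ j → f j ℚ.* g (k ∸ j)) (upTo (suc k)))

_^ps_ : PS → ℕ → PS
f ^ps zero  = one
f ^ps suc M = f ⊛ (f ^ps M)

-- 1/(1 - q^i) = Σ_j q^(i j)  (used for i ≥ 1)
geom : ℕ → PS
geom i j = if ⌊ i ∣? j ⌋ then ℚ.1ℚ else ℚ.0ℚ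

invPoch : ℕ → PS
invPoch zero    = one
invPoch (suc m) = invPoch m ⊛ geom (suc m)

invPochVec : List ℕ → PS
invPochVec []       = one
invPochVec (m ∷ ms) = invPoch m ⊛ invPochVec ms

term : ℚ → ℤ → PS → LS
term c e f k with k ℤ.- e
... | + j      = c ℚ.* f j
... | -[1+ _ ] = ℚ.0ℚ

sumLS : List LS → LS
sumLS fs k = sumℚ (map (λ f → f k) fs)

boxℕ : (d B : ℕ) → List (Vec ℕ d)
boxℕ zero    B = [ []ᵥ ]
boxℕ (suc d) B = concatMap (λ x → map (x ∷ᵥ_) (boxℕ d B)) (upTo (suc B))

rangeℤ : ℕ → List ℤ
rangeℤ B = map (λ i → (+ i) ℤ.- (+ B)) (upTo (suc (B ℕ.+ B)))

boxℤ : (d B : ℕ) → List (Vec ℤ d)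
boxℤ zero    B = [ []ᵥ ]
boxℤ (suc d) B = concatMap (λ x → map (x ∷ᵥ_) (boxℤ d B)) (rangeℤ B)

sqSum : List ℤ → ℤ
sqSum = foldr (λ x s → x ℤ.* x ℤ.+ s) (+ 0)

adjSum : List ℤ → ℤ
adjSum (x ∷ y ∷ r) = x ℤ.* y ℤ.+ adjSum (y ∷ r)
adjSum _           = + 0

altSum : List ℤ → ℤ
altSum []      = + 0
altSum (x ∷ r) = x ℤ.- altSum r

-- ½ 𝐦 C 𝐦ᵗ + |𝐦|₋  for C the Cartan matrix of A_{N-1}
lhsExp : List ℕ → ℤ
lhsExp ms = let zs = map +_ ms in (sqSum zs ℤ.- adjSum zs) ℤ.+ altSum zs

lhsPartial : ℕ → ℕ → LS
lhsPartial n B =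
  sumLS (map (λ m → term ℚ.1ℚ (lhsExp (toList m)) (invPochVec (toList m)))
             (boxℕ (n ℕ.+ n) B))

-- a / b as a rational (b is always nonzero where used)
frac : ℤ → ℕ → ℚ
frac a zero    = ℚ.0ℚ
frac a (suc b) = a / suc b

-- χ(𝐯/𝛒*) for a list of pairs (ρ*_i , v_i), ρ*_i = i increasing:
--   ∏_i v_i/ρ_i · ∏_{i<j} (v_i² - v_j²)/(ρ_i² - ρ_j²)
-- (each pair factor written as (v_j² - v_i²)/(ρ_j² - ρ_i²), same value)
chi : List (ℕ × ℤ) → ℚ
chi []             = ℚ.1ℚ
chi ((r , v) ∷ rest) =
  frac v r ℚ.*
  (prodℚ (map (λ { (r' , v') → frac (v' ℤ.* v' ℤ.- v ℤ.* v) (r' ℕ.* r' ∸ r ℕ.* r) }) rest)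
   ℚ.* chi rest)

rhoStar : ℕ → List ℕ
rhoStar n = map suc (upTo n)

-- 𝐯 with v_i = (ρ*_i + 1) + (2n+4) k_i  — this parametrises exactly the
-- 𝐯 ∈ ℤⁿ with v_i ≡ ρ*_i + 1 (mod 2n+4)
vOf : (n : ℕ) → List ℤ → List ℤ
vOf n ks = Data.List.zipWith (λ r k → + suc r ℤ.+ (+ (2 ℕ.* n ℕ.+ 4)) ℤ.* k) (rhoStar n) ks

-- (‖𝐯‖² - ‖𝛒*+1‖²) / (4(n+2))   (the division is exact)
rhsExp : ℕ → List ℤ → ℤ
rhsExp n vs = (sqSum vs ℤ.- sqSum (map (λ r → + suc r) (rhoStar n))) /ℕ (4 ℕ.* (2 ℕ.+ n))

rhsPartial : ℕ → ℕ → LS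
rhsPartial n B =
  sumLS (map (λ k → let vs = vOf n (toList k) in
                    term (chi (zip (rhoStar n) vs)) (rhsExp n vs)
                         (invPoch B ^ps (2 ℕ.* n ℕ.* n ℕ.+ n)))
             (boxℤ n B))

SameLimit : (ℕ → LS) → (ℕ → LS) → Set
SameLimit A C = ∀ (k : ℤ) → ∃[ B₀ ] (∀ B → B₀ ≤ B → (A B k ≡ A B₀ k) × (C B k ≡ A B₀ k))

{-# OPTIONS --safe #-}

-- Put tri x = x (x - 1) / 2. The left-hand side is a sum over paths 0 = m₀, m₁, …, m₂ₙ, m₂ₙ₊₁ = 0 of the weights
-- ∏ q^tri(m_even - m_odd) / ∏ (q)_m over the edges and vertices. Big q-Hermite polynomials in y intertwine the two transfer
-- matrices, with infinite products as eigenvalues; by the Jacobi triple product the sum is (q)_∞^(-2n) times a coefficient of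
-- ϑ(y)^2n D(y), where ϑ(y) = Σ q^tri(k) y^k and D(y) = Σ (-1)^l q^tri(l) y^(2l).
--
-- The coefficients of that series are odd and quasi-periodic of period 2n+4 in the exponent, hence determined by n+1 of them,
-- c₁, …, c₍ₙ₊₁₎; its zero of order 2n+1 at y = -1 gives n linear relations between the c_j, with coefficients the odd moments
-- Σ v^(2i-1) q^(v²/4(n+2)) over v ≡ j. By Cramer's rule the sum on the right-hand side, over the classes 2, …, n+1, is
-- c₁ W / t, where t is the (2n+1)-st moment of the series and W is the analogous sum over all the classes 1, …, n+1. The next
-- moment relation and the heat equation turn into a first order differential equation for W, so that W is a multiple of
-- (q)_∞^((n+1)(2n+3)) (Macdonald's identity for C_{n+1}), while t is a power of (q)_∞^3 by Jacobi's identity.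
--
-- Everything takes place modulo q^N, where all the sums are finite.
module Submission where

open import Defs
open import Level using (0ℓ)
open import Algebra.Bundles using (CommutativeRing)
open import Data.Empty using (⊥-elim)
open import Data.Integer as ℤ using (ℤ; +_; -[1+_])
open import Data.Integer.DivMod using (_/ℕ_)
import Data.Integer.Properties as ℤ
open import Data.Integer.Tactic.RingSolver using (solve-∀)
open import Data.List using (List; []; _∷_; _++_; length; map; foldr; concatMap; upTo; applyUpTo; zipWith; zip)
open import Data.List.Membership.Propositional using (_∈_)
open import Data.List.Properties using (map-++; map-∘; map-cong)
open import Data.List.Relation.Unary.All using (All; []; _∷_)
open import Data.List.Relation.Unary.Any using (here; there)
open import Data.Maybe as Maybe using (Maybe)
open import Data.Nat as ℕ using (ℕ; zero; suc; z≤n; s≤s; _≤_; _!)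
open import Data.Nat.Divisibility using (_∣?_; ∣⇒≤; ∣m+n∣m⇒∣n; ∣m∣n⇒∣m+n; ∣-refl; _∣0)
import Data.Nat.DivMod as ℕ
import Data.Nat.Properties as ℕ
open import Data.Nat.Tactic.RingSolver using () renaming (solve-∀ to solveℕ-∀)
open import Data.Product using (_×_; _,_; ∃-syntax; proj₁; proj₂)
open import Data.Rational as ℚ using (ℚ)
import Data.Rational.Properties as ℚ
import Data.Rational.Unnormalised as ℚᵘ
import Data.Rational.Unnormalised.Properties as ℚᵘ
open import Data.Sum using (_⊎_; inj₁; inj₂)
open import Data.Vec using (Vec; toList) renaming (_∷_ to _∷ᵥ_)
import Data.Vec.Properties as Vec
open import Function using (_∘_; id)
open import Relation.Binary.PropositionalEquality as ≡ using (_≡_; _≢_)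
open import Relation.Nullary using (yes; no)
open import Relation.Nullary.Decidable using (dec⇒maybe)

-- Let V be the sum over the classes 2, ..., n+1. In V = ± c₁ W / t the factor c₁ is the left-hand
-- side times (q)_∞^(2n), while W and t carry the powers (n+1)(2n+3) and 3(2n+1); this leaves the
-- exponent 2n²+n. The zero at y = -1 has order 2n+1 because tri x = tri (1 - x) makes each of the
-- 2n factors ϑ, and D too, vanish there; the period 2n+4 is one for each ϑ and four for D. Oddness
-- kills the even moments, so the orders 1, 3, ..., 2n-1 give the n relations. No matrix is
-- inverted: an alternating sum in which a residue class is repeated is zero, and this replaces the
-- determinants. The obstacle is the division by c₁, which contains the unknown left-hand side; it
-- can be cancelled because its constant term, read off from the relation between c₁ W and t V, is a
-- nonzero rational. The differential equation determines W up to a constant, since the kernel of q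
-- d/dq consists of constants even modulo q^N; the constant is the value of the alternating product
-- at v = (1, ..., n+1).

module RingKit (R : CommutativeRing 0ℓ 0ℓ) where
  open CommutativeRing R public hiding (zero)
  open import Algebra.Properties.Ring ring public using (-‿distribˡ-*; -‿distribʳ-*; -0#≈0#; -‿involutive; -‿+-comm)
  open import Algebra.Properties.Semiring.Exp semiring public using (_^_; ^-homo-*)
  open import Relation.Binary.Reasoning.Setoid setoid public
  import Algebra.Solver.Ring as RingSolver
  import Algebra.Solver.Ring.AlmostCommutativeRing as ACR

  -- The integers inside a commutative ring.

  κℕ : ℕ → Carrier
  κℕ 0             = 0#
  -- With its own clause at 1, `κ (+ 1)` reduces to `1#`, as the homomorphism of the ring solver and
  -- its constants `con (+ 1)` require.
  κℕ 1             = 1#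
  κℕ (suc (suc n)) = 1# + κℕ (suc n)

  κℕ-suc : ∀ n → κℕ (suc n) ≈ 1# + κℕ n
  κℕ-suc zero    = sym (+-identityʳ 1#)
  κℕ-suc (suc n) = refl

  κℕ-+ : ∀ m n → κℕ (m ℕ.+ n) ≈ κℕ m + κℕ n
  κℕ-+ zero    n = sym (+-identityˡ _)
  κℕ-+ (suc m) n = begin
    κℕ (suc (m ℕ.+ n))    ≈⟨ κℕ-suc (m ℕ.+ n) ⟩
    1# + κℕ (m ℕ.+ n)     ≈⟨ +-congˡ (κℕ-+ m n) ⟩
    1# + (κℕ m + κℕ n)    ≈⟨ +-assoc _ _ _ ⟨
    1# + κℕ m + κℕ n      ≈⟨ +-congʳ (κℕ-suc m) ⟨
    κℕ (suc m) + κℕ n     ∎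

  κℕ-* : ∀ m n → κℕ (m ℕ.* n) ≈ κℕ m * κℕ n
  κℕ-* zero    n = sym (zeroˡ _)
  κℕ-* (suc m) n = begin
    κℕ (n ℕ.+ m ℕ.* n)      ≈⟨ κℕ-+ n (m ℕ.* n) ⟩
    κℕ n + κℕ (m ℕ.* n)     ≈⟨ +-cong (sym (*-identityˡ _)) (κℕ-* m n) ⟩
    1# * κℕ n + κℕ m * κℕ n ≈⟨ distribʳ _ _ _ ⟨
    (1# + κℕ m) * κℕ n      ≈⟨ *-congʳ (κℕ-suc m) ⟨
    κℕ (suc m) * κℕ n       ∎

  κ : ℤ → Carrier
  κ (+ n)     = κℕ n
  κ (-[1+ n ]) = - κℕ (suc n)

  κ-⊖ : ∀ m n → κ (m ℤ.⊖ n) ≈ κℕ m + - κℕ n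
  κ-⊖ m       zero    = sym (trans (+-congˡ -0#≈0#) (+-identityʳ _))
  κ-⊖ zero    (suc n) = sym (+-identityˡ _)
  κ-⊖ (suc m) (suc n) = begin
    κ (suc m ℤ.⊖ suc n)              ≡⟨ ≡.cong κ (ℤ.[1+m]⊖[1+n]≡m⊖n m n) ⟩
    κ (m ℤ.⊖ n)                      ≈⟨ κ-⊖ m n ⟩
    κℕ m + - κℕ n                    ≈⟨ +-congˡ (+-identityˡ _) ⟨
    κℕ m + (0# + - κℕ n)             ≈⟨ +-congˡ (+-congʳ (-‿inverseʳ 1#)) ⟨
    κℕ m + (1# + - 1# + - κℕ n)      ≈⟨ +-congˡ (+-assoc _ _ _) ⟩
    κℕ m + (1# + (- 1# + - κℕ n))    ≈⟨ +-assoc _ _ _ ⟨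
    κℕ m + 1# + (- 1# + - κℕ n)      ≈⟨ +-cong (+-comm _ _) (-‿+-comm _ _) ⟩
    1# + κℕ m + - (1# + κℕ n)        ≈⟨ +-cong (κℕ-suc m) (-‿cong (κℕ-suc n)) ⟨
    κℕ (suc m) + - κℕ (suc n)        ∎

  κ-neg : ∀ x → κ (ℤ.- x) ≈ - κ x
  κ-neg (+ zero)  = sym -0#≈0#
  κ-neg (+ suc n) = refl
  κ-neg -[1+ n ]  = sym (-‿involutive _)

  κ-+ : ∀ x y → κ (x ℤ.+ y) ≈ κ x + κ y
  κ-+ (+ m)    (+ n)    = κℕ-+ m n
  κ-+ (+ m)    -[1+ n ] = κ-⊖ m (suc n)
  κ-+ -[1+ m ] (+ n)    = trans (κ-⊖ n (suc m)) (+-comm _ _)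
  κ-+ -[1+ m ] -[1+ n ] = begin
    - κℕ (suc (suc (m ℕ.+ n)))    ≡⟨ ≡.cong (λ t → - κℕ (suc t)) (≡.sym (ℕ.+-suc m n)) ⟩
    - κℕ (suc m ℕ.+ suc n)        ≈⟨ -‿cong (κℕ-+ (suc m) (suc n)) ⟩
    - (κℕ (suc m) + κℕ (suc n))   ≈⟨ -‿+-comm _ _ ⟨
    - κℕ (suc m) + - κℕ (suc n)   ∎

  κ-+* : ∀ m y → κ (+ m ℤ.* y) ≈ κℕ m * κ y
  κ-+* zero    y = trans (reflexive (≡.cong κ (ℤ.*-zeroˡ y))) (sym (zeroˡ _))
  κ-+* (suc m) y = begin
    κ (+ suc m ℤ.* y)       ≡⟨ ≡.cong κ (ℤ.suc-* (+ m) y) ⟩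
    κ (y ℤ.+ + m ℤ.* y)     ≈⟨ κ-+ y (+ m ℤ.* y) ⟩
    κ y + κ (+ m ℤ.* y)     ≈⟨ +-cong (sym (*-identityˡ _)) (κ-+* m y) ⟩
    1# * κ y + κℕ m * κ y   ≈⟨ distribʳ _ _ _ ⟨
    (1# + κℕ m) * κ y       ≈⟨ *-congʳ (κℕ-suc m) ⟨
    κℕ (suc m) * κ y        ∎

  κ-* : ∀ x y → κ (x ℤ.* y) ≈ κ x * κ y
  κ-* (+ m)    y = κ-+* m y
  κ-* -[1+ m ] y = begin
    κ (-[1+ m ] ℤ.* y)       ≡⟨ ≡.cong κ (ℤ.neg-distribˡ-* (+ suc m) y) ⟨
    κ (ℤ.- (+ suc m ℤ.* y))  ≈⟨ κ-neg (+ suc m ℤ.* y) ⟩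
    - κ (+ suc m ℤ.* y)      ≈⟨ -‿cong (κ-+* (suc m) y) ⟩
    - (κℕ (suc m) * κ y)     ≈⟨ -‿distribˡ-* _ _ ⟩
    - κℕ (suc m) * κ y       ∎

  κ-morphism : ℤ.+-*-rawRing ACR.-Raw-AlmostCommutative⟶ ACR.fromCommutativeRing R
  κ-morphism = record { ⟦_⟧ = κ ; +-homo = κ-+ ; *-homo = κ-* ; -‿homo = κ-neg ; 0-homo = refl ; 1-homo = refl }

  κ-≟ : ∀ x y → Maybe (κ x ≈ κ y)
  κ-≟ x y = Maybe.map (λ e → reflexive (≡.cong κ e)) (dec⇒maybe (x ℤ.≟ y))

  open RingSolver ℤ.+-*-rawRing (ACR.fromCommutativeRing R) κ-morphism κ-≟ public
    using (solve; _:=_; con; _:+_; _:*_; _:-_; :-_; _:^_)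

  -- Finite sums.

  opaque
    Σ : ℕ → (ℕ → Carrier) → Carrier
    Σ zero    f = 0#
    Σ (suc n) f = f 0 + Σ n (λ i → f (suc i))

    Σ-cong< : ∀ n {f g} → (∀ i → i ℕ.< n → f i ≈ g i) → Σ n f ≈ Σ n g
    Σ-cong< zero    h = refl
    Σ-cong< (suc n) h = +-cong (h 0 (s≤s z≤n)) (Σ-cong< n (λ i p → h (suc i) (s≤s p)))

    Σ-cong : ∀ n {f g} → (∀ i → f i ≈ g i) → Σ n f ≈ Σ n g
    Σ-cong n h = Σ-cong< n (λ i _ → h i)

    Σ-0 : ∀ n {f} → (∀ i → i ℕ.< n → f i ≈ 0#) → Σ n f ≈ 0#
    Σ-0 zero    h = refl
    Σ-0 (suc n) h = trans (+-cong (h 0 (s≤s z≤n)) (Σ-0 n (λ i p → h (suc i) (s≤s p)))) (+-identityˡ _)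

    Σ-+ : ∀ n f g → Σ n (λ i → f i + g i) ≈ Σ n f + Σ n g
    Σ-+ zero    f g = sym (+-identityˡ _)
    Σ-+ (suc n) f g = trans (+-congˡ (Σ-+ n _ _))
      (solve 4 (λ a b c d → a :+ b :+ (c :+ d) := a :+ c :+ (b :+ d)) refl _ _ _ _)

    Σ-*ˡ : ∀ n x f → x * Σ n f ≈ Σ n (λ i → x * f i)
    Σ-*ˡ zero    x f = zeroʳ x
    Σ-*ˡ (suc n) x f = trans (distribˡ _ _ _) (+-congˡ (Σ-*ˡ n x _))

    Σ-*ʳ : ∀ n x f → Σ n f * x ≈ Σ n (λ i → f i * x)
    Σ-*ʳ n x f = trans (*-comm _ _) (trans (Σ-*ˡ n x f) (Σ-cong n (λ i → *-comm _ _)))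

    Σ-neg : ∀ n f → - Σ n f ≈ Σ n (λ i → - f i)
    Σ-neg zero    f = -0#≈0#
    Σ-neg (suc n) f = trans (sym (-‿+-comm _ _)) (+-congˡ (Σ-neg n _))

    Σ-last : ∀ n f → Σ (suc n) f ≈ Σ n f + f n
    Σ-last zero    f = +-comm _ _
    Σ-last (suc n) f = trans (+-congˡ (Σ-last n _)) (sym (+-assoc _ _ _))

    Σ-swap : ∀ m n (f : ℕ → ℕ → Carrier) → Σ m (λ i → Σ n (f i)) ≈ Σ n (λ j → Σ m (λ i → f i j))
    Σ-swap zero    n f = sym (Σ-0 n (λ _ _ → refl))
    Σ-swap (suc m) n f = trans (+-congˡ (Σ-swap m n _)) (sym (Σ-+ n _ _))

    Σ-split : ∀ m n f → Σ (m ℕ.+ n) f ≈ Σ m f + Σ n (λ i → f (m ℕ.+ i))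
    Σ-split zero    n f = sym (+-identityˡ _)
    Σ-split (suc m) n f = trans (+-congˡ (Σ-split m n _)) (sym (+-assoc _ _ _))

    Σ-rev : ∀ n f → Σ n f ≈ Σ n (λ i → f (n ℕ.∸ suc i))
    Σ-rev zero    f = refl
    Σ-rev (suc n) f = trans (Σ-last n f) (trans (+-comm _ _) (+-congˡ (Σ-rev n f)))

    Σ-trunc : ∀ {m n} f → m ℕ.≤ n → (∀ i → m ℕ.≤ i → f i ≈ 0#) → Σ n f ≈ Σ m f
    Σ-trunc {zero}  {n}     f _       h = Σ-0 n (λ i _ → h i z≤n)
    Σ-trunc {suc m} {suc n} f (s≤s l) h = +-congˡ (Σ-trunc _ l (λ i p → h (suc i) (s≤s p)))

    Σ-triangle : ∀ n (F : ℕ → ℕ → Carrier) →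
      Σ n (λ b → Σ (suc b) (λ i → F i (b ℕ.∸ i))) ≈ Σ n (λ i → Σ (n ℕ.∸ i) (F i))
    Σ-triangle zero    F = refl
    Σ-triangle (suc n) F = begin
      Σ (suc n) (λ b → F 0 b + Σ b (λ i → F (suc i) (b ℕ.∸ suc i)))
        ≈⟨ Σ-+ (suc n) (F 0) (λ b → Σ b (λ i → F (suc i) (b ℕ.∸ suc i))) ⟩
      Σ (suc n) (F 0) + (0# + Σ n (λ b → Σ (suc b) (λ i → F (suc i) (b ℕ.∸ i))))
        ≈⟨ +-congˡ (trans (+-identityˡ _) (Σ-triangle n (λ i → F (suc i)))) ⟩
      Σ (suc n) (F 0) + Σ n (λ i → Σ (n ℕ.∸ i) (F (suc i))) ∎

    Σ-block : ∀ m n f → Σ (m ℕ.* n) f ≈ Σ m (λ k → Σ n (λ j → f (k ℕ.* n ℕ.+ j)))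
    Σ-block zero    n f = refl
    Σ-block (suc m) n f = trans (Σ-split n (m ℕ.* n) f)
      (+-congˡ (trans (Σ-block m n _) (Σ-cong m (λ k → Σ-cong n (λ j → reflexive (≡.cong f (≡.sym (ℕ.+-assoc n (k ℕ.* n) j))))))))

    Σ-zero : ∀ f → Σ 0 f ≈ 0#
    Σ-zero f = refl

    Σ-suc : ∀ n f → Σ (suc n) f ≈ f 0 + Σ n (λ i → f (suc i))
    Σ-suc n f = refl

    Σ-one : ∀ f → Σ 1 f ≈ f 0
    Σ-one f = +-identityʳ _

-- Triangular numbers with integer index.

T : ℕ → ℕ
T zero    = 0
T (suc n) = suc n ℕ.+ T n

-- tri x = x (x - 1) / 2
tri : ℤ → ℕ
tri (+ zero)  = 0
tri (+ suc n) = T n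
tri -[1+ n ]  = T (suc n)

T-≥ : ∀ n → n ℕ.≤ T n
T-≥ zero    = z≤n
T-≥ (suc n) = ℕ.m≤m+n (suc n) (T n)

-- Growth at least linear in |x| makes `q^ tri x` vanish modulo q^N once |x| > N, so that all theta
-- sums become finite.
tri-≥ : ∀ x → ℤ.∣ x ∣ ℕ.≤ suc (tri x)
tri-≥ (+ zero)  = z≤n
tri-≥ (+ suc n) = s≤s (T-≥ n)
tri-≥ -[1+ n ]  = ℕ.≤-trans (T-≥ (suc n)) (ℕ.n≤1+n _)

tri-sucℕ : ∀ n → tri (+ suc n) ≡ n ℕ.+ tri (+ n)
tri-sucℕ zero    = ≡.refl
tri-sucℕ (suc n) = ≡.refl

tri-suc : ∀ x → + tri (x ℤ.+ + 1) ≡ + tri x ℤ.+ x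
tri-suc (+ n) = ≡.trans (≡.cong (λ t → + tri (+ t)) (ℕ.+-comm n 1))
                        (≡.cong +_ (≡.trans (tri-sucℕ n) (ℕ.+-comm n _)))
tri-suc -[1+ zero ]  = ≡.refl
tri-suc -[1+ suc n ] = l (+ T (suc n)) (+ suc (suc n))
  where
  l : ∀ a b → a ≡ b ℤ.+ a ℤ.- b
  l = solve-∀

ℤ-ind : (P : ℤ → Set) → P (+ 0) → (∀ x → P x → P (x ℤ.+ + 1)) → (∀ x → P (x ℤ.+ + 1) → P x) → ∀ x → P x
ℤ-ind P z f g (+ zero)     = z
ℤ-ind P z f g (+ suc n)    = ≡.subst P (≡.cong +_ (ℕ.+-comm n 1)) (f (+ n) (ℤ-ind P z f g (+ n)))
ℤ-ind P z f g -[1+ zero ]  = g -[1+ 0 ] z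
ℤ-ind P z f g -[1+ suc n ] = g -[1+ suc n ] (ℤ-ind P z f g -[1+ n ])

+ℤ-cancelʳ : ∀ c {x y} → x ℤ.+ c ≡ y ℤ.+ c → x ≡ y
+ℤ-cancelʳ c {x} {y} e = ≡.trans (l x c) (≡.trans (≡.cong (ℤ._- c) e) (≡.sym (l y c)))
  where
  l : ∀ x c → x ≡ x ℤ.+ c ℤ.- c
  l = solve-∀

tri-double : ∀ x → + 2 ℤ.* + tri x ≡ x ℤ.* x ℤ.- x
tri-double = ℤ-ind _ ≡.refl
  (λ x h → ≡.trans (≡.cong (+ 2 ℤ.*_) (tri-suc x)) (≡.trans (ℤ.*-distribˡ-+ (+ 2) (+ tri x) x)
             (≡.trans (≡.cong (ℤ._+ + 2 ℤ.* x) h) (l₁ x))))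
  (λ x h → +ℤ-cancelʳ (+ 2 ℤ.* x) (≡.trans (≡.sym (ℤ.*-distribˡ-+ (+ 2) (+ tri x) x))
             (≡.trans (≡.cong (+ 2 ℤ.*_) (≡.sym (tri-suc x))) (≡.trans h (≡.sym (l₁ x))))))
  where
  l₁ : ∀ x → x ℤ.* x ℤ.- x ℤ.+ + 2 ℤ.* x ≡ (x ℤ.+ + 1) ℤ.* (x ℤ.+ + 1) ℤ.- (x ℤ.+ + 1)
  l₁ = solve-∀

tri-unique : ∀ x n → + 2 ℤ.* + n ≡ x ℤ.* x ℤ.- x → tri x ≡ n
tri-unique x n h = ℤ.+-injective (ℤ.*-cancelˡ-≡ (+ 2) (+ tri x) (+ n) (≡.trans (tri-double x) (≡.sym h)))

-- The reflection exchanges the roots 0 and 1 of x (x - 1). The oddness of the sequences below, and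
-- with it their zeros at y = -1, comes from here.
tri-flip : ∀ x → tri (+ 1 ℤ.- x) ≡ tri x
tri-flip x = tri-unique (+ 1 ℤ.- x) (tri x) (≡.trans (tri-double x) (l x))
  where
  l : ∀ x → x ℤ.* x ℤ.- x ≡ (+ 1 ℤ.- x) ℤ.* (+ 1 ℤ.- x) ℤ.- (+ 1 ℤ.- x)
  l = solve-∀

tri-pred : ∀ x → + tri x ≡ + tri (x ℤ.- + 1) ℤ.+ (x ℤ.- + 1)
tri-pred x = ≡.trans (≡.cong (λ t → + tri t) (l x)) (tri-suc (x ℤ.- + 1))
  where
  l : ∀ x → x ≡ x ℤ.- + 1 ℤ.+ + 1
  l = solve-∀

-- Axioms of the coefficient ring.

-- A model of ℚ[[q]]/(q^N): u i stands for 1/(q)_i, D for q d/dq, and ε for the constant term.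
record QRing : Set₁ where
  field
    R : CommutativeRing 0ℓ 0ℓ
  open RingKit R public
  field
    q      : Carrier
    N      : ℕ
    q-nil  : q ^ N ≈ 0#
    u      : ℕ → Carrier
    u-zero : u 0 ≈ 1#
    u-suc  : ∀ i → (1# + - (q ^ suc i)) * u (suc i) ≈ u i
    κ-inv  : ∀ z → z ≢ + 0 → ∃[ y ] κ z * y ≈ 1#
    D      : Carrier → Carrier
    D-cong : ∀ {x y} → x ≈ y → D x ≈ D y
    D-+    : ∀ x y → D (x + y) ≈ D x + D y
    D-*    : ∀ x y → D (x * y) ≈ D x * y + x * D y
    D-q    : D q ≈ q
    ε      : Carrier → Carrier
    ε-cong : ∀ {x y} → x ≈ y → ε x ≈ ε y
    ε-+    : ∀ x y → ε (x + y) ≈ ε x + ε y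
    ε-*    : ∀ x y → ε (x * y) ≈ ε x * ε y
    ε-1    : ε 1# ≈ 1#
    ε-q    : ε q ≈ 0#
    D-ker  : ∀ {x} → D x ≈ 0# → x ≈ ε x
    ε-unit : ∀ {x y z} → ε x * y ≈ 1# → x * z ≈ 0# → z ≈ 0#

-- Powers of q and Euler's coefficients.

module Powers (Q : QRing) where
  open QRing Q public

  infix 9 q^_

  opaque
    q^_ : ℕ → Carrier
    q^ n = q ^ n

    q^0 : q^ 0 ≈ 1#
    q^0 = refl

    q^suc : ∀ n → q^ (suc n) ≈ q * q^ n
    q^suc n = refl

    q+ : ∀ a b {c} → c ≡ a ℕ.+ b → q^ c ≈ q^ a * q^ b
    q+ a b ≡.refl = ^-homo-* q a b

    q-big : ∀ e → N ℕ.≤ e → q^ e ≈ 0#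
    q-big e l = trans (q+ N (e ℕ.∸ N) (≡.sym (ℕ.m+[n∸m]≡n l))) (trans (*-congʳ q-nil) (zeroˡ _))

    u-step : ∀ i → (1# + - (q^ suc i)) * u (suc i) ≈ u i
    u-step = u-suc

  q≡ : ∀ {m n} → m ≡ n → q^ m ≈ q^ n
  q≡ e = reflexive (≡.cong q^_ e)

  qq : ∀ a b c d → a ℕ.+ b ≡ c ℕ.+ d → q^ a * q^ b ≈ q^ c * q^ d
  qq a b c d e = trans (sym (q+ a b ≡.refl)) (q+ c d e)

  opaque
    θ : ℤ → Carrier
    θ x = q^ tri x

    θ-def : ∀ x → θ x ≈ q^ tri x
    θ-def x = refl

  θ≡ : ∀ {x y} → x ≡ y → θ x ≈ θ y
  θ≡ e = reflexive (≡.cong θ e)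

  θ-big : ∀ x → N ℕ.< ℤ.∣ x ∣ → θ x ≈ 0#
  θ-big x l = trans (θ-def x) (q-big _ (ℕ.≤-pred (ℕ.≤-trans l (tri-≥ x))))

  θ-big* : ∀ x y → N ℕ.< ℤ.∣ x ∣ → θ x * y ≈ 0#
  θ-big* x y l = trans (*-congʳ (θ-big x l)) (zeroˡ y)

  θ-qq : ∀ a x b y → a ℕ.+ tri x ≡ b ℕ.+ tri y → q^ a * θ x ≈ q^ b * θ y
  θ-qq a x b y e = trans (*-congˡ (θ-def x)) (trans (qq a _ b _ e) (*-congˡ (sym (θ-def y))))

  θ-sucℕ : ∀ n → θ (+ suc n) ≈ q^ n * θ (+ n)
  θ-sucℕ n = trans (θ-def _) (trans (q+ n _ (tri-sucℕ n)) (*-congˡ (sym (θ-def _))))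

  1-q^0 : 1# + - (q^ 0) ≈ 0#
  1-q^0 = trans (+-congˡ (-‿cong q^0)) (-‿inverseʳ 1#)

  -- The factor 1 - q^i turns 1/(q)_i into 1/(q)_(i-1) and kills the term i = 0. Together with
  -- `split-1-q` this index shift produces most of the recurrences below.
  u-shift : ∀ n (g : ℕ → Carrier) → Σ (suc n) (λ i → (1# + - (q^ i)) * (u i * g i)) ≈ Σ n (λ i → u i * g (suc i))
  u-shift n g = trans (Σ-suc n _) (trans (+-cong (trans (*-congʳ 1-q^0) (zeroˡ _))
      (Σ-cong n (λ i → trans (sym (*-assoc _ _ _)) (*-congʳ (u-step i))))) (+-identityˡ _))

  -- Euler's coefficients: the series Σ `w c k` x^k is the product (-x q^c; q)_∞.
  w : ℕ → ℕ → Carrier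
  w c k = θ (+ (k ℕ.+ c)) * u k

  w-suc : ∀ c k → (1# + - (q^ suc k)) * w c (suc k) ≈ q^ (k ℕ.+ c) * w c k
  w-suc c k = begin
    (1# + - (q^ suc k)) * (θ (+ (suc k ℕ.+ c)) * u (suc k))
      ≈⟨ *-congˡ (*-congʳ (θ-sucℕ (k ℕ.+ c))) ⟩
    (1# + - (q^ suc k)) * (q^ (k ℕ.+ c) * θ (+ (k ℕ.+ c)) * u (suc k))
      ≈⟨ solve 4 (λ a b c d → a :* (b :* c :* d) := b :* (c :* (a :* d))) refl _ _ _ _ ⟩
    q^ (k ℕ.+ c) * (θ (+ (k ℕ.+ c)) * ((1# + - (q^ suc k)) * u (suc k)))
      ≈⟨ *-congˡ (*-congˡ (u-step k)) ⟩
    q^ (k ℕ.+ c) * w c k ∎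

  w-shift : ∀ c n (g : ℕ → Carrier) → Σ (suc n) (λ k → (1# + - (q^ k)) * (w c k * g k))
                    ≈ Σ n (λ k → q^ (k ℕ.+ c) * (w c k * g (suc k)))
  w-shift c n g = trans (Σ-suc n _) (trans (+-cong (trans (*-congʳ 1-q^0) (zeroˡ _))
      (Σ-cong n (λ k → trans (sym (*-assoc _ _ _)) (trans (*-congʳ (w-suc c k)) (*-assoc _ _ _))))) (+-identityˡ _))

  -- The two summands are chosen so that each lowers one index of a convolution over a + b = n.
  split-1-q : ∀ a b {n} → n ≡ a ℕ.+ b → ∀ x →
    (1# + - (q^ n)) * x ≈ (1# + - (q^ a)) * x + q^ a * ((1# + - (q^ b)) * x)
  split-1-q a b e x = trans (*-congʳ (+-congˡ (-‿cong (q+ a b e))))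
    (solve 3 (λ a b x → (con (+ 1) :- a :* b) :* x := (con (+ 1) :- a) :* x :+ a :* ((con (+ 1) :- b) :* x)) refl (q^ a) (q^ b) x)

-- Rogers-Szegő and big q-Hermite polynomials.

-- With y acting on sequences as the shift s ↦ s + 1, H m is the Rogers–Szegő polynomial Σ y^(i-j) / ((q)_i (q)_j)
-- over i + j = m, and G c b is a big q-Hermite polynomial divided by (q)_b.
module Hermite (Q : QRing) where
  open Powers Q public

  Seq : Set
  Seq = ℤ → Carrier

  H : Seq → ℕ → ℤ → Carrier
  H U m s = Σ (suc m) (λ i → u i * (u (m ℕ.∸ i) * U (s ℤ.+ (+ i ℤ.- + (m ℕ.∸ i)))))

  pre : (ℕ → ℤ → Carrier) → ℕ → ℤ → Carrier
  pre f zero    s = 0#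
  pre f (suc m) s = f m s

  -- The recurrence (1 - q^(m+1)) h_(m+1) = (y + 1/y) h_m - h_(m-1) of the continuous q-Hermite
  -- polynomials divided by (q)_m: `split-1-q` lets the factor act on i and on m + 1 - i separately.
  H-rec : ∀ U m s → (1# + - (q^ suc m)) * H U (suc m) s
        ≈ H U m (s ℤ.+ + 1) + H U m (s ℤ.- + 1) + - pre (H U) m s
  H-rec U m s = begin
    (1# + - (q^ n)) * Σ (suc n) t
      ≈⟨ Σ-*ˡ (suc n) _ t ⟩
    Σ (suc n) (λ i → (1# + - (q^ n)) * t i)
      ≈⟨ Σ-cong< (suc n) (λ i l → split-1-q i (n ℕ.∸ i) (≡.sym (ℕ.m+[n∸m]≡n (ℕ.≤-pred l))) (t i)) ⟩
    Σ (suc n) (λ i → (1# + - (q^ i)) * t i + q^ i * ((1# + - (q^ (n ℕ.∸ i))) * t i))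
      ≈⟨ Σ-+ (suc n) (λ i → (1# + - (q^ i)) * t i) _ ⟩
    Σ (suc n) (λ i → (1# + - (q^ i)) * t i) + Σ (suc n) B
      ≈⟨ +-cong partA partB ⟩
    H U m (s ℤ.+ + 1) + (H U m (s ℤ.- + 1) + - pre (H U) m s)
      ≈⟨ +-assoc _ _ _ ⟨
    H U m (s ℤ.+ + 1) + H U m (s ℤ.- + 1) + - pre (H U) m s ∎
    where
    n = suc m
    t : ℕ → Carrier
    t i = u i * (u (n ℕ.∸ i) * U (s ℤ.+ (+ i ℤ.- + (n ℕ.∸ i))))
    B : ℕ → Carrier
    B i = q^ i * ((1# + - (q^ (n ℕ.∸ i))) * t i)
    C : ℕ → Carrier
    C i = u i * (u (m ℕ.∸ i) * U (s ℤ.- + 1 ℤ.+ (+ i ℤ.- + (m ℕ.∸ i))))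
    l₁ : ∀ s i k → s ℤ.+ (+ 1 ℤ.+ i ℤ.- k) ≡ s ℤ.+ + 1 ℤ.+ (i ℤ.- k)
    l₁ = solve-∀
    l₂ : ∀ s i k → s ℤ.+ (i ℤ.- (+ 1 ℤ.+ k)) ≡ s ℤ.- + 1 ℤ.+ (i ℤ.- k)
    l₂ = solve-∀
    l₃ : ∀ s i k → s ℤ.- + 1 ℤ.+ (+ 1 ℤ.+ i ℤ.- k) ≡ s ℤ.+ (i ℤ.- k)
    l₃ = solve-∀
    partA : Σ (suc n) (λ i → (1# + - (q^ i)) * t i) ≈ H U m (s ℤ.+ + 1)
    partA = trans (u-shift n (λ i → u (n ℕ.∸ i) * U (s ℤ.+ (+ i ℤ.- + (n ℕ.∸ i)))))
      (Σ-cong n (λ i → *-congˡ (*-congˡ (reflexive (≡.cong U (l₁ s (+ i) (+ (m ℕ.∸ i))))))))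
    B≈ : ∀ i → i ℕ.< n → B i ≈ C i + - ((1# + - (q^ i)) * C i)
    B≈ i (s≤s l) rewrite ℕ.+-∸-assoc 1 l = begin
      q^ i * ((1# + - (q^ suc (m ℕ.∸ i))) * (u i * (u (suc (m ℕ.∸ i)) * U (s ℤ.+ (+ i ℤ.- + suc (m ℕ.∸ i))))))
        ≈⟨ solve 5 (λ a b c d e → a :* (b :* (c :* (d :* e))) := a :* (c :* ((b :* d) :* e))) refl _ _ _ _ _ ⟩
      q^ i * (u i * ((1# + - (q^ suc (m ℕ.∸ i))) * u (suc (m ℕ.∸ i)) * U (s ℤ.+ (+ i ℤ.- + suc (m ℕ.∸ i)))))
        ≈⟨ *-congˡ (*-congˡ (*-cong (u-step (m ℕ.∸ i)) (reflexive (≡.cong U (l₂ s (+ i) (+ (m ℕ.∸ i))))))) ⟩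
      q^ i * C i
        ≈⟨ solve 2 (λ a c → a :* c := c :- (con (+ 1) :- a) :* c) refl (q^ i) (C i) ⟩
      C i + - ((1# + - (q^ i)) * C i) ∎
    last0 : B n ≈ 0#
    last0 rewrite ℕ.n∸n≡0 m = trans (*-congˡ (trans (*-congʳ 1-q^0) (zeroˡ _))) (zeroʳ _)
    shiftC : ∀ m → Σ m (λ i → u i * (u (m ℕ.∸ suc i) * U (s ℤ.- + 1 ℤ.+ (+ suc i ℤ.- + (m ℕ.∸ suc i))))) ≈ pre (H U) m s
    shiftC zero    = Σ-zero _
    shiftC (suc m) = Σ-cong (suc m) (λ i → *-congˡ (*-congˡ (reflexive (≡.cong U (l₃ s (+ i) (+ (m ℕ.∸ i)))))))
    partB : Σ (suc n) B ≈ H U m (s ℤ.- + 1) + - pre (H U) m s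
    partB = begin
      Σ (suc n) B                                               ≈⟨ Σ-last n B ⟩
      Σ n B + B n                                               ≈⟨ trans (+-congˡ last0) (+-identityʳ _) ⟩
      Σ n B                                                     ≈⟨ Σ-cong< n B≈ ⟩
      Σ n (λ i → C i + - ((1# + - (q^ i)) * C i))              ≈⟨ Σ-+ n C _ ⟩
      Σ n C + Σ n (λ i → - ((1# + - (q^ i)) * C i))            ≈⟨ +-congˡ (Σ-neg n _) ⟨
      Σ n C + - Σ n (λ i → (1# + - (q^ i)) * C i)
        ≈⟨ +-congˡ (-‿cong (trans (u-shift m (λ i → u (m ℕ.∸ i) * U (s ℤ.- + 1 ℤ.+ (+ i ℤ.- + (m ℕ.∸ i))))) (shiftC m))) ⟩
      H U m (s ℤ.- + 1) + - pre (H U) m s ∎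

  G : ℕ → Seq → ℕ → ℤ → Carrier
  G c U b s = Σ (suc b) (λ k → w c k * H U (b ℕ.∸ k) s)

  -- The generating function Σ G_b t^b is (-q^c t)_∞ / ((ty)_∞ (t/y)_∞), so the parameter of the big
  -- q-Hermite polynomials is -q^c; it adds the term with q^(b+c) to `H-rec`.
  G-rec : ∀ c U b s → (1# + - (q^ suc b)) * G c U (suc b) s
        ≈ G c U b (s ℤ.+ + 1) + G c U b (s ℤ.- + 1) + q^ (b ℕ.+ c) * G c U b s + - pre (G c U) b s
  G-rec c U b s = begin
    (1# + - (q^ n)) * Σ (suc n) t
      ≈⟨ Σ-*ˡ (suc n) _ t ⟩
    Σ (suc n) (λ k → (1# + - (q^ n)) * t k)
      ≈⟨ Σ-cong< (suc n) (λ k l → split-1-q (n ℕ.∸ k) k (≡.sym (ℕ.m∸n+n≡m (ℕ.≤-pred l))) (t k)) ⟩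
    Σ (suc n) (λ k → A k + q^ (n ℕ.∸ k) * ((1# + - (q^ k)) * t k))
      ≈⟨ Σ-+ (suc n) A _ ⟩
    Σ (suc n) A + Σ (suc n) (λ k → q^ (n ℕ.∸ k) * ((1# + - (q^ k)) * t k))
      ≈⟨ +-cong partA partB ⟩
    G c U b (s ℤ.+ + 1) + G c U b (s ℤ.- + 1) + - pre (G c U) b s + q^ (b ℕ.+ c) * G c U b s
      ≈⟨ solve 3 (λ a b c → a :+ b :+ c := a :+ c :+ b) refl _ _ _ ⟩
    G c U b (s ℤ.+ + 1) + G c U b (s ℤ.- + 1) + q^ (b ℕ.+ c) * G c U b s + - pre (G c U) b s ∎
    where
    n = suc b
    t A : ℕ → Carrier
    t k = w c k * H U (n ℕ.∸ k) s
    A k = (1# + - (q^ (n ℕ.∸ k))) * t k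
    last0 : A n ≈ 0#
    last0 rewrite ℕ.n∸n≡0 b = trans (*-congʳ 1-q^0) (zeroˡ _)
    A≈ : ∀ k → k ℕ.< n → A k ≈ w c k * H U (b ℕ.∸ k) (s ℤ.+ + 1) + w c k * H U (b ℕ.∸ k) (s ℤ.- + 1) + - (w c k * pre (H U) (b ℕ.∸ k) s)
    A≈ k (s≤s l) rewrite ℕ.+-∸-assoc 1 l = begin
      (1# + - (q^ suc (b ℕ.∸ k))) * (w c k * H U (suc (b ℕ.∸ k)) s)
        ≈⟨ solve 3 (λ a b c → a :* (b :* c) := b :* (a :* c)) refl _ _ _ ⟩
      w c k * ((1# + - (q^ suc (b ℕ.∸ k))) * H U (suc (b ℕ.∸ k)) s)
        ≈⟨ *-congˡ (H-rec U (b ℕ.∸ k) s) ⟩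
      w c k * (H U (b ℕ.∸ k) (s ℤ.+ + 1) + H U (b ℕ.∸ k) (s ℤ.- + 1) + - pre (H U) (b ℕ.∸ k) s)
        ≈⟨ solve 4 (λ w x y z → w :* (x :+ y :- z) := w :* x :+ w :* y :- w :* z) refl _ _ _ _ ⟩
      w c k * H U (b ℕ.∸ k) (s ℤ.+ + 1) + w c k * H U (b ℕ.∸ k) (s ℤ.- + 1) + - (w c k * pre (H U) (b ℕ.∸ k) s) ∎
    pre≈ : ∀ b → Σ (suc b) (λ k → w c k * pre (H U) (b ℕ.∸ k) s) ≈ pre (G c U) b s
    pre≈ zero    = trans (Σ-one _) (zeroʳ _)
    pre≈ (suc b) = begin
      Σ (suc (suc b)) (λ k → w c k * pre (H U) (suc b ℕ.∸ k) s)
        ≈⟨ Σ-last (suc b) _ ⟩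
      Σ (suc b) (λ k → w c k * pre (H U) (suc b ℕ.∸ k) s) + w c (suc b) * pre (H U) (b ℕ.∸ b) s
        ≈⟨ +-cong (Σ-cong< (suc b) (λ { k (s≤s l) → *-congˡ (reflexive (≡.cong (λ m → pre (H U) m s) (ℕ.+-∸-assoc 1 l))) }))
                  (trans (*-congˡ (reflexive (≡.cong (λ m → pre (H U) m s) (ℕ.n∸n≡0 b)))) (zeroʳ _)) ⟩
      Σ (suc b) (λ k → w c k * H U (b ℕ.∸ k) s) + 0#
        ≈⟨ +-identityʳ _ ⟩
      G c U b s ∎
    partA : Σ (suc n) A ≈ G c U b (s ℤ.+ + 1) + G c U b (s ℤ.- + 1) + - pre (G c U) b s
    partA = begin
      Σ (suc n) A     ≈⟨ Σ-last n A ⟩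
      Σ n A + A n     ≈⟨ trans (+-congˡ last0) (+-identityʳ _) ⟩
      Σ n A           ≈⟨ Σ-cong< n A≈ ⟩
      Σ n (λ k → w c k * H U (b ℕ.∸ k) (s ℤ.+ + 1) + w c k * H U (b ℕ.∸ k) (s ℤ.- + 1) + - (w c k * pre (H U) (b ℕ.∸ k) s))
        ≈⟨ trans (Σ-+ n _ _) (+-cong (Σ-+ n _ _) (sym (Σ-neg n _))) ⟩
      G c U b (s ℤ.+ + 1) + G c U b (s ℤ.- + 1) + - Σ n (λ k → w c k * pre (H U) (b ℕ.∸ k) s)
        ≈⟨ +-congˡ (-‿cong (pre≈ b)) ⟩
      G c U b (s ℤ.+ + 1) + G c U b (s ℤ.- + 1) + - pre (G c U) b s ∎
    partB : Σ (suc n) (λ k → q^ (n ℕ.∸ k) * ((1# + - (q^ k)) * t k)) ≈ q^ (b ℕ.+ c) * G c U b s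
    partB = begin
      Σ (suc n) (λ k → q^ (n ℕ.∸ k) * ((1# + - (q^ k)) * t k))
        ≈⟨ Σ-cong (suc n) (λ k → solve 4 (λ a b c d → a :* (b :* (c :* d)) := b :* (c :* (a :* d))) refl _ _ _ _) ⟩
      Σ (suc n) (λ k → (1# + - (q^ k)) * (w c k * (q^ (n ℕ.∸ k) * H U (n ℕ.∸ k) s)))
        ≈⟨ w-shift c n (λ k → q^ (n ℕ.∸ k) * H U (n ℕ.∸ k) s) ⟩
      Σ n (λ k → q^ (k ℕ.+ c) * (w c k * (q^ (b ℕ.∸ k) * H U (b ℕ.∸ k) s)))
        ≈⟨ Σ-cong< n (λ { k (s≤s l) → trans
             (solve 4 (λ a b c d → a :* (b :* (c :* d)) := (a :* c) :* (b :* d)) refl _ _ _ _)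
             (*-congʳ (sym (q+ (k ℕ.+ c) (b ℕ.∸ k) (e k l)))) }) ⟩
      Σ n (λ k → q^ (b ℕ.+ c) * (w c k * H U (b ℕ.∸ k) s))
        ≈⟨ Σ-*ˡ n _ _ ⟨
      q^ (b ℕ.+ c) * G c U b s ∎
      where
      e : ∀ k → k ℕ.≤ b → b ℕ.+ c ≡ k ℕ.+ c ℕ.+ (b ℕ.∸ k)
      e k l = ≡.trans (≡.cong (ℕ._+ c) (≡.sym (ℕ.m+[n∸m]≡n l)))
        (≡.trans (ℕ.+-assoc k _ c) (≡.trans (≡.cong (k ℕ.+_) (ℕ.+-comm _ c)) (≡.sym (ℕ.+-assoc k c _))))

-- The q-Vandermonde sum.

pos-∸ : ∀ {m n} → n ℕ.≤ m → + (m ℕ.∸ n) ≡ + m ℤ.- + n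
pos-∸ {m} {n} h = ≡.sym (≡.trans (ℤ.m-n≡m⊖n m n) (ℤ.⊖-≥ h))

∣m-n∣-big : ∀ {N} m a → suc (a ℕ.+ N) ℕ.≤ m → N ℕ.< ℤ.∣ + m ℤ.- + a ∣
∣m-n∣-big {N} m a l = ≡.subst (λ t → N ℕ.< ℤ.∣ t ∣)
  (pos-∸ (ℕ.≤-trans (ℕ.≤-trans (ℕ.m≤m+n a N) (ℕ.n≤1+n _)) l))
  (ℕ.m+n≤o⇒m≤o∸n (suc N) (≡.subst (ℕ._≤ m) (≡.cong suc (ℕ.+-comm a N)) l))

-- Matches the exponents when a product of two Euler series is rewritten by `vandermonde`.
tri-add : ∀ z i j → tri (+ (z ℕ.+ (i ℕ.+ j))) ℕ.+ tri (+ z) ≡ i ℕ.* j ℕ.+ (tri (+ (z ℕ.+ i)) ℕ.+ tri (+ (z ℕ.+ j)))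
tri-add z i j = ℤ.+-injective (ℤ.*-cancelˡ-≡ (+ 2) _ _ (≡.trans (two (+ (z ℕ.+ (i ℕ.+ j))) (+ z)) (≡.trans
    (l (+ z) (+ i) (+ j)) (≡.sym (≡.trans (ℤ.*-distribˡ-+ (+ 2) (+ (i ℕ.* j)) (+ (tri (+ (z ℕ.+ i)) ℕ.+ tri (+ (z ℕ.+ j)))))
      (≡.cong₂ ℤ._+_ (≡.cong (+ 2 ℤ.*_) (ℤ.pos-* i j)) (two (+ (z ℕ.+ i)) (+ (z ℕ.+ j)))))))))
  where
  two : ∀ x y → + 2 ℤ.* + (tri x ℕ.+ tri y) ≡ (x ℤ.* x ℤ.- x) ℤ.+ (y ℤ.* y ℤ.- y)
  two x y = ≡.trans (ℤ.*-distribˡ-+ (+ 2) (+ tri x) (+ tri y)) (≡.cong₂ ℤ._+_ (tri-double x) (tri-double y))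
  l : ∀ z i j → ((z ℤ.+ (i ℤ.+ j)) ℤ.* (z ℤ.+ (i ℤ.+ j)) ℤ.- (z ℤ.+ (i ℤ.+ j))) ℤ.+ (z ℤ.* z ℤ.- z)
    ≡ + 2 ℤ.* (i ℤ.* j) ℤ.+ (((z ℤ.+ i) ℤ.* (z ℤ.+ i) ℤ.- (z ℤ.+ i)) ℤ.+ ((z ℤ.+ j) ℤ.* (z ℤ.+ j) ℤ.- (z ℤ.+ j)))
  l = solve-∀

module Vandermonde (Q : QRing) where
  open Hermite Q public

  p : ℕ → Carrier
  p zero    = 1#
  p (suc i) = p i * (1# + - (q^ suc i))

  p-u : ∀ i → p i * u i ≈ 1#
  p-u zero    = trans (*-identityˡ _) u-zero
  p-u (suc i) = trans (*-assoc _ _ _) (trans (*-congˡ (u-step i)) (p-u i))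

  *-cancel-unit : ∀ {a b x y} → a * b ≈ 1# → a * x ≈ a * y → x ≈ y
  *-cancel-unit {a} {b} {x} {y} h e = begin
    x            ≈⟨ *-identityˡ x ⟨
    1# * x       ≈⟨ *-congʳ h ⟨
    a * b * x    ≈⟨ solve 3 (λ a b x → a :* b :* x := b :* (a :* x)) refl a b x ⟩
    b * (a * x)  ≈⟨ *-congˡ e ⟩
    b * (a * y)  ≈⟨ solve 3 (λ a b x → b :* (a :* x) := a :* b :* x) refl a b y ⟩
    a * b * y    ≈⟨ *-congʳ h ⟩
    1# * y       ≈⟨ *-identityˡ y ⟩
    y            ∎

  1-q-cancel : ∀ i {x y} → (1# + - (q^ suc i)) * x ≈ (1# + - (q^ suc i)) * y → x ≈ y
  1-q-cancel i = *-cancel-unit {b = u (suc i) * p i}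
    (trans (sym (*-assoc _ _ _)) (trans (*-congʳ (u-step i)) (trans (*-comm _ _) (p-u i))))

  -- u (a ∸ k) when k ≤ a, and 0 otherwise
  uh : ℕ → ℕ → Carrier
  uh a       zero    = u a
  uh zero    (suc k) = 0#
  uh (suc a) (suc k) = uh a k

  uh-zero : ∀ a k → a ℕ.< k → uh a k ≈ 0#
  uh-zero zero    (suc k) _       = refl
  uh-zero (suc a) (suc k) (s≤s l) = uh-zero a k l

  uh-+ : ∀ k i → uh (k ℕ.+ i) k ≡ u i
  uh-+ zero    i = ≡.refl
  uh-+ (suc k) i = uh-+ k i

  uh-step : ∀ a k → k ℕ.≤ suc a → (1# + - (q^ (suc a ℕ.∸ k))) * uh (suc a) k ≈ uh a k
  uh-step a       zero          l             = u-step a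
  uh-step zero    (suc zero)    l             = trans (*-congʳ 1-q^0) (zeroˡ _)
  uh-step zero    (suc (suc k)) (s≤s ())
  uh-step (suc a) (suc k)       (s≤s l)       = uh-step a k l

  vt : ℕ → ℕ → ℕ → Carrier
  vt A B k = q^ ((A ℕ.∸ k) ℕ.* (B ℕ.∸ k)) * (uh A k * (uh B k * u k))

  -- Induction on A: 1 - q^(A+1) splits into 1 - q^(A+1-k), which lowers A, and 1 - q^k, which
  -- shifts k; the two results recombine into the sum for A.
  vandermonde′ : ∀ A B → Σ (suc A) (vt A B) ≈ u A * u B
  vandermonde′ zero    B = begin
    Σ 1 (vt 0 B)                   ≈⟨ Σ-one _ ⟩
    q^ 0 * (u 0 * (u B * u 0))     ≈⟨ *-cong q^0 (*-congˡ (trans (*-congˡ u-zero) (*-identityʳ _))) ⟩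
    1# * (u 0 * u B)               ≈⟨ *-identityˡ _ ⟩
    u 0 * u B                      ∎
  vandermonde′ (suc A) B = 1-q-cancel A (begin
    (1# + - (q^ suc A)) * Σ (suc (suc A)) (vt (suc A) B)
      ≈⟨ Σ-*ˡ (suc (suc A)) _ _ ⟩
    Σ (suc (suc A)) (λ k → (1# + - (q^ suc A)) * vt (suc A) B k)
      ≈⟨ Σ-cong< (suc (suc A)) (λ k l → trans
           (split-1-q (suc A ℕ.∸ k) k (≡.sym (ℕ.m∸n+n≡m (ℕ.≤-pred l))) (vt (suc A) B k))
           (+-cong (trans (solve 4 (λ a b c d → a :* (b :* (c :* d)) := b :* (a :* c :* d)) refl _ _ _ _)
                          (*-congˡ (*-congʳ (uh-step A k (ℕ.≤-pred l)))))
                   (solve 6 (λ a b c d e f → a :* (b :* (c :* (d :* (e :* f)))) := b :* (f :* (a :* c :* (d :* e)))) refl _ _ _ _ _ _))) ⟩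
    Σ (suc (suc A)) (λ k → F k + (1# + - (q^ k)) * (u k * g k))
      ≈⟨ Σ-+ (suc (suc A)) F _ ⟩
    Σ (suc (suc A)) F + Σ (suc (suc A)) (λ k → (1# + - (q^ k)) * (u k * g k))
      ≈⟨ +-cong (trans (Σ-last (suc A) F) (trans (+-congˡ F0) (+-identityʳ _))) (u-shift (suc A) g) ⟩
    Σ (suc A) F + Σ (suc A) (λ k → u k * g (suc k))
      ≈⟨ Σ-+ (suc A) F _ ⟨
    Σ (suc A) (λ k → F k + u k * g (suc k))
      ≈⟨ Σ-cong< (suc A) (λ k l → comb k (ℕ.≤-pred l)) ⟩
    Σ (suc A) (vt A B)
      ≈⟨ vandermonde′ A B ⟩
    u A * u B
      ≈⟨ *-congʳ (u-step A) ⟨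
    (1# + - (q^ suc A)) * u (suc A) * u B
      ≈⟨ *-assoc _ _ _ ⟩
    (1# + - (q^ suc A)) * (u (suc A) * u B) ∎)
    where
    F g : ℕ → Carrier
    F k = q^ ((suc A ℕ.∸ k) ℕ.* (B ℕ.∸ k)) * (uh A k * (uh B k * u k))
    g k = q^ (suc A ℕ.∸ k) * q^ ((suc A ℕ.∸ k) ℕ.* (B ℕ.∸ k)) * (uh (suc A) k * uh B k)
    F0 : F (suc A) ≈ 0#
    F0 = trans (*-congˡ (trans (*-congʳ (uh-zero A (suc A) ℕ.≤-refl)) (zeroˡ _))) (zeroʳ _)
    -- For k < B the two terms carry q^(B-k) and 1 - q^(B-k) and add up. For k ≥ B the second term
    -- is zero, and the exponents on both sides are 0 by truncated subtraction.
    comb : ∀ k → k ℕ.≤ A → F k + u k * g (suc k) ≈ vt A B k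
    comb k l with k ℕ.<? B
    ... | yes k<B = begin
      q^ ((suc A ℕ.∸ k) ℕ.* (B ℕ.∸ k)) * (uh A k * (uh B k * u k))
        + u k * (q^ (A ℕ.∸ k) * q^ ((A ℕ.∸ k) ℕ.* (B ℕ.∸ suc k)) * (uh A k * uh B (suc k)))
        ≈⟨ +-cong (*-congʳ (trans (q≡ (≡.cong₂ ℕ._*_ (ℕ.+-∸-assoc 1 l) B-k)) (q+ (suc β) (α ℕ.* suc β) ≡.refl)))
                  (*-congˡ (*-cong (sym (q+ α (α ℕ.* β) (ℕ.*-suc α β))) (*-congˡ (sym uB)))) ⟩
      q^ suc β * q^ (α ℕ.* suc β) * (uh A k * (uh B k * u k))
        + u k * (q^ (α ℕ.* suc β) * (uh A k * ((1# + - (q^ suc β)) * uh B k)))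
        ≈⟨ solve 5 (λ a b c d e → a :* b :* (c :* (d :* e)) :+ e :* (b :* (c :* ((con (+ 1) :- a) :* d))) := b :* (c :* (d :* e)))
             refl (q^ suc β) (q^ (α ℕ.* suc β)) (uh A k) (uh B k) (u k) ⟩
      q^ (α ℕ.* suc β) * (uh A k * (uh B k * u k))
        ≈⟨ *-congʳ (q≡ (≡.cong (α ℕ.*_) (≡.sym B-k))) ⟩
      vt A B k ∎
      where
      α = A ℕ.∸ k
      β = B ℕ.∸ suc k
      B-k : B ℕ.∸ k ≡ suc β
      B-k = ℕ.+-∸-assoc 1 k<B
      uhB : ∀ B k → k ℕ.< B → (1# + - (q^ suc (B ℕ.∸ suc k))) * uh B k ≈ uh B (suc k)
      uhB (suc B) zero    _       = u-step B
      uhB (suc B) (suc k) (s≤s l) = uhB B k l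
      uB = uhB B k k<B
    ... | no k≮B = begin
      q^ ((suc A ℕ.∸ k) ℕ.* (B ℕ.∸ k)) * (uh A k * (uh B k * u k))
        + u k * (q^ (A ℕ.∸ k) * q^ ((A ℕ.∸ k) ℕ.* (B ℕ.∸ suc k)) * (uh A k * uh B (suc k)))
        ≈⟨ +-cong (*-congʳ (q≡ (≡.trans (≡.cong ((suc A ℕ.∸ k) ℕ.*_) B-k) (ℕ.*-zeroʳ (suc A ℕ.∸ k)))))
                  (*-congˡ (*-congˡ (*-congˡ (uh-zero B (suc k) (s≤s B≤k))))) ⟩
      q^ 0 * (uh A k * (uh B k * u k))
        + u k * (q^ (A ℕ.∸ k) * q^ ((A ℕ.∸ k) ℕ.* (B ℕ.∸ suc k)) * (uh A k * 0#))
        ≈⟨ solve 5 (λ a b c d e → a :* b :+ c :* (d :* (e :* con (+ 0))) := a :* b) refl _ _ _ _ _ ⟩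
      q^ 0 * (uh A k * (uh B k * u k))
        ≈⟨ *-congʳ (q≡ (≡.sym (≡.trans (≡.cong ((A ℕ.∸ k) ℕ.*_) B-k) (ℕ.*-zeroʳ (A ℕ.∸ k))))) ⟩
      vt A B k ∎
      where
      B≤k = ℕ.≮⇒≥ k≮B
      B-k : B ℕ.∸ k ≡ 0
      B-k = ℕ.m≤n⇒m∸n≡0 B≤k

  vandermonde : ∀ L A B → A ℕ.< L → Σ L (vt A B) ≈ u A * u B
  vandermonde L A B l = trans (Σ-trunc (vt A B) l (λ k m → trans (*-congˡ (trans (*-congʳ (uh-zero A k m)) (zeroˡ _))) (zeroʳ _)))
                              (vandermonde′ A B)

-- The recurrence of the transfer matrices.

module Transfer (Q : QRing) where
  open Vandermonde Q public

  P P̄ : ℕ → ℕ → Seq → Seq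
  P L c U s = Σ L (λ A → w c A * U (s ℤ.+ + A))
  P̄ L c U s = Σ L (λ B → w c B * U (s ℤ.- + B))

  -- The transfer matrix between consecutive positions of a path: c = 1 goes from odd to even positions, c = 0 from even
  -- to odd ones, and c′ = 1 - c is the type of the polynomials in the image.
  X : ℕ → ℕ → Seq → ℤ → ℤ → Carrier
  X B c U a s = Σ B (λ b → θ (+ (b ℕ.+ c) ℤ.- a) * G c U b s)

  -- The kernel θ(b + c - a) trades q^(b+c) for q^a, and q^(a+c′) for q^b, at the cost of moving a
  -- by one. This turns the recurrence of `G c` in b into the one with parameter c′ in a. The bound
  -- on B makes the terms at the end of the box vanish.
  X-rec : ∀ B c c′ U a s → c ℕ.+ c′ ≡ 1 → suc (suc (a ℕ.+ N)) ℕ.≤ B →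
    X B c U (+ suc a) s ≈ X B c U (+ a) (s ℤ.+ + 1) + X B c U (+ a) (s ℤ.- + 1)
      + q^ (a ℕ.+ c′) * X B c U (+ a) s + - ((1# + - (q^ a)) * X B c U (+ a ℤ.- + 1) s)
  X-rec (suc B′) c c′ U a s cc (s≤s hB) = sym (begin
    Σ B (λ b → k b * G₊ b) + Σ B (λ b → k b * G₋ b) + q^ (a ℕ.+ c′) * Σ B (λ b → k b * G₀ b)
      + - ((1# + - (q^ a)) * Σ B (λ b → km b * G₀ b))
      ≈⟨ +-cong (+-cong (sym (Σ-+ B _ _)) (Σ-*ˡ B _ _)) (trans (-‿cong (Σ-*ˡ B _ _)) (Σ-neg B _)) ⟩
    Σ B (λ b → k b * G₊ b + k b * G₋ b) + Σ B (λ b → q^ (a ℕ.+ c′) * (k b * G₀ b))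
      + Σ B (λ b → - ((1# + - (q^ a)) * (km b * G₀ b)))
      ≈⟨ trans (+-congʳ (sym (Σ-+ B _ _))) (sym (Σ-+ B _ _)) ⟩
    Σ B (λ b → k b * G₊ b + k b * G₋ b + q^ (a ℕ.+ c′) * (k b * G₀ b) + - ((1# + - (q^ a)) * (km b * G₀ b)))
      ≈⟨ Σ-cong B term≈ ⟩
    Σ B (λ b → f (suc b) + k b * pre (G c U) b s + (q^ b * kp b + - km b) * G₀ b)
      ≈⟨ trans (Σ-+ B _ _) (+-congʳ (Σ-+ B _ _)) ⟩
    Σ B (λ b → f (suc b)) + Σ B (λ b → k b * pre (G c U) b s) + Σ B (λ b → (q^ b * kp b + - km b) * G₀ b)
      ≈⟨ +-congʳ (+-cong sum-f sum-pre) ⟩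
    Σ B f + Σ B (λ b → km b * G₀ b) + Σ B (λ b → (q^ b * kp b + - km b) * G₀ b)
      ≈⟨ trans (+-congʳ (sym (Σ-+ B _ _))) (sym (Σ-+ B _ _)) ⟩
    Σ B (λ b → f b + km b * G₀ b + (q^ b * kp b + - km b) * G₀ b)
      ≈⟨ Σ-cong B (λ b → solve 4 (λ x y z g → (con (+ 1) :- z) :* (x :* g) :+ y :* g :+ (z :* x :- y) :* g := x :* g) refl (kp b) (km b) (q^ b)
           (G₀ b)) ⟩
    Σ B (λ b → kp b * G₀ b) ∎)
    where
    B = suc B′
    k kp km G₊ G₋ G₀ f : ℕ → Carrier
    k b  = θ (+ (b ℕ.+ c) ℤ.- + a)
    kp b = θ (+ (b ℕ.+ c) ℤ.- + suc a)
    km b = θ (+ (b ℕ.+ c) ℤ.- (+ a ℤ.- + 1))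
    G₊ b = G c U b (s ℤ.+ + 1)
    G₋ b = G c U b (s ℤ.- + 1)
    G₀ b = G c U b s
    f b  = (1# + - (q^ b)) * (kp b * G₀ b)
    ix₁ : ∀ b c a → + 1 ℤ.+ (b ℤ.+ c) ℤ.- (+ 1 ℤ.+ a) ≡ b ℤ.+ c ℤ.- a
    ix₁ = solve-∀
    ix₂ : ∀ b c a → + 1 ℤ.+ (b ℤ.+ c) ℤ.- a ≡ b ℤ.+ c ℤ.- (a ℤ.- + 1)
    ix₂ = solve-∀
    kp-suc : ∀ b → kp (suc b) ≈ k b
    kp-suc b = θ≡ (ix₁ (+ b) (+ c) (+ a))
    k-suc : ∀ b → k (suc b) ≈ km b
    k-suc b = θ≡ (ix₂ (+ b) (+ c) (+ a))
    q-k : ∀ b → q^ (b ℕ.+ c) * k b ≈ q^ a * km b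
    q-k b = θ-qq (b ℕ.+ c) _ a _ (ℤ.+-injective (≡.sym (≡.trans (≡.cong (λ t → + a ℤ.+ t) (≡.trans
        (≡.cong (λ t → + tri t) (l₁ (+ b) (+ c) (+ a))) (tri-suc (+ (b ℕ.+ c) ℤ.- + a))))
        (l₂ (+ b) (+ c) (+ a) (+ tri (+ (b ℕ.+ c) ℤ.- + a))))))
      where
      l₁ : ∀ b c a → b ℤ.+ c ℤ.- (a ℤ.- + 1) ≡ b ℤ.+ c ℤ.- a ℤ.+ + 1
      l₁ = solve-∀
      l₂ : ∀ b c a t → a ℤ.+ (t ℤ.+ (b ℤ.+ c ℤ.- a)) ≡ b ℤ.+ c ℤ.+ t
      l₂ = solve-∀
    q-k′ : ∀ b → q^ (a ℕ.+ c′) * k b ≈ q^ b * kp b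
    q-k′ b = θ-qq (a ℕ.+ c′) _ b _ (ℤ.+-injective (≡.trans (≡.cong (λ t → + a ℤ.+ + c′ ℤ.+ t) (≡.trans
        (tri-pred (+ (b ℕ.+ c) ℤ.- + a)) (≡.cong (λ t → + tri t ℤ.+ (+ (b ℕ.+ c) ℤ.- + a ℤ.- + 1)) (l₁ (+ b) (+ c) (+ a)))))
        (≡.trans (l₂ (+ b) (+ c) (+ a) (+ c′) (+ tri (+ (b ℕ.+ c) ℤ.- + suc a)))
                 (≡.trans (≡.cong (λ t → + b ℤ.+ + tri (+ (b ℕ.+ c) ℤ.- + suc a) ℤ.+ (t ℤ.- + 1)) (≡.cong +_ cc)) (ℤ.+-identityʳ _)))))
      where
      l₁ : ∀ b c a → b ℤ.+ c ℤ.- a ℤ.- + 1 ≡ b ℤ.+ c ℤ.- (+ 1 ℤ.+ a)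
      l₁ = solve-∀
      l₂ : ∀ b c a c′ t → a ℤ.+ c′ ℤ.+ (t ℤ.+ (b ℤ.+ c ℤ.- a ℤ.- + 1)) ≡ b ℤ.+ t ℤ.+ (c ℤ.+ c′ ℤ.- + 1)
      l₂ = solve-∀
    term≈ : ∀ b → k b * G₊ b + k b * G₋ b + q^ (a ℕ.+ c′) * (k b * G₀ b) + - ((1# + - (q^ a)) * (km b * G₀ b))
               ≈ f (suc b) + k b * pre (G c U) b s + (q^ b * kp b + - km b) * G₀ b
    term≈ b = begin
      k b * G₊ b + k b * G₋ b + q^ (a ℕ.+ c′) * (k b * G₀ b) + - ((1# + - (q^ a)) * (km b * G₀ b))
        ≈⟨ solve 9 (λ k x y g z qq qb qa km →
             k :* x :+ k :* y :+ qq :* (k :* g) :- (con (+ 1) :- qa) :* (km :* g)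
             := k :* (x :+ y :+ qb :* g :- z) :- qb :* k :* g :+ k :* z :+ (qq :* k) :* g :- km :* g :+ qa :* km :* g)
             refl (k b) (G₊ b) (G₋ b) (G₀ b) (pre (G c U) b s) (q^ (a ℕ.+ c′)) (q^ (b ℕ.+ c)) (q^ a) (km b) ⟩
      k b * (G₊ b + G₋ b + q^ (b ℕ.+ c) * G₀ b + - pre (G c U) b s) + - (q^ (b ℕ.+ c) * k b * G₀ b) + k b * pre (G c U) b s
        + (q^ (a ℕ.+ c′) * k b) * G₀ b + - (km b * G₀ b) + q^ a * km b * G₀ b
        ≈⟨ +-cong (+-congʳ (+-cong (+-congʳ (+-cong (*-cong (sym (kp-suc b)) (sym (G-rec c U b s)))
             (-‿cong (*-congʳ (q-k b))))) (*-congʳ (q-k′ b)))) refl ⟩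
      kp (suc b) * ((1# + - (q^ suc b)) * G₀ (suc b)) + - (q^ a * km b * G₀ b) + k b * pre (G c U) b s
        + (q^ b * kp b) * G₀ b + - (km b * G₀ b) + q^ a * km b * G₀ b
        ≈⟨ solve 8 (λ k q g a m z x y → k :* (q :* g) :- a :* m :* z :+ x :+ y :* z :- m :* z :+ a :* m :* z := q :* (k :* g) :+ x :+ (y :- m) :* z)
             refl (kp (suc b)) (1# + - (q^ suc b)) (G₀ (suc b)) (q^ a) (km b) (G₀ b) (k b * pre (G c U) b s) (q^ b * kp b) ⟩
      f (suc b) + k b * pre (G c U) b s + (q^ b * kp b + - km b) * G₀ b ∎
    sum-f : Σ B (λ b → f (suc b)) ≈ Σ B f
    sum-f = begin
      Σ B (λ b → f (suc b))          ≈⟨ +-identityˡ _ ⟨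
      0# + Σ B (λ b → f (suc b))     ≈⟨ +-congʳ (trans (*-congʳ 1-q^0) (zeroˡ _)) ⟨
      f 0 + Σ B (λ b → f (suc b))    ≈⟨ Σ-suc B f ⟨
      Σ (suc B) f                    ≈⟨ Σ-last B f ⟩
      Σ B f + f B                    ≈⟨ +-congˡ (trans (*-congˡ (θ-big* _ _ (∣m-n∣-big (B ℕ.+ c) (suc a) (ℕ.≤-trans (s≤s hB) (ℕ.m≤m+n B c)))))
           (zeroʳ _)) ⟩
      Σ B f + 0#                     ≈⟨ +-identityʳ _ ⟩
      Σ B f                          ∎
    sum-pre : Σ B (λ b → k b * pre (G c U) b s) ≈ Σ B (λ b → km b * G₀ b)
    sum-pre = begin
      Σ B (λ b → k b * pre (G c U) b s)                   ≈⟨ Σ-suc B′ _ ⟩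
      k 0 * 0# + Σ B′ (λ b → k (suc b) * G₀ b)            ≈⟨ trans (+-congʳ (zeroʳ _)) (+-identityˡ _) ⟩
      Σ B′ (λ b → k (suc b) * G₀ b)                       ≈⟨ Σ-cong B′ (λ b → *-congʳ (k-suc b)) ⟩
      Σ B′ (λ b → km b * G₀ b)                            ≈⟨ +-identityʳ _ ⟨
      Σ B′ (λ b → km b * G₀ b) + 0#
        ≈⟨ +-congˡ (trans (*-congʳ (sym (k-suc B′))) (θ-big* _ _ (∣m-n∣-big (suc B′ ℕ.+ c) a (ℕ.≤-trans hB (ℕ.≤-trans (ℕ.n≤1+n B′)
             (ℕ.m≤m+n _ c)))))) ⟨
      Σ B′ (λ b → km b * G₀ b) + km B′ * G₀ B′            ≈⟨ Σ-last B′ _ ⟨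
      Σ B (λ b → km b * G₀ b)                             ∎

two-tri : ∀ x y → + 2 ℤ.* + (tri x ℕ.+ tri y) ≡ (x ℤ.* x ℤ.- x) ℤ.+ (y ℤ.* y ℤ.- y)
two-tri x y = ≡.trans (ℤ.*-distribˡ-+ (+ 2) (+ tri x) (+ tri y)) (≡.cong₂ ℤ._+_ (tri-double x) (tri-double y))

tri-two : ∀ x y z m n → (x ℤ.* x ℤ.- x) ℤ.+ (y ℤ.* y ℤ.- y) ≡ (z ℤ.* z ℤ.- z) ℤ.+ + 2 ℤ.* (+ m ℤ.* + n) →
  tri x ℕ.+ tri y ≡ tri z ℕ.+ m ℕ.* n
tri-two x y z m n e = ℤ.+-injective (ℤ.*-cancelˡ-≡ (+ 2) _ _ (≡.trans (two-tri x y) (≡.trans e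
  (≡.sym (≡.trans (ℤ.*-distribˡ-+ (+ 2) (+ tri z) (+ (m ℕ.* n))) (≡.cong₂ ℤ._+_ (tri-double z) (≡.cong (+ 2 ℤ.*_) (ℤ.pos-* m n))))))))

-- Eigenvalues of the transfer matrices.

module Theta (Q : QRing) where
  open Transfer Q public

  𝕃 : ℕ
  𝕃 = suc N

  Σ-drop : ∀ {k n} f → k ℕ.≤ n → (∀ i → i ℕ.< k → f i ≈ 0#) → Σ n f ≈ Σ (n ℕ.∸ k) (λ i → f (k ℕ.+ i))
  Σ-drop {k} {n} f l h = begin
    Σ n f                                          ≡⟨ ≡.cong (λ t → Σ t f) (≡.sym (ℕ.m+[n∸m]≡n l)) ⟩
    Σ (k ℕ.+ (n ℕ.∸ k)) f                          ≈⟨ Σ-split k (n ℕ.∸ k) f ⟩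
    Σ k f + Σ (n ℕ.∸ k) (λ i → f (k ℕ.+ i))        ≈⟨ trans (+-congʳ (Σ-0 k h)) (+-identityˡ _) ⟩
    Σ (n ℕ.∸ k) (λ i → f (k ℕ.+ i))                ∎

  -- Both sides become one sum over k, i, j with b = k + i + j. On the left `G` and `H` are
  -- expanded; on the right A = k + i and B = k + j, where `vandermonde` splits 1/((q)_A (q)_B) and
  -- `tri-add` matches the powers of q. In terms of y the value is (-q^c y)_∞ (-q^c / y)_∞.
  X-zero : ∀ L c U s → N ℕ.< L → X L c U (+ 0) s ≈ P L c (P̄ L c U) s
  X-zero L c U s hL = trans lhs (sym rhs)
    where
    r : ℕ → ℕ → ℕ → Carrier
    r k i j = θ (+ (k ℕ.+ (i ℕ.+ j) ℕ.+ c)) * (w c k * (u i * (u j * U (s ℤ.+ (+ i ℤ.- + j)))))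
    F : ℕ → ℕ → Carrier
    F k m = θ (+ (k ℕ.+ m ℕ.+ c)) * (w c k * H U m s)
    F≈ : ∀ k → Σ (L ℕ.∸ k) (F k) ≈ Σ (L ℕ.∸ k) (λ i → Σ (L ℕ.∸ k) (r k i))
    F≈ k = begin
      Σ (L ℕ.∸ k) (F k)
        ≈⟨ Σ-cong (L ℕ.∸ k) (λ m → trans (*-congˡ (Σ-*ˡ (suc m) _ _)) (Σ-*ˡ (suc m) _ _)) ⟩
      Σ (L ℕ.∸ k) (λ m → Σ (suc m) (λ i → θ (+ (k ℕ.+ m ℕ.+ c)) * (w c k * (u i * (u (m ℕ.∸ i) * U (s ℤ.+ (+ i ℤ.- + (m ℕ.∸ i))))))))
        ≈⟨ Σ-cong (L ℕ.∸ k) (λ m → Σ-cong< (suc m) (λ { i (s≤s l) →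
             *-congʳ (θ≡ (≡.cong (λ t → + (k ℕ.+ t ℕ.+ c)) (≡.sym (ℕ.m+[n∸m]≡n l)))) })) ⟩
      Σ (L ℕ.∸ k) (λ m → Σ (suc m) (λ i → r k i (m ℕ.∸ i)))
        ≈⟨ Σ-triangle (L ℕ.∸ k) (r k) ⟩
      Σ (L ℕ.∸ k) (λ i → Σ (L ℕ.∸ k ℕ.∸ i) (r k i))
        -- Filling the triangle up to a square adds only terms with k + i + j ≥ L > N, where θ
        -- vanishes.
        ≈⟨ Σ-cong (L ℕ.∸ k) (λ i → sym (Σ-trunc (r k i) (ℕ.m∸n≤m (L ℕ.∸ k) i) (λ j l → θ-big* _ _ (big i j l)))) ⟩
      Σ (L ℕ.∸ k) (λ i → Σ (L ℕ.∸ k) (r k i)) ∎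
      where
      big : ∀ i j → L ℕ.∸ k ℕ.∸ i ℕ.≤ j → N ℕ.< k ℕ.+ (i ℕ.+ j) ℕ.+ c
      big i j l = ℕ.≤-trans hL (ℕ.≤-trans (ℕ.≤-trans (ℕ.m≤n+m∸n L k) (ℕ.+-monoʳ-≤ k
        (ℕ.≤-trans (ℕ.m≤n+m∸n (L ℕ.∸ k) i) (ℕ.+-monoʳ-≤ i l)))) (ℕ.m≤m+n _ c))
    lhs : X L c U (+ 0) s ≈ Σ L (λ k → Σ (L ℕ.∸ k) (λ i → Σ (L ℕ.∸ k) (r k i)))
    lhs = begin
      Σ L (λ b → θ (+ (b ℕ.+ c) ℤ.- + 0) * Σ (suc b) (λ k → w c k * H U (b ℕ.∸ k) s))
        ≈⟨ Σ-cong L (λ b → trans (*-congʳ (θ≡ (ℤ.+-identityʳ (+ (b ℕ.+ c))))) (Σ-*ˡ (suc b) _ _)) ⟩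
      Σ L (λ b → Σ (suc b) (λ k → θ (+ (b ℕ.+ c)) * (w c k * H U (b ℕ.∸ k) s)))
        ≈⟨ Σ-cong L (λ b → Σ-cong< (suc b) (λ { k (s≤s l) →
             *-congʳ (θ≡ (≡.cong (λ t → + (t ℕ.+ c)) (≡.sym (ℕ.m+[n∸m]≡n l)))) })) ⟩
      Σ L (λ b → Σ (suc b) (λ k → F k (b ℕ.∸ k)))
        ≈⟨ Σ-triangle L F ⟩
      Σ L (λ k → Σ (L ℕ.∸ k) (F k))
        ≈⟨ Σ-cong L F≈ ⟩
      Σ L (λ k → Σ (L ℕ.∸ k) (λ i → Σ (L ℕ.∸ k) (r k i))) ∎
    y : ℕ → ℕ → ℕ → Carrier
    y k A B = θ (+ (A ℕ.+ c)) * θ (+ (B ℕ.+ c)) * vt A B k * U (s ℤ.+ + A ℤ.- + B)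
    shift : ∀ k → k ℕ.≤ L → Σ L (λ A → Σ L (λ B → y k A B)) ≈ Σ (L ℕ.∸ k) (λ i → Σ (L ℕ.∸ k) (r k i))
    shift k kL = begin
      Σ L (λ A → Σ L (λ B → y k A B))
        ≈⟨ Σ-drop _ kL (λ A l → Σ-0 L (λ B _ → y0 A B (vtA A B l))) ⟩
      Σ (L ℕ.∸ k) (λ i → Σ L (λ B → y k (k ℕ.+ i) B))
        ≈⟨ Σ-cong (L ℕ.∸ k) (λ i → Σ-drop _ kL (λ B l → y0 (k ℕ.+ i) B (vtB (k ℕ.+ i) B l))) ⟩
      Σ (L ℕ.∸ k) (λ i → Σ (L ℕ.∸ k) (λ j → y k (k ℕ.+ i) (k ℕ.+ j)))
        ≈⟨ Σ-cong (L ℕ.∸ k) (λ i → Σ-cong (L ℕ.∸ k) (λ j → match i j)) ⟩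
      Σ (L ℕ.∸ k) (λ i → Σ (L ℕ.∸ k) (r k i)) ∎
      where
      y0 : ∀ A B → vt A B k ≈ 0# → y k A B ≈ 0#
      y0 A B e = trans (*-congʳ (trans (*-congˡ e) (zeroʳ _))) (zeroˡ _)
      vtA : ∀ A B → A ℕ.< k → vt A B k ≈ 0#
      vtA A B l = trans (*-congˡ (trans (*-congʳ (uh-zero A k l)) (zeroˡ _))) (zeroʳ _)
      vtB : ∀ A B → B ℕ.< k → vt A B k ≈ 0#
      vtB A B l = trans (*-congˡ (trans (*-congˡ (trans (*-congʳ (uh-zero B k l)) (zeroˡ _))) (zeroʳ _))) (zeroʳ _)
      ix : ∀ s k i j → s ℤ.+ (k ℤ.+ i) ℤ.- (k ℤ.+ j) ≡ s ℤ.+ (i ℤ.- j)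
      ix = solve-∀
      arr : ∀ k i c → k ℕ.+ i ℕ.+ c ≡ k ℕ.+ c ℕ.+ i
      arr k i c = ≡.trans (ℕ.+-assoc k i c) (≡.trans (≡.cong (k ℕ.+_) (ℕ.+-comm i c)) (≡.sym (ℕ.+-assoc k c i)))
      match : ∀ i j → y k (k ℕ.+ i) (k ℕ.+ j) ≈ r k i j
      match i j = begin
        θ (+ (k ℕ.+ i ℕ.+ c)) * θ (+ (k ℕ.+ j ℕ.+ c))
          * (q^ ((k ℕ.+ i ℕ.∸ k) ℕ.* (k ℕ.+ j ℕ.∸ k)) * (uh (k ℕ.+ i) k * (uh (k ℕ.+ j) k * u k))) * U (s ℤ.+ + (k ℕ.+ i) ℤ.- + (k ℕ.+ j))
          ≈⟨ *-cong (*-cong (*-cong (trans (θ-def _) (q≡ (≡.cong (λ t → tri (+ t)) (arr k i c))))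
                                    (trans (θ-def _) (q≡ (≡.cong (λ t → tri (+ t)) (arr k j c)))))
               (*-cong (q≡ (≡.cong₂ ℕ._*_ (ℕ.m+n∸m≡n k i) (ℕ.m+n∸m≡n k j)))
                 (*-cong (reflexive (uh-+ k i)) (*-congʳ (reflexive (uh-+ k j))))))
               (reflexive (≡.cong U (ix s (+ k) (+ i) (+ j)))) ⟩
        q^ (tri (+ (k ℕ.+ c ℕ.+ i))) * q^ (tri (+ (k ℕ.+ c ℕ.+ j))) * (q^ (i ℕ.* j) * (u i * (u j * u k))) * U (s ℤ.+ (+ i ℤ.- + j))
          ≈⟨ solve 7 (λ a b c d e f g → a :* b :* (c :* (d :* (e :* f))) :* g := (c :* (a :* b)) :* (f :* (d :* (e :* g)))) refl _ _ _ _ _ _ _ ⟩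
        (q^ (i ℕ.* j) * (q^ (tri (+ (k ℕ.+ c ℕ.+ i))) * q^ (tri (+ (k ℕ.+ c ℕ.+ j))))) * (u k * (u i * (u j * U (s ℤ.+ (+ i ℤ.- + j)))))
          ≈⟨ *-congʳ (trans (*-congˡ (sym (q+ _ _ ≡.refl))) (trans (qq _ _ _ _ (≡.sym (tri-add (k ℕ.+ c) i j)))
               (*-cong (trans (q≡ (≡.cong (λ t → tri (+ t)) (≡.sym (arr k (i ℕ.+ j) c)))) (sym (θ-def _))) (sym (θ-def _))))) ⟩
        θ (+ (k ℕ.+ (i ℕ.+ j) ℕ.+ c)) * θ (+ (k ℕ.+ c)) * (u k * (u i * (u j * U (s ℤ.+ (+ i ℤ.- + j)))))
          ≈⟨ solve 4 (λ a b c d → a :* b :* (c :* d) := a :* (b :* c :* d)) refl _ _ _ _ ⟩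
        r k i j ∎
    rhs : P L c (P̄ L c U) s ≈ Σ L (λ k → Σ (L ℕ.∸ k) (λ i → Σ (L ℕ.∸ k) (r k i)))
    rhs = begin
      Σ L (λ A → w c A * Σ L (λ B → w c B * U (s ℤ.+ + A ℤ.- + B)))
        ≈⟨ Σ-cong< L (λ A l → trans (Σ-*ˡ L _ _) (Σ-cong L (λ B → expand A B l))) ⟩
      Σ L (λ A → Σ L (λ B → Σ L (λ k → y k A B)))
        ≈⟨ Σ-cong L (λ A → Σ-swap L L _) ⟩
      Σ L (λ A → Σ L (λ k → Σ L (λ B → y k A B)))
        ≈⟨ Σ-swap L L _ ⟩
      Σ L (λ k → Σ L (λ A → Σ L (λ B → y k A B)))
        ≈⟨ Σ-cong< L (λ k l → shift k (ℕ.<⇒≤ l)) ⟩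
      Σ L (λ k → Σ (L ℕ.∸ k) (λ i → Σ (L ℕ.∸ k) (r k i))) ∎
      where
      expand : ∀ A B → A ℕ.< L → w c A * (w c B * U (s ℤ.+ + A ℤ.- + B)) ≈ Σ L (λ k → y k A B)
      expand A B l = begin
        θ (+ (A ℕ.+ c)) * u A * (θ (+ (B ℕ.+ c)) * u B * U (s ℤ.+ + A ℤ.- + B))
          ≈⟨ solve 5 (λ a b c d e → a :* b :* (c :* d :* e) := a :* c :* (b :* d) :* e) refl _ _ _ _ _ ⟩
        θ (+ (A ℕ.+ c)) * θ (+ (B ℕ.+ c)) * (u A * u B) * U (s ℤ.+ + A ℤ.- + B)
          ≈⟨ *-congʳ (*-congˡ (vandermonde L A B l)) ⟨
        θ (+ (A ℕ.+ c)) * θ (+ (B ℕ.+ c)) * Σ L (vt A B) * U (s ℤ.+ + A ℤ.- + B)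
          ≈⟨ trans (*-congʳ (Σ-*ˡ L _ _)) (Σ-*ʳ L _ _) ⟩
        Σ L (λ k → y k A B) ∎

  -- A truncated power series in y or 1/y, acting by translations; such operators commute.
  Op : (ℕ → Carrier) → (ℕ → ℤ) → Seq → Seq
  Op a d U s = Σ 𝕃 (λ A → a A * U (s ℤ.+ d A))

  Op-cong : ∀ a d {U V : Seq} → (∀ s → U s ≈ V s) → ∀ s → Op a d U s ≈ Op a d V s
  Op-cong a d h s = Σ-cong 𝕃 (λ A → *-congˡ (h _))

  Op-comm : ∀ a d a′ d′ U s → Op a d (Op a′ d′ U) s ≈ Op a′ d′ (Op a d U) s
  Op-comm a d a′ d′ U s = begin
    Σ 𝕃 (λ A → a A * Σ 𝕃 (λ B → a′ B * U (s ℤ.+ d A ℤ.+ d′ B)))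
      ≈⟨ Σ-cong 𝕃 (λ A → Σ-*ˡ 𝕃 _ _) ⟩
    Σ 𝕃 (λ A → Σ 𝕃 (λ B → a A * (a′ B * U (s ℤ.+ d A ℤ.+ d′ B))))
      ≈⟨ Σ-swap 𝕃 𝕃 _ ⟩
    Σ 𝕃 (λ B → Σ 𝕃 (λ A → a A * (a′ B * U (s ℤ.+ d A ℤ.+ d′ B))))
      ≈⟨ Σ-cong 𝕃 (λ B → Σ-cong 𝕃 (λ A → trans (solve 3 (λ x y z → x :* (y :* z) := y :* (x :* z)) refl _ _ _)
           (*-congˡ (*-congˡ (reflexive (≡.cong U (ix s (d A) (d′ B)))))))) ⟩
    Σ 𝕃 (λ B → Σ 𝕃 (λ A → a′ B * (a A * U (s ℤ.+ d′ B ℤ.+ d A))))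
      ≈⟨ Σ-cong 𝕃 (λ B → sym (Σ-*ˡ 𝕃 _ _)) ⟩
    Σ 𝕃 (λ B → a′ B * Σ 𝕃 (λ A → a A * U (s ℤ.+ d′ B ℤ.+ d A))) ∎
    where
    ix : ∀ s a b → s ℤ.+ a ℤ.+ b ≡ s ℤ.+ b ℤ.+ a
    ix = solve-∀

  ℙ ℙ̄ : ℕ → Seq → Seq
  ℙ c = Op (w c) (λ A → + A)
  ℙ̄ c = Op (w c) (λ A → ℤ.- + A)

  w-big : ∀ c A → N ℕ.< A → w c A ≈ 0#
  w-big c A l = θ-big* (+ (A ℕ.+ c)) (u A) (ℕ.≤-trans l (ℕ.m≤m+n A c))

  X-zero′ : ∀ L c U s → N ℕ.< L → X L c U (+ 0) s ≈ ℙ c (ℙ̄ c U) s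
  X-zero′ L c U s l = trans (X-zero L c U s l) (trans (Σ-cong L (λ A → *-congˡ
      (Σ-trunc _ l (λ B m → trans (*-congʳ (w-big c B m)) (zeroˡ _)))))
      (Σ-trunc _ l (λ B m → trans (*-congʳ (w-big c B m)) (zeroˡ _))))

  Λ : ℕ → Seq → Seq
  Λ c U = ℙ c (ℙ̄ c U)

  tri-c : ∀ c c′ → c ℕ.+ c′ ≡ 1 → tri (+ c′) ≡ 0
  tri-c zero          .1 ≡.refl = ≡.refl
  tri-c (suc zero)    .0 ≡.refl = ≡.refl

  G-zero : ∀ c c′ → c ℕ.+ c′ ≡ 1 → ∀ V s → G c′ V 0 s ≈ V s
  G-zero c c′ e V s = begin
    Σ 1 (λ k → w c′ k * H V (0 ℕ.∸ k) s)       ≈⟨ Σ-one _ ⟩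
    θ (+ c′) * u 0 * H V 0 s
      ≈⟨ *-cong (*-cong (trans (θ-def _) (trans (q≡ (tri-c c c′ e)) q^0)) u-zero) (Σ-one _) ⟩
    1# * 1# * (u 0 * (u 0 * V (s ℤ.+ (+ 0))))
      ≈⟨ *-congˡ (*-cong u-zero (*-cong u-zero (reflexive (≡.cong V (ℤ.+-identityʳ s))))) ⟩
    1# * 1# * (1# * (1# * V s))                ≈⟨ solve 1 (λ x → con (+ 1) :* con (+ 1) :* (con (+ 1) :* (con (+ 1) :* x)) := x) refl _ ⟩
    V s ∎

  -- `X-rec` with the initial value `X-zero′` is the recurrence of (q)_a times `G c′`. So the
  -- transfer matrix of type c carries the polynomials of parameter c to those of parameter c′, with
  -- eigenvalue `Λ c`.
  X-eval : ∀ B c c′ U → c ℕ.+ c′ ≡ 1 → ∀ a s → suc (a ℕ.+ N) ℕ.≤ B →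
    X B c U (+ a) s ≈ p a * G c′ (Λ c U) a s
  X-eval-pre : ∀ B c c′ U → c ℕ.+ c′ ≡ 1 → ∀ a s → suc (a ℕ.+ N) ℕ.≤ B →
    (1# + - (q^ a)) * X B c U (+ a ℤ.- + 1) s ≈ p a * pre (G c′ (Λ c U)) a s
  X-eval B c c′ U e zero    s l = trans (X-zero′ B c U s l) (sym (trans (*-identityˡ _) (G-zero c c′ e (Λ c U) s)))
  X-eval B c c′ U e (suc a) s l = begin
    X B c U (+ suc a) s
      ≈⟨ X-rec B c c′ U a s e l ⟩
    X B c U (+ a) (s ℤ.+ + 1) + X B c U (+ a) (s ℤ.- + 1)
      + q^ (a ℕ.+ c′) * X B c U (+ a) s + - ((1# + - (q^ a)) * X B c U (+ a ℤ.- + 1) s)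
      ≈⟨ +-cong (+-cong (+-cong (X-eval B c c′ U e a (s ℤ.+ + 1) l′) (X-eval B c c′ U e a (s ℤ.- + 1) l′)) (*-congˡ (X-eval B c c′ U e a s l′)))
                (-‿cong (X-eval-pre B c c′ U e a s l′)) ⟩
    p a * g (s ℤ.+ + 1) + p a * g (s ℤ.- + 1) + q^ (a ℕ.+ c′) * (p a * g s) + - (p a * pre (G c′ (Λ c U)) a s)
      ≈⟨ solve 6 (λ p x y q g z → p :* x :+ p :* y :+ q :* (p :* g) :- p :* z := p :* (x :+ y :+ q :* g :- z)) refl (p a) (g (s ℤ.+ + 1)) (g
           (s ℤ.- + 1)) (q^ (a ℕ.+ c′)) (g s) (pre (G c′ (Λ c U)) a s) ⟩
    p a * (g (s ℤ.+ + 1) + g (s ℤ.- + 1) + q^ (a ℕ.+ c′) * g s + - pre (G c′ (Λ c U)) a s)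
      ≈⟨ *-congˡ (G-rec c′ (Λ c U) a s) ⟨
    p a * ((1# + - (q^ suc a)) * G c′ (Λ c U) (suc a) s)
      ≈⟨ *-assoc _ _ _ ⟨
    p (suc a) * G c′ (Λ c U) (suc a) s ∎
    where
    l′ : suc (a ℕ.+ N) ℕ.≤ B
    l′ = ℕ.≤-trans (ℕ.n≤1+n _) l
    g : Seq
    g = G c′ (Λ c U) a
  X-eval-pre B c c′ U e zero    s l = trans (trans (*-congʳ 1-q^0) (zeroˡ _)) (sym (zeroʳ _))
  X-eval-pre B c c′ U e (suc a) s l = begin
    (1# + - (q^ suc a)) * X B c U (+ a) s               ≈⟨ *-congˡ (X-eval B c c′ U e a s (ℕ.≤-trans (ℕ.n≤1+n _) l)) ⟩
    (1# + - (q^ suc a)) * (p a * G c′ (Λ c U) a s)      ≈⟨ solve 3 (λ x y z → x :* (y :* z) := y :* x :* z) refl _ _ _ ⟩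
    p (suc a) * G c′ (Λ c U) a s                        ∎

  -- Appends one edge to a path. Values of f beyond a + N never enter, since there θ(b + c - a) is
  -- zero; hence the box has to grow by N only for each further edge.
  path-step : ∀ B c c′ U a s (f : ℕ → Carrier) → c ℕ.+ c′ ≡ 1 → suc (a ℕ.+ N) ℕ.≤ B →
    (∀ b → b ℕ.≤ a ℕ.+ N → f b ≈ p b * G c U b s) →
    Σ B (λ b → θ (+ (b ℕ.+ c) ℤ.- + a) * (u b * f b)) ≈ p a * G c′ (Λ c U) a s
  path-step B c c′ U a s f e l h = trans (Σ-cong B go) (X-eval B c c′ U e a s l)
    where
    go : ∀ b → θ (+ (b ℕ.+ c) ℤ.- + a) * (u b * f b) ≈ θ (+ (b ℕ.+ c) ℤ.- + a) * G c U b s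
    go b with b ℕ.≤? a ℕ.+ N
    ... | yes b≤ = *-congˡ (begin
      u b * f b                    ≈⟨ *-congˡ (h b b≤) ⟩
      u b * (p b * G c U b s)      ≈⟨ solve 3 (λ x y z → x :* (y :* z) := y :* x :* z) refl _ _ _ ⟩
      p b * u b * G c U b s        ≈⟨ trans (*-congʳ (p-u b)) (*-identityˡ _) ⟩
      G c U b s                    ∎)
    ... | no b≰ = trans (θ-big* _ _ big) (sym (θ-big* _ _ big))
      where
      big : N ℕ.< ℤ.∣ + (b ℕ.+ c) ℤ.- + a ∣
      big = ∣m-n∣-big (b ℕ.+ c) a (ℕ.≤-trans (ℕ.≰⇒> b≰) (ℕ.m≤m+n b c))

  q^-w₀ : ∀ A → q^ A * w 0 A ≈ w 1 A
  q^-w₀ A = trans (sym (*-assoc _ _ _)) (*-congʳ (trans (*-congˡ (θ≡ (≡.cong +_ (ℕ.+-identityʳ A))))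
    (trans (sym (θ-sucℕ A)) (θ≡ (≡.cong +_ (ℕ.+-comm 1 A))))))

  w₁-N : w 1 N ≈ 0#
  w₁-N = θ-big* (+ (N ℕ.+ 1)) _ (ℕ.≤-reflexive (ℕ.+-comm 1 N))

  -- The factorisation (-x)_∞ = (1 + x) (-qx)_∞, where x acts as the translation by e.
  Op-split : ∀ d e → (∀ A s → s ℤ.+ d (suc A) ≡ s ℤ.+ e ℤ.+ d A) → ∀ U s →
    Op (w 0) d U s ≈ Op (w 1) d U s + Op (w 1) d U (s ℤ.+ e)
  Op-split d e de U s = begin
    Σ 𝕃 (λ A → w 0 A * U (s ℤ.+ d A))
      ≈⟨ Σ-cong 𝕃 (λ A → trans (solve 3 (λ q w g → w :* g := q :* w :* g :+ (con (+ 1) :- q) :* (w :* g)) refl (q^ A) (w 0 A) _)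
           (+-congʳ (*-congʳ (q^-w₀ A)))) ⟩
    Σ 𝕃 (λ A → w 1 A * U (s ℤ.+ d A) + (1# + - (q^ A)) * (w 0 A * U (s ℤ.+ d A)))
      ≈⟨ Σ-+ 𝕃 _ _ ⟩
    Op (w 1) d U s + Σ 𝕃 (λ A → (1# + - (q^ A)) * (w 0 A * U (s ℤ.+ d A)))
      ≈⟨ +-congˡ (w-shift 0 N (λ A → U (s ℤ.+ d A))) ⟩
    Op (w 1) d U s + Σ N (λ A → q^ (A ℕ.+ 0) * (w 0 A * U (s ℤ.+ d (suc A))))
      ≈⟨ +-congˡ (Σ-cong N (λ A → trans (sym (*-assoc _ _ _)) (*-cong (trans (*-congʳ (q≡ (ℕ.+-identityʳ A))) (q^-w₀ A)) (reflexive (≡.cong U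
           (de A s)))))) ⟩
    Op (w 1) d U s + Σ N (λ A → w 1 A * U (s ℤ.+ e ℤ.+ d A))
      ≈⟨ +-congˡ (sym (trans (Σ-last N _) (trans (+-congˡ (trans (*-congʳ w₁-N) (zeroˡ _))) (+-identityʳ _)))) ⟩
    Op (w 1) d U s + Op (w 1) d U (s ℤ.+ e) ∎

  -- The product side (-y)_∞ (-q/y)_∞ of the triple product, without its factor (q)_∞.
  JT : Seq → Seq
  JT U = ℙ 0 (ℙ̄ 1 U)

  -- As 1 + 1/y = y^(-1) (1 + y), the product (-qy)_∞ (-1/y)_∞ is y^(-1) (-y)_∞ (-q/y)_∞.
  JT-shift : ∀ V s → ℙ 1 (ℙ̄ 0 V) s ≈ JT V (s ℤ.- + 1)
  JT-shift V s = begin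
    ℙ 1 (ℙ̄ 0 V) s
      ≈⟨ Op-cong (w 1) _ (Op-split (λ A → ℤ.- + A) (ℤ.- + 1) (λ A s → l₁ s (+ A)) V) s ⟩
    ℙ 1 (λ s → ℙ̄ 1 V s + ℙ̄ 1 V (s ℤ.- + 1)) s
      ≈⟨ trans (Σ-cong 𝕃 (λ A → distribˡ _ _ _)) (Σ-+ 𝕃 _ _) ⟩
    ℙ 1 (ℙ̄ 1 V) s + Σ 𝕃 (λ A → w 1 A * ℙ̄ 1 V (s ℤ.+ + A ℤ.- + 1))
      ≈⟨ +-cong (reflexive (≡.cong (ℙ 1 (ℙ̄ 1 V)) (l₃ s))) (Σ-cong 𝕃 (λ A → *-congˡ (reflexive (≡.cong (ℙ̄ 1 V) (l₂ s (+ A)))))) ⟩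
    ℙ 1 (ℙ̄ 1 V) (s ℤ.- + 1 ℤ.+ + 1) + ℙ 1 (ℙ̄ 1 V) (s ℤ.- + 1)
      ≈⟨ +-comm _ _ ⟩
    ℙ 1 (ℙ̄ 1 V) (s ℤ.- + 1) + ℙ 1 (ℙ̄ 1 V) (s ℤ.- + 1 ℤ.+ + 1)
      ≈⟨ Op-split (λ A → + A) (+ 1) (λ A s → l₄ s (+ A)) (ℙ̄ 1 V) (s ℤ.- + 1) ⟨
    JT V (s ℤ.- + 1) ∎
    where
    l₁ : ∀ s A → s ℤ.+ ℤ.- (+ 1 ℤ.+ A) ≡ s ℤ.+ ℤ.- + 1 ℤ.+ ℤ.- A
    l₁ = solve-∀
    l₂ : ∀ s A → s ℤ.+ A ℤ.- + 1 ≡ s ℤ.- + 1 ℤ.+ A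
    l₂ = solve-∀
    l₃ : ∀ s → s ≡ s ℤ.- + 1 ℤ.+ + 1
    l₃ = solve-∀
    l₄ : ∀ s A → s ℤ.+ (+ 1 ℤ.+ A) ≡ s ℤ.+ + 1 ℤ.+ A
    l₄ = solve-∀

  -- Two successive eigenvalues consist of four infinite products. Regrouped, they are one triple
  -- product and one more that `JT-shift` brings into the same form.
  Λ₁Λ₀ : ∀ U s → Λ 1 (Λ 0 U) s ≈ JT (JT U) (s ℤ.- + 1)
  Λ₁Λ₀ U s = trans (Op-cong (w 1) _ (λ t → begin
      ℙ̄ 1 (ℙ 0 (ℙ̄ 0 U)) t   ≈⟨ Op-cong (w 1) _ (Op-comm (w 0) _ (w 0) _ U) t ⟩
      ℙ̄ 1 (ℙ̄ 0 (ℙ 0 U)) t   ≈⟨ Op-comm (w 1) _ (w 0) _ (ℙ 0 U) t ⟩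
      ℙ̄ 0 (ℙ̄ 1 (ℙ 0 U)) t   ≈⟨ Op-cong (w 0) _ (Op-comm (w 1) _ (w 0) _ U) t ⟩
      ℙ̄ 0 (JT U) t           ∎) s)
    (JT-shift (JT U) s)

-- Two-sided sums and the Jacobi triple product.

module Triple (Q : QRing) where
  open Theta Q public

  I : ℤ → ℕ → Seq → Carrier
  I a n g = Σ n (λ i → g (a ℤ.+ + i))

  Van : ℕ → Seq → Set
  Van C g = ∀ x → C ℕ.< ℤ.∣ x ∣ → g x ≈ 0#

  opaque
    𝕀 : ℕ → Seq → Carrier
    𝕀 zero    g = g (+ 0)
    𝕀 (suc C) g = 𝕀 C g + (g (+ suc C) + g -[1+ C ])

    𝕀-zero : ∀ g → 𝕀 0 g ≈ g (+ 0)
    𝕀-zero g = refl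

    𝕀-next : ∀ C g → 𝕀 (suc C) g ≈ 𝕀 C g + (g (+ suc C) + g -[1+ C ])
    𝕀-next C g = refl

    𝕀-cong : ∀ C {f g} → (∀ x → f x ≈ g x) → 𝕀 C f ≈ 𝕀 C g
    𝕀-cong zero    h = h _
    𝕀-cong (suc C) h = +-cong (𝕀-cong C h) (+-cong (h _) (h _))

    𝕀-+ : ∀ C f g → 𝕀 C (λ x → f x + g x) ≈ 𝕀 C f + 𝕀 C g
    𝕀-+ zero    f g = refl
    𝕀-+ (suc C) f g = trans (+-congʳ (𝕀-+ C f g))
      (solve 6 (λ a b c d e f → a :+ b :+ (c :+ d :+ (e :+ f)) := a :+ (c :+ e) :+ (b :+ (d :+ f))) refl _ _ _ _ _ _)

    𝕀-*ˡ : ∀ C y f → y * 𝕀 C f ≈ 𝕀 C (λ x → y * f x)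
    𝕀-*ˡ zero    y f = refl
    𝕀-*ˡ (suc C) y f = trans (distribˡ _ _ _) (+-cong (𝕀-*ˡ C y f) (distribˡ _ _ _))

    𝕀-0 : ∀ C → 𝕀 C (λ _ → 0#) ≈ 0#
    𝕀-0 zero    = refl
    𝕀-0 (suc C) = trans (+-cong (𝕀-0 C) (+-identityˡ _)) (+-identityˡ _)

    𝕀-swap : ∀ C E (f : ℤ → ℤ → Carrier) → 𝕀 C (λ x → 𝕀 E (f x)) ≈ 𝕀 E (λ y → 𝕀 C (λ x → f x y))
    𝕀-swap zero    E f = refl
    𝕀-swap (suc C) E f = trans (+-cong (𝕀-swap C E f) (sym (𝕀-+ E _ _))) (sym (𝕀-+ E _ _))

    𝕀-Σ : ∀ C n (f : ℤ → ℕ → Carrier) → 𝕀 C (λ x → Σ n (f x)) ≈ Σ n (λ i → 𝕀 C (λ x → f x i))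
    𝕀-Σ zero    n f = refl
    𝕀-Σ (suc C) n f = trans (+-cong (𝕀-Σ C n f) (sym (Σ-+ n _ _))) (sym (Σ-+ n _ _))

    𝕀-flip : ∀ C g → 𝕀 C (λ x → g (ℤ.- x)) ≈ 𝕀 C g
    𝕀-flip zero    g = refl
    𝕀-flip (suc C) g = +-cong (𝕀-flip C g) (+-comm _ _)

    𝕀-ext : ∀ {C E g} → Van C g → C ℕ.≤ E → 𝕀 E g ≈ 𝕀 C g
    𝕀-ext {C} {E} {g} v l = ≡.subst (λ t → 𝕀 t g ≈ 𝕀 C g) (ℕ.m∸n+n≡m l) (go (E ℕ.∸ C))
      where
      go : ∀ d → 𝕀 (d ℕ.+ C) g ≈ 𝕀 C g
      go zero    = refl
      go (suc d) = trans (+-cong (go d) (trans (+-cong (v _ (s≤s (ℕ.m≤n+m C d))) (v _ (s≤s (ℕ.m≤n+m C d)))) (+-identityˡ _))) (+-identityʳ _)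

    𝕀-suc : ∀ C g → 𝕀 C (λ x → g (x ℤ.+ + 1)) + g (ℤ.- + C) ≈ 𝕀 C g + g (+ suc C)
    𝕀-suc zero    g = +-comm _ _
    𝕀-suc (suc C) g = begin
      𝕀 C (λ x → g (x ℤ.+ + 1)) + (g (+ suc C ℤ.+ + 1) + g (-[1+ C ] ℤ.+ + 1)) + g -[1+ C ]
        ≈⟨ solve 4 (λ a b c d → a :+ (b :+ c) :+ d := a :+ c :+ (b :+ d)) refl _ _ _ _ ⟩
      𝕀 C (λ x → g (x ℤ.+ + 1)) + g (-[1+ C ] ℤ.+ + 1) + (g (+ suc C ℤ.+ + 1) + g -[1+ C ])
        ≈⟨ +-cong (trans (+-congˡ (reflexive (≡.cong g (l C)))) (𝕀-suc C g)) (+-congʳ (reflexive (≡.cong (λ t → g (+ t)) (ℕ.+-comm (suc C) 1)))) ⟩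
      𝕀 C g + g (+ suc C) + (g (+ suc (suc C)) + g -[1+ C ])
        ≈⟨ solve 4 (λ a b c d → a :+ b :+ (c :+ d) := a :+ (b :+ d) :+ c) refl _ _ _ _ ⟩
      𝕀 C g + (g (+ suc C) + g -[1+ C ]) + g (+ suc (suc C)) ∎
      where
      l : ∀ C → -[1+ C ] ℤ.+ + 1 ≡ ℤ.- + C
      l zero    = ≡.refl
      l (suc C) = ≡.refl

    𝕀-halves : ∀ C g → 𝕀 C g ≈ Σ (suc C) (λ i → g (+ i)) + Σ C (λ i → g -[1+ i ])
    𝕀-halves zero    g = sym (trans (+-cong (Σ-one _) (Σ-zero _)) (+-identityʳ _))
    𝕀-halves (suc C) g = trans (+-congʳ (𝕀-halves C g)) (sym (trans (+-cong (Σ-last (suc C) _) (Σ-last C _))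
      (solve 4 (λ a b c d → a :+ b :+ (c :+ d) := a :+ c :+ (b :+ d)) refl _ _ _ _)))

    𝕀-I : ∀ C g → 𝕀 C g ≈ I (ℤ.- + C) (suc (C ℕ.+ C)) g
    𝕀-I zero    g = sym (Σ-one _)
    𝕀-I (suc C) g = sym (begin
      Σ (suc (suc C ℕ.+ suc C)) (λ i → g (-[1+ C ] ℤ.+ + i))
        ≡⟨ ≡.cong (λ t → Σ (suc (suc t)) (λ i → g (-[1+ C ] ℤ.+ + i))) (ℕ.+-suc C C) ⟩
      Σ (suc (suc (suc (C ℕ.+ C)))) (λ i → g (-[1+ C ] ℤ.+ + i))
        ≈⟨ trans (Σ-suc _ _) (+-congˡ (Σ-last _ _)) ⟩
      g (-[1+ C ] ℤ.+ + 0) + (Σ (suc (C ℕ.+ C)) (λ i → g (-[1+ C ] ℤ.+ + suc i)) + g (-[1+ C ] ℤ.+ + suc (suc (C ℕ.+ C))))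
        ≈⟨ +-cong refl (+-cong (trans (Σ-cong (suc (C ℕ.+ C)) (λ i → reflexive (≡.cong g (l₁ (+ C) (+ i))))) (sym (𝕀-I C g)))
             (reflexive (≡.cong g (l₂ (+ C))))) ⟩
      g -[1+ C ] + (𝕀 C g + g (+ suc C))
        ≈⟨ solve 3 (λ a b c → a :+ (b :+ c) := b :+ (c :+ a)) refl _ _ _ ⟩
      𝕀 C g + (g (+ suc C) + g -[1+ C ]) ∎)
      where
      l₁ : ∀ C i → ℤ.- (+ 1 ℤ.+ C) ℤ.+ (+ 1 ℤ.+ i) ≡ ℤ.- C ℤ.+ i
      l₁ = solve-∀
      l₂ : ∀ C → ℤ.- (+ 1 ℤ.+ C) ℤ.+ (+ 2 ℤ.+ (C ℤ.+ C)) ≡ + 1 ℤ.+ C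
      l₂ = solve-∀

  𝕀-neg : ∀ C f → 𝕀 C (λ x → - f x) ≈ - 𝕀 C f
  𝕀-neg C f = begin
    𝕀 C (λ x → - f x)          ≈⟨ 𝕀-cong C (λ x → solve 1 (λ y → :- y := (:- con (+ 1)) :* y) refl (f x)) ⟩
    𝕀 C (λ x → - 1# * f x)     ≈⟨ 𝕀-*ˡ C _ _ ⟨
    - 1# * 𝕀 C f               ≈⟨ solve 1 (λ y → (:- con (+ 1)) :* y := :- y) refl (𝕀 C f) ⟩
    - 𝕀 C f                    ∎

  𝕀-shiftℕ : ∀ {C E} g d → Van C g → C ℕ.+ d ℕ.≤ E → 𝕀 E (λ x → g (x ℤ.+ + d)) ≈ 𝕀 E g
  𝕀-shiftℕ {C} {E} g zero    v l = 𝕀-cong E (λ x → reflexive (≡.cong g (ℤ.+-identityʳ x)))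
  𝕀-shiftℕ {C} {E} g (suc d) v l = begin
    𝕀 E (λ x → g (x ℤ.+ + suc d))              ≈⟨ 𝕀-cong E (λ x → reflexive (≡.cong g (≡.sym (ℤ.+-assoc x (+ 1) (+ d))))) ⟩
    𝕀 E (λ x → g′ (x ℤ.+ + 1))                 ≈⟨ +-identityʳ _ ⟨
    𝕀 E (λ x → g′ (x ℤ.+ + 1)) + 0#            ≈⟨ +-congˡ (v _ low) ⟨
    𝕀 E (λ x → g′ (x ℤ.+ + 1)) + g′ (ℤ.- + E)  ≈⟨ 𝕀-suc E g′ ⟩
    𝕀 E g′ + g′ (+ suc E)                      ≈⟨ trans (+-congˡ (v _ high)) (+-identityʳ _) ⟩
    𝕀 E g′                                     ≈⟨ 𝕀-shiftℕ g d v (ℕ.≤-trans (ℕ.+-monoʳ-≤ C (ℕ.n≤1+n d)) l) ⟩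
    𝕀 E g                                      ∎
    where
    g′ : Seq
    g′ x = g (x ℤ.+ + d)
    l′ : suc (d ℕ.+ C) ℕ.≤ E
    l′ = ≡.subst (ℕ._≤ E) (≡.trans (ℕ.+-suc C d) (≡.cong suc (ℕ.+-comm C d))) l
    low : C ℕ.< ℤ.∣ ℤ.- + E ℤ.+ + d ∣
    low = ≡.subst (C ℕ.<_) (≡.trans (≡.sym (ℤ.∣-i∣≡∣i∣ (+ E ℤ.- + d))) (≡.cong ℤ.∣_∣ (l₁ (+ E) (+ d)))) (∣m-n∣-big E d l′)
      where
      l₁ : ∀ E d → ℤ.- (E ℤ.- d) ≡ ℤ.- E ℤ.+ d
      l₁ = solve-∀
    high : C ℕ.< suc (E ℕ.+ d)
    high = s≤s (ℕ.≤-trans (ℕ.≤-trans (ℕ.m≤m+n C (suc d)) l) (ℕ.m≤m+n E d))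

  𝕀-shift : ∀ {C E} g d → Van C g → C ℕ.+ ℤ.∣ d ∣ ℕ.≤ E → 𝕀 E (λ x → g (x ℤ.+ d)) ≈ 𝕀 E g
  𝕀-shift {C} {E} g (+ d)    v l = 𝕀-shiftℕ g d v l
  𝕀-shift {C} {E} g -[1+ d ] v l = begin
    𝕀 E (λ x → g (x ℤ.+ -[1+ d ]))            ≈⟨ 𝕀-flip E _ ⟨
    𝕀 E (λ x → g (ℤ.- x ℤ.+ -[1+ d ]))        ≈⟨ 𝕀-cong E (λ x → reflexive (≡.cong g (≡.sym (ℤ.neg-distrib-+ x (+ suc d))))) ⟩
    𝕀 E (λ x → g (ℤ.- (x ℤ.+ + suc d)))       ≈⟨ 𝕀-shiftℕ (λ x → g (ℤ.- x)) (suc d) (λ x m → v _ (≡.subst (C ℕ.<_) (≡.sym (ℤ.∣-i∣≡∣i∣ x)) m)) l ⟩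
    𝕀 E (λ x → g (ℤ.- x))                     ≈⟨ 𝕀-flip E g ⟩
    𝕀 E g                                     ∎

  ϑ : Seq → Seq
  ϑ U s = 𝕀 N (λ K → θ K * U (s ℤ.+ K))

  Σ-square : ∀ L (F : ℕ → ℕ → Carrier) → Σ L (λ A → Σ L (F A))
    ≈ Σ L (λ K → Σ (L ℕ.∸ K) (λ B → F (B ℕ.+ K) B)) + Σ L (λ K → Σ (L ℕ.∸ suc K) (λ A → F A (A ℕ.+ suc K)))
  Σ-square zero    F = trans (Σ-zero _) (sym (trans (+-cong (Σ-zero _) (Σ-zero _)) (+-identityˡ _)))
  Σ-square (suc L) F = begin
    Σ (suc L) (λ A → Σ (suc L) (F A))
      ≈⟨ Σ-suc L _ ⟩
    Σ (suc L) (F 0) + Σ L (λ A → Σ (suc L) (F (suc A)))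
      ≈⟨ +-cong (Σ-suc L _) (trans (Σ-cong L (λ A → Σ-suc L _)) (Σ-+ L _ _)) ⟩
    (F 0 0 + Σ L (λ B → F 0 (suc B))) + (Σ L (λ A → F (suc A) 0) + Σ L (λ A → Σ L (λ B → F (suc A) (suc B))))
      ≈⟨ +-congˡ (+-congˡ (Σ-square L (λ A B → F (suc A) (suc B)))) ⟩
    (F 0 0 + Σ L (λ B → F 0 (suc B))) + (Σ L (λ A → F (suc A) 0) + (X₁ + X₂))
      ≈⟨ solve 5 (λ a b c d e → a :+ b :+ (c :+ (d :+ e)) := a :+ c :+ d :+ (b :+ e)) refl _ _ _ _ _ ⟩
    (F 0 0 + Σ L (λ A → F (suc A) 0)) + X₁ + (Σ L (λ B → F 0 (suc B)) + X₂)
      ≈⟨ +-cong upper lower ⟩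
    Σ (suc L) (λ K → Σ (suc L ℕ.∸ K) (λ B → F (B ℕ.+ K) B)) + Σ (suc L) (λ K → Σ (L ℕ.∸ K) (λ A → F A (A ℕ.+ suc K))) ∎
    where
    X₁ = Σ L (λ K → Σ (L ℕ.∸ K) (λ B → F (suc (B ℕ.+ K)) (suc B)))
    X₂ = Σ L (λ K → Σ (L ℕ.∸ suc K) (λ A → F (suc A) (suc (A ℕ.+ suc K))))
    upper : (F 0 0 + Σ L (λ A → F (suc A) 0)) + X₁ ≈ Σ (suc L) (λ K → Σ (suc L ℕ.∸ K) (λ B → F (B ℕ.+ K) B))
    upper = sym (begin
      Σ (suc L) (λ K → Σ (suc L ℕ.∸ K) (λ B → F (B ℕ.+ K) B))
        ≈⟨ Σ-cong< (suc L) (λ { K (s≤s l) → trans (reflexive (≡.cong (λ t → Σ t (λ B → F (B ℕ.+ K) B)) (ℕ.+-∸-assoc 1 l))) (Σ-suc _ _) }) ⟩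
      Σ (suc L) (λ K → F K 0 + Σ (L ℕ.∸ K) (λ B → F (suc (B ℕ.+ K)) (suc B)))
        ≈⟨ Σ-+ (suc L) _ _ ⟩
      Σ (suc L) (λ K → F K 0) + Σ (suc L) (λ K → Σ (L ℕ.∸ K) (λ B → F (suc (B ℕ.+ K)) (suc B)))
        ≈⟨ +-cong (Σ-suc L _) (trans (Σ-last L _) (trans (+-congˡ (trans (reflexive (≡.cong (λ t → Σ t (λ B → F (suc (B ℕ.+ L)) (suc B)))
             (ℕ.n∸n≡0 L))) (Σ-zero _))) (+-identityʳ _))) ⟩
      F 0 0 + Σ L (λ A → F (suc A) 0) + X₁ ∎)
    lower : Σ L (λ B → F 0 (suc B)) + X₂ ≈ Σ (suc L) (λ K → Σ (L ℕ.∸ K) (λ A → F A (A ℕ.+ suc K)))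
    lower = sym (begin
      Σ (suc L) (λ K → Σ (L ℕ.∸ K) (λ A → F A (A ℕ.+ suc K)))
        ≈⟨ trans (Σ-last L _) (trans (+-congˡ (trans (reflexive (≡.cong (λ t → Σ t (λ A → F A (A ℕ.+ suc L))) (ℕ.n∸n≡0 L))) (Σ-zero _)))
             (+-identityʳ _)) ⟩
      Σ L (λ K → Σ (L ℕ.∸ K) (λ A → F A (A ℕ.+ suc K)))
        ≈⟨ Σ-cong< L (λ K l → trans (reflexive (≡.cong (λ t → Σ t (λ A → F A (A ℕ.+ suc K))) (e K l))) (Σ-suc _ _)) ⟩
      Σ L (λ K → F 0 (suc K) + Σ (L ℕ.∸ suc K) (λ A → F (suc A) (suc (A ℕ.+ suc K))))
        ≈⟨ Σ-+ L _ _ ⟩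
      Σ L (λ B → F 0 (suc B)) + X₂ ∎)
      where
      e : ∀ K → K ℕ.< L → L ℕ.∸ K ≡ suc (L ℕ.∸ suc K)
      e K l = ℕ.+-∸-assoc 1 l

  -- durfee 0 K is independent of K, and only its first term survives once q^K = 0.
  durfee : ℕ → ℕ → Carrier
  durfee e K = Σ 𝕃 (λ B → q^ (B ℕ.* (B ℕ.+ K ℕ.+ e)) * (u B * u (B ℕ.+ K)))

  -- Both sides are compared with `durfee 1 K`: splitting off 1 - q^B on the left and 1 - q^(B+K+1)
  -- on the right leaves the same remainder.
  durfee-suc : ∀ K → durfee 0 K ≈ durfee 0 (suc K)
  durfee-suc K = begin
    durfee 0 K
      ≈⟨ Σ-cong 𝕃 (λ B → trans (solve 3 (λ q x y → x :* y := x :* q :* y :+ (con (+ 1) :- q) :* (x :* y)) refl (q^ B) _ _)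
           (+-cong (*-congʳ (sym (q+ _ B (≡.trans (≡.cong (λ t → B ℕ.* t) (ℕ.+-assoc B K 1)) (f B K))))) (solve 4 (λ a b c d → a :* (b :*
                (c :* d)) := a :* (c :* (b :* d))) refl _ _ _ _))) ⟩
    Σ 𝕃 (λ B → q^ (B ℕ.* (B ℕ.+ K ℕ.+ 1)) * (u B * u (B ℕ.+ K)) + (1# + - (q^ B)) * (u B * (q^ (B ℕ.* (B ℕ.+ K ℕ.+ 0)) * u (B ℕ.+ K))))
      ≈⟨ Σ-+ 𝕃 _ _ ⟩
    durfee 1 K + Σ 𝕃 (λ B → (1# + - (q^ B)) * (u B * (q^ (B ℕ.* (B ℕ.+ K ℕ.+ 0)) * u (B ℕ.+ K))))
      ≈⟨ +-cong dec (u-shift N _) ⟩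
    (durfee 0 (suc K) + - Σ N Z) + Σ N (λ B → u B * (q^ (suc B ℕ.* (suc B ℕ.+ K ℕ.+ 0)) * u (suc B ℕ.+ K)))
      ≈⟨ +-congˡ (Σ-cong N (λ B → trans (solve 3 (λ a b c → a :* (b :* c) := b :* (a :* c)) refl _ _ _)
           (*-cong (trans (q+ (suc (B ℕ.+ K)) (B ℕ.* (B ℕ.+ suc K)) (f₃ B K)) refl) (*-congˡ (reflexive (≡.cong u (≡.sym (ℕ.+-suc B K)))))))) ⟩
    (durfee 0 (suc K) + - Σ N Z) + Σ N Z
      ≈⟨ solve 2 (λ a b → a :- b :+ b := a) refl _ _ ⟩
    durfee 0 (suc K) ∎
    where
    Z : ℕ → Carrier
    Z B = q^ (suc (B ℕ.+ K)) * q^ (B ℕ.* (B ℕ.+ suc K)) * (u B * u (B ℕ.+ suc K))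
    f : ∀ B K → B ℕ.* (B ℕ.+ (K ℕ.+ 1)) ≡ B ℕ.* (B ℕ.+ K ℕ.+ 0) ℕ.+ B
    f B K = ≡.trans (≡.cong (B ℕ.*_) (≡.trans (≡.cong (B ℕ.+_) (ℕ.+-comm K 1)) (ℕ.+-suc B K)))
      (≡.trans (ℕ.*-suc B (B ℕ.+ K)) (≡.trans (ℕ.+-comm B _) (≡.cong (λ t → B ℕ.* t ℕ.+ B) (≡.sym (ℕ.+-identityʳ (B ℕ.+ K))))))
    f₃ : ∀ B K → suc B ℕ.* (suc B ℕ.+ K ℕ.+ 0) ≡ suc (B ℕ.+ K) ℕ.+ B ℕ.* (B ℕ.+ suc K)
    f₃ B K = ≡.cong₂ ℕ._+_ (ℕ.+-identityʳ (suc (B ℕ.+ K))) (≡.cong (B ℕ.*_) (≡.trans (ℕ.+-identityʳ _) (≡.sym (ℕ.+-suc B K))))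
    dec : durfee 1 K ≈ durfee 0 (suc K) + - Σ N Z
    dec = begin
      durfee 1 K
        ≈⟨ Σ-cong 𝕃 (λ B → *-cong (q≡ (≡.cong (B ℕ.*_) (≡.trans (ℕ.+-comm (B ℕ.+ K) 1) (≡.sym (ℕ.+-suc B K)))))
             (*-congˡ (trans (sym (u-step (B ℕ.+ K))) (*-congˡ (reflexive (≡.cong u (≡.sym (ℕ.+-suc B K)))))))) ⟩
      Σ 𝕃 (λ B → q^ (B ℕ.* (B ℕ.+ suc K)) * (u B * ((1# + - (q^ suc (B ℕ.+ K))) * u (B ℕ.+ suc K))))
        ≈⟨ Σ-cong 𝕃 (λ B → solve 4 (λ a b c d → a :* (b :* ((con (+ 1) :- c) :* d)) := a :* (b :* d) :- c :* a :* (b :* d)) refl _ _ _ _) ⟩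
      Σ 𝕃 (λ B → q^ (B ℕ.* (B ℕ.+ suc K)) * (u B * u (B ℕ.+ suc K)) + - Z B)
        ≈⟨ trans (Σ-+ 𝕃 _ _) (+-cong (Σ-cong 𝕃 (λ B → *-congʳ (q≡ (≡.cong (B ℕ.*_) (≡.sym (ℕ.+-identityʳ (B ℕ.+ suc K)))))))
             (trans (sym (Σ-neg 𝕃 Z)) (-‿cong (trans (Σ-last N Z) (trans (+-congˡ ZN) (+-identityʳ _)))))) ⟩
      durfee 0 (suc K) + - Σ N Z ∎
      where
      ZN : Z N ≈ 0#
      ZN = trans (*-congʳ (trans (*-congʳ (q-big _ (ℕ.≤-trans (ℕ.m≤m+n N K) (ℕ.n≤1+n _)))) (zeroˡ _))) (zeroˡ _)

  -- The factors 1 - q^i with i ≥ N are 1, so `u N` stands for 1/(q)_∞ and `p N` for (q)_∞.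
  u-stable : ∀ d → u (d ℕ.+ N) ≈ u N
  u-stable zero    = refl
  u-stable (suc d) = begin
    u (suc (d ℕ.+ N))                                          ≈⟨ *-identityˡ _ ⟨
    1# * u (suc (d ℕ.+ N))                                     ≈⟨ *-congʳ (trans (+-congˡ (trans (-‿cong (q-big _ (ℕ.≤-trans (ℕ.m≤n+m N d)
         (ℕ.n≤1+n _)))) -0#≈0#)) (+-identityʳ _)) ⟨
    (1# + - (q^ suc (d ℕ.+ N))) * u (suc (d ℕ.+ N))            ≈⟨ u-step (d ℕ.+ N) ⟩
    u (d ℕ.+ N)                                                ≈⟨ u-stable d ⟩
    u N                                                        ∎

  durfee-value : ∀ K → durfee 0 K ≈ u N
  durfee-value K = begin
    durfee 0 K            ≈⟨ up N ⟩
    durfee 0 (N ℕ.+ K)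
      ≈⟨ trans (Σ-suc N _) (trans (+-congˡ (Σ-0 N (λ B _ → q-big* _ (big B)))) (+-identityʳ _)) ⟩
    q^ 0 * (u 0 * u (N ℕ.+ K))
      ≈⟨ trans (*-cong q^0 (*-congʳ u-zero)) (trans (*-identityˡ _) (*-identityˡ _)) ⟩
    u (N ℕ.+ K)           ≡⟨ ≡.cong u (ℕ.+-comm N K) ⟩
    u (K ℕ.+ N)           ≈⟨ u-stable K ⟩
    u N                   ∎
    where
    up : ∀ d → durfee 0 K ≈ durfee 0 (d ℕ.+ K)
    up zero    = refl
    up (suc d) = trans (up d) (durfee-suc (d ℕ.+ K))
    q-big* : ∀ {e} x → N ℕ.≤ e → q^ e * x ≈ 0#
    q-big* x l = trans (*-congʳ (q-big _ l)) (zeroˡ x)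
    big : ∀ B → N ℕ.≤ suc B ℕ.* (suc B ℕ.+ (N ℕ.+ K) ℕ.+ 0)
    big B = ℕ.≤-trans (ℕ.≤-trans (ℕ.m≤m+n N K) (ℕ.≤-trans (ℕ.m≤n+m (N ℕ.+ K) (suc B)) (ℕ.m≤m+n _ 0))) (ℕ.m≤m+n _ _)

  -- The terms of the double sum with A - B = K add up to θ(K) times `durfee 0` at |K|, that is to
  -- θ(K) / (q)_∞.
  JTP : ∀ U s → p N * JT U s ≈ ϑ U s
  JTP U s = begin
    p N * Σ 𝕃 (λ A → w 0 A * Σ 𝕃 (λ B → w 1 B * U (s ℤ.+ + A ℤ.+ ℤ.- + B)))
      ≈⟨ *-congˡ (trans (Σ-cong 𝕃 (λ A → Σ-*ˡ 𝕃 _ _)) (Σ-square 𝕃 F)) ⟩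
    p N * (Σ 𝕃 (λ K → Σ (𝕃 ℕ.∸ K) (λ B → F (B ℕ.+ K) B)) + Σ 𝕃 (λ K → Σ (𝕃 ℕ.∸ suc K) (λ A → F A (A ℕ.+ suc K))))
      ≈⟨ *-congˡ (+-cong (Σ-cong 𝕃 upper) (Σ-cong 𝕃 lower)) ⟩
    p N * (Σ 𝕃 (λ K → u N * g (+ K)) + Σ 𝕃 (λ K → u N * g -[1+ K ]))
      ≈⟨ *-congˡ (+-cong (sym (Σ-*ˡ 𝕃 _ _)) (trans (sym (Σ-*ˡ 𝕃 _ _)) (*-congˡ (trans (Σ-last N _) (trans (+-congˡ (θ-big* -[1+ N ] _ ℕ.≤-refl))
           (+-identityʳ _)))))) ⟩
    p N * (u N * Σ 𝕃 (λ K → g (+ K)) + u N * Σ N (λ K → g -[1+ K ]))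
      ≈⟨ solve 4 (λ p u x y → p :* (u :* x :+ u :* y) := p :* u :* (x :+ y)) refl _ _ _ _ ⟩
    p N * u N * (Σ 𝕃 (λ K → g (+ K)) + Σ N (λ K → g -[1+ K ]))
      ≈⟨ trans (*-congʳ (p-u N)) (trans (*-identityˡ _) (sym (𝕀-halves N g))) ⟩
    ϑ U s ∎
    where
    g : Seq
    g K = θ K * U (s ℤ.+ K)
    F : ℕ → ℕ → Carrier
    F A B = w 0 A * (w 1 B * U (s ℤ.+ + A ℤ.+ ℤ.- + B))
    core : ∀ A B x m n (a b : ℕ) → tri (+ A) ℕ.+ tri (+ (B ℕ.+ 1)) ≡ tri x ℕ.+ m ℕ.* n →
      (u A * u B ≈ u a * u b) → s ℤ.+ + A ℤ.+ ℤ.- + B ≡ s ℤ.+ x → F A B ≈ g x * (q^ (m ℕ.* n) * (u a * u b))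
    core A B x m n a b e h i = begin
      θ (+ (A ℕ.+ 0)) * u A * (θ (+ (B ℕ.+ 1)) * u B * U (s ℤ.+ + A ℤ.+ ℤ.- + B))
        ≈⟨ solve 5 (λ a b c d e → a :* b :* (c :* d :* e) := a :* c :* (b :* d) :* e) refl _ _ _ _ _ ⟩
      θ (+ (A ℕ.+ 0)) * θ (+ (B ℕ.+ 1)) * (u A * u B) * U (s ℤ.+ + A ℤ.+ ℤ.- + B)
        ≈⟨ *-cong (*-cong (trans (*-cong (trans (θ≡ (≡.cong +_ (ℕ.+-identityʳ A))) (θ-def _)) (θ-def _))
             (trans (qq _ _ _ _ e) (*-congʳ (sym (θ-def x))))) h) (reflexive (≡.cong U i)) ⟩
      θ x * q^ (m ℕ.* n) * (u a * u b) * U (s ℤ.+ x)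
        ≈⟨ solve 4 (λ a b c d → a :* b :* c :* d := a :* d :* (b :* c)) refl _ _ _ _ ⟩
      g x * (q^ (m ℕ.* n) * (u a * u b)) ∎
    upper : ∀ K → Σ (𝕃 ℕ.∸ K) (λ B → F (B ℕ.+ K) B) ≈ u N * g (+ K)
    upper K = begin
      Σ (𝕃 ℕ.∸ K) (λ B → F (B ℕ.+ K) B)
        ≈⟨ Σ-trunc _ (ℕ.m∸n≤m 𝕃 K) (λ B l → trans (*-congʳ (w-big 0 (B ℕ.+ K) (ℕ.≤-trans (ℕ.m≤n+m∸n 𝕃 K) (≡.subst (K ℕ.+ (𝕃 ℕ.∸ K) ℕ.≤_)
             (ℕ.+-comm K B) (ℕ.+-monoʳ-≤ K l))))) (zeroˡ _)) ⟨
      Σ 𝕃 (λ B → F (B ℕ.+ K) B)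
        ≈⟨ Σ-cong 𝕃 (λ B → trans (core (B ℕ.+ K) B (+ K) B (B ℕ.+ K) B (B ℕ.+ K)
             (tri-two (+ (B ℕ.+ K)) (+ (B ℕ.+ 1)) (+ K) B (B ℕ.+ K) (l₁ (+ B) (+ K))) (*-comm _ _) (l₂ s (+ B) (+ K)))
             (*-congˡ (*-congʳ (q≡ (≡.cong (B ℕ.*_) (≡.sym (ℕ.+-identityʳ _))))))) ⟩
      Σ 𝕃 (λ B → g (+ K) * (q^ (B ℕ.* (B ℕ.+ K ℕ.+ 0)) * (u B * u (B ℕ.+ K))))
        ≈⟨ Σ-*ˡ 𝕃 _ _ ⟨
      g (+ K) * durfee 0 K
        ≈⟨ trans (*-congˡ (durfee-value K)) (*-comm _ _) ⟩
      u N * g (+ K) ∎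
      where
      l₁ : ∀ B K → ((B ℤ.+ K) ℤ.* (B ℤ.+ K) ℤ.- (B ℤ.+ K)) ℤ.+ ((B ℤ.+ + 1) ℤ.* (B ℤ.+ + 1) ℤ.- (B ℤ.+ + 1)) ≡ (K ℤ.* K ℤ.- K) ℤ.+ + 2 ℤ.*
           (B ℤ.* (B ℤ.+ K))
      l₁ = solve-∀
      l₂ : ∀ s B K → s ℤ.+ (B ℤ.+ K) ℤ.+ ℤ.- B ≡ s ℤ.+ K
      l₂ = solve-∀
    lower : ∀ K → Σ (𝕃 ℕ.∸ suc K) (λ A → F A (A ℕ.+ suc K)) ≈ u N * g -[1+ K ]
    lower K = begin
      Σ (𝕃 ℕ.∸ suc K) (λ A → F A (A ℕ.+ suc K))
        ≈⟨ Σ-trunc _ (ℕ.m∸n≤m 𝕃 (suc K)) (λ A l → trans (*-congˡ (trans (*-congʳ (w-big 1 (A ℕ.+ suc K)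
             (ℕ.≤-trans (ℕ.m≤n+m∸n 𝕃 (suc K)) (≡.subst (suc K ℕ.+ (𝕃 ℕ.∸ suc K) ℕ.≤_) (ℕ.+-comm (suc K) A) (ℕ.+-monoʳ-≤ (suc K) l)))))
                  (zeroˡ _))) (zeroʳ _)) ⟨
      Σ 𝕃 (λ A → F A (A ℕ.+ suc K))
        ≈⟨ Σ-cong 𝕃 (λ A → trans (core A (A ℕ.+ suc K) -[1+ K ] A (A ℕ.+ suc K) A (A ℕ.+ suc K)
             (tri-two (+ A) (+ (A ℕ.+ suc K ℕ.+ 1)) -[1+ K ] A (A ℕ.+ suc K) (l₁ (+ A) (+ suc K))) refl (l₂ s (+ A) (+ suc K)))
             (*-congˡ (*-congʳ (q≡ (≡.cong (A ℕ.*_) (≡.sym (ℕ.+-identityʳ _))))))) ⟩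
      Σ 𝕃 (λ A → g -[1+ K ] * (q^ (A ℕ.* (A ℕ.+ suc K ℕ.+ 0)) * (u A * u (A ℕ.+ suc K))))
        ≈⟨ Σ-*ˡ 𝕃 _ _ ⟨
      g -[1+ K ] * durfee 0 (suc K)
        ≈⟨ trans (*-congˡ (durfee-value (suc K))) (*-comm _ _) ⟩
      u N * g -[1+ K ] ∎
      where
      l₁ : ∀ A K → (A ℤ.* A ℤ.- A) ℤ.+ ((A ℤ.+ K ℤ.+ + 1) ℤ.* (A ℤ.+ K ℤ.+ + 1) ℤ.- (A ℤ.+ K ℤ.+ + 1)) ≡ (ℤ.- K ℤ.* ℤ.- K ℤ.- ℤ.- K) ℤ.+ + 2 ℤ.*
           (A ℤ.* (A ℤ.+ K))
      l₁ = solve-∀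
      l₂ : ∀ s A K → s ℤ.+ A ℤ.+ ℤ.- (A ℤ.+ K) ≡ s ℤ.+ ℤ.- K
      l₂ = solve-∀

-- Theta sequences, Euler's product and Jacobi's identity.

parity : ∀ x → (∃[ l ] x ≡ l ℤ.+ l) ⊎ (∃[ l ] x ≡ l ℤ.+ l ℤ.+ + 1)
parity = ℤ-ind _ (inj₁ (+ 0 , ≡.refl))
  (λ { x (inj₁ (l , e)) → inj₂ (l , ≡.cong (ℤ._+ + 1) e)
     ; x (inj₂ (l , e)) → inj₁ (l ℤ.+ + 1 , ≡.trans (≡.cong (ℤ._+ + 1) e) (l₁ l)) })
  (λ { x (inj₁ (l , e)) → inj₂ (l ℤ.- + 1 , +ℤ-cancelʳ (+ 1) (≡.trans e (l₂ l)))
     ; x (inj₂ (l , e)) → inj₁ (l , +ℤ-cancelʳ (+ 1) e) })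
  where
  l₁ : ∀ l → l ℤ.+ l ℤ.+ + 1 ℤ.+ + 1 ≡ (l ℤ.+ + 1) ℤ.+ (l ℤ.+ + 1)
  l₁ = solve-∀
  l₂ : ∀ l → l ℤ.+ l ≡ (l ℤ.- + 1) ℤ.+ (l ℤ.- + 1) ℤ.+ + 1 ℤ.+ + 1
  l₂ = solve-∀

double-injective : ∀ x y → x ℤ.+ x ≡ y ℤ.+ y → x ≡ y
double-injective x y e = ℤ.*-cancelˡ-≡ (+ 2) x y (≡.trans (l x) (≡.trans e (≡.sym (l y))))
  where
  l : ∀ x → + 2 ℤ.* x ≡ x ℤ.+ x
  l = solve-∀

even≢odd : ∀ x y → x ℤ.+ x ≢ y ℤ.+ y ℤ.+ + 1
even≢odd x y e = no-half ℤ.∣ x ℤ.- y ∣ (≡.trans (≡.sym (ℤ.abs-* (+ 2) (x ℤ.- y))) (≡.cong ℤ.∣_∣ (≡.trans (l₁ x y) (≡.trans (≡.cong (ℤ._-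
     (y ℤ.+ y)) e) (l₂ y)))))
  where
  l₁ : ∀ x y → + 2 ℤ.* (x ℤ.- y) ≡ x ℤ.+ x ℤ.- (y ℤ.+ y)
  l₁ = solve-∀
  l₂ : ∀ y → y ℤ.+ y ℤ.+ + 1 ℤ.- (y ℤ.+ y) ≡ + 1
  l₂ = solve-∀
  no-half : ∀ n → 2 ℕ.* n ≢ 1
  no-half zero    ()
  no-half (suc n) h with ≡.trans (≡.sym (ℕ.+-suc n (n ℕ.+ 0))) (ℕ.suc-injective h)
  ... | ()

module Sequences (Q : QRing) where
  open Triple Q public

  sg : ℕ → Carrier
  sg zero    = 1#
  sg (suc n) = - sg n

  σ : ℤ → Carrier
  σ x = sg ℤ.∣ x ∣

  σ≡ : ∀ {x y} → x ≡ y → σ x ≈ σ y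
  σ≡ e = reflexive (≡.cong σ e)

  σ-suc : ∀ x → σ (x ℤ.+ + 1) ≈ - σ x
  σ-suc (+ n)        = reflexive (≡.cong sg (ℕ.+-comm n 1))
  σ-suc -[1+ zero ]  = sym (-‿involutive _)
  σ-suc -[1+ suc n ] = sym (-‿involutive _)

  σ-+ : ∀ x y → σ (x ℤ.+ y) ≈ σ x * σ y
  σ-+ x = ℤ-ind _ (trans (σ≡ (ℤ.+-identityʳ x)) (sym (*-identityʳ _)))
    (λ y h → begin
      σ (x ℤ.+ (y ℤ.+ + 1))   ≈⟨ σ≡ (≡.sym (ℤ.+-assoc x y (+ 1))) ⟩
      σ (x ℤ.+ y ℤ.+ + 1)     ≈⟨ σ-suc (x ℤ.+ y) ⟩
      - σ (x ℤ.+ y)           ≈⟨ trans (-‿cong h) (-‿distribʳ-* _ _) ⟩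
      σ x * - σ y             ≈⟨ *-congˡ (σ-suc y) ⟨
      σ x * σ (y ℤ.+ + 1)     ∎)
    (λ y h → begin
      σ (x ℤ.+ y)              ≈⟨ -‿involutive _ ⟨
      - - σ (x ℤ.+ y)          ≈⟨ -‿cong (σ-suc (x ℤ.+ y)) ⟨
      - σ (x ℤ.+ y ℤ.+ + 1)    ≈⟨ -‿cong (trans (σ≡ (ℤ.+-assoc x y (+ 1))) h) ⟩
      - (σ x * σ (y ℤ.+ + 1))  ≈⟨ -‿cong (*-congˡ (σ-suc y)) ⟩
      - (σ x * - σ y)          ≈⟨ solve 2 (λ a b → :- (a :* (:- b)) := a :* b) refl _ _ ⟩
      σ x * σ y                ∎)

  σ-neg : ∀ x → σ (ℤ.- x) ≈ σ x
  σ-neg x = reflexive (≡.cong sg (ℤ.∣-i∣≡∣i∣ x))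

  sg² : ∀ n → sg n * sg n ≈ 1#
  sg² zero    = *-identityˡ _
  sg² (suc n) = trans (solve 1 (λ a → (:- a) :* (:- a) := a :* a) refl (sg n)) (sg² n)

  double-zero : ∀ {x} → x ≈ - x → x ≈ 0#
  double-zero {x} e with κ-inv (+ 2) (λ ())
  ... | y , h = *-cancel-unit h (begin
    (1# + 1#) * x     ≈⟨ solve 1 (λ x → con (+ 2) :* x := x :+ x) refl x ⟩
    x + x             ≈⟨ +-congˡ e ⟩
    x + - x           ≈⟨ -‿inverseʳ x ⟩
    0#                ≈⟨ zeroʳ _ ⟨
    (1# + 1#) * 0#    ∎)

  euler : Carrier
  euler = Σ 𝕃 (λ B → sg B * w 1 B)

  euler-at : ℕ → Carrier
  euler-at c = Σ 𝕃 (λ B → sg B * q^ (c ℕ.* B) * w 1 B)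

  -- `euler-at c` is Euler's series for (q^(c+1); q)_∞, and raising c splits off one factor.
  euler-step : ∀ c → euler-at c ≈ (1# + - (q^ suc c)) * euler-at (suc c)
  euler-step c = begin
    euler-at c
      ≈⟨ Σ-cong 𝕃 (λ B → trans (solve 4 (λ q s c w → s :* c :* w := s :* (q :* c) :* w :+ (con (+ 1) :- q) :* (w :* (s :* c))) refl (q^ B)
           (sg B) (q^ (c ℕ.* B)) (w 1 B))
           (+-congʳ (*-congʳ (*-congˡ (sym (q+ B (c ℕ.* B) ≡.refl)))))) ⟩
    Σ 𝕃 (λ B → sg B * q^ (suc c ℕ.* B) * w 1 B + (1# + - (q^ B)) * (w 1 B * (sg B * q^ (c ℕ.* B))))
      ≈⟨ trans (Σ-+ 𝕃 _ _) (+-congˡ (w-shift 1 N (λ B → sg B * q^ (c ℕ.* B)))) ⟩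
    euler-at (suc c) + Σ N (λ k → q^ (k ℕ.+ 1) * (w 1 k * (- sg k * q^ (c ℕ.* suc k))))
      ≈⟨ +-congˡ (Σ-cong N (λ k → trans (solve 4 (λ a b c d → a :* (b :* ((:- c) :* d)) := (:- (a :* d)) :* (c :* b)) refl _ _ _ _)
           (trans (*-congʳ (-‿cong (qq (k ℕ.+ 1) (c ℕ.* suc k) (suc c) (suc c ℕ.* k) (e k))))
             (solve 4 (λ a b c d → (:- (a :* b)) :* (c :* d) := (:- a) :* (c :* b :* d)) refl _ _ _ _)))) ⟩
    euler-at (suc c) + Σ N (λ k → - (q^ suc c) * (sg k * q^ (suc c ℕ.* k) * w 1 k))
      ≈⟨ +-congˡ (trans (sym (trans (Σ-last N _) (trans (+-congˡ (trans (*-congˡ (trans (*-congˡ w₁-N) (zeroʳ _))) (zeroʳ _)))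
           (+-identityʳ _)))) (sym (Σ-*ˡ 𝕃 _ _))) ⟩
    euler-at (suc c) + - (q^ suc c) * euler-at (suc c)
      ≈⟨ solve 2 (λ e q → e :+ (:- q) :* e := (con (+ 1) :- q) :* e) refl _ _ ⟩
    (1# + - (q^ suc c)) * euler-at (suc c) ∎
    where
    e : ∀ k → k ℕ.+ 1 ℕ.+ c ℕ.* suc k ≡ suc c ℕ.+ suc c ℕ.* k
    e k = ≡.trans (≡.cong₂ ℕ._+_ (ℕ.+-comm k 1) (ℕ.*-suc c k)) (≡.cong suc
      (≡.trans (≡.sym (ℕ.+-assoc k c _)) (≡.trans (≡.cong (ℕ._+ c ℕ.* k) (ℕ.+-comm k c)) (ℕ.+-assoc c k _))))

  euler-value : euler ≈ p N
  euler-value = begin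
    euler                 ≈⟨ Σ-cong 𝕃 (λ B → *-congʳ (trans (sym (*-identityʳ _)) (*-congˡ (sym q^0)))) ⟩
    euler-at 0            ≈⟨ go N ⟩
    p N * euler-at N      ≈⟨ *-congˡ (trans (Σ-suc N _) (trans (+-cong first rest) (+-identityʳ _))) ⟩
    p N * 1#              ≈⟨ *-identityʳ _ ⟩
    p N                   ∎
    where
    go : ∀ c → euler-at 0 ≈ p c * euler-at c
    go zero    = sym (*-identityˡ _)
    go (suc c) = trans (go c) (trans (*-congˡ (euler-step c)) (sym (*-assoc _ _ _)))
    first : sg 0 * q^ (N ℕ.* 0) * w 1 0 ≈ 1#
    first = trans (*-cong (trans (*-identityˡ _) (trans (q≡ (ℕ.*-zeroʳ N)) q^0)) (*-cong (trans (θ-def _) q^0) u-zero))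
      (trans (*-identityˡ _) (*-identityˡ _))
    rest : Σ N (λ B → sg (suc B) * q^ (N ℕ.* suc B) * w 1 (suc B)) ≈ 0#
    rest = Σ-0 N (λ B _ → trans (*-congʳ (trans (*-congˡ (q-big _ (ℕ.≤-trans (ℕ.m≤m+n N (N ℕ.* B)) (ℕ.≤-reflexive (≡.sym (ℕ.*-suc N B))))))
         (zeroʳ _))) (zeroˡ _))

  -- The partial sums of Euler's series for (1; q)_∞ = 0 telescope; the closed form vanishes modulo
  -- q^N at L = N.
  alt-partial : ∀ L → Σ (suc L) (λ A → sg A * w 0 A) ≈ sg L * w 1 L
  alt-partial zero    = trans (Σ-one _) refl-w
    where
    refl-w : 1# * w 0 0 ≈ 1# * w 1 0
    refl-w = *-congˡ (*-congʳ (trans (θ-def _) (sym (θ-def _))))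
  alt-partial (suc L) = begin
    Σ (suc (suc L)) (λ A → sg A * w 0 A)          ≈⟨ Σ-last (suc L) _ ⟩
    Σ (suc L) (λ A → sg A * w 0 A) + - sg L * w 0 (suc L)
      ≈⟨ +-congʳ (trans (alt-partial L) (*-congˡ w1L)) ⟩
    sg L * ((1# + - (q^ suc L)) * w 0 (suc L)) + - sg L * w 0 (suc L)
      ≈⟨ solve 3 (λ s q w → s :* ((con (+ 1) :- q) :* w) :+ (:- s) :* w := (:- s) :* (q :* w)) refl _ _ _ ⟩
    - sg L * (q^ suc L * w 0 (suc L))             ≈⟨ *-congˡ (q^-w₀ (suc L)) ⟩
    - sg L * w 1 (suc L)                          ∎
    where
    w1L : w 1 L ≈ (1# + - (q^ suc L)) * w 0 (suc L)
    w1L = sym (trans (w-suc 0 L) (trans (*-congʳ (q≡ (ℕ.+-identityʳ L))) (q^-w₀ L)))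

  alt-zero : Σ 𝕃 (λ A → sg A * w 0 A) ≈ 0#
  alt-zero = trans (alt-partial N) (trans (*-congˡ w₁-N) (zeroʳ _))

  -- Summation by parts from `alt-partial`. At L = N it gives the derivative of Euler's series at
  -- its simple zero.
  alt-moment : ∀ L → Σ (suc L) (λ A → κℕ A * (sg A * w 0 A)) ≈ κℕ L * (sg L * w 1 L) + - Σ L (λ A → sg A * w 1 A)
  alt-moment zero    = trans (Σ-one _) (sym (trans (+-congˡ (trans (-‿cong (Σ-zero _)) -0#≈0#)) (trans (+-identityʳ _) (trans (zeroˡ _) (sym
       (zeroˡ _))))))
  alt-moment (suc L) = begin
    Σ (suc (suc L)) (λ A → κℕ A * (sg A * w 0 A))
      ≈⟨ trans (Σ-last (suc L) _) (+-cong (alt-moment L) (*-congʳ (κℕ-suc L))) ⟩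
    κℕ L * (sg L * w 1 L) + - Σ L f + (1# + κℕ L) * (sg (suc L) * w 0 (suc L))
      ≈⟨ solve 4 (λ k x y z → k :* x :- y :+ (con (+ 1) :+ k) :* z := (con (+ 1) :+ k) :* (x :+ z) :- (y :+ x)) refl _ _ _ _ ⟩
    (1# + κℕ L) * (sg L * w 1 L + sg (suc L) * w 0 (suc L)) + - (Σ L f + sg L * w 1 L)
      ≈⟨ +-cong (*-cong (sym (κℕ-suc L)) (trans (+-congʳ (sym (alt-partial L))) (trans (sym (Σ-last (suc L) _)) (alt-partial (suc L))))) (-‿cong
           (sym (Σ-last L f))) ⟩
    κℕ (suc L) * (sg (suc L) * w 1 (suc L)) + - Σ (suc L) f ∎
    where
    f : ℕ → Carrier
    f A = sg A * w 1 A

  alt-first : Σ 𝕃 (λ A → κℕ A * (sg A * w 0 A)) ≈ - p N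
  alt-first = begin
    Σ 𝕃 (λ A → κℕ A * (sg A * w 0 A))                ≈⟨ alt-moment N ⟩
    κℕ N * (sg N * w 1 N) + - Σ N (λ A → sg A * w 1 A)
      ≈⟨ +-cong (trans (*-congˡ z) (zeroʳ _)) (-‿cong (trans (sym (+-identityʳ _)) (trans (+-congˡ (sym z)) (sym (Σ-last N _))))) ⟩
    0# + - euler                                     ≈⟨ +-identityˡ _ ⟩
    - euler                                          ≈⟨ -‿cong euler-value ⟩
    - p N                                            ∎
    where
    z : sg N * w 1 N ≈ 0#
    z = trans (*-congˡ w₁-N) (zeroʳ _)

  odd₁ : ℤ → ℤ
  odd₁ K = + 2 ℤ.* K ℤ.- + 1

  -- The derivative of the triple product at y = -1: of the weight 2A - (2B + 1) only the part with
  -- A survives, because Σ (-1)^A `w 0 A` is zero. The factor 2 appears because K runs over all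
  -- integers and K and 1 - K contribute equally.
  jacobi : 𝕀 N (λ K → θ K * (σ K * κ (odd₁ K))) ≈ - (κ (+ 2) * (p N * p N * p N))
  jacobi = begin
    𝕀 N (λ K → θ K * V K)
      ≈⟨ 𝕀-cong N (λ K → *-congˡ (reflexive (≡.cong V (≡.sym (ℤ.+-identityˡ K))))) ⟩
    ϑ V (+ 0)
      ≈⟨ JTP V (+ 0) ⟨
    p N * Σ 𝕃 (λ A → w 0 A * Σ 𝕃 (λ B → w 1 B * V (+ 0 ℤ.+ + A ℤ.+ ℤ.- + B)))
      ≈⟨ *-congˡ (Σ-cong 𝕃 inner) ⟩
    p N * Σ 𝕃 (λ A → κ (+ 2) * p N * (κℕ A * (sg A * w 0 A)) + (- (κ (+ 2) * e₁) + - p N) * (sg A * w 0 A))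
      ≈⟨ *-congˡ (trans (Σ-+ 𝕃 _ _) (+-cong (sym (Σ-*ˡ 𝕃 _ _)) (sym (Σ-*ˡ 𝕃 _ _)))) ⟩
    p N * (κ (+ 2) * p N * Σ 𝕃 (λ A → κℕ A * (sg A * w 0 A)) + (- (κ (+ 2) * e₁) + - p N) * Σ 𝕃 (λ A → sg A * w 0 A))
      ≈⟨ *-congˡ (+-cong (*-congˡ alt-first) (*-congˡ alt-zero)) ⟩
    p N * (κ (+ 2) * p N * - p N + (- (κ (+ 2) * e₁) + - p N) * 0#)
      ≈⟨ solve 2 (λ p y → p :* (con (+ 2) :* p :* (:- p) :+ y :* con (+ 0)) := :- (con (+ 2) :* (p :* p :* p))) refl (p N) _ ⟩
    - (κ (+ 2) * (p N * p N * p N)) ∎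
    where
    V : Seq
    V x = σ x * κ (odd₁ x)
    e₁ = Σ 𝕃 (λ B → κℕ B * (sg B * w 1 B))
    l₁ : ∀ A B → + 2 ℤ.* (+ 0 ℤ.+ A ℤ.+ ℤ.- B) ℤ.- + 1 ≡ + 2 ℤ.* A ℤ.- (+ 2 ℤ.* B ℤ.+ + 1)
    l₁ = solve-∀
    V≈ : ∀ A B → V (+ 0 ℤ.+ + A ℤ.+ ℤ.- + B) ≈ sg A * sg B * (κ (+ 2) * κℕ A + - (κ (+ 2) * κℕ B + 1#))
    V≈ A B = *-cong (trans (σ≡ (≡.cong (ℤ._+ ℤ.- + B) (ℤ.+-identityˡ (+ A)))) (trans (σ-+ (+ A) (ℤ.- + B)) (*-congˡ (σ-neg (+ B)))))
      (trans (reflexive (≡.cong κ (l₁ (+ A) (+ B)))) (trans (κ-+ (+ 2 ℤ.* + A) (ℤ.- (+ 2 ℤ.* + B ℤ.+ + 1)))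
        (+-cong (κ-* (+ 2) (+ A)) (trans (κ-neg (+ 2 ℤ.* + B ℤ.+ + 1)) (-‿cong (trans (κ-+ (+ 2 ℤ.* + B) (+ 1)) (+-congʳ (κ-* (+ 2) (+ B)))))))))
    inner : ∀ A → w 0 A * Σ 𝕃 (λ B → w 1 B * V (+ 0 ℤ.+ + A ℤ.+ ℤ.- + B))
      ≈ κ (+ 2) * p N * (κℕ A * (sg A * w 0 A)) + (- (κ (+ 2) * e₁) + - p N) * (sg A * w 0 A)
    inner A = begin
      w 0 A * Σ 𝕃 (λ B → w 1 B * V (+ 0 ℤ.+ + A ℤ.+ ℤ.- + B))
        ≈⟨ *-congˡ (trans (Σ-cong 𝕃 (λ B → trans (*-congˡ (V≈ A B))
             (solve 5 (λ w a b k l → w :* (a :* b :* (con (+ 2) :* k :- (con (+ 2) :* l :+ con (+ 1))))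
               := (a :* (con (+ 2) :* k :- con (+ 1))) :* (b :* w) :+ (:- (con (+ 2) :* a)) :* (l :* (b :* w))) refl (w 1 B) (sg A) (sg B)
                    (κℕ A) (κℕ B))))
             (trans (Σ-+ 𝕃 _ _) (+-cong (sym (Σ-*ˡ 𝕃 _ _)) (sym (Σ-*ˡ 𝕃 _ _))))) ⟩
      w 0 A * (sg A * (κ (+ 2) * κℕ A + - 1#) * euler + - (κ (+ 2) * sg A) * e₁)
        ≈⟨ *-congˡ (+-congʳ (*-congˡ euler-value)) ⟩
      w 0 A * (sg A * (κ (+ 2) * κℕ A + - 1#) * p N + - (κ (+ 2) * sg A) * e₁)
        ≈⟨ solve 5 (λ w a k p e → w :* (a :* (con (+ 2) :* k :- con (+ 1)) :* p :+ (:- (con (+ 2) :* a)) :* e)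
             := con (+ 2) :* p :* (k :* (a :* w)) :+ (:- (con (+ 2) :* e) :- p) :* (a :* w)) refl (w 0 A) (sg A) (κℕ A) (p N) e₁ ⟩
      κ (+ 2) * p N * (κℕ A * (sg A * w 0 A)) + (- (κ (+ 2) * e₁) + - p N) * (sg A * w 0 A) ∎

  -- The coefficient sequence after the substitution of y² for y.
  spread : Seq → Seq
  spread h x with parity x
  ... | inj₁ (l , _) = h l
  ... | inj₂ _       = 0#

  spread-even : ∀ h l → spread h (l ℤ.+ l) ≈ h l
  spread-even h l with parity (l ℤ.+ l)
  ... | inj₁ (m , e) = reflexive (≡.cong h (≡.sym (double-injective l m e)))
  ... | inj₂ (m , e) = ⊥-elim (even≢odd l m e)

  spread-odd : ∀ h l → spread h (l ℤ.+ l ℤ.+ + 1) ≈ 0#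
  spread-odd h l with parity (l ℤ.+ l ℤ.+ + 1)
  ... | inj₁ (m , e) = ⊥-elim (even≢odd m l (≡.sym e))
  ... | inj₂ (m , e) = refl

  spread≈ : ∀ h {x} l → x ≡ l ℤ.+ l → spread h x ≈ h l
  spread≈ h l ≡.refl = spread-even h l

  spread≈0 : ∀ h {x} l → x ≡ l ℤ.+ l ℤ.+ + 1 → spread h x ≈ 0#
  spread≈0 h l ≡.refl = spread-odd h l

  -- The functional U ↦ H U m (+ 0) at U₀ annihilates every Rogers–Szegő polynomial of positive degree.
  U₀ : Seq
  U₀ = spread (λ l → σ l * θ l)

  ũ : ℕ → Seq
  ũ zero    = U₀
  ũ (suc M) = ϑ (ũ M)

  ϑ-cong : ∀ {U V : Seq} → (∀ s → U s ≈ V s) → ∀ s → ϑ U s ≈ ϑ V s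
  ϑ-cong h s = 𝕀-cong N (λ K → *-congˡ (h _))

  ϑ-Van : ∀ (U : Seq) s → Van N (λ K → θ K * U (s ℤ.+ K))
  ϑ-Van U s K l = θ-big* K _ l

  ϑ-flip : ∀ U s → ϑ U s ≈ 𝕀 N (λ K → θ K * U (s ℤ.+ (+ 1 ℤ.- K)))
  ϑ-flip U s = begin
    𝕀 N g                             ≈⟨ 𝕀-ext {E = suc N} (ϑ-Van U s) (ℕ.n≤1+n N) ⟨
    𝕀 (suc N) g                       ≈⟨ 𝕀-flip (suc N) g ⟨
    𝕀 (suc N) (λ K → g (ℤ.- K))       ≈⟨ 𝕀-shift (λ K → g (ℤ.- K)) (ℤ.- + 1) (λ K l → ϑ-Van U s _ (≡.subst (N ℕ.<_) (≡.sym (ℤ.∣-i∣≡∣i∣ K)) l))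
         (ℕ.≤-reflexive (ℕ.+-comm N 1)) ⟨
    𝕀 (suc N) (λ K → g (ℤ.- (K ℤ.+ ℤ.- + 1)))
      ≈⟨ 𝕀-cong (suc N) (λ K → *-cong (trans (θ-def _) (trans (q≡ (≡.trans (≡.cong tri (l₁ K)) (tri-flip K))) (sym (θ-def _))))
           (reflexive (≡.cong (λ t → U (s ℤ.+ t)) (l₁ K)))) ⟩
    𝕀 (suc N) (λ K → θ K * U (s ℤ.+ (+ 1 ℤ.- K)))
      ≈⟨ 𝕀-ext (λ K l → θ-big* K _ l) (ℕ.n≤1+n N) ⟩
    𝕀 N (λ K → θ K * U (s ℤ.+ (+ 1 ℤ.- K))) ∎
    where
    g : Seq
    g K = θ K * U (s ℤ.+ K)
    l₁ : ∀ K → ℤ.- (K ℤ.+ ℤ.- + 1) ≡ + 1 ℤ.- K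
    l₁ = solve-∀

  -- `tri-flip` in every factor: U₀ is odd about 1, and each ϑ, symmetric about 1/2, moves the
  -- centre down by 1/2.
  ũ-antisym : ∀ M s → ũ M (+ 2 ℤ.- + M ℤ.- s) ≈ - ũ M s
  ũ-antisym zero s with parity s
  ... | inj₁ (l , ≡.refl) = begin
    U₀ (+ 2 ℤ.- (l ℤ.+ l))                    ≈⟨ spread≈ _ (+ 1 ℤ.- l) (l₁ l) ⟩
    σ (+ 1 ℤ.- l) * θ (+ 1 ℤ.- l)
      ≈⟨ *-cong (trans (σ≡ (ℤ.+-comm (+ 1) (ℤ.- l))) (trans (σ-suc (ℤ.- l)) (-‿cong (σ-neg l))))
           (trans (θ-def _) (trans (q≡ (tri-flip l)) (sym (θ-def _)))) ⟩
    - σ l * θ l                               ≈⟨ -‿distribˡ-* _ _ ⟨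
    - (σ l * θ l)                             ∎
    where
    l₁ : ∀ l → + 2 ℤ.- (l ℤ.+ l) ≡ (+ 1 ℤ.- l) ℤ.+ (+ 1 ℤ.- l)
    l₁ = solve-∀
  ... | inj₂ (l , ≡.refl) = trans (spread≈0 _ (ℤ.- l) (l₁ l)) (sym -0#≈0#)
    where
    l₁ : ∀ l → + 2 ℤ.- (l ℤ.+ l ℤ.+ + 1) ≡ ℤ.- l ℤ.+ ℤ.- l ℤ.+ + 1
    l₁ = solve-∀
  ũ-antisym (suc M) s = begin
    ϑ (ũ M) (+ 2 ℤ.- + suc M ℤ.- s)
      ≈⟨ ϑ-flip (ũ M) (+ 2 ℤ.- + suc M ℤ.- s) ⟩
    𝕀 N (λ K → θ K * ũ M (+ 2 ℤ.- + suc M ℤ.- s ℤ.+ (+ 1 ℤ.- K)))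
      ≈⟨ 𝕀-cong N (λ K → trans (*-congˡ (trans (reflexive (≡.cong (ũ M) (l₁ (+ M) s K))) (ũ-antisym M (s ℤ.+ K)))) (sym (-‿distribʳ-* _ _))) ⟩
    𝕀 N (λ K → - (θ K * ũ M (s ℤ.+ K)))
      ≈⟨ 𝕀-neg N _ ⟩
    - ϑ (ũ M) s ∎
    where
    l₁ : ∀ M s K → + 2 ℤ.- (+ 1 ℤ.+ M) ℤ.- s ℤ.+ (+ 1 ℤ.- K) ≡ + 2 ℤ.- M ℤ.- (s ℤ.+ K)
    l₁ = solve-∀

  -- Passing from l to l + 2 in U₀ gives the period 4, and every ϑ adds 1 by the substitution of K -
  -- 1 for K. The exponent s + M + 1 may be negative, so it is written as a - b with a power of q on
  -- each side.
  ũ-quasi : ∀ M s a b → + a ≡ + b ℤ.+ (s ℤ.+ + M ℤ.+ + 1) → q^ b * ũ M (s ℤ.+ + M ℤ.+ + 4) ≈ q^ a * ũ M s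
  ũ-quasi zero s a b e with parity s
  ... | inj₁ (l , ≡.refl) = begin
    q^ b * U₀ (l ℤ.+ l ℤ.+ + 0 ℤ.+ + 4)          ≈⟨ *-congˡ (spread≈ _ (l ℤ.+ + 1 ℤ.+ + 1) (l₁ l)) ⟩
    q^ b * (σ (l ℤ.+ + 1 ℤ.+ + 1) * θ (l ℤ.+ + 1 ℤ.+ + 1))
      ≈⟨ *-congˡ (*-congʳ (trans (σ-suc (l ℤ.+ + 1)) (trans (-‿cong (σ-suc l)) (-‿involutive _)))) ⟩
    q^ b * (σ l * θ (l ℤ.+ + 1 ℤ.+ + 1))
      ≈⟨ solve 3 (λ a b c → a :* (b :* c) := b :* (a :* c)) refl _ _ _ ⟩
    σ l * (q^ b * θ (l ℤ.+ + 1 ℤ.+ + 1))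
      ≈⟨ *-congˡ (θ-qq b _ a l (ℤ.+-injective (≡.trans (≡.cong (λ t → + b ℤ.+ t) (≡.trans (tri-suc (l ℤ.+ + 1)) (≡.cong (ℤ._+ (l ℤ.+ + 1))
           (tri-suc l))))
           (≡.trans (l₂ l (+ b) (+ tri l)) (≡.cong (ℤ._+ + tri l) (≡.sym e)))))) ⟩
    σ l * (q^ a * θ l)
      ≈⟨ solve 3 (λ a b c → a :* (b :* c) := b :* (a :* c)) refl _ _ _ ⟩
    q^ a * (σ l * θ l) ∎
    where
    l₁ : ∀ l → l ℤ.+ l ℤ.+ + 0 ℤ.+ + 4 ≡ (l ℤ.+ + 1 ℤ.+ + 1) ℤ.+ (l ℤ.+ + 1 ℤ.+ + 1)
    l₁ = solve-∀
    l₂ : ∀ l b t → b ℤ.+ (t ℤ.+ l ℤ.+ (l ℤ.+ + 1)) ≡ b ℤ.+ (l ℤ.+ l ℤ.+ + 0 ℤ.+ + 1) ℤ.+ t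
    l₂ = solve-∀
  ... | inj₂ (l , ≡.refl) = trans (*-congˡ (spread≈0 _ (l ℤ.+ + 2) (l₁ l))) (trans (zeroʳ _) (sym (zeroʳ _)))
    where
    l₁ : ∀ l → l ℤ.+ l ℤ.+ + 1 ℤ.+ + 0 ℤ.+ + 4 ≡ (l ℤ.+ + 2) ℤ.+ (l ℤ.+ + 2) ℤ.+ + 1
    l₁ = solve-∀
  ũ-quasi (suc M) s a b e = begin
    q^ b * 𝕀 N g
      ≈⟨ *-congˡ (trans (sym (𝕀-ext {E = suc N} (ϑ-Van (ũ M) s′) (ℕ.n≤1+n N)))
           (sym (𝕀-shift g (ℤ.- + 1) (ϑ-Van (ũ M) s′) (ℕ.≤-reflexive (ℕ.+-comm N 1))))) ⟩
    q^ b * 𝕀 (suc N) (λ K → g (K ℤ.- + 1))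
      ≈⟨ 𝕀-*ˡ (suc N) _ _ ⟩
    𝕀 (suc N) (λ K → q^ b * (θ (K ℤ.- + 1) * ũ M (s′ ℤ.+ (K ℤ.- + 1))))
      ≈⟨ 𝕀-cong (suc N) term≈ ⟩
    𝕀 (suc N) (λ K → q^ a * (θ K * ũ M (s ℤ.+ K)))
      ≈⟨ 𝕀-*ˡ (suc N) _ _ ⟨
    q^ a * 𝕀 (suc N) (λ K → θ K * ũ M (s ℤ.+ K))
      ≈⟨ *-congˡ (𝕀-ext (ϑ-Van (ũ M) s) (ℕ.n≤1+n N)) ⟩
    q^ a * ϑ (ũ M) s ∎
    where
    s′ = s ℤ.+ + suc M ℤ.+ + 4
    g : Seq
    g K = θ K * ũ M (s′ ℤ.+ K)
    l₁ : ∀ s M K → s ℤ.+ (+ 1 ℤ.+ M) ℤ.+ + 4 ℤ.+ (K ℤ.- + 1) ≡ s ℤ.+ K ℤ.+ M ℤ.+ + 4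
    l₁ = solve-∀
    l₂ : ∀ s M K b t → b ℤ.+ (s ℤ.+ (+ 1 ℤ.+ M) ℤ.+ + 1) ℤ.+ (t ℤ.+ (K ℤ.- + 1)) ≡ b ℤ.+ t ℤ.+ (s ℤ.+ K ℤ.+ M ℤ.+ + 1)
    l₂ = solve-∀
    term≈ : ∀ K → q^ b * (θ (K ℤ.- + 1) * ũ M (s′ ℤ.+ (K ℤ.- + 1))) ≈ q^ a * (θ K * ũ M (s ℤ.+ K))
    term≈ K = begin
      q^ b * (θ (K ℤ.- + 1) * ũ M (s′ ℤ.+ (K ℤ.- + 1)))
        ≈⟨ trans (sym (*-assoc _ _ _)) (*-cong (trans (*-congˡ (θ-def _)) (sym (q+ b _ ≡.refl))) (reflexive (≡.cong (ũ M) (l₁ s (+ M) K)))) ⟩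
      q^ (b ℕ.+ tri (K ℤ.- + 1)) * ũ M (s ℤ.+ K ℤ.+ + M ℤ.+ + 4)
        ≈⟨ ũ-quasi M (s ℤ.+ K) (a ℕ.+ tri K) (b ℕ.+ tri (K ℤ.- + 1)) (≡.trans (≡.cong₂ ℤ._+_ e (tri-pred K)) (l₂ s (+ M) K (+ b) (+ tri
             (K ℤ.- + 1)))) ⟩
      q^ (a ℕ.+ tri K) * ũ M (s ℤ.+ K)
        ≈⟨ trans (*-congʳ (trans (q+ a _ ≡.refl) (*-congˡ (sym (θ-def _))))) (*-assoc _ _ _) ⟩
      q^ a * (θ K * ũ M (s ℤ.+ K)) ∎

  reach : ℕ → ℕ
  reach zero    = N ℕ.+ N
  reach (suc M) = reach M ℕ.+ N

  ũ-Van : ∀ M → Van (reach M) (ũ M)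
  ũ-Van zero s l with parity s
  ... | inj₁ (x , ≡.refl) with N ℕ.<? ℤ.∣ x ∣
  ...   | yes h = trans (*-congˡ (θ-big x h)) (zeroʳ _)
  ...   | no h  = ⊥-elim (ℕ.<⇒≱ l (ℕ.≤-trans (ℤ.∣i+j∣≤∣i∣+∣j∣ x x) (ℕ.+-mono-≤ (ℕ.≮⇒≥ h) (ℕ.≮⇒≥ h))))
  ũ-Van zero s l | inj₂ _ = refl
  ũ-Van (suc M) s l = trans (𝕀-cong N go) (𝕀-0 N)
    where
    go : ∀ K → θ K * ũ M (s ℤ.+ K) ≈ 0#
    go K with N ℕ.<? ℤ.∣ K ∣
    ... | yes h = θ-big* K _ h
    ... | no h  = trans (*-congˡ (ũ-Van M (s ℤ.+ K) (ℕ.≰⇒> λ c → ℕ.<⇒≱ l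
        (ℕ.≤-trans (ℕ.≤-reflexive (≡.cong ℤ.∣_∣ (l₁ s K))) (ℕ.≤-trans (ℤ.∣i-j∣≤∣i∣+∣j∣ (s ℤ.+ K) K) (ℕ.+-mono-≤ c (ℕ.≮⇒≥ h))))))) (zeroʳ _)
      where
      l₁ : ∀ s K → s ≡ s ℤ.+ K ℤ.- K
      l₁ = solve-∀

-- The path sum as a theta coefficient.

module Paths (Q : QRing) where
  open Sequences Q public

  orth : ℕ → ℕ → Carrier
  orth r m = Σ (suc m) (λ i → u i * (u (m ℕ.∸ i) * (σ (+ i ℤ.- + r) * θ (+ i ℤ.- + r))))

  -- Consecutive sums have the ratio known from the q-binomial theorem. Its factor 1 - q^(m-r) is
  -- zero at m = r, which annihilates all sums with m > r.
  orth-rec : ∀ r m → r ℕ.≤ m → (1# + - (q^ suc m)) * orth r (suc m) ≈ (1# + - (q^ (m ℕ.∸ r))) * orth r m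
  orth-rec r m rm = begin
    (1# + - (q^ suc m)) * Σ (suc (suc m)) t
      ≈⟨ Σ-*ˡ (suc (suc m)) _ _ ⟩
    Σ (suc (suc m)) (λ i → (1# + - (q^ suc m)) * t i)
      ≈⟨ Σ-cong< (suc (suc m)) (λ i l → split-1-q (suc m ℕ.∸ i) i (≡.sym (ℕ.m∸n+n≡m (ℕ.≤-pred l))) (t i)) ⟩
    Σ (suc (suc m)) (λ i → A i + q^ (suc m ℕ.∸ i) * ((1# + - (q^ i)) * t i))
      ≈⟨ Σ-+ (suc (suc m)) _ _ ⟩
    Σ (suc (suc m)) A + Σ (suc (suc m)) (λ i → q^ (suc m ℕ.∸ i) * ((1# + - (q^ i)) * t i))
      ≈⟨ +-cong (trans (Σ-last (suc m) A) (trans (+-congˡ A0) (+-identityʳ _)))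
                (Σ-cong (suc (suc m)) (λ i → solve 4 (λ a b c d → a :* (b :* (c :* d)) := b :* (c :* (a :* d))) refl _ _ _ _)) ⟩
    Σ (suc m) A + Σ (suc (suc m)) (λ i → (1# + - (q^ i)) * (u i * g i))
      ≈⟨ +-cong (Σ-cong< (suc m) A≈) (u-shift (suc m) g) ⟩
    orth r m + Σ (suc m) (λ i → u i * g (suc i))
      ≈⟨ +-congˡ (trans (Σ-cong< (suc m) g≈) (sym (Σ-*ˡ (suc m) _ _))) ⟩
    orth r m + - (q^ (m ℕ.∸ r)) * orth r m
      ≈⟨ solve 2 (λ a q → a :+ (:- q) :* a := (con (+ 1) :- q) :* a) refl _ _ ⟩
    (1# + - (q^ (m ℕ.∸ r))) * orth r m ∎
    where
    z t A g : ℕ → Carrier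
    z i = σ (+ i ℤ.- + r) * θ (+ i ℤ.- + r)
    t i = u i * (u (suc m ℕ.∸ i) * z i)
    A i = (1# + - (q^ (suc m ℕ.∸ i))) * t i
    g i = q^ (suc m ℕ.∸ i) * (u (suc m ℕ.∸ i) * z i)
    A0 : A (suc m) ≈ 0#
    A0 rewrite ℕ.n∸n≡0 m = trans (*-congʳ 1-q^0) (zeroˡ _)
    A≈ : ∀ i → i ℕ.< suc m → A i ≈ u i * (u (m ℕ.∸ i) * z i)
    A≈ i (s≤s l) rewrite ℕ.+-∸-assoc 1 l =
      trans (solve 4 (λ a b c d → a :* (b :* (c :* d)) := b :* (a :* c :* d)) refl _ _ _ _) (*-congˡ (*-congʳ (u-step (m ℕ.∸ i))))
    g≈ : ∀ i → i ℕ.< suc m → u i * g (suc i) ≈ - (q^ (m ℕ.∸ r)) * (u i * (u (m ℕ.∸ i) * z i))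
    g≈ i (s≤s l) = begin
      u i * (q^ (m ℕ.∸ i) * (u (m ℕ.∸ i) * (σ (+ suc i ℤ.- + r) * θ (+ suc i ℤ.- + r))))
        ≈⟨ solve 5 (λ a b c d e → a :* (b :* (c :* (d :* e))) := a :* (c :* (d :* (b :* e)))) refl _ _ _ _ _ ⟩
      u i * (u (m ℕ.∸ i) * (σ (+ suc i ℤ.- + r) * (q^ (m ℕ.∸ i) * θ (+ suc i ℤ.- + r))))
        ≈⟨ *-congˡ (*-congˡ (*-cong (trans (σ≡ (l₁ (+ i) (+ r))) (σ-suc (+ i ℤ.- + r))) (θ-qq (m ℕ.∸ i) _ (m ℕ.∸ r) _ e))) ⟩
      u i * (u (m ℕ.∸ i) * (- σ (+ i ℤ.- + r) * (q^ (m ℕ.∸ r) * θ (+ i ℤ.- + r))))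
        ≈⟨ solve 5 (λ a b c d e → a :* (b :* ((:- c) :* (d :* e))) := (:- d) :* (a :* (b :* (c :* e)))) refl _ _ _ _ _ ⟩
      - (q^ (m ℕ.∸ r)) * (u i * (u (m ℕ.∸ i) * z i)) ∎
      where
      l₁ : ∀ i r → + 1 ℤ.+ i ℤ.- r ≡ i ℤ.- r ℤ.+ + 1
      l₁ = solve-∀
      l₂ : ∀ m i r t → m ℤ.- i ℤ.+ (t ℤ.+ (i ℤ.- r)) ≡ m ℤ.- r ℤ.+ t
      l₂ = solve-∀
      e : (m ℕ.∸ i) ℕ.+ tri (+ suc i ℤ.- + r) ≡ (m ℕ.∸ r) ℕ.+ tri (+ i ℤ.- + r)
      e = ℤ.+-injective (≡.trans (≡.cong₂ ℤ._+_ (pos-∸ l) (≡.trans (≡.cong (λ t → + tri t) (l₁ (+ i) (+ r))) (tri-suc (+ i ℤ.- + r))))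
        (≡.trans (l₂ (+ m) (+ i) (+ r) (+ tri (+ i ℤ.- + r))) (≡.cong (ℤ._+ + tri (+ i ℤ.- + r)) (≡.sym (pos-∸ rm)))))

  orth-zero : ∀ r d → orth r (suc (d ℕ.+ r)) ≈ 0#
  orth-zero r zero    = 1-q-cancel r (trans (orth-rec r r ℕ.≤-refl) (trans (*-congʳ (trans (+-congˡ (-‿cong (q≡ (ℕ.n∸n≡0 r)))) 1-q^0)) (trans
       (zeroˡ _) (sym (zeroʳ _)))))
  orth-zero r (suc d) = 1-q-cancel (suc (d ℕ.+ r)) (trans (orth-rec r (suc (d ℕ.+ r)) (ℕ.≤-trans (ℕ.m≤n+m r d) (ℕ.n≤1+n _)))
    (trans (*-congˡ (orth-zero r d)) (trans (zeroʳ _) (sym (zeroʳ _)))))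

  -- In even degree 2r the sum is `orth r` at 2r > r; in odd degree only the odd positions of U₀ are
  -- met.
  H-U₀-zero : ∀ m → H U₀ (suc m) (+ 0) ≈ 0#
  H-U₀-zero m with parity (+ suc m)
  ... | inj₁ (+ zero , ())
  ... | inj₁ (+ suc r , e) = begin
    H U₀ (suc m) (+ 0)
      ≈⟨ Σ-cong< (suc (suc m)) (λ i l → *-congˡ (*-congˡ (spread≈ _ (+ i ℤ.- + suc r) (ix i (ℕ.≤-pred l))))) ⟩
    orth (suc r) (suc m)      ≡⟨ ≡.cong (orth (suc r)) (ℤ.+-injective e) ⟩
    orth (suc r) (suc r ℕ.+ suc r)   ≈⟨ orth-zero (suc r) r ⟩
    0#                        ∎
    where
    l₁ : ∀ i j → i ℤ.- j ≡ i ℤ.+ i ℤ.- (i ℤ.+ j)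
    l₁ = solve-∀
    l₂ : ∀ i r → i ℤ.+ i ℤ.- (r ℤ.+ r) ≡ (i ℤ.- r) ℤ.+ (i ℤ.- r)
    l₂ = solve-∀
    ix : ∀ i → i ℕ.≤ suc m → + 0 ℤ.+ (+ i ℤ.- + (suc m ℕ.∸ i)) ≡ (+ i ℤ.- + suc r) ℤ.+ (+ i ℤ.- + suc r)
    ix i l = ≡.trans (ℤ.+-identityˡ _) (≡.trans (l₁ (+ i) (+ (suc m ℕ.∸ i)))
      (≡.trans (≡.cong (λ t → + i ℤ.+ + i ℤ.- t) (≡.trans (≡.cong +_ (ℕ.m+[n∸m]≡n l)) e)) (l₂ (+ i) (+ suc r))))
  ... | inj₁ (-[1+ r ] , ())
  ... | inj₂ (r , e) = Σ-0 (suc (suc m)) (λ i l → trans (*-congˡ (trans (*-congˡ (spread≈0 _ (+ i ℤ.- r ℤ.- + 1) (ix i (ℕ.≤-pred l))))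
       (zeroʳ _))) (zeroʳ _))
    where
    l₁ : ∀ i j → i ℤ.- j ≡ i ℤ.+ i ℤ.- (i ℤ.+ j)
    l₁ = solve-∀
    l₂ : ∀ i r → i ℤ.+ i ℤ.- (r ℤ.+ r ℤ.+ + 1) ≡ (i ℤ.- r ℤ.- + 1) ℤ.+ (i ℤ.- r ℤ.- + 1) ℤ.+ + 1
    l₂ = solve-∀
    ix : ∀ i → i ℕ.≤ suc m → + 0 ℤ.+ (+ i ℤ.- + (suc m ℕ.∸ i)) ≡ (+ i ℤ.- r ℤ.- + 1) ℤ.+ (+ i ℤ.- r ℤ.- + 1) ℤ.+ + 1
    ix i l = ≡.trans (ℤ.+-identityˡ _) (≡.trans (l₁ (+ i) (+ (suc m ℕ.∸ i)))
      (≡.trans (≡.cong (λ t → + i ℤ.+ + i ℤ.- t) (≡.trans (≡.cong +_ (ℕ.m+[n∸m]≡n l)) e)) (l₂ (+ i) r)))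

  H-U₀-one : H U₀ 0 (+ 0) ≈ 1#
  H-U₀-one = trans (Σ-one _) (trans (*-cong u-zero (*-cong u-zero (trans (spread-even (λ l → σ l * θ l) (+ 0)) (trans (*-identityˡ _) (trans
       (θ-def (+ 0)) q^0)))))
    (trans (*-identityˡ _) (*-identityˡ _)))

  -- The weight of the last edge, down to 0, is itself a big q-Hermite value: at U₀ only the term of
  -- `G` with H of degree 0 survives, and its coefficient is `w 0 a`. This starts the induction
  -- along the path.
  G-U₀ : ∀ a → θ (+ a) ≈ p a * G 0 U₀ a (+ 0)
  G-U₀ a = sym (begin
    p a * Σ (suc a) (λ k → w 0 k * H U₀ (a ℕ.∸ k) (+ 0))
      ≈⟨ *-congˡ (trans (Σ-last a _) (trans (+-cong (Σ-0 a low) top) (+-identityˡ _))) ⟩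
    p a * w 0 a
      ≈⟨ solve 3 (λ p t u → p :* (t :* u) := t :* (p :* u)) refl _ _ _ ⟩
    θ (+ (a ℕ.+ 0)) * (p a * u a)
      ≈⟨ trans (*-cong (θ≡ (≡.cong +_ (ℕ.+-identityʳ a))) (p-u a)) (*-identityʳ _) ⟩
    θ (+ a) ∎)
    where
    low : ∀ k → k ℕ.< a → w 0 k * H U₀ (a ℕ.∸ k) (+ 0) ≈ 0#
    low k l = trans (*-congˡ (trans (reflexive (≡.cong (λ t → H U₀ t (+ 0)) (ℕ.+-∸-assoc 1 l))) (H-U₀-zero (a ℕ.∸ suc k)))) (zeroʳ _)
    top : w 0 a * H U₀ (a ℕ.∸ a) (+ 0) ≈ w 0 a
    top = trans (*-congˡ (trans (reflexive (≡.cong (λ t → H U₀ t (+ 0)) (ℕ.n∸n≡0 a))) H-U₀-one)) (*-identityʳ _)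

  -- Sums over the rest of a path from height a at an even or an odd position. By `tri-flip` θ(b + 1
  -- - a) is θ(a - b), so both kinds of edges fit the kernel of `X`.
  pathE pathO : ℕ → ℕ → ℕ → Carrier
  pathE B zero    a = θ (+ a)
  pathE B (suc n) a = Σ B (λ b → θ (+ (b ℕ.+ 1) ℤ.- + a) * (u b * pathO B n b))
  pathO B n       a = Σ B (λ b → θ (+ (b ℕ.+ 0) ℤ.- + a) * (u b * pathE B n b))

  𝕌 : ℕ → Seq
  𝕌 zero    = U₀
  𝕌 (suc n) = Λ 1 (Λ 0 (𝕌 n))

  -- The bound leaves room for every edge to climb by N; a steeper edge has weight zero.
  pathE-value : ∀ B n a → a ℕ.+ (n ℕ.+ n) ℕ.* N ℕ.< B → pathE B n a ≈ p a * G 0 (𝕌 n) a (+ 0)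
  pathO-value : ∀ B n a → a ℕ.+ suc (n ℕ.+ n) ℕ.* N ℕ.< B → pathO B n a ≈ p a * G 1 (Λ 0 (𝕌 n)) a (+ 0)
  pathE-value B zero    a l = G-U₀ a
  pathE-value B (suc n) a l = path-step B 1 0 (Λ 0 (𝕌 n)) a (+ 0) (pathO B n) ≡.refl
    (ℕ.≤-trans (s≤s (ℕ.+-monoʳ-≤ a (ℕ.m≤m+n N _))) l)
    (λ b b≤ → pathO-value B n b (ℕ.≤-trans (s≤s (ℕ.+-monoˡ-≤ (suc (n ℕ.+ n) ℕ.* N) b≤))
      (≡.subst (ℕ._≤ B) (≡.cong suc (≡.trans (≡.cong (λ t → a ℕ.+ (N ℕ.+ t ℕ.* N)) (ℕ.+-suc n n)) (≡.sym (ℕ.+-assoc a N _)))) l)))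
  pathO-value B n a l = path-step B 0 1 (𝕌 n) a (+ 0) (pathE B n) ≡.refl
    (ℕ.≤-trans (s≤s (ℕ.+-monoʳ-≤ a (ℕ.m≤m+n N _))) l)
    (λ b b≤ → pathE-value B n b (ℕ.≤-trans (s≤s (ℕ.+-monoˡ-≤ ((n ℕ.+ n) ℕ.* N) b≤))
      (≡.subst (ℕ._≤ B) (≡.cong suc (≡.sym (ℕ.+-assoc a N _))) l)))

  path-value : ∀ B n → (n ℕ.+ n) ℕ.* N ℕ.< B → pathE B n 0 ≈ 𝕌 n (+ 0)
  path-value B n l = trans (pathE-value B n 0 l) (trans (*-identityˡ _) (G-zero 1 0 ≡.refl (𝕌 n) (+ 0)))

  ϑ-* : ∀ y U s → y * ϑ U s ≈ ϑ (λ t → y * U t) s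
  ϑ-* y U s = trans (𝕀-*ˡ N _ _) (𝕀-cong N (λ K → solve 3 (λ a b c → a :* (b :* c) := b :* (a :* c)) refl _ _ _))

  pow : Carrier → ℕ → Carrier
  pow x zero    = 1#
  pow x (suc n) = x * pow x n

  -- Each pair of edges contributes two triple products, hence two factors (q)_∞, two factors ϑ, and
  -- the shift by one from `Λ₁Λ₀`.
  𝕌-ũ : ∀ n s → pow (p N) (n ℕ.+ n) * 𝕌 n s ≈ ũ (n ℕ.+ n) (s ℤ.- + n)
  𝕌-ũ zero    s = trans (*-identityˡ _) (reflexive (≡.cong U₀ (≡.sym (ℤ.+-identityʳ s))))
  𝕌-ũ (suc n) s = begin
    pow (p N) (suc n ℕ.+ suc n) * Λ 1 (Λ 0 (𝕌 n)) s
      ≈⟨ *-cong (reflexive (≡.cong (λ t → p N * pow (p N) t) (ℕ.+-suc n n))) (Λ₁Λ₀ (𝕌 n) s) ⟩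
    p N * (p N * pow (p N) (n ℕ.+ n)) * JT (JT (𝕌 n)) (s ℤ.- + 1)
      ≈⟨ solve 3 (λ p x j → p :* (p :* x) :* j := p :* x :* (p :* j)) refl _ _ _ ⟩
    p N * pow (p N) (n ℕ.+ n) * (p N * JT (JT (𝕌 n)) (s ℤ.- + 1))
      ≈⟨ *-congˡ (JTP (JT (𝕌 n)) (s ℤ.- + 1)) ⟩
    p N * pow (p N) (n ℕ.+ n) * ϑ (JT (𝕌 n)) (s ℤ.- + 1)
      ≈⟨ trans (ϑ-* _ (JT (𝕌 n)) (s ℤ.- + 1)) (ϑ-cong (λ t → begin
           p N * pow (p N) (n ℕ.+ n) * JT (𝕌 n) t                 ≈⟨ solve 3 (λ p x j → p :* x :* j := x :* (p :* j)) refl _ _ _ ⟩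
           pow (p N) (n ℕ.+ n) * (p N * JT (𝕌 n) t)               ≈⟨ *-congˡ (JTP (𝕌 n) t) ⟩
           pow (p N) (n ℕ.+ n) * ϑ (𝕌 n) t                        ≈⟨ ϑ-* _ (𝕌 n) t ⟩
           ϑ (λ t → pow (p N) (n ℕ.+ n) * 𝕌 n t) t                ≈⟨ ϑ-cong (𝕌-ũ n) t ⟩
           ϑ (λ t → ũ (n ℕ.+ n) (t ℤ.- + n)) t                    ≈⟨ 𝕀-cong N (λ K → *-congˡ (reflexive (≡.cong (ũ (n ℕ.+ n)) (l₁ t K (+ n))))) ⟩
           ϑ (ũ (n ℕ.+ n)) (t ℤ.- + n)                            ∎) (s ℤ.- + 1)) ⟩
    ϑ (λ t → ϑ (ũ (n ℕ.+ n)) (t ℤ.- + n)) (s ℤ.- + 1)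
      ≈⟨ 𝕀-cong N (λ K → *-congˡ (reflexive (≡.cong (ϑ (ũ (n ℕ.+ n))) (l₂ s K (+ n))))) ⟩
    ũ (suc (suc (n ℕ.+ n))) (s ℤ.- + suc n)
      ≡⟨ ≡.cong (λ t → ũ (suc t) (s ℤ.- + suc n)) (≡.sym (ℕ.+-suc n n)) ⟩
    ũ (suc n ℕ.+ suc n) (s ℤ.- + suc n) ∎
    where
    l₁ : ∀ t K n → t ℤ.+ K ℤ.- n ≡ t ℤ.- n ℤ.+ K
    l₁ = solve-∀
    l₂ : ∀ s K n → s ℤ.- + 1 ℤ.+ K ℤ.- n ≡ s ℤ.- (+ 1 ℤ.+ n) ℤ.+ K
    l₂ = solve-∀

-- Moments at y = -1 and the heat equation.

choose2 choose3 : ℕ → ℕ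
choose2 zero    = 0
choose2 (suc r) = r ℕ.+ choose2 r
choose3 zero    = 0
choose3 (suc r) = choose2 r ℕ.+ choose3 r

2*choose2 : ∀ r → 2 ℕ.* choose2 (suc r) ≡ suc r ℕ.* r
2*choose2 zero    = ≡.refl
2*choose2 (suc r) = ≡.trans (ℕ.*-distribˡ-+ 2 (suc r) (choose2 (suc r))) (≡.trans (≡.cong (2 ℕ.* suc r ℕ.+_) (2*choose2 r)) (l r))
  where
  l : ∀ r → 2 ℕ.* suc r ℕ.+ suc r ℕ.* r ≡ suc (suc r) ℕ.* suc r
  l = solveℕ-∀

6*choose3 : ∀ r → 6 ℕ.* choose3 (2 ℕ.+ r) ≡ (2 ℕ.+ r) ℕ.* (1 ℕ.+ r) ℕ.* r
6*choose3 zero    = ≡.refl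
6*choose3 (suc r) = ≡.trans (l₁ (choose2 (2 ℕ.+ r)) (choose3 (2 ℕ.+ r)))
    (≡.trans (≡.cong₂ (λ a b → 3 ℕ.* a ℕ.+ b) (2*choose2 (suc r)) (6*choose3 r)) (l₂ r))
  where
  l₁ : ∀ a b → 6 ℕ.* (a ℕ.+ b) ≡ 3 ℕ.* (2 ℕ.* a) ℕ.+ 6 ℕ.* b
  l₁ = solveℕ-∀
  l₂ : ∀ r → 3 ℕ.* (suc (suc r) ℕ.* suc r) ℕ.+ (2 ℕ.+ r) ℕ.* (1 ℕ.+ r) ℕ.* r ≡ (3 ℕ.+ r) ℕ.* (2 ℕ.+ r) ℕ.* suc r
  l₂ = solveℕ-∀

module Moments (Q : QRing) where
  open Paths Q public

  pow-* : ∀ x y n → pow (x * y) n ≈ pow x n * pow y n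
  pow-* x y zero    = sym (*-identityˡ _)
  pow-* x y (suc n) = trans (*-congˡ (pow-* x y n)) (solve 4 (λ a b c d → a :* b :* (c :* d) := a :* c :* (b :* d)) refl _ _ _ _)

  pow-cong : ∀ {x y} n → x ≈ y → pow x n ≈ pow y n
  pow-cong zero    e = refl
  pow-cong (suc n) e = *-cong e (pow-cong n e)

  pow-+ : ∀ x m n → pow x (m ℕ.+ n) ≈ pow x m * pow x n
  pow-+ x zero    n = sym (*-identityˡ _)
  pow-+ x (suc m) n = trans (*-congˡ (pow-+ x m n)) (sym (*-assoc _ _ _))

  -- J r i j stands for Σ (x - y)^r x^i y^j over two independent families with moments f (of x) and μ (of y).
  module Joint (J : ℕ → ℕ → ℕ → Carrier) (μ f : ℕ → Carrier) (M : ℕ)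
    (J-zero : ∀ i j → J 0 i j ≈ μ j * f i)
    (J-suc : ∀ r i j → J (suc r) i j ≈ J r (suc i) j + - J r i (suc j))
    (f-low : ∀ i → i ℕ.≤ M → f i ≈ 0#) where

    a b c d : Carrier
    a = f (1 ℕ.+ M)
    b = f (2 ℕ.+ M)
    c = f (3 ℕ.+ M)
    d = f (4 ℕ.+ M)

    -- As f vanishes up to M, only t terms of the binomial expansion survive in total degree M + t;
    -- `deg₁` to `deg₄` list them.
    deg₀ : ∀ r i j → r ℕ.+ i ℕ.≤ M → J r i j ≈ 0#
    deg₀ zero    i j h = trans (J-zero i j) (trans (*-congˡ (f-low i h)) (zeroʳ _))
    deg₀ (suc r) i j h = trans (J-suc r i j) (trans (+-cong (deg₀ r (suc i) j (≡.subst (ℕ._≤ M) (≡.sym (ℕ.+-suc r i)) h))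
      (trans (-‿cong (deg₀ r i (suc j) (ℕ.≤-trans (ℕ.n≤1+n _) h))) -0#≈0#)) (+-identityˡ _))

    deg₁ : ∀ r i j → r ℕ.+ i ≡ 1 ℕ.+ M → J r i j ≈ μ j * a
    deg₁ zero    i j ≡.refl = J-zero i j
    deg₁ (suc r) i j h = trans (J-suc r i j) (trans (+-cong (deg₁ r (suc i) j (≡.trans (ℕ.+-suc r i) h))
      (trans (-‿cong (deg₀ r i (suc j) (ℕ.≤-reflexive (ℕ.suc-injective h)))) -0#≈0#)) (+-identityʳ _))

    deg₂ : ∀ r i j → r ℕ.+ i ≡ 2 ℕ.+ M → J r i j ≈ μ j * b + - (κℕ r * (μ (1 ℕ.+ j) * a))
    deg₂ zero    i j ≡.refl = trans (J-zero i j) (solve 2 (λ x y → x := x :- con (+ 0) :* y) refl _ _)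
    deg₂ (suc r) i j h = begin
      J (suc r) i j
        ≈⟨ trans (J-suc r i j) (+-cong (deg₂ r (suc i) j (≡.trans (ℕ.+-suc r i) h)) (-‿cong (deg₁ r i (suc j) (ℕ.suc-injective h)))) ⟩
      μ j * b + - (κℕ r * (μ (1 ℕ.+ j) * a)) + - (μ (1 ℕ.+ j) * a)
        ≈⟨ solve 3 (λ x k y → x :- k :* y :- y := x :- (con (+ 1) :+ k) :* y) refl _ _ _ ⟩
      μ j * b + - ((1# + κℕ r) * (μ (1 ℕ.+ j) * a))
        ≈⟨ +-congˡ (-‿cong (*-congʳ (κℕ-suc r))) ⟨
      μ j * b + - (κℕ (suc r) * (μ (1 ℕ.+ j) * a)) ∎

    deg₃ : ∀ r i j → r ℕ.+ i ≡ 3 ℕ.+ M →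
      J r i j ≈ μ j * c + - (κℕ r * (μ (1 ℕ.+ j) * b)) + κℕ (choose2 r) * (μ (2 ℕ.+ j) * a)
    deg₃ zero    i j ≡.refl = trans (J-zero i j) (solve 3 (λ x y z → x := x :- con (+ 0) :* y :+ con (+ 0) :* z) refl _ _ _)
    deg₃ (suc r) i j h = begin
      J (suc r) i j
        ≈⟨ trans (J-suc r i j) (+-cong (deg₃ r (suc i) j (≡.trans (ℕ.+-suc r i) h)) (-‿cong (deg₂ r i (suc j) (ℕ.suc-injective h)))) ⟩
      μ j * c + - (κℕ r * (μ (1 ℕ.+ j) * b)) + κℕ (choose2 r) * (μ (2 ℕ.+ j) * a)
        + - (μ (1 ℕ.+ j) * b + - (κℕ r * (μ (2 ℕ.+ j) * a)))
        ≈⟨ solve 5 (λ x k y l z → x :- k :* y :+ l :* z :- (y :- k :* z) := x :- (con (+ 1) :+ k) :* y :+ (k :+ l) :* z) refl _ _ _ _ _ ⟩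
      μ j * c + - ((1# + κℕ r) * (μ (1 ℕ.+ j) * b)) + (κℕ r + κℕ (choose2 r)) * (μ (2 ℕ.+ j) * a)
        ≈⟨ +-cong (+-congˡ (-‿cong (*-congʳ (κℕ-suc r)))) (*-congʳ (κℕ-+ r (choose2 r))) ⟨
      μ j * c + - (κℕ (suc r) * (μ (1 ℕ.+ j) * b)) + κℕ (choose2 (suc r)) * (μ (2 ℕ.+ j) * a) ∎

    deg₄ : ∀ r i j → r ℕ.+ i ≡ 4 ℕ.+ M →
      J r i j ≈ μ j * d + - (κℕ r * (μ (1 ℕ.+ j) * c)) + κℕ (choose2 r) * (μ (2 ℕ.+ j) * b) + - (κℕ (choose3 r) * (μ (3 ℕ.+ j) * a))
    deg₄ zero    i j ≡.refl = trans (J-zero i j) (solve 4 (λ x y z w → x := x :- con (+ 0) :* y :+ con (+ 0) :* z :- con (+ 0) :* w) refl _ _ _ _)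
    deg₄ (suc r) i j h = begin
      J (suc r) i j
        ≈⟨ trans (J-suc r i j) (+-cong (deg₄ r (suc i) j (≡.trans (ℕ.+-suc r i) h)) (-‿cong (deg₃ r i (suc j) (ℕ.suc-injective h)))) ⟩
      μ j * d + - (κℕ r * (μ (1 ℕ.+ j) * c)) + κℕ (choose2 r) * (μ (2 ℕ.+ j) * b) + - (κℕ (choose3 r) * (μ (3 ℕ.+ j) * a))
        + - (μ (1 ℕ.+ j) * c + - (κℕ r * (μ (2 ℕ.+ j) * b)) + κℕ (choose2 r) * (μ (3 ℕ.+ j) * a))
        ≈⟨ solve 7 (λ x k y l z m w → x :- k :* y :+ l :* z :- m :* w :- (y :- k :* z :+ l :* w)
             := x :- (con (+ 1) :+ k) :* y :+ (k :+ l) :* z :- (l :+ m) :* w) refl _ _ _ _ _ _ _ ⟩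
      μ j * d + - ((1# + κℕ r) * (μ (1 ℕ.+ j) * c)) + (κℕ r + κℕ (choose2 r)) * (μ (2 ℕ.+ j) * b) + - ((κℕ (choose2 r) + κℕ (choose3 r)) * (μ
           (3 ℕ.+ j) * a))
        ≈⟨ +-cong (+-cong (+-congˡ (-‿cong (*-congʳ (κℕ-suc r)))) (*-congʳ (κℕ-+ r (choose2 r)))) (-‿cong (*-congʳ (κℕ-+ (choose2 r) (choose3 r)))) ⟨
      μ j * d + - (κℕ (suc r) * (μ (1 ℕ.+ j) * c)) + κℕ (choose2 (suc r)) * (μ (2 ℕ.+ j) * b) + - (κℕ (choose3 (suc r)) * (μ (3 ℕ.+ j) * a)) ∎

  μ : ℕ → Carrier
  μ r = 𝕀 N (λ K → θ K * (σ K * pow (κ (odd₁ K)) r))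

  -- Replacing K by 1 - K changes the sign of `σ K` and of 2K - 1 but keeps `θ K`, so for even r the
  -- sum is its own negative.
  μ-even : ∀ r → (∀ y → pow (- y) r ≈ pow y r) → μ r ≈ 0#
  μ-even r h = double-zero (begin
    μ r
      ≈⟨ 𝕀-cong N (λ K → *-congˡ (reflexive (≡.cong V (≡.sym (ℤ.+-identityˡ K))))) ⟩
    ϑ V (+ 0)
      ≈⟨ ϑ-flip V (+ 0) ⟩
    𝕀 N (λ K → θ K * V (+ 0 ℤ.+ (+ 1 ℤ.- K)))
      ≈⟨ 𝕀-cong N (λ K → trans (*-congˡ (flip K)) (sym (-‿distribʳ-* _ _))) ⟩
    𝕀 N (λ K → - (θ K * V K))
      ≈⟨ 𝕀-neg N _ ⟩
    - μ r ∎)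
    where
    V : Seq
    V K = σ K * pow (κ (odd₁ K)) r
    l₁ : ∀ K → + 0 ℤ.+ (+ 1 ℤ.- K) ≡ ℤ.- K ℤ.+ + 1
    l₁ = solve-∀
    l₂ : ∀ K → + 2 ℤ.* (+ 0 ℤ.+ (+ 1 ℤ.- K)) ℤ.- + 1 ≡ ℤ.- (+ 2 ℤ.* K ℤ.- + 1)
    l₂ = solve-∀
    flip : ∀ K → V (+ 0 ℤ.+ (+ 1 ℤ.- K)) ≈ - V K
    flip K = trans (*-cong (trans (σ≡ (l₁ K)) (trans (σ-suc (ℤ.- K)) (-‿cong (σ-neg K))))
        (trans (pow-cong r (trans (reflexive (≡.cong κ (l₂ K))) (κ-neg (odd₁ K)))) (h _))) (sym (-‿distribˡ-* _ _))

  μ₀ : μ 0 ≈ 0#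
  μ₀ = μ-even 0 (λ _ → refl)

  μ₂ : μ 2 ≈ 0#
  μ₂ = μ-even 2 (solve 1 (λ y → (:- y) :* ((:- y) :* con (+ 1)) := y :* (y :* con (+ 1))) refl)

  p³ : Carrier
  p³ = p N * p N * p N

  μ₁ : μ 1 ≈ - (κ (+ 2) * p³)
  μ₁ = trans (𝕀-cong N (λ K → *-congˡ (*-congˡ (*-identityʳ _)))) jacobi

  -- Twice the offset of s from the centre 1 - M/2 of `ũ-antisym`; the doubling keeps it an integer.
  center : ℕ → ℤ → Carrier
  center M s = κ (+ 2 ℤ.* s ℤ.+ + M ℤ.- + 2)

  mom : ℕ → ℕ → ℕ → Carrier
  mom E M r = 𝕀 E (λ s → σ s * pow (center M s) r * ũ M s)

  𝕀-double : ∀ C g → (∀ l → g (l ℤ.+ l ℤ.+ + 1) ≈ 0#) → 𝕀 (C ℕ.+ C) g ≈ 𝕀 C (λ l → g (l ℤ.+ l))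
  𝕀-double zero    g h = trans (𝕀-zero g) (sym (𝕀-zero _))
  𝕀-double (suc C) g h = begin
    𝕀 (suc C ℕ.+ suc C) g
      ≡⟨ ≡.cong (λ t → 𝕀 (suc t) g) (ℕ.+-suc C C) ⟩
    𝕀 (suc (suc (C ℕ.+ C))) g
      ≈⟨ trans (𝕀-next _ g) (+-congʳ (𝕀-next _ g)) ⟩
    𝕀 (C ℕ.+ C) g + (g (+ suc (C ℕ.+ C)) + g -[1+ (C ℕ.+ C) ]) + (g (+ suc (suc (C ℕ.+ C))) + g -[1+ suc (C ℕ.+ C) ])
      ≈⟨ +-cong (+-cong (𝕀-double C g h) (trans (+-cong (trans (reflexive (≡.cong g (l₁ (+ C)))) (h (+ C))) (trans (reflexive (≡.cong g (l₂
           (+ C)))) (h -[1+ C ]))) (+-identityˡ _)))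
           (+-cong (reflexive (≡.cong g (l₃ (+ C)))) refl) ⟩
    𝕀 C (λ l → g (l ℤ.+ l)) + 0# + (g (+ suc C ℤ.+ + suc C) + g (-[1+ C ] ℤ.+ -[1+ C ]))
      ≈⟨ trans (+-congʳ (+-identityʳ _)) (sym (𝕀-next C _)) ⟩
    𝕀 (suc C) (λ l → g (l ℤ.+ l)) ∎
    where
    l₁ : ∀ C → + 1 ℤ.+ (C ℤ.+ C) ≡ C ℤ.+ C ℤ.+ + 1
    l₁ = solve-∀
    l₂ : ∀ C → ℤ.- (+ 1 ℤ.+ (C ℤ.+ C)) ≡ ℤ.- (+ 1 ℤ.+ C) ℤ.+ ℤ.- (+ 1 ℤ.+ C) ℤ.+ + 1
    l₂ = solve-∀
    l₃ : ∀ C → + 2 ℤ.+ (C ℤ.+ C) ≡ (+ 1 ℤ.+ C) ℤ.+ (+ 1 ℤ.+ C)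
    l₃ = solve-∀

  mom-base : ∀ E r → reach 0 ℕ.≤ E → mom E 0 r ≈ pow (κ (+ 2)) r * μ r
  mom-base E r l = begin
    mom E 0 r
      ≈⟨ 𝕀-ext (λ s m → trans (*-congˡ (ũ-Van 0 s m)) (zeroʳ _)) l ⟩
    mom (N ℕ.+ N) 0 r
      ≈⟨ 𝕀-double N _ (λ x → trans (*-congˡ (spread-odd (λ l → σ l * θ l) x)) (zeroʳ _)) ⟩
    𝕀 N (λ x → σ (x ℤ.+ x) * pow (center 0 (x ℤ.+ x)) r * ũ 0 (x ℤ.+ x))
      ≈⟨ 𝕀-cong N term≈ ⟩
    𝕀 N (λ x → pow (κ (+ 2)) r * (θ x * (σ x * pow (κ (odd₁ x)) r)))
      ≈⟨ 𝕀-*ˡ N _ _ ⟨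
    pow (κ (+ 2)) r * μ r ∎
    where
    l₁ : ∀ x → + 2 ℤ.* (x ℤ.+ x) ℤ.+ + 0 ℤ.- + 2 ≡ + 2 ℤ.* (+ 2 ℤ.* x ℤ.- + 1)
    l₁ = solve-∀
    term≈ : ∀ x → σ (x ℤ.+ x) * pow (center 0 (x ℤ.+ x)) r * ũ 0 (x ℤ.+ x) ≈ pow (κ (+ 2)) r * (θ x * (σ x * pow (κ (odd₁ x)) r))
    term≈ x = begin
      σ (x ℤ.+ x) * pow (center 0 (x ℤ.+ x)) r * ũ 0 (x ℤ.+ x)
        ≈⟨ *-cong (*-cong (trans (σ-+ x x) (sg² ℤ.∣ x ∣)) (trans (pow-cong r (trans (reflexive (≡.cong κ (l₁ x))) (κ-* (+ 2) (odd₁ x))))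
             (pow-* _ _ r)))
             (spread-even (λ l → σ l * θ l) x) ⟩
      1# * (pow (κ (+ 2)) r * pow (κ (odd₁ x)) r) * (σ x * θ x)
        ≈⟨ solve 4 (λ a b c d → con (+ 1) :* (a :* b) :* (c :* d) := a :* (d :* (c :* b))) refl _ _ _ _ ⟩
      pow (κ (+ 2)) r * (θ x * (σ x * pow (κ (odd₁ x)) r)) ∎

  joint : ℕ → ℕ → ℕ → ℕ → ℕ → Carrier
  joint E M r i j = 𝕀 N (λ K → θ K * σ K * 𝕀 E (λ v → σ v * ũ M v * (pow (center M v + - κ (odd₁ K)) r * (pow (center M v) i * pow (κ (odd₁ K)) j))))

  joint-zero : ∀ E M i j → joint E M 0 i j ≈ μ j * mom E M i
  joint-zero E M i j = begin
    joint E M 0 i j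
      ≈⟨ 𝕀-cong N (λ K → trans (*-congˡ (trans (𝕀-cong E (λ v → solve 4 (λ a b c d → a :* b :* (con (+ 1) :* (c :* d)) := d :*
           (a :* c :* b)) refl _ _ _ _)) (sym (𝕀-*ˡ E _ _))))
           (solve 4 (λ a b c m → a :* b :* (c :* m) := m :* (a :* (b :* c))) refl _ _ _ (mom E M i))) ⟩
    𝕀 N (λ K → mom E M i * (θ K * (σ K * pow (κ (odd₁ K)) j)))
      ≈⟨ trans (sym (𝕀-*ˡ N _ _)) (*-comm _ _) ⟩
    μ j * mom E M i ∎

  joint-suc : ∀ E M r i j → joint E M (suc r) i j ≈ joint E M r (suc i) j + - joint E M r i (suc j)
  joint-suc E M r i j = begin
    joint E M (suc r) i j
      ≈⟨ 𝕀-cong N (λ K → trans (*-congˡ (trans (𝕀-cong E (λ v →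
             solve 6 (λ s x y z a b → s :* ((x :- y) :* z :* (a :* b)) := s :* (z :* (x :* a :* b)) :- s :* (z :* (a :* (y :* b))))
               refl (σ v * ũ M v) (center M v) (κ (odd₁ K)) (pow (center M v + - κ (odd₁ K)) r) (pow (center M v) i) (pow (κ (odd₁ K)) j)))
             (trans (𝕀-+ E _ _) (+-congˡ (𝕀-neg E _)))))
           (solve 3 (λ a b c → a :* (b :- c) := a :* b :- a :* c) refl _ _ _)) ⟩
    𝕀 N (λ K → θ K * σ K * 𝕀 E (λ v → σ v * ũ M v * (pow (center M v + - κ (odd₁ K)) r * (pow (center M v) (suc i) * pow (κ (odd₁ K)) j)))
      + - (θ K * σ K * 𝕀 E (λ v → σ v * ũ M v * (pow (center M v + - κ (odd₁ K)) r * (pow (center M v) i * pow (κ (odd₁ K)) (suc j))))))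
      ≈⟨ trans (𝕀-+ N _ _) (+-congˡ (𝕀-neg N _)) ⟩
    joint E M r (suc i) j + - joint E M r i (suc j) ∎

  -- With v = s + K, `center` at s for M + 1 is `center` at v for M minus 2K - 1. Multiplication by
  -- ϑ thus becomes a joint moment of x - y.
  mom-joint : ∀ E M r → reach (suc M) ℕ.≤ E → mom E (suc M) r ≈ joint E M r 0 0
  mom-joint E M r l = begin
    𝕀 E (λ s → σ s * pow (center (suc M) s) r * 𝕀 N (λ K → θ K * ũ M (s ℤ.+ K)))
      ≈⟨ 𝕀-cong E (λ s → 𝕀-*ˡ N _ _) ⟩
    𝕀 E (λ s → 𝕀 N (λ K → σ s * pow (center (suc M) s) r * (θ K * ũ M (s ℤ.+ K))))
      ≈⟨ 𝕀-swap E N _ ⟩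
    𝕀 N (λ K → 𝕀 E (λ s → σ s * pow (center (suc M) s) r * (θ K * ũ M (s ℤ.+ K))))
      ≈⟨ 𝕀-cong N (λ K → trans (𝕀-cong E (λ s → trans (solve 3 (λ a b c → a :* (b :* c) := b :* (a :* c)) refl _ _ _)
           (*-congˡ (*-congʳ (*-cong (σ≡ (l₁ s K)) (pow-cong r (reflexive (≡.cong κ (l₂ s K (+ M)))))))))) (sym (𝕀-*ˡ E _ _))) ⟩
    𝕀 N (λ K → θ K * 𝕀 E (λ s → g K (s ℤ.+ K)))
      ≈⟨ 𝕀-cong N shift ⟩
    𝕀 N (λ K → θ K * 𝕀 E (g K))
      ≈⟨ 𝕀-cong N (λ K → trans (*-congˡ (trans (𝕀-cong E (g≈ K)) (sym (𝕀-*ˡ E _ _)))) (sym (*-assoc _ _ _))) ⟩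
    joint E M r 0 0 ∎
    where
    g : ℤ → Seq
    g K v = σ (v ℤ.- K) * pow (κ (+ 2 ℤ.* v ℤ.+ + M ℤ.- + 2 ℤ.- odd₁ K)) r * ũ M v
    l₁ : ∀ s K → s ≡ s ℤ.+ K ℤ.- K
    l₁ = solve-∀
    l₂ : ∀ s K M → + 2 ℤ.* s ℤ.+ (+ 1 ℤ.+ M) ℤ.- + 2 ≡ + 2 ℤ.* (s ℤ.+ K) ℤ.+ M ℤ.- + 2 ℤ.- (+ 2 ℤ.* K ℤ.- + 1)
    l₂ = solve-∀
    shift : ∀ K → θ K * 𝕀 E (λ s → g K (s ℤ.+ K)) ≈ θ K * 𝕀 E (g K)
    shift K with N ℕ.<? ℤ.∣ K ∣
    ... | yes h = trans (θ-big* K _ h) (sym (θ-big* K _ h))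
    ... | no h  = *-congˡ (𝕀-shift (g K) K (λ v m → trans (*-congˡ (ũ-Van M v m)) (zeroʳ _)) (ℕ.≤-trans (ℕ.+-monoʳ-≤ (reach M) (ℕ.≮⇒≥ h)) l))
    g≈ : ∀ K v → g K v ≈ σ K * (σ v * ũ M v * (pow (center M v + - κ (odd₁ K)) r * (1# * 1#)))
    g≈ K v = trans (*-congʳ (*-cong (trans (σ-+ v (ℤ.- K)) (*-congˡ (σ-neg K)))
        (pow-cong r (trans (κ-+ (+ 2 ℤ.* v ℤ.+ + M ℤ.- + 2) (ℤ.- odd₁ K)) (+-congˡ (κ-neg (odd₁ K)))))))
      (solve 4 (λ a b c d → a :* b :* c :* d := b :* (a :* d :* (c :* (con (+ 1) :* con (+ 1))))) refl _ _ _ _)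

  -- The order of the zero at y = -1 is M + 1: one from U₀ and one from each ϑ, because μ 0
  -- vanishes.
  mom-low : ∀ E M → reach M ℕ.≤ E → ∀ r → r ℕ.≤ M → mom E M r ≈ 0#
  mom-low E zero    l .zero z≤n = trans (mom-base E 0 l) (trans (*-congˡ μ₀) (zeroʳ _))
  mom-low E (suc M) l r h = trans (mom-joint E M r l) (low (ℕ.m≤n⇒m<n∨m≡n h))
    where
    l′ : reach M ℕ.≤ E
    l′ = ℕ.≤-trans (ℕ.m≤m+n (reach M) N) l
    open Joint (joint E M) μ (mom E M) M (joint-zero E M) (joint-suc E M) (mom-low E M l′)
    low : (r ℕ.< suc M) ⊎ (r ≡ suc M) → joint E M r 0 0 ≈ 0#
    low (inj₁ (s≤s r≤M)) = deg₀ r 0 0 (ℕ.≤-trans (ℕ.≤-reflexive (ℕ.+-identityʳ r)) r≤M)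
    low (inj₂ ≡.refl)    = trans (deg₁ (suc M) 0 0 (ℕ.+-identityʳ _)) (trans (*-congʳ μ₀) (zeroˡ _))

  mom-next : ∀ E M → reach (suc M) ℕ.≤ E → mom E (suc M) (2 ℕ.+ M) ≈ - (κℕ (2 ℕ.+ M) * (μ 1 * mom E M (suc M)))
  mom-next E M l = trans (mom-joint E M (2 ℕ.+ M) l) (trans (deg₂ (2 ℕ.+ M) 0 0 (ℕ.+-identityʳ _))
      (trans (+-congʳ (trans (*-congʳ μ₀) (zeroˡ _))) (+-identityˡ _)))
    where
    open Joint (joint E M) μ (mom E M) M (joint-zero E M) (joint-suc E M) (mom-low E M (ℕ.≤-trans (ℕ.m≤m+n (reach M) N) l))

  -- In exponential generating functions each ϑ begins, up to sign, with μ₁ x + μ₃ x³/6 and U₀ with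
  -- the same at 2x, which counts four times in the cubic ratio. Together this gives (M + 4) μ₃ / (6
  -- μ₁), multiplied by (M+3)! / (M+1)! = (M + 2)(M + 3).
  mom-third : ∀ E M → reach M ℕ.≤ E → κ (+ 6) * μ 1 * mom E M (3 ℕ.+ M)
    ≈ κℕ ((2 ℕ.+ M) ℕ.* (3 ℕ.+ M) ℕ.* (4 ℕ.+ M)) * (μ 3 * mom E M (suc M))
  mom-third E zero    l = begin
    κ (+ 6) * μ 1 * mom E 0 3
      ≈⟨ *-congˡ (mom-base E 3 l) ⟩
    κ (+ 6) * μ 1 * (pow (κ (+ 2)) 3 * μ 3)
      ≈⟨ solve 2 (λ a b → con (+ 6) :* a :* (con (+ 2) :* (con (+ 2) :* (con (+ 2) :* con (+ 1))) :* b) := con (+ 24) :* (b :* (con (+ 2) :* con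
           (+ 1) :* a))) refl (μ 1) (μ 3) ⟩
    κℕ 24 * (μ 3 * (pow (κ (+ 2)) 1 * μ 1))
      ≈⟨ *-congˡ (*-congˡ (mom-base E 1 l)) ⟨
    κℕ 24 * (μ 3 * mom E 0 1) ∎
  mom-third E (suc M) l = begin
    κ (+ 6) * μ 1 * mom E (suc M) (4 ℕ.+ M)
      ≈⟨ *-congˡ (trans (mom-joint E M (4 ℕ.+ M) l) (deg₄ (4 ℕ.+ M) 0 0 (ℕ.+-identityʳ _))) ⟩
    κ (+ 6) * μ 1 * (μ 0 * d + - (κℕ (4 ℕ.+ M) * (μ 1 * c)) + κℕ c₂ * (μ 2 * b) + - (κℕ c₃ * (μ 3 * a)))
      ≈⟨ *-congˡ (+-congʳ (+-cong (+-congʳ (*-congʳ μ₀)) (*-congˡ (*-congʳ μ₂)))) ⟩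
    κ (+ 6) * μ 1 * (0# * d + - (κℕ (4 ℕ.+ M) * (μ 1 * c)) + κℕ c₂ * (0# * b) + - (κℕ c₃ * (μ 3 * a)))
      ≈⟨ solve 9 (λ m₁ m₃ k₄ c2 c3 a b c d → con (+ 6) :* m₁ :* (con (+ 0) :* d :- k₄ :* (m₁ :* c) :+ c2 :* (con (+ 0) :* b) :- c3 :* (m₃ :* a))
           := :- (k₄ :* m₁ :* (con (+ 6) :* m₁ :* c) :+ m₁ :* (con (+ 6) :* c3) :* (m₃ :* a))) refl (μ 1) (μ 3) (κℕ (4 ℕ.+ M)) (κℕ c₂)
                (κℕ c₃) a b c d ⟩
    - (κℕ (4 ℕ.+ M) * μ 1 * (κ (+ 6) * μ 1 * c) + μ 1 * (κ (+ 6) * κℕ c₃) * (μ 3 * a))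
      ≈⟨ -‿cong (+-cong (*-congˡ (mom-third E M l′)) (*-congʳ (*-congˡ (trans (sym (κℕ-* 6 c₃)) (reflexive (≡.cong κℕ (6*choose3 (2 ℕ.+ M)))))))) ⟩
    - (κℕ (4 ℕ.+ M) * μ 1 * (κℕ P₁ * (μ 3 * a)) + μ 1 * κℕ P₂ * (μ 3 * a))
      ≈⟨ solve 6 (λ k₄ m₁ p₁ p₂ m₃ a → :- (k₄ :* m₁ :* (p₁ :* (m₃ :* a)) :+ m₁ :* p₂ :* (m₃ :* a)) := (k₄ :* p₁ :+ p₂) :* (:- (m₃ :*
           (m₁ :* a)))) refl _ _ _ _ _ _ ⟩
    (κℕ (4 ℕ.+ M) * κℕ P₁ + κℕ P₂) * - (μ 3 * (μ 1 * a))
      ≈⟨ *-congʳ (trans (+-congʳ (sym (κℕ-* (4 ℕ.+ M) P₁))) (trans (sym (κℕ-+ ((4 ℕ.+ M) ℕ.* P₁) P₂)) (trans (reflexive (≡.cong κℕ (num M)))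
           (κℕ-* P₃ (2 ℕ.+ M))))) ⟩
    κℕ P₃ * κℕ (2 ℕ.+ M) * - (μ 3 * (μ 1 * a))
      ≈⟨ solve 5 (λ p k m₃ m₁ a → p :* k :* (:- (m₃ :* (m₁ :* a))) := p :* (m₃ :* (:- (k :* (m₁ :* a))))) refl _ _ _ _ _ ⟩
    κℕ P₃ * (μ 3 * - (κℕ (2 ℕ.+ M) * (μ 1 * a)))
      ≈⟨ *-congˡ (*-congˡ (mom-next E M l)) ⟨
    κℕ P₃ * (μ 3 * mom E (suc M) (2 ℕ.+ M)) ∎
    where
    l′ : reach M ℕ.≤ E
    l′ = ℕ.≤-trans (ℕ.m≤m+n (reach M) N) l
    open Joint (joint E M) μ (mom E M) M (joint-zero E M) (joint-suc E M) (mom-low E M l′)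
    c₂ c₃ P₁ P₂ P₃ : ℕ
    c₂ = choose2 (4 ℕ.+ M)
    c₃ = choose3 (4 ℕ.+ M)
    P₁ = (2 ℕ.+ M) ℕ.* (3 ℕ.+ M) ℕ.* (4 ℕ.+ M)
    P₂ = (4 ℕ.+ M) ℕ.* (3 ℕ.+ M) ℕ.* (2 ℕ.+ M)
    P₃ = (3 ℕ.+ M) ℕ.* (4 ℕ.+ M) ℕ.* (5 ℕ.+ M)
    num : ∀ M → (4 ℕ.+ M) ℕ.* ((2 ℕ.+ M) ℕ.* (3 ℕ.+ M) ℕ.* (4 ℕ.+ M)) ℕ.+ (4 ℕ.+ M) ℕ.* (3 ℕ.+ M) ℕ.* (2 ℕ.+ M) ≡ (3 ℕ.+ M) ℕ.* (4 ℕ.+ M) ℕ.*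
         (5 ℕ.+ M) ℕ.* (2 ℕ.+ M)
    num = solveℕ-∀

  -- The product of first moments: each ϑ contributes -μ₁ = 2 (q)_∞^3 and U₀ contributes 2 μ₁; the
  -- factorial comes from the order of the zero.
  mom-leading : ∀ E M → reach M ℕ.≤ E → mom E M (suc M) ≈ - (pow (κ (+ 2)) (2 ℕ.+ M) * (κℕ (suc M !) * pow p³ (suc M)))
  mom-leading E zero    l = trans (mom-base E 1 l) (trans (*-congˡ μ₁)
    (solve 1 (λ x → con (+ 2) :* con (+ 1) :* (:- (con (+ 2) :* x)) := :- (con (+ 2) :* (con (+ 2) :* con (+ 1)) :* (con (+ 1) :* (x :* con
         (+ 1))))) refl p³))
  mom-leading E (suc M) l = begin
    mom E (suc M) (2 ℕ.+ M)
      ≈⟨ mom-next E M l ⟩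
    - (κℕ (2 ℕ.+ M) * (μ 1 * mom E M (suc M)))
      ≈⟨ -‿cong (*-congˡ (*-cong μ₁ (mom-leading E M (ℕ.≤-trans (ℕ.m≤m+n (reach M) N) l)))) ⟩
    - (κℕ (2 ℕ.+ M) * (- (κ (+ 2) * p³) * - (pow (κ (+ 2)) (2 ℕ.+ M) * (κℕ (suc M !) * pow p³ (suc M)))))
      ≈⟨ solve 5 (λ k x a f y → :- (k :* ((:- (con (+ 2) :* x)) :* (:- (a :* (f :* y))))) := :- (con (+ 2) :* a :* (k :* f :*
           (x :* y)))) refl _ _ _ _ _ ⟩
    - (pow (κ (+ 2)) (3 ℕ.+ M) * (κℕ (2 ℕ.+ M) * κℕ (suc M !) * pow p³ (2 ℕ.+ M)))
      ≈⟨ -‿cong (*-congˡ (*-congʳ (κℕ-* (2 ℕ.+ M) (suc M !)))) ⟨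
    - (pow (κ (+ 2)) (3 ℕ.+ M) * (κℕ ((2 ℕ.+ M) !) * pow p³ (2 ℕ.+ M))) ∎

  D-0 : D 0# ≈ 0#
  D-0 = begin
    D 0#                   ≈⟨ solve 1 (λ x → x := x :+ x :- x) refl _ ⟩
    D 0# + D 0# + - D 0#   ≈⟨ +-congʳ (D-+ 0# 0#) ⟨
    D (0# + 0#) + - D 0#   ≈⟨ +-congʳ (D-cong (+-identityˡ 0#)) ⟩
    D 0# + - D 0#          ≈⟨ -‿inverseʳ _ ⟩
    0#                     ∎

  D-1 : D 1# ≈ 0#
  D-1 = begin
    D 1#                             ≈⟨ solve 1 (λ x → x := x :* con (+ 1) :+ con (+ 1) :* x :- x) refl (D 1#) ⟩
    D 1# * 1# + 1# * D 1# + - D 1#   ≈⟨ +-congʳ (D-* 1# 1#) ⟨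
    D (1# * 1#) + - D 1#             ≈⟨ +-congʳ (D-cong (*-identityˡ 1#)) ⟩
    D 1# + - D 1#                    ≈⟨ -‿inverseʳ _ ⟩
    0#                               ∎

  D-neg : ∀ x → D (- x) ≈ - D x
  D-neg x = begin
    D (- x)                     ≈⟨ solve 2 (λ a b → a := b :+ a :- b) refl _ (D x) ⟩
    D x + D (- x) + - D x       ≈⟨ +-congʳ (trans (sym (D-+ x (- x))) (trans (D-cong (-‿inverseʳ x)) D-0)) ⟩
    0# + - D x                  ≈⟨ +-identityˡ _ ⟩
    - D x                       ∎

  D-κℕ : ∀ n → D (κℕ n) ≈ 0#
  D-κℕ zero    = D-0
  D-κℕ (suc n) = trans (D-cong (κℕ-suc n)) (trans (D-+ _ _) (trans (+-cong D-1 (D-κℕ n)) (+-identityˡ _)))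

  D-κ : ∀ z → D (κ z) ≈ 0#
  D-κ (+ n)    = D-κℕ n
  D-κ -[1+ n ] = trans (D-neg _) (trans (-‿cong (D-κℕ (suc n))) -0#≈0#)

  D-sg : ∀ n → D (sg n) ≈ 0#
  D-sg zero    = D-1
  D-sg (suc n) = trans (D-neg _) (trans (-‿cong (D-sg n)) -0#≈0#)

  D-q^ : ∀ n → D (q^ n) ≈ κℕ n * q^ n
  D-q^ zero    = trans (D-cong q^0) (trans D-1 (sym (zeroˡ _)))
  D-q^ (suc n) = begin
    D (q^ suc n)                      ≈⟨ trans (D-cong (q^suc n)) (D-* _ _) ⟩
    D q * q^ n + q * D (q^ n)         ≈⟨ +-cong (*-congʳ D-q) (*-congˡ (D-q^ n)) ⟩
    q * q^ n + q * (κℕ n * q^ n)      ≈⟨ solve 3 (λ q x k → q :* x :+ q :* (k :* x) := (con (+ 1) :+ k) :* (q :* x)) refl _ _ _ ⟩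
    (1# + κℕ n) * (q * q^ n)          ≈⟨ *-cong (κℕ-suc n) (q^suc n) ⟨
    κℕ (suc n) * q^ suc n             ∎

  D-*0 : ∀ x y → D y ≈ 0# → D (x * y) ≈ D x * y
  D-*0 x y h = trans (D-* x y) (trans (+-congˡ (trans (*-congˡ h) (zeroʳ _))) (+-identityʳ _))

  opaque
    unfolding 𝕀
    D-𝕀 : ∀ C g → D (𝕀 C g) ≈ 𝕀 C (λ x → D (g x))
    D-𝕀 zero    g = refl
    D-𝕀 (suc C) g = trans (D-+ _ _) (+-cong (D-𝕀 C g) (D-+ _ _))

  -- Since (2K - 1)² = 8 tri K + 1, raising the order of the moment by two is the operator 8 q d/dq
  -- + 1.
  heat : μ 3 ≈ κ (+ 8) * D (μ 1) + μ 1
  heat = sym (begin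
    κ (+ 8) * D (μ 1) + μ 1
      ≈⟨ +-congʳ (trans (*-congˡ (D-𝕀 N _)) (𝕀-*ˡ N _ _)) ⟩
    𝕀 N (λ K → κ (+ 8) * D (θ K * (σ K * pow (κ (odd₁ K)) 1))) + μ 1
      ≈⟨ 𝕀-+ N _ _ ⟨
    𝕀 N (λ K → κ (+ 8) * D (θ K * (σ K * pow (κ (odd₁ K)) 1)) + θ K * (σ K * pow (κ (odd₁ K)) 1))
      ≈⟨ 𝕀-cong N term≈ ⟩
    μ 3 ∎)
    where
    l₁ : ∀ K t → + 4 ℤ.* (+ 2 ℤ.* t) ℤ.+ + 1 ≡ + 8 ℤ.* t ℤ.+ + 1
    l₁ K t = ≡.cong (ℤ._+ + 1) (≡.sym (ℤ.*-assoc (+ 4) (+ 2) t))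
    l₂ : ∀ K → + 4 ℤ.* (K ℤ.* K ℤ.- K) ℤ.+ + 1 ≡ (+ 2 ℤ.* K ℤ.- + 1) ℤ.* (+ 2 ℤ.* K ℤ.- + 1)
    l₂ = solve-∀
    square : ∀ K → κ (+ 8) * κℕ (tri K) + 1# ≈ κ (odd₁ K) * κ (odd₁ K)
    square K = begin
      κ (+ 8) * κℕ (tri K) + 1#             ≈⟨ +-congʳ (sym (κ-* (+ 8) (+ tri K))) ⟩
      κ (+ 8 ℤ.* + tri K) + 1#              ≈⟨ κ-+ (+ 8 ℤ.* + tri K) (+ 1) ⟨
      κ (+ 8 ℤ.* + tri K ℤ.+ + 1)           ≡⟨ ≡.cong κ (≡.trans (≡.sym (l₁ K (+ tri K))) (≡.trans (≡.cong (λ t → + 4 ℤ.* t ℤ.+ + 1)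
           (tri-double K)) (l₂ K))) ⟩
      κ (odd₁ K ℤ.* odd₁ K)                 ≈⟨ κ-* (odd₁ K) (odd₁ K) ⟩
      κ (odd₁ K) * κ (odd₁ K)               ∎
    const : ∀ K → D (σ K * pow (κ (odd₁ K)) 1) ≈ 0#
    const K = trans (D-*0 _ _ (trans (D-*0 _ _ D-1) (trans (*-congʳ (D-κ (odd₁ K))) (zeroˡ _)))) (trans (*-congʳ (D-sg ℤ.∣ K ∣)) (zeroˡ _))
    term≈ : ∀ K → κ (+ 8) * D (θ K * (σ K * pow (κ (odd₁ K)) 1)) + θ K * (σ K * pow (κ (odd₁ K)) 1) ≈ θ K * (σ K * pow (κ (odd₁ K)) 3)
    term≈ K = begin
      κ (+ 8) * D (θ K * (σ K * pow (κ (odd₁ K)) 1)) + θ K * (σ K * pow (κ (odd₁ K)) 1)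
        ≈⟨ +-congʳ (*-congˡ (trans (D-*0 _ _ (const K)) (*-congʳ (trans (D-cong (θ-def K)) (trans (D-q^ (tri K)) (*-congˡ (sym (θ-def K)))))))) ⟩
      κ (+ 8) * (κℕ (tri K) * θ K * (σ K * pow (κ (odd₁ K)) 1)) + θ K * (σ K * pow (κ (odd₁ K)) 1)
        ≈⟨ solve 4 (λ k t s y → con (+ 8) :* (k :* t :* (s :* (y :* con (+ 1)))) :+ t :* (s :* (y :* con (+ 1))) := (con (+ 8) :* k :+ con
             (+ 1)) :* (t :* (s :* y))) refl (κℕ (tri K)) (θ K) (σ K) (κ (odd₁ K)) ⟩
      (κ (+ 8) * κℕ (tri K) + 1#) * (θ K * (σ K * κ (odd₁ K)))
        ≈⟨ *-congʳ (square K) ⟩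
      κ (odd₁ K) * κ (odd₁ K) * (θ K * (σ K * κ (odd₁ K)))
        ≈⟨ solve 3 (λ t s y → y :* y :* (t :* (s :* y)) := t :* (s :* (y :* (y :* (y :* con (+ 1)))))) refl _ _ _ ⟩
      θ K * (σ K * pow (κ (odd₁ K)) 3) ∎

-- Alternating products.

diffs : ℤ → List ℤ → ℤ
diffs v []       = + 1
diffs v (w ∷ ws) = (w ℤ.* w ℤ.- v ℤ.* v) ℤ.* diffs v ws

-- Up to a power of 2 the product of the positive roots of type C at the given point, and the
-- numerator of χ.
Δ : List ℤ → ℤ
Δ []       = + 1
Δ (v ∷ vs) = v ℤ.* diffs v vs ℤ.* Δ vs

squares : List ℤ → ℤ
squares []       = + 0
squares (v ∷ vs) = v ℤ.* v ℤ.+ squares vs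

range : ℕ → ℕ → List ℕ
range a zero    = []
range a (suc m) = a ∷ range (suc a) m

length-range : ∀ a m → length (range a m) ≡ m
length-range a zero    = ≡.refl
length-range a (suc m) = ≡.cong suc (length-range (suc a) m)

∈-range : ∀ a m i → i ℕ.< m → i ℕ.+ a ∈ range a m
∈-range a (suc m) zero    _       = here ≡.refl
∈-range a (suc m) (suc i) (s≤s l) = there (≡.subst (_∈ range (suc a) m) (ℕ.+-suc i a) (∈-range (suc a) m i l))

diffs-swap : ∀ x xs v w ys → diffs x (xs ++ v ∷ w ∷ ys) ≡ diffs x (xs ++ w ∷ v ∷ ys)
diffs-swap x []       v w ys = l (v ℤ.* v ℤ.- x ℤ.* x) (w ℤ.* w ℤ.- x ℤ.* x) (diffs x ys)
  where
  l : ∀ a b c → a ℤ.* (b ℤ.* c) ≡ b ℤ.* (a ℤ.* c)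
  l = solve-∀
diffs-swap x (y ∷ xs) v w ys = ≡.cong ((y ℤ.* y ℤ.- x ℤ.* x) ℤ.*_) (diffs-swap x xs v w ys)

squares-swap : ∀ xs v w ys → squares (xs ++ v ∷ w ∷ ys) ≡ squares (xs ++ w ∷ v ∷ ys)
squares-swap []       v w ys = l (v ℤ.* v) (w ℤ.* w) (squares ys)
  where
  l : ∀ a b c → a ℤ.+ (b ℤ.+ c) ≡ b ℤ.+ (a ℤ.+ c)
  l = solve-∀
squares-swap (y ∷ xs) v w ys = ≡.cong (λ t → y ℤ.* y ℤ.+ t) (squares-swap xs v w ys)

Δ-swap : ∀ xs v w ys → Δ (xs ++ v ∷ w ∷ ys) ≡ ℤ.- Δ (xs ++ w ∷ v ∷ ys)
Δ-swap []       v w ys = l v w (diffs v ys) (diffs w ys) (Δ ys)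
  where
  l : ∀ v w a b c → v ℤ.* ((w ℤ.* w ℤ.- v ℤ.* v) ℤ.* a) ℤ.* (w ℤ.* b ℤ.* c) ≡ ℤ.- (w ℤ.* ((v ℤ.* v ℤ.- w ℤ.* w) ℤ.* b) ℤ.* (v ℤ.* a ℤ.* c))
  l = solve-∀
Δ-swap (x ∷ xs) v w ys = ≡.trans (≡.cong₂ (λ a b → x ℤ.* a ℤ.* b) (diffs-swap x xs v w ys) (Δ-swap xs v w ys))
  (≡.sym (ℤ.neg-distribʳ-* (x ℤ.* diffs x (xs ++ w ∷ v ∷ ys)) (Δ (xs ++ w ∷ v ∷ ys))))

-- Residue classes modulo 2n+4.

module Weyl (Q : QRing) (n : ℕ) where
  open Moments Q public

  𝕂 : ℕ
  𝕂 = suc (suc n)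

  τ : ℤ
  τ = + 2 ℤ.* + 𝕂

  node : ℕ → ℤ → ℤ
  node j k = + j ℤ.+ τ ℤ.* k

  -- F carries the theta coefficients of the generating function whose zero of order 2n+1 gives the linear relations among
  -- the residue classes.
  F : ℤ → Carrier
  F v = σ (v ℤ.+ (+ 1 ℤ.- + n)) * ũ (n ℕ.+ n) (v ℤ.+ (+ 1 ℤ.- + n))

  σ-even : ∀ x y → σ (x ℤ.+ (y ℤ.+ y)) ≈ σ x
  σ-even x y = trans (σ-+ x (y ℤ.+ y)) (trans (*-congˡ (trans (σ-+ y y) (sg² ℤ.∣ y ∣))) (*-identityʳ _))

  -- The shift by 1 - n in `F` puts the centre of `ũ-antisym` for 2n factors at 0.
  F-odd : ∀ v → F (ℤ.- v) ≈ - F v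
  F-odd v = begin
    σ (ℤ.- v ℤ.+ c) * ũ (n ℕ.+ n) (ℤ.- v ℤ.+ c)
      ≈⟨ *-cong (trans (σ≡ (l₁ v (+ n))) (σ-even (v ℤ.+ c) (ℤ.- v))) (trans (reflexive (≡.cong (ũ (n ℕ.+ n)) (l₂ v (+ n)))) (ũ-antisym (n ℕ.+ n)
           (v ℤ.+ c))) ⟩
    σ (v ℤ.+ c) * - ũ (n ℕ.+ n) (v ℤ.+ c)
      ≈⟨ -‿distribʳ-* _ _ ⟨
    - F v ∎
    where
    c = + 1 ℤ.- + n
    l₁ : ∀ v n → ℤ.- v ℤ.+ (+ 1 ℤ.- n) ≡ v ℤ.+ (+ 1 ℤ.- n) ℤ.+ (ℤ.- v ℤ.+ ℤ.- v)
    l₁ = solve-∀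
    l₂ : ∀ v n → ℤ.- v ℤ.+ (+ 1 ℤ.- n) ≡ + 2 ℤ.- (n ℤ.+ n) ℤ.- (v ℤ.+ (+ 1 ℤ.- n))
    l₂ = solve-∀

  F-quasi : ∀ v a b → + a ≡ + b ℤ.+ (v ℤ.+ + 𝕂) → q^ b * F (v ℤ.+ τ) ≈ q^ a * F v
  F-quasi v a b e = begin
    q^ b * (σ (v ℤ.+ τ ℤ.+ c) * ũ (n ℕ.+ n) (v ℤ.+ τ ℤ.+ c))
      ≈⟨ *-congˡ (*-cong (trans (σ≡ (l₁ v (+ n))) (σ-even (v ℤ.+ c) (+ 𝕂))) (reflexive (≡.cong (ũ (n ℕ.+ n)) (l₂ v (+ n))))) ⟩
    q^ b * (σ (v ℤ.+ c) * ũ (n ℕ.+ n) (v ℤ.+ c ℤ.+ + (n ℕ.+ n) ℤ.+ + 4))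
      ≈⟨ solve 3 (λ a b c → a :* (b :* c) := b :* (a :* c)) refl _ _ _ ⟩
    σ (v ℤ.+ c) * (q^ b * ũ (n ℕ.+ n) (v ℤ.+ c ℤ.+ + (n ℕ.+ n) ℤ.+ + 4))
      ≈⟨ *-congˡ (ũ-quasi (n ℕ.+ n) (v ℤ.+ c) a b (≡.trans e (l₃ v (+ n) (+ b)))) ⟩
    σ (v ℤ.+ c) * (q^ a * ũ (n ℕ.+ n) (v ℤ.+ c))
      ≈⟨ solve 3 (λ a b c → a :* (b :* c) := b :* (a :* c)) refl _ _ _ ⟩
    q^ a * F v ∎
    where
    c = + 1 ℤ.- + n
    l₁ : ∀ v n → v ℤ.+ + 2 ℤ.* (+ 2 ℤ.+ n) ℤ.+ (+ 1 ℤ.- n) ≡ v ℤ.+ (+ 1 ℤ.- n) ℤ.+ ((+ 2 ℤ.+ n) ℤ.+ (+ 2 ℤ.+ n))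
    l₁ = solve-∀
    l₂ : ∀ v n → v ℤ.+ + 2 ℤ.* (+ 2 ℤ.+ n) ℤ.+ (+ 1 ℤ.- n) ≡ v ℤ.+ (+ 1 ℤ.- n) ℤ.+ (n ℤ.+ n) ℤ.+ + 4
    l₂ = solve-∀
    l₃ : ∀ v n b → b ℤ.+ (v ℤ.+ (+ 2 ℤ.+ n)) ≡ b ℤ.+ (v ℤ.+ (+ 1 ℤ.- n) ℤ.+ (n ℤ.+ n) ℤ.+ + 1)
    l₃ = solve-∀

  -- (v² - j²) / (4 (n+2)) for v = node j k
  expo : ℕ → ℤ → ℕ
  expo j (+ m)    = m ℕ.* (j ℕ.+ 𝕂 ℕ.* m)
  expo j -[1+ m ] = suc m ℕ.* (𝕂 ℕ.* suc m ℕ.∸ j)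

  j≤𝕂m : ∀ j m → j ℕ.≤ 𝕂 → j ℕ.≤ 𝕂 ℕ.* suc m
  j≤𝕂m j m l = ℕ.≤-trans l (ℕ.≤-trans (ℕ.m≤m+n 𝕂 (𝕂 ℕ.* m)) (ℕ.≤-reflexive (≡.sym (ℕ.*-suc 𝕂 m))))

  expo-ℤ : ∀ j k → j ℕ.≤ 𝕂 → + expo j k ≡ k ℤ.* (+ j ℤ.+ + 𝕂 ℤ.* k)
  expo-ℤ j (+ m)    l = ≡.trans (ℤ.pos-* m _) (≡.cong (λ t → + m ℤ.* (+ j ℤ.+ t)) (ℤ.pos-* 𝕂 m))
  expo-ℤ j -[1+ m ] l = ≡.trans (ℤ.pos-* (suc m) _) (≡.trans (≡.cong (+ suc m ℤ.*_) (≡.trans (pos-∸ (j≤𝕂m j m l)) (≡.cong (ℤ._- + j) (ℤ.pos-* 𝕂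
       (suc m)))))
      (l₁ (+ j) (+ 𝕂) (+ suc m)))
    where
    l₁ : ∀ j K m → m ℤ.* (K ℤ.* m ℤ.- j) ≡ ℤ.- m ℤ.* (j ℤ.+ K ℤ.* ℤ.- m)
    l₁ = solve-∀

  -- `F-quasi` is iterated upwards for k > 0 and downwards for k < 0. Hence F enters only through
  -- its values at the representatives j, with exactly the powers of q that the theorem has.
  F-node : ∀ j k → j ℕ.≤ 𝕂 → F (node j k) ≈ q^ (expo j k) * F (+ j)
  F-node j (+ zero)  l = trans (reflexive (≡.cong F (l₁ (+ j) τ))) (sym (trans (*-congʳ q^0) (*-identityˡ _)))
    where
    l₁ : ∀ j t → j ℤ.+ t ℤ.* + 0 ≡ j
    l₁ = solve-∀
  F-node j (+ suc m) l = begin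
    F (node j (+ suc m))                      ≈⟨ trans (reflexive (≡.cong F (l₁ (+ j) τ (+ m)))) (sym (trans (*-congʳ q^0) (*-identityˡ _))) ⟩
    q^ 0 * F (node j (+ m) ℤ.+ τ)             ≈⟨ F-quasi (node j (+ m)) a 0 a≡ ⟩
    q^ a * F (node j (+ m))                   ≈⟨ *-congˡ (F-node j (+ m) l) ⟩
    q^ a * (q^ (expo j (+ m)) * F (+ j))      ≈⟨ trans (sym (*-assoc _ _ _)) (*-congʳ (sym (q+ a _ e≡))) ⟩
    q^ (expo j (+ suc m)) * F (+ j)           ∎
    where
    a = j ℕ.+ 2 ℕ.* 𝕂 ℕ.* m ℕ.+ 𝕂
    l₁ : ∀ j t m → j ℤ.+ t ℤ.* (+ 1 ℤ.+ m) ≡ j ℤ.+ t ℤ.* m ℤ.+ t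
    l₁ = solve-∀
    l₂ : ∀ j K m → j ℤ.+ + 2 ℤ.* K ℤ.* m ℤ.+ K ≡ + 0 ℤ.+ (j ℤ.+ + 2 ℤ.* K ℤ.* m ℤ.+ K)
    l₂ = solve-∀
    l₃ : ∀ j K m → (+ 1 ℤ.+ m) ℤ.* (j ℤ.+ K ℤ.* (+ 1 ℤ.+ m)) ≡ (j ℤ.+ + 2 ℤ.* K ℤ.* m ℤ.+ K) ℤ.+ m ℤ.* (j ℤ.+ K ℤ.* m)
    l₃ = solve-∀
    a-ℤ : + a ≡ + j ℤ.+ + 2 ℤ.* + 𝕂 ℤ.* + m ℤ.+ + 𝕂
    a-ℤ = ≡.cong (λ t → + j ℤ.+ t ℤ.+ + 𝕂) (≡.trans (ℤ.pos-* (2 ℕ.* 𝕂) m) (≡.cong (ℤ._* + m) (ℤ.pos-* 2 𝕂)))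
    a≡ : + a ≡ + 0 ℤ.+ (node j (+ m) ℤ.+ + 𝕂)
    a≡ = ≡.trans a-ℤ (l₂ (+ j) (+ 𝕂) (+ m))
    e≡ : expo j (+ suc m) ≡ a ℕ.+ expo j (+ m)
    e≡ = ℤ.+-injective (≡.trans (expo-ℤ j (+ suc m) l) (≡.trans (l₃ (+ j) (+ 𝕂) (+ m)) (≡.cong₂ ℤ._+_ (≡.sym a-ℤ) (≡.sym (expo-ℤ j (+ m) l)))))
  F-node j -[1+ m ] l = begin
    F (node j -[1+ m ])                       ≈⟨ sym (trans (*-congʳ q^0) (*-identityˡ _)) ⟩
    q^ 0 * F (node j -[1+ m ])                ≈⟨ F-quasi (node j -[1+ m ]) 0 b b≡ ⟨
    q^ b * F (node j -[1+ m ] ℤ.+ τ)          ≈⟨ *-congˡ (trans (reflexive (≡.cong F (l₁ (+ j) τ (+ m)))) (F-node-neg m)) ⟩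
    q^ b * (q^ (expo j (ℤ.- + m)) * F (+ j))  ≈⟨ trans (sym (*-assoc _ _ _)) (*-congʳ (sym (q+ b _ e≡))) ⟩
    q^ (expo j -[1+ m ]) * F (+ j)            ∎
    where
    b = 𝕂 ℕ.* suc m ℕ.∸ j ℕ.+ 𝕂 ℕ.* m
    F-node-neg : ∀ m → F (node j (ℤ.- + m)) ≈ q^ (expo j (ℤ.- + m)) * F (+ j)
    F-node-neg zero    = F-node j (+ 0) l
    F-node-neg (suc m) = F-node j -[1+ m ] l
    l₁ : ∀ j t m → j ℤ.+ t ℤ.* ℤ.- (+ 1 ℤ.+ m) ℤ.+ t ≡ j ℤ.+ t ℤ.* ℤ.- m
    l₁ = solve-∀
    l₂ : ∀ j K m → + 0 ≡ (K ℤ.* (+ 1 ℤ.+ m) ℤ.- j ℤ.+ K ℤ.* m) ℤ.+ (j ℤ.+ + 2 ℤ.* K ℤ.* ℤ.- (+ 1 ℤ.+ m) ℤ.+ K)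
    l₂ = solve-∀
    l₃ : ∀ j K m → ℤ.- (+ 1 ℤ.+ m) ℤ.* (j ℤ.+ K ℤ.* ℤ.- (+ 1 ℤ.+ m)) ≡ (K ℤ.* (+ 1 ℤ.+ m) ℤ.- j ℤ.+ K ℤ.* m) ℤ.+ ℤ.- m ℤ.* (j ℤ.+ K ℤ.* ℤ.- m)
    l₃ = solve-∀
    b-ℤ : + b ≡ + 𝕂 ℤ.* + suc m ℤ.- + j ℤ.+ + 𝕂 ℤ.* + m
    b-ℤ = ≡.cong₂ ℤ._+_ (≡.trans (pos-∸ (j≤𝕂m j m l)) (≡.cong (ℤ._- + j) (ℤ.pos-* 𝕂 (suc m)))) (ℤ.pos-* 𝕂 m)
    b≡ : + 0 ≡ + b ℤ.+ (node j -[1+ m ] ℤ.+ + 𝕂)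
    b≡ = ≡.trans (l₂ (+ j) (+ 𝕂) (+ m)) (≡.cong (ℤ._+ (node j -[1+ m ] ℤ.+ + 𝕂)) (≡.sym b-ℤ))
    e≡ : expo j -[1+ m ] ≡ b ℕ.+ expo j (ℤ.- + m)
    e≡ = ℤ.+-injective (≡.trans (expo-ℤ j -[1+ m ] l) (≡.trans (l₃ (+ j) (+ 𝕂) (+ m)) (≡.cong₂ ℤ._+_ (≡.sym b-ℤ) (≡.sym (expo-ℤ j (ℤ.- + m) l)))))

  F-zero : ∀ k → F (node 0 k) ≈ 0#
  F-zero k = trans (F-node 0 k z≤n) (trans (*-congˡ (double-zero (F-odd (+ 0)))) (zeroʳ _))

  -- The class of n + 2 is its own negative, and the quasi-period from -(n+2) to n + 2 involves the
  -- power q^0, so oddness forces the value 0.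
  F-𝕂 : ∀ k → F (node 𝕂 k) ≈ 0#
  F-𝕂 k = trans (F-node 𝕂 k ℕ.≤-refl) (trans (*-congˡ (double-zero F𝕂)) (zeroʳ _))
    where
    l₁ : ∀ K → K ≡ ℤ.- K ℤ.+ + 2 ℤ.* K
    l₁ = solve-∀
    l₂ : ∀ K → + 0 ≡ + 0 ℤ.+ (ℤ.- K ℤ.+ K)
    l₂ = solve-∀
    F𝕂 : F (+ 𝕂) ≈ - F (+ 𝕂)
    F𝕂 = begin
      F (+ 𝕂)                      ≈⟨ trans (reflexive (≡.cong F (l₁ (+ 𝕂)))) (sym (trans (*-congʳ q^0) (*-identityˡ _))) ⟩
      q^ 0 * F (ℤ.- + 𝕂 ℤ.+ τ)     ≈⟨ F-quasi (ℤ.- + 𝕂) 0 0 (l₂ (+ 𝕂)) ⟩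
      q^ 0 * F (ℤ.- + 𝕂)           ≈⟨ trans (*-congʳ q^0) (*-identityˡ _) ⟩
      F (ℤ.- + 𝕂)                  ≈⟨ F-odd (+ 𝕂) ⟩
      - F (+ 𝕂)                    ∎

  𝔼 : ℕ
  𝔼 = reach (n ℕ.+ n) ℕ.+ suc n

  ∣1-n∣≤ : ℤ.∣ + 1 ℤ.- + n ∣ ℕ.≤ suc n
  ∣1-n∣≤ = ℤ.∣i-j∣≤∣i∣+∣j∣ (+ 1) (+ n)

  F-Van : Van 𝔼 F
  F-Van v l = trans (*-congˡ (ũ-Van (n ℕ.+ n) _ (ℕ.≰⇒> λ h → ℕ.<⇒≱ l
    (ℕ.≤-trans (ℕ.≤-reflexive (≡.cong ℤ.∣_∣ (l₁ v (+ 1 ℤ.- + n)))) (ℕ.≤-trans (ℤ.∣i-j∣≤∣i∣+∣j∣ (v ℤ.+ (+ 1 ℤ.- + n)) (+ 1 ℤ.- + n))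
         (ℕ.+-mono-≤ h ∣1-n∣≤)))))) (zeroʳ _)
    where
    l₁ : ∀ v c → v ≡ v ℤ.+ c ℤ.- c
    l₁ = solve-∀

  opaque
    residues : ℕ → Seq → Carrier
    residues B g = Σ (suc n) (λ i → 𝕀 B (λ k → g (node (suc i) k)))

    residues-cong : ∀ B {f g : Seq} → (∀ v → f v ≈ g v) → residues B f ≈ residues B g
    residues-cong B h = Σ-cong (suc n) (λ i → 𝕀-cong B (λ k → h _))

    -- The 2n+4 residue classes pair off under v ↦ -v, except for the classes of 0 and n+2, on which g vanishes.
    residues-total : ∀ B g → 𝔼 ℕ.≤ B → Van 𝔼 g → (∀ v → g (ℤ.- v) ≈ g v) → (∀ k → g (node 0 k) ≈ 0#) → (∀ k → g (node 𝕂 k) ≈ 0#) →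
      𝕀 𝔼 g ≈ residues B g + residues B g
    residues-total B g l van even g0 g𝕂 = sym (begin
      residues B g + residues B g
        ≈⟨ solve 2 (λ a b → a :+ b := a :+ (con (+ 0) :+ (b :+ con (+ 0)))) refl _ _ ⟩
      residues B g + (0# + (residues B g + 0#))
        ≈⟨ +-cong negs (+-cong (sym zer) (+-cong poss (sym top))) ⟩
      Σ (suc n) (λ i → b i) + (b (suc n ℕ.+ 0) + (Σ (suc n) (λ i → b (suc n ℕ.+ suc i)) + b (suc n ℕ.+ suc (suc n ℕ.+ 0))))
        ≈⟨ +-congˡ (trans (+-congˡ (+-congˡ (sym (Σ-one _)))) (trans (+-congˡ (sym (Σ-split (suc n) 1 _))) (sym (Σ-suc (suc n ℕ.+ 1) _)))) ⟩
      Σ (suc n) b + Σ (suc (suc n ℕ.+ 1)) (λ i → b (suc n ℕ.+ i))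
        ≈⟨ Σ-split (suc n) _ b ⟨
      Σ per b
        ≈⟨ 𝕀-Σ B per _ ⟨
      𝕀 B (λ k → Σ per (λ i → g (base ℤ.+ + i ℤ.+ τ ℤ.* k)))
        ≈⟨ 𝕀-I B _ ⟩
      Σ (suc (B ℕ.+ B)) (λ x → Σ per (λ i → g (base ℤ.+ + i ℤ.+ τ ℤ.* (ℤ.- + B ℤ.+ + x))))
        ≈⟨ Σ-cong (suc (B ℕ.+ B)) (λ x → Σ-cong per (λ i → reflexive (≡.cong g (index x i)))) ⟩
      Σ (suc (B ℕ.+ B)) (λ x → Σ per (λ i → g (ℤ.- + C ℤ.+ + (x ℕ.* per ℕ.+ i))))
        ≈⟨ Σ-block (suc (B ℕ.+ B)) per (λ t → g (ℤ.- + C ℤ.+ + t)) ⟨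
      Σ (suc (B ℕ.+ B) ℕ.* per) (λ t → g (ℤ.- + C ℤ.+ + t))
        ≡⟨ ≡.cong (λ t → Σ t (λ t → g (ℤ.- + C ℤ.+ + t))) len ⟩
      Σ (suc (suc (C ℕ.+ C))) (λ t → g (ℤ.- + C ℤ.+ + t))
        ≈⟨ trans (Σ-last _ _) (+-cong (sym (𝕀-I C g)) (van _ last)) ⟩
      𝕀 C g + 0#
        ≈⟨ trans (+-identityʳ _) (𝕀-ext van 𝔼≤C) ⟩
      𝕀 𝔼 g ∎)
      where
      -- The classes -(n+1), ..., n+2 over 2B + 1 periods fill the interval from -C to C + 1; its
      -- last point lies outside the support of g.
      per C : ℕ
      per = suc n ℕ.+ suc (suc n ℕ.+ 1)
      C = suc n ℕ.+ per ℕ.* B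
      base : ℤ
      base = ℤ.- + suc n
      b : ℕ → Carrier
      b i = 𝕀 B (λ k → g (base ℤ.+ + i ℤ.+ τ ℤ.* k))
      per-ℤ : + per ≡ τ
      per-ℤ = l₁ (+ n)
        where
        l₁ : ∀ n → (+ 1 ℤ.+ n) ℤ.+ (+ 1 ℤ.+ ((+ 1 ℤ.+ n) ℤ.+ + 1)) ≡ + 2 ℤ.* (+ 2 ℤ.+ n)
        l₁ = solve-∀
      negs : residues B g ≈ Σ (suc n) b
      negs = sym (trans (Σ-rev (suc n) b) (Σ-cong< (suc n) (λ { i (s≤s i≤n) → trans
          (𝕀-cong B (λ k → trans (reflexive (≡.cong g (≡.trans (≡.cong (λ t → base ℤ.+ t ℤ.+ τ ℤ.* k) (pos-∸ i≤n)) (l₁ (+ n) (+ i) τ k)))) (even _)))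
          (𝕀-flip B (λ k → g (node (suc i) k))) })))
        where
        l₁ : ∀ n i t k → ℤ.- (+ 1 ℤ.+ n) ℤ.+ (n ℤ.- i) ℤ.+ t ℤ.* k ≡ ℤ.- ((+ 1 ℤ.+ i) ℤ.+ t ℤ.* ℤ.- k)
        l₁ = solve-∀
      zer : b (suc n ℕ.+ 0) ≈ 0#
      zer = trans (𝕀-cong B (λ k → trans (reflexive (≡.cong g (l₁ (+ n) τ k))) (g0 k))) (𝕀-0 B)
        where
        l₁ : ∀ n t k → ℤ.- (+ 1 ℤ.+ n) ℤ.+ (+ 1 ℤ.+ n ℤ.+ + 0) ℤ.+ t ℤ.* k ≡ + 0 ℤ.+ t ℤ.* k
        l₁ = solve-∀
      poss : residues B g ≈ Σ (suc n) (λ i → b (suc n ℕ.+ suc i))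
      poss = Σ-cong (suc n) (λ i → 𝕀-cong B (λ k → reflexive (≡.cong g (l₁ (+ n) (+ i) τ k))))
        where
        l₁ : ∀ n i t k → (+ 1 ℤ.+ i) ℤ.+ t ℤ.* k ≡ ℤ.- (+ 1 ℤ.+ n) ℤ.+ (+ 1 ℤ.+ n ℤ.+ (+ 1 ℤ.+ i)) ℤ.+ t ℤ.* k
        l₁ = solve-∀
      top : b (suc n ℕ.+ suc (suc n ℕ.+ 0)) ≈ 0#
      top = trans (𝕀-cong B (λ k → trans (reflexive (≡.cong g (l₁ (+ n) τ k))) (g𝕂 k))) (𝕀-0 B)
        where
        l₁ : ∀ n t k → ℤ.- (+ 1 ℤ.+ n) ℤ.+ (+ 1 ℤ.+ n ℤ.+ (+ 1 ℤ.+ (+ 1 ℤ.+ n ℤ.+ + 0))) ℤ.+ t ℤ.* k ≡ + 2 ℤ.+ n ℤ.+ t ℤ.* k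
        l₁ = solve-∀
      C-ℤ : + C ≡ + suc n ℤ.+ τ ℤ.* + B
      C-ℤ = ≡.cong (λ t → + suc n ℤ.+ t) (≡.trans (ℤ.pos-* per B) (≡.cong (ℤ._* + B) per-ℤ))
      index : ∀ x i → base ℤ.+ + i ℤ.+ τ ℤ.* (ℤ.- + B ℤ.+ + x) ≡ ℤ.- + C ℤ.+ + (x ℕ.* per ℕ.+ i)
      index x i = ≡.trans (l₁ (+ suc n) (+ i) τ (+ B) (+ x)) (≡.sym (≡.cong₂ (λ a b → ℤ.- a ℤ.+ (b ℤ.+ + i)) C-ℤ (≡.trans (ℤ.pos-* x per)
           (≡.cong (+ x ℤ.*_) per-ℤ))))
        where
        l₁ : ∀ n i t B x → ℤ.- n ℤ.+ i ℤ.+ t ℤ.* (ℤ.- B ℤ.+ x) ≡ ℤ.- (n ℤ.+ t ℤ.* B) ℤ.+ (x ℤ.* t ℤ.+ i)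
        l₁ = solve-∀
      len : suc (B ℕ.+ B) ℕ.* per ≡ suc (suc (C ℕ.+ C))
      len = ℤ.+-injective (≡.trans (ℤ.pos-* (suc (B ℕ.+ B)) per) (≡.trans (≡.cong (+ suc (B ℕ.+ B) ℤ.*_) per-ℤ)
        (≡.trans (l₁ (+ B) (+ n)) (≡.sym (≡.cong (λ t → + 2 ℤ.+ (t ℤ.+ t)) C-ℤ)))))
        where
        l₁ : ∀ B n → (+ 1 ℤ.+ (B ℤ.+ B)) ℤ.* (+ 2 ℤ.* (+ 2 ℤ.+ n)) ≡ + 2 ℤ.+ ((+ 1 ℤ.+ n ℤ.+ (+ 2 ℤ.* (+ 2 ℤ.+ n)) ℤ.* B) ℤ.+ (+ 1 ℤ.+ n ℤ.+
             (+ 2 ℤ.* (+ 2 ℤ.+ n)) ℤ.* B))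
        l₁ = solve-∀
      𝔼≤C : 𝔼 ℕ.≤ C
      𝔼≤C = ℕ.≤-trans l (ℕ.≤-trans (ℕ.m≤m+n B _) (ℕ.m≤n+m (per ℕ.* B) (suc n)))
      last : 𝔼 ℕ.< ℤ.∣ ℤ.- + C ℤ.+ + suc (C ℕ.+ C) ∣
      last = ≡.subst (λ t → 𝔼 ℕ.< ℤ.∣ t ∣) (≡.sym (l₁ (+ C))) (s≤s 𝔼≤C)
        where
        l₁ : ∀ C → ℤ.- C ℤ.+ (+ 1 ℤ.+ (C ℤ.+ C)) ≡ + 1 ℤ.+ C
        l₁ = solve-∀

    residues-def : ∀ B g → residues B g ≈ Σ (suc n) (λ i → 𝕀 B (λ k → g (node (suc i) k)))
    residues-def B g = refl

    residues-+ : ∀ B (f g : Seq) → residues B (λ v → f v + g v) ≈ residues B f + residues B g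
    residues-+ B f g = trans (Σ-cong (suc n) (λ i → 𝕀-+ B _ _)) (Σ-+ (suc n) _ _)

    residues-*ˡ : ∀ B y (f : Seq) → y * residues B f ≈ residues B (λ v → y * f v)
    residues-*ˡ B y f = trans (Σ-*ˡ (suc n) _ _) (Σ-cong (suc n) (λ i → 𝕀-*ˡ B _ _))

  -- The power 2s + 1 written through v², so that a factor a² - v² of `diffs` acts by raising s.
  oddpow : ℕ → ℤ → Carrier
  oddpow s v = κ v * pow (κ v * κ v) s

  oddpow-pow : ∀ s v → oddpow s v ≈ pow (κ v) (suc (s ℕ.+ s))
  oddpow-pow s v = *-congˡ (trans (pow-* _ _ s) (sym (pow-+ _ s s)))

  m̂ : ℕ → ℕ → Carrier
  m̂ B s = residues B (λ v → F v * oddpow s v)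

  -- `center` at v + 1 - n is 2v, which gives 2^(2s+1); pairing v with -v gives one more factor 2.
  m̂-mom : ∀ B s → 𝔼 ℕ.≤ B → pow (κ (+ 2)) (2 ℕ.+ (s ℕ.+ s)) * m̂ B s ≈ mom 𝔼 (n ℕ.+ n) (suc (s ℕ.+ s))
  m̂-mom B s l = sym (begin
    𝕀 𝔼 G′
      ≈⟨ 𝕀-shift G′ (+ 1 ℤ.- + n) (λ x h → trans (*-congˡ (ũ-Van (n ℕ.+ n) x h)) (zeroʳ _)) (ℕ.+-monoʳ-≤ (reach (n ℕ.+ n)) ∣1-n∣≤) ⟨
    𝕀 𝔼 (λ v → G′ (v ℤ.+ (+ 1 ℤ.- + n)))
      ≈⟨ 𝕀-cong 𝔼 term≈ ⟩
    𝕀 𝔼 (λ v → pow (κ (+ 2)) r * g v)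
      ≈⟨ 𝕀-*ˡ 𝔼 _ _ ⟨
    pow (κ (+ 2)) r * 𝕀 𝔼 g
      ≈⟨ *-congˡ (residues-total B g l (λ v h → trans (*-congʳ (F-Van v h)) (zeroˡ _)) g-even
           (λ k → trans (*-congʳ (F-zero k)) (zeroˡ _)) (λ k → trans (*-congʳ (F-𝕂 k)) (zeroˡ _))) ⟩
    pow (κ (+ 2)) r * (m̂ B s + m̂ B s)
      ≈⟨ solve 2 (λ a b → a :* (b :+ b) := con (+ 2) :* a :* b) refl _ _ ⟩
    pow (κ (+ 2)) (suc r) * m̂ B s ∎)
    where
    r : ℕ
    r = suc (s ℕ.+ s)
    g G′ : Seq
    g v  = F v * oddpow s v
    G′ x = σ x * pow (center (n ℕ.+ n) x) r * ũ (n ℕ.+ n) x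
    l₁ : ∀ v n → + 2 ℤ.* (v ℤ.+ (+ 1 ℤ.- n)) ℤ.+ (n ℤ.+ n) ℤ.- + 2 ≡ + 2 ℤ.* v
    l₁ = solve-∀
    term≈ : ∀ v → G′ (v ℤ.+ (+ 1 ℤ.- + n)) ≈ pow (κ (+ 2)) r * g v
    term≈ v = trans (*-congʳ (*-congˡ (trans (pow-cong r (trans (reflexive (≡.cong κ (l₁ v (+ n)))) (κ-* (+ 2) v))) (trans (pow-* _ _ r)
         (*-congˡ (sym (oddpow-pow s v)))))))
      (solve 4 (λ a b c d → a :* (b :* c) :* d := b :* (a :* d :* c)) refl _ _ _ _)
    g-even : ∀ v → g (ℤ.- v) ≈ g v
    g-even v = trans (*-cong (F-odd v) (trans (*-cong (κ-neg v) (pow-cong s (trans (*-cong (κ-neg v) (κ-neg v)) (solve 1 (λ a → (:- a) :*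
         (:- a) := a :* a) refl _)))) refl))
      (solve 3 (λ a b c → (:- a) :* ((:- b) :* c) := a :* (b :* c)) refl (F v) (κ v) (pow (κ v * κ v) s))

-- Products over consecutive integers.

nodes : ℕ → ℕ → List ℤ
nodes a m = map +_ (range a m)

range-All : ∀ {b} a m → a ℕ.+ m ℕ.≤ b → All (ℕ._< b) (range a m)
range-All     a zero    l = []
range-All {b} a (suc m) l = ℕ.≤-trans (s≤s (ℕ.m≤m+n a m)) l′ ∷ range-All (suc a) m l′
  where
  l′ : suc a ℕ.+ m ℕ.≤ b
  l′ = ≡.subst (ℕ._≤ b) (ℕ.+-suc a m) l

squares-range : ∀ a m → + 6 ℤ.* squares (nodes a m) ≡
  + m ℤ.* (+ 6 ℤ.* (+ a ℤ.* + a) ℤ.+ + 6 ℤ.* + a ℤ.* (+ m ℤ.- + 1) ℤ.+ (+ m ℤ.- + 1) ℤ.* (+ 2 ℤ.* + m ℤ.- + 1))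
squares-range a zero    = ≡.refl
squares-range a (suc m) = ≡.trans (ℤ.*-distribˡ-+ (+ 6) (+ a ℤ.* + a) (squares (nodes (suc a) m)))
  (≡.trans (≡.cong (λ t → + 6 ℤ.* (+ a ℤ.* + a) ℤ.+ t) (squares-range (suc a) m)) (l (+ a) (+ m)))
  where
  l : ∀ a m → + 6 ℤ.* (a ℤ.* a) ℤ.+ m ℤ.* (+ 6 ℤ.* ((+ 1 ℤ.+ a) ℤ.* (+ 1 ℤ.+ a)) ℤ.+ + 6 ℤ.* (+ 1 ℤ.+ a) ℤ.* (m ℤ.- + 1) ℤ.+ (m ℤ.- + 1) ℤ.*
       (+ 2 ℤ.* m ℤ.- + 1))
    ≡ (+ 1 ℤ.+ m) ℤ.* (+ 6 ℤ.* (a ℤ.* a) ℤ.+ + 6 ℤ.* a ℤ.* (+ 1 ℤ.+ m ℤ.- + 1) ℤ.+ (+ 1 ℤ.+ m ℤ.- + 1) ℤ.* (+ 2 ℤ.* (+ 1 ℤ.+ m) ℤ.- + 1))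
  l = solve-∀

*-≢0 : ∀ x y → x ≢ + 0 → y ≢ + 0 → x ℤ.* y ≢ + 0
*-≢0 x y hx hy e with ℤ.i*j≡0⇒i≡0∨j≡0 x e
... | inj₁ h = hx h
... | inj₂ h = hy h

diffs-≢0 : ∀ a b m → a ℕ.< b → diffs (+ a) (nodes b m) ≢ + 0
diffs-≢0 a b zero    l = λ ()
diffs-≢0 a b (suc m) l = *-≢0 _ _ (λ e → ℕ.<⇒≢ (ℕ.*-mono-< l l) (≡.sym (ℤ.+-injective
  (≡.trans (ℤ.pos-* b b) (≡.trans (ℤ.i-j≡0⇒i≡j _ _ e) (≡.sym (ℤ.pos-* a a))))))) (diffs-≢0 a (suc b) m (ℕ.≤-trans l (ℕ.n≤1+n b)))

Δ-≢0 : ∀ a m → Δ (nodes (suc a) m) ≢ + 0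
Δ-≢0 a zero    = λ ()
Δ-≢0 a (suc m) = *-≢0 (+ suc a ℤ.* diffs (+ suc a) (nodes (suc (suc a)) m)) _ (*-≢0 (+ suc a) _ (λ ()) (diffs-≢0 (suc a) (suc
     (suc a)) m ℕ.≤-refl)) (Δ-≢0 (suc a) m)

!-≢0 : ∀ n → + (n !) ≢ + 0
!-≢0 n e with n ! | ℕ.1≤n! n
!-≢0 n () | suc k | _

range-snoc : ∀ a m → range a (suc m) ≡ range a m ++ (a ℕ.+ m ∷ [])
range-snoc a zero    = ≡.cong (_∷ []) (≡.sym (ℕ.+-identityʳ a))
range-snoc a (suc m) = ≡.cong (a ∷_) (≡.trans (range-snoc (suc a) m) (≡.cong (λ t → range (suc a) m ++ (t ∷ [])) (≡.sym (ℕ.+-suc a m))))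

nodes-snoc : ∀ a m → nodes a (suc m) ≡ nodes a m ++ (+ (a ℕ.+ m) ∷ [])
nodes-snoc a m = ≡.trans (≡.cong (map +_) (range-snoc a m)) (map-++ +_ (range a m) _)

below : ℤ → List ℤ → ℤ
below w []       = + 1
below w (x ∷ xs) = (w ℤ.* w ℤ.- x ℤ.* x) ℤ.* below w xs

below-snoc : ∀ w xs y → below w (xs ++ (y ∷ [])) ≡ below w xs ℤ.* (w ℤ.* w ℤ.- y ℤ.* y)
below-snoc w []       y = ℤ.*-comm (w ℤ.* w ℤ.- y ℤ.* y) (+ 1)
below-snoc w (x ∷ xs) y = ≡.trans (≡.cong ((w ℤ.* w ℤ.- x ℤ.* x) ℤ.*_) (below-snoc w xs y)) (≡.sym (ℤ.*-assoc (w ℤ.* w ℤ.- x ℤ.* x) _ _))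

diffs-snoc : ∀ v xs w → diffs v (xs ++ (w ∷ [])) ≡ diffs v xs ℤ.* (w ℤ.* w ℤ.- v ℤ.* v)
diffs-snoc v []       w = ℤ.*-comm (w ℤ.* w ℤ.- v ℤ.* v) (+ 1)
diffs-snoc v (x ∷ xs) w = ≡.trans (≡.cong ((x ℤ.* x ℤ.- v ℤ.* v) ℤ.*_) (diffs-snoc v xs w)) (≡.sym (ℤ.*-assoc (x ℤ.* x ℤ.- v ℤ.* v) _ _))

Δ-snoc : ∀ xs w → Δ (xs ++ (w ∷ [])) ≡ w ℤ.* below w xs ℤ.* Δ xs
Δ-snoc []       w = ≡.refl
Δ-snoc (x ∷ xs) w = ≡.trans (≡.cong₂ (λ a b → x ℤ.* a ℤ.* b) (diffs-snoc x xs w) (Δ-snoc xs w)) (l x w (diffs x xs) (below w xs) (Δ xs))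
  where
  l : ∀ x w a b c → x ℤ.* (a ℤ.* (w ℤ.* w ℤ.- x ℤ.* x)) ℤ.* (w ℤ.* b ℤ.* c) ≡ w ℤ.* ((w ℤ.* w ℤ.- x ℤ.* x) ℤ.* b) ℤ.* (x ℤ.* a ℤ.* c)
  l = solve-∀

!-step : ∀ a m → (a ℕ.+ suc m) ℕ.* (a ℕ.+ m) ! ≡ (a ℕ.+ suc m) !
!-step a m rewrite ℕ.+-suc a m = ≡.refl

-- The product w Π (w² - x²) over x ≤ m runs through all integers from w - m to w + m, and r is w -
-- m - 1.
below-factorial : ∀ m r → let w = suc (m ℕ.+ r) in + w ℤ.* below (+ w) (nodes 1 m) ℤ.* + (r !) ≡ + ((w ℕ.+ m) !)
below-factorial zero    r = ≡.trans (≡.cong (ℤ._* + (r !)) (ℤ.*-identityʳ (+ suc r)))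
  (≡.trans (≡.sym (ℤ.pos-* (suc r) (r !))) (≡.cong (λ t → + (t !)) (≡.sym (ℕ.+-identityʳ (suc r)))))
below-factorial (suc m) r = ≡.trans (≡.cong (λ t → + w ℤ.* t ℤ.* + (r !)) (≡.trans (≡.cong (below (+ w)) (nodes-snoc 1 m)) (below-snoc (+ w)
     (nodes 1 m) (+ suc m))))
  (≡.trans (l₁ (+ m) (+ r) (below (+ w) (nodes 1 m)) (+ (r !)))
  (≡.trans (≡.cong₂ ℤ._*_ {x = + w ℤ.* below (+ w) (nodes 1 m) ℤ.* (+ suc r ℤ.* + (r !))} {u = + w ℤ.+ + suc m}
     (≡.trans (≡.cong (+ w ℤ.* below (+ w) (nodes 1 m) ℤ.*_) (≡.sym (ℤ.pos-* (suc r) (r !))))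
       (≡.trans (≡.cong (λ t → + t ℤ.* below (+ t) (nodes 1 m) ℤ.* + (suc r !)) e) (≡.trans (below-factorial m (suc r)) (≡.cong (λ t → +
            ((t ℕ.+ m) !)) (≡.sym e)))))
     ≡.refl)
  (≡.trans (≡.sym (ℤ.pos-* ((w ℕ.+ m) !) (w ℕ.+ suc m))) (≡.cong +_ (≡.trans (ℕ.*-comm ((w ℕ.+ m) !) (w ℕ.+ suc m)) f)))))
  where
  w = suc (suc m ℕ.+ r)
  e : w ≡ suc (m ℕ.+ suc r)
  e = ≡.cong suc (≡.sym (ℕ.+-suc m r))
  f : (w ℕ.+ suc m) ℕ.* (w ℕ.+ m) ! ≡ (w ℕ.+ suc m) !
  f = !-step w m
  l₁ : ∀ m r b z → (+ 1 ℤ.+ (+ 1 ℤ.+ m ℤ.+ r)) ℤ.* (b ℤ.* ((+ 1 ℤ.+ (+ 1 ℤ.+ m ℤ.+ r)) ℤ.* (+ 1 ℤ.+ (+ 1 ℤ.+ m ℤ.+ r)) ℤ.- (+ 1 ℤ.+ m) ℤ.*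
       (+ 1 ℤ.+ m))) ℤ.* z
    ≡ (+ 1 ℤ.+ (+ 1 ℤ.+ m ℤ.+ r)) ℤ.* b ℤ.* ((+ 1 ℤ.+ r) ℤ.* z) ℤ.* ((+ 1 ℤ.+ (+ 1 ℤ.+ m ℤ.+ r)) ℤ.+ (+ 1 ℤ.+ m))
  l₁ = solve-∀

-- The factor (2n+1)! is the one in the leading moment `m̂-top`; the two cancel in `V-value`.
Δ-range : ∀ n → Δ (nodes 1 (suc n)) ≡ + (suc (n ℕ.+ n) !) ℤ.* Δ (nodes 1 n)
Δ-range n = ≡.trans (≡.cong Δ (nodes-snoc 1 n)) (≡.trans (Δ-snoc (nodes 1 n) (+ suc n))
  (≡.cong (ℤ._* Δ (nodes 1 n)) (≡.trans (≡.sym (ℤ.*-identityʳ (+ suc n ℤ.* below (+ suc n) (nodes 1 n)))) (≡.trans (≡.cong (λ t → + t ℤ.* below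
       (+ t) (nodes 1 n) ℤ.* + 1) (≡.cong suc (≡.sym (ℕ.+-identityʳ n))))
    (≡.trans (below-factorial n 0) (≡.cong (λ t → + (suc (t ℕ.+ n) !)) (ℕ.+-identityʳ n)))))))

-- Sums over residue boxes and Cramer's rule.

module BoxSums (Q : QRing) (n : ℕ) where
  open Weyl Q n public

  -- With js = 2, ..., n+1 and Δ as summand this is the truncated sum of the theorem, up to the
  -- denominator of χ and the power of (q)_∞; with js = 1, ..., n+1 it is Macdonald's sum for
  -- C_(n+1).
  𝕊 : ℕ → List ℕ → (List ℤ → Carrier) → Carrier
  𝕊 B []       Ψ = Ψ []
  𝕊 B (j ∷ js) Ψ = 𝕀 B (λ k → q^ (expo j k) * 𝕊 B js (λ vs → Ψ (node j k ∷ vs)))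

  𝕊-cong : ∀ B js {Φ Ψ : List ℤ → Carrier} → (∀ vs → length vs ≡ length js → Φ vs ≈ Ψ vs) → 𝕊 B js Φ ≈ 𝕊 B js Ψ
  𝕊-cong B []       h = h [] ≡.refl
  𝕊-cong B (j ∷ js) h = 𝕀-cong B (λ k → *-congˡ (𝕊-cong B js (λ vs e → h (node j k ∷ vs) (≡.cong suc e))))

  𝕊-*ˡ : ∀ B js y Ψ → y * 𝕊 B js Ψ ≈ 𝕊 B js (λ vs → y * Ψ vs)
  𝕊-*ˡ B []       y Ψ = refl
  𝕊-*ˡ B (j ∷ js) y Ψ = trans (𝕀-*ˡ B _ _) (𝕀-cong B (λ k →
    trans (solve 3 (λ a b c → a :* (b :* c) := b :* (a :* c)) refl _ _ _) (*-congˡ (𝕊-*ˡ B js y _))))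

  𝕊-+ : ∀ B js (Φ Ψ : List ℤ → Carrier) → 𝕊 B js (λ vs → Φ vs + Ψ vs) ≈ 𝕊 B js Φ + 𝕊 B js Ψ
  𝕊-+ B []       Φ Ψ = refl
  𝕊-+ B (j ∷ js) Φ Ψ = trans (𝕀-cong B (λ k → trans (*-congˡ (𝕊-+ B js _ _)) (distribˡ _ _ _))) (𝕀-+ B _ _)

  𝕊-𝕀 : ∀ B js C (Φ : ℤ → List ℤ → Carrier) → 𝕊 B js (λ vs → 𝕀 C (λ x → Φ x vs)) ≈ 𝕀 C (λ x → 𝕊 B js (Φ x))
  𝕊-𝕀 B []       C Φ = refl
  𝕊-𝕀 B (j ∷ js) C Φ = trans (𝕀-cong B (λ k → trans (*-congˡ (𝕊-𝕀 B js C (λ x vs → Φ x (node j k ∷ vs)))) (𝕀-*ˡ C _ _))) (𝕀-swap B C _)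

  𝕊-Σ : ∀ B js m (Φ : ℕ → List ℤ → Carrier) → 𝕊 B js (λ vs → Σ m (λ i → Φ i vs)) ≈ Σ m (λ i → 𝕊 B js (Φ i))
  𝕊-Σ B []       m Φ = refl
  𝕊-Σ B (j ∷ js) m Φ = trans (𝕀-cong B (λ k → trans (*-congˡ (𝕊-Σ B js m (λ i vs → Φ i (node j k ∷ vs)))) (Σ-*ˡ m _ _))) (𝕀-Σ B m _)

  Alternating : (List ℤ → Carrier) → Set
  Alternating Ψ = ∀ xs v w ys → Ψ (xs ++ v ∷ w ∷ ys) ≈ - Ψ (xs ++ w ∷ v ∷ ys)

  𝕊-transpose : ∀ B j i js Ψ → Alternating Ψ → 𝕊 B (j ∷ i ∷ js) Ψ ≈ - 𝕊 B (i ∷ j ∷ js) Ψ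
  𝕊-transpose B j i js Ψ alt = begin
    𝕀 B (λ k → q^ (expo j k) * 𝕀 B (λ l → q^ (expo i l) * 𝕊 B js (λ vs → Ψ (node j k ∷ node i l ∷ vs))))
      ≈⟨ 𝕀-cong B (λ k → 𝕀-*ˡ B _ _) ⟩
    𝕀 B (λ k → 𝕀 B (λ l → q^ (expo j k) * (q^ (expo i l) * 𝕊 B js (λ vs → Ψ (node j k ∷ node i l ∷ vs)))))
      ≈⟨ 𝕀-swap B B _ ⟩
    𝕀 B (λ l → 𝕀 B (λ k → q^ (expo j k) * (q^ (expo i l) * 𝕊 B js (λ vs → Ψ (node j k ∷ node i l ∷ vs)))))
      ≈⟨ 𝕀-cong B (λ l → trans (𝕀-cong B (λ k → trans (*-congˡ (*-congˡ (trans (𝕊-cong B js (λ vs _ →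
            trans (alt [] (node j k) (node i l) vs) (solve 1 (λ x → :- x := (:- con (+ 1)) :* x) refl _))) (sym (𝕊-*ˡ B js _ _)))))
          (solve 3 (λ a b c → a :* (b :* ((:- con (+ 1)) :* c)) := (:- b) :* (a :* c)) refl _ _ _))) (sym (𝕀-*ˡ B _ _))) ⟩
    𝕀 B (λ l → - (q^ (expo i l)) * 𝕀 B (λ k → q^ (expo j k) * 𝕊 B js (λ vs → Ψ (node i l ∷ node j k ∷ vs))))
      ≈⟨ trans (𝕀-cong B (λ l → sym (-‿distribˡ-* _ _))) (𝕀-neg B _) ⟩
    - 𝕊 B (i ∷ j ∷ js) Ψ ∎

  -- Transpositions carry j inwards to its second occurrence, where the sum is its own negative.
  𝕊-repeated : ∀ B j js Ψ → Alternating Ψ → j ∈ js → 𝕊 B (j ∷ js) Ψ ≈ 0#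
  𝕊-repeated B j (.j ∷ js) Ψ alt (here ≡.refl) = double-zero (𝕊-transpose B j j js Ψ alt)
  𝕊-repeated B j (i ∷ js)  Ψ alt (there m)     = begin
    𝕊 B (j ∷ i ∷ js) Ψ                 ≈⟨ 𝕊-transpose B j i js Ψ alt ⟩
    - 𝕊 B (i ∷ j ∷ js) Ψ
      ≈⟨ -‿cong (trans (𝕀-cong B (λ l → trans (*-congˡ (𝕊-repeated B j js (λ vs → Ψ (node i l ∷ vs)) (λ xs v w ys → alt
           (node i l ∷ xs) v w ys) m)) (zeroʳ _))) (𝕀-0 B)) ⟩
    - 0#                               ≈⟨ -0#≈0# ⟩
    0#                                 ∎

  -- Of the n+1 classes of v only the first contributes: the others already occur in range 2 n.
  cramer : ∀ B Ψ → Alternating Ψ → F (+ 1) * 𝕊 B (range 1 (suc n)) Ψ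
    ≈ 𝕊 B (range 2 n) (λ vs → residues B (λ v → F v * Ψ (v ∷ vs)))
  cramer B Ψ alt = sym (begin
    𝕊 B js (λ vs → residues B (λ v → F v * Ψ (v ∷ vs)))
      ≈⟨ 𝕊-cong B js (λ vs _ → residues-def B _) ⟩
    𝕊 B js (λ vs → Σ (suc n) (λ i → 𝕀 B (λ k → F (node (suc i) k) * Ψ (node (suc i) k ∷ vs))))
      ≈⟨ trans (𝕊-Σ B js (suc n) _) (Σ-cong (suc n) (λ i → 𝕊-𝕀 B js B _)) ⟩
    Σ (suc n) (λ i → 𝕀 B (λ k → 𝕊 B js (λ vs → F (node (suc i) k) * Ψ (node (suc i) k ∷ vs))))
      ≈⟨ Σ-cong< (suc n) (λ i l → trans (𝕀-cong B (λ k → trans (sym (𝕊-*ˡ B js _ _)) (trans (*-congʳ (F-node (suc i) k (ℕ.≤-trans l (ℕ.n≤1+n _))))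
           (solve 3 (λ a b c → a :* b :* c := b :* (a :* c)) refl _ _ _)))) (sym (𝕀-*ˡ B _ _))) ⟩
    Σ (suc n) (λ i → F (+ suc i) * 𝕊 B (suc i ∷ js) Ψ)
      ≈⟨ trans (Σ-suc n _) (+-congˡ (Σ-0 n (λ i l → trans (*-congˡ (𝕊-repeated B (suc (suc i)) js Ψ alt
           (≡.subst (_∈ js) (ℕ.+-comm i 2) (∈-range 2 n i l)))) (zeroʳ _)))) ⟩
    F (+ 1) * 𝕊 B (1 ∷ js) Ψ + 0#
      ≈⟨ +-identityʳ _ ⟩
    F (+ 1) * 𝕊 B (1 ∷ js) Ψ ∎)
    where js = range 2 n

  -- F paired with the odd polynomial v^(2s+1) Π (a² - v²), the part of Δ that contains the first
  -- variable. As the low moments vanish, only its top coefficients matter.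
  L̂ : ℕ → ℕ → List ℤ → Carrier
  L̂ B s as = residues B (λ v → F v * (oddpow s v * κ (diffs v as)))

  L̂-nil : ∀ B s → L̂ B s [] ≈ m̂ B s
  L̂-nil B s = residues-cong B (λ v → *-congˡ (*-identityʳ _))

  κ-diff : ∀ a v → κ (a ℤ.* a ℤ.- v ℤ.* v) ≈ κ (a ℤ.* a) + - (κ v * κ v)
  κ-diff a v = trans (κ-+ (a ℤ.* a) (ℤ.- (v ℤ.* v))) (+-congˡ (trans (κ-neg (v ℤ.* v)) (-‿cong (κ-* v v))))

  L̂-cons : ∀ B s a as → L̂ B s (a ∷ as) ≈ κ (a ℤ.* a) * L̂ B s as + - L̂ B (suc s) as
  L̂-cons B s a as = begin
    L̂ B s (a ∷ as)
      ≈⟨ residues-cong B (λ v → trans (*-congˡ (*-congˡ (trans (κ-* (a ℤ.* a ℤ.- v ℤ.* v) (diffs v as)) (*-congʳ (κ-diff a v)))))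
           (solve 5 (λ f a v p d → f :* (v :* p :* ((a :- v :* v) :* d)) := a :* (f :* (v :* p :* d)) :+ (:- con (+ 1)) :* (f :* (v :*
                (v :* v :* p) :* d))) refl
             (F v) (κ (a ℤ.* a)) (κ v) (pow (κ v * κ v) s) (κ (diffs v as)))) ⟩
    residues B (λ v → κ (a ℤ.* a) * (F v * (oddpow s v * κ (diffs v as))) + - 1# * (F v * (oddpow (suc s) v * κ (diffs v as))))
      ≈⟨ trans (residues-+ B _ _) (+-cong (sym (residues-*ˡ B _ _)) (sym (residues-*ˡ B _ _))) ⟩
    κ (a ℤ.* a) * L̂ B s as + - 1# * L̂ B (suc s) as
      ≈⟨ +-congˡ (solve 1 (λ x → (:- con (+ 1)) :* x := :- x) refl _) ⟩
    κ (a ℤ.* a) * L̂ B s as + - L̂ B (suc s) as ∎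

  module _ (B : ℕ) (low : ∀ s → s ℕ.< n → m̂ B s ≈ 0#) where

    L̂-low : ∀ s as → s ℕ.+ length as ℕ.< n → L̂ B s as ≈ 0#
    L̂-low s []       h = trans (L̂-nil B s) (low s (≡.subst (ℕ._< n) (ℕ.+-identityʳ s) h))
    L̂-low s (a ∷ as) h = trans (L̂-cons B s a as) (trans (+-cong
        (trans (*-congˡ (L̂-low s as (ℕ.≤-trans (s≤s (ℕ.+-monoʳ-≤ s (ℕ.n≤1+n _))) h))) (zeroʳ _))
        (trans (-‿cong (L̂-low (suc s) as (≡.subst (ℕ._< n) (ℕ.+-suc s _) h))) -0#≈0#)) (+-identityˡ _))

    L̂-top : ∀ s as → s ℕ.+ length as ≡ n → L̂ B s as ≈ sg (length as) * m̂ B n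
    L̂-top s []       h = trans (L̂-nil B s) (trans (reflexive (≡.cong (m̂ B) (≡.trans (≡.sym (ℕ.+-identityʳ s)) h))) (sym (*-identityˡ _)))
    L̂-top s (a ∷ as) h = trans (L̂-cons B s a as) (trans (+-cong
        (trans (*-congˡ (L̂-low s as (ℕ.≤-reflexive (≡.trans (≡.sym (ℕ.+-suc s _)) h)))) (zeroʳ _))
        (-‿cong (L̂-top (suc s) as (≡.trans (≡.sym (ℕ.+-suc s _)) h)))) (trans (+-identityˡ _) (-‿distribˡ-* _ _)))

    -- One step above the first nonzero moment two coefficients remain, (-1)^l and (-1)^(l-1) Σ a²,
    -- where l is the number of factors.
    L̂-next : ∀ s as → s ℕ.+ length as ≡ suc n → L̂ B s as ≈ sg (length as) * (m̂ B (suc n) + - (κ (squares as) * m̂ B n))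
    L̂-next s []       h = trans (L̂-nil B s) (trans (reflexive (≡.cong (m̂ B) (≡.trans (≡.sym (ℕ.+-identityʳ s)) h)))
        (solve 2 (λ a b → a := con (+ 1) :* (a :- con (+ 0) :* b)) refl _ _))
    L̂-next s (a ∷ as) h = begin
      L̂ B s (a ∷ as)
        ≈⟨ trans (L̂-cons B s a as) (+-cong (*-congˡ (L̂-top s as (ℕ.suc-injective h′))) (-‿cong (L̂-next (suc s) as h′))) ⟩
      κ (a ℤ.* a) * (sg (length as) * m̂ B n) + - (sg (length as) * (m̂ B (suc n) + - (κ (squares as) * m̂ B n)))
        ≈⟨ solve 5 (λ a s t x y → a :* (s :* t) :- s :* (x :- y :* t) := (:- s) :* (x :- (a :+ y) :* t)) refl _ _ _ _ _ ⟩
      - sg (length as) * (m̂ B (suc n) + - ((κ (a ℤ.* a) + κ (squares as)) * m̂ B n))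
        ≈⟨ *-congˡ (+-congˡ (-‿cong (*-congʳ (κ-+ (a ℤ.* a) (squares as))))) ⟨
      sg (length (a ∷ as)) * (m̂ B (suc n) + - (κ (squares (a ∷ as)) * m̂ B n)) ∎
      where
      h′ : suc s ℕ.+ length as ≡ suc n
      h′ = ≡.trans (≡.sym (ℕ.+-suc s _)) h

  -- The factor |v|² in Ψ₁ is the one that q d/dq produces in `𝕊-heat`.
  Ψ₀ Ψ₁ : List ℤ → Carrier
  Ψ₀ vs = κ (Δ vs)
  Ψ₁ vs = κ (squares vs) * κ (Δ vs)

  Ψ₀-alt : Alternating Ψ₀
  Ψ₀-alt xs v w ys = trans (reflexive (≡.cong κ (Δ-swap xs v w ys))) (κ-neg (Δ (xs ++ w ∷ v ∷ ys)))

  Ψ₁-alt : Alternating Ψ₁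
  Ψ₁-alt xs v w ys = trans (*-cong (reflexive (≡.cong κ (squares-swap xs v w ys))) (Ψ₀-alt xs v w ys)) (sym (-‿distribʳ-* _ _))

  Ψ₀-cons : ∀ v vs → Ψ₀ (v ∷ vs) ≈ κ v * κ (diffs v vs) * κ (Δ vs)
  Ψ₀-cons v vs = trans (κ-* (v ℤ.* diffs v vs) (Δ vs)) (*-congʳ (κ-* v (diffs v vs)))

  inner₀ : ∀ B vs → residues B (λ v → F v * Ψ₀ (v ∷ vs)) ≈ L̂ B 0 vs * κ (Δ vs)
  inner₀ B vs = trans (residues-cong B (λ v → trans (*-congˡ (Ψ₀-cons v vs))
      (solve 4 (λ f v d e → f :* (v :* d :* e) := e :* (f :* (v :* con (+ 1) :* d))) refl (F v) (κ v) (κ (diffs v vs)) (κ (Δ vs)))))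
    (trans (sym (residues-*ˡ B _ _)) (*-comm _ _))

  inner₁ : ∀ B vs → residues B (λ v → F v * Ψ₁ (v ∷ vs)) ≈ (L̂ B 1 vs + κ (squares vs) * L̂ B 0 vs) * κ (Δ vs)
  inner₁ B vs = begin
    residues B (λ v → F v * Ψ₁ (v ∷ vs))
      ≈⟨ residues-cong B (λ v → trans (*-congˡ (*-cong (trans (κ-+ (v ℤ.* v) (squares vs)) (+-congʳ (κ-* v v))) (Ψ₀-cons v vs)))
           (solve 5 (λ f v d e s → f :* ((v :* v :+ s) :* (v :* d :* e)) := e :* (f :* (v :* (v :* v :* con (+ 1)) :* d)) :+ (e :* s) :* (f :*
                (v :* con (+ 1) :* d))) refl
             (F v) (κ v) (κ (diffs v vs)) (κ (Δ vs)) (κ (squares vs)))) ⟩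
    residues B (λ v → κ (Δ vs) * (F v * (oddpow 1 v * κ (diffs v vs))) + (κ (Δ vs) * κ (squares vs)) * (F v * (oddpow 0 v * κ (diffs v vs))))
      ≈⟨ trans (residues-+ B _ _) (+-cong (sym (residues-*ˡ B _ _)) (sym (residues-*ˡ B _ _))) ⟩
    κ (Δ vs) * L̂ B 1 vs + (κ (Δ vs) * κ (squares vs)) * L̂ B 0 vs
      ≈⟨ solve 4 (λ e a s b → e :* a :+ e :* s :* b := (a :+ s :* b) :* e) refl _ _ _ _ ⟩
    (L̂ B 1 vs + κ (squares vs) * L̂ B 0 vs) * κ (Δ vs) ∎

  node-square : ∀ j k → j ℕ.≤ 𝕂 → κ (node j k ℤ.* node j k) ≈ κ (+ j ℤ.* + j) + κ (+ 4) * κℕ 𝕂 * κℕ (expo j k)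
  node-square j k l = begin
    κ (node j k ℤ.* node j k)                                       ≡⟨ ≡.cong κ (≡.trans (l₁ (+ j) (+ 𝕂) k) (≡.cong
         (λ t → + j ℤ.* + j ℤ.+ + 4 ℤ.* + 𝕂 ℤ.* t) (≡.sym (expo-ℤ j k l)))) ⟩
    κ (+ j ℤ.* + j ℤ.+ + 4 ℤ.* + 𝕂 ℤ.* + expo j k)                  ≈⟨ κ-+ (+ j ℤ.* + j) (+ 4 ℤ.* + 𝕂 ℤ.* + expo j k) ⟩
    κ (+ j ℤ.* + j) + κ (+ 4 ℤ.* + 𝕂 ℤ.* + expo j k)                ≈⟨ +-congˡ (trans (κ-* (+ 4 ℤ.* + 𝕂) (+ expo j k)) (*-congʳ (κ-* (+ 4) (+ 𝕂)))) ⟩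
    κ (+ j ℤ.* + j) + κ (+ 4) * κℕ 𝕂 * κℕ (expo j k)                ∎
    where
    l₁ : ∀ j K k → (j ℤ.+ + 2 ℤ.* K ℤ.* k) ℤ.* (j ℤ.+ + 2 ℤ.* K ℤ.* k) ≡ j ℤ.* j ℤ.+ + 4 ℤ.* K ℤ.* (k ℤ.* (j ℤ.+ K ℤ.* k))
    l₁ = solve-∀

  -- At the points of the sum |v|² is |js|² plus 4(n+2) times the exponent of q, and q d/dq brings
  -- that exponent down.
  𝕊-heat : ∀ B js Ψ → All (ℕ._< 𝕂) js → (∀ vs → D (Ψ vs) ≈ 0#) →
    𝕊 B js (λ vs → κ (squares vs) * Ψ vs) ≈ κ (+ 4) * κℕ 𝕂 * D (𝕊 B js Ψ) + κ (squares (map +_ js)) * 𝕊 B js Ψ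
  𝕊-heat B []       Ψ []       dΨ = sym (trans (+-congʳ (trans (*-congˡ (dΨ [])) (zeroʳ _))) (+-identityˡ _))
  𝕊-heat B (j ∷ js) Ψ (l ∷ ls) dΨ = sym (begin
    c * D (𝕀 B (λ k → q^ (expo j k) * S k)) + κ (+ j ℤ.* + j ℤ.+ squares (map +_ js)) * 𝕀 B (λ k → q^ (expo j k) * S k)
      ≈⟨ +-cong (*-congˡ (D-𝕀 B _)) (*-congʳ (κ-+ (+ j ℤ.* + j) (squares (map +_ js)))) ⟩
    c * 𝕀 B (λ k → D (q^ (expo j k) * S k)) + (κ (+ j ℤ.* + j) + κ (squares (map +_ js))) * 𝕀 B (λ k → q^ (expo j k) * S k)
      ≈⟨ trans (+-cong (𝕀-*ˡ B _ _) (𝕀-*ˡ B _ _)) (sym (𝕀-+ B _ _)) ⟩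
    𝕀 B (λ k → c * D (q^ (expo j k) * S k) + (κ (+ j ℤ.* + j) + κ (squares (map +_ js))) * (q^ (expo j k) * S k))
      ≈⟨ 𝕀-cong B term≈ ⟩
    𝕀 B (λ k → q^ (expo j k) * 𝕊 B js (λ vs → κ (squares (node j k ∷ vs)) * Ψ (node j k ∷ vs))) ∎)
    where
    c : Carrier
    c = κ (+ 4) * κℕ 𝕂
    S : ℤ → Carrier
    S k = 𝕊 B js (λ vs → Ψ (node j k ∷ vs))
    term≈ : ∀ k → c * D (q^ (expo j k) * S k) + (κ (+ j ℤ.* + j) + κ (squares (map +_ js))) * (q^ (expo j k) * S k)
      ≈ q^ (expo j k) * 𝕊 B js (λ vs → κ (squares (node j k ∷ vs)) * Ψ (node j k ∷ vs))
    term≈ k = begin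
      c * D (q^ (expo j k) * S k) + (κ (+ j ℤ.* + j) + κ (squares (map +_ js))) * (q^ (expo j k) * S k)
        ≈⟨ +-congʳ (*-congˡ (trans (D-* _ _) (+-congʳ (*-congʳ (D-q^ (expo j k)))))) ⟩
      c * (κℕ (expo j k) * q^ (expo j k) * S k + q^ (expo j k) * D (S k)) + (κ (+ j ℤ.* + j) + κ (squares (map +_ js))) * (q^ (expo j k) * S k)
        ≈⟨ solve 7 (λ c e q s d a b → c :* (e :* q :* s :+ q :* d) :+ (a :+ b) :* (q :* s) := q :* ((a :+ c :* e) :* s :+ (c :* d :+ b :* s))) refl
             c (κℕ (expo j k)) (q^ (expo j k)) (S k) (D (S k)) (κ (+ j ℤ.* + j)) (κ (squares (map +_ js))) ⟩
      q^ (expo j k) * ((κ (+ j ℤ.* + j) + c * κℕ (expo j k)) * S k + (c * D (S k) + κ (squares (map +_ js)) * S k))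
        ≈⟨ *-congˡ (+-cong (*-congʳ (sym (node-square j k (ℕ.<⇒≤ l)))) (sym (𝕊-heat B js (λ vs → Ψ (node j k ∷ vs)) ls (λ vs → dΨ _)))) ⟩
      q^ (expo j k) * (κ (node j k ℤ.* node j k) * S k + 𝕊 B js (λ vs → κ (squares vs) * Ψ (node j k ∷ vs)))
        ≈⟨ *-congˡ (trans (+-congʳ (𝕊-*ˡ B js _ _)) (trans (sym (𝕊-+ B js _ _)) (𝕊-cong B js (λ vs _ →
             trans (sym (distribʳ _ _ _)) (*-congʳ (sym (κ-+ (node j k ℤ.* node j k) (squares vs)))))))) ⟩
      q^ (expo j k) * 𝕊 B js (λ vs → κ (squares (node j k ∷ vs)) * Ψ (node j k ∷ vs)) ∎

  ε-κℕ : ∀ m → ε (κℕ m) ≈ κℕ m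
  ε-κℕ zero    = begin
    ε 0#                   ≈⟨ solve 1 (λ x → x := x :+ x :- x) refl _ ⟩
    ε 0# + ε 0# + - ε 0#   ≈⟨ +-congʳ (ε-+ 0# 0#) ⟨
    ε (0# + 0#) + - ε 0#   ≈⟨ +-congʳ (ε-cong (+-identityˡ 0#)) ⟩
    ε 0# + - ε 0#          ≈⟨ -‿inverseʳ _ ⟩
    0#                     ∎
  ε-κℕ (suc m) = trans (ε-cong (κℕ-suc m)) (trans (ε-+ _ _) (trans (+-cong ε-1 (ε-κℕ m)) (sym (κℕ-suc m))))

  ε-neg : ∀ x → ε (- x) ≈ - ε x
  ε-neg x = begin
    ε (- x)                     ≈⟨ solve 2 (λ a b → a := b :+ a :- b) refl _ (ε x) ⟩
    ε x + ε (- x) + - ε x       ≈⟨ +-congʳ (trans (sym (ε-+ x (- x))) (trans (ε-cong (-‿inverseʳ x)) (ε-κℕ 0))) ⟩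
    0# + - ε x                  ≈⟨ +-identityˡ _ ⟩
    - ε x                       ∎

  ε-κ : ∀ z → ε (κ z) ≈ κ z
  ε-κ (+ m)    = ε-κℕ m
  ε-κ -[1+ m ] = trans (ε-neg _) (-‿cong (ε-κℕ (suc m)))

  ε-sg : ∀ m → ε (sg m) ≈ sg m
  ε-sg zero    = ε-1
  ε-sg (suc m) = trans (ε-neg _) (-‿cong (ε-sg m))

  ε-pow : ∀ x m → ε (pow x m) ≈ pow (ε x) m
  ε-pow x zero    = ε-1
  ε-pow x (suc m) = trans (ε-* _ _) (*-congˡ (ε-pow x m))

  ε-q^ : ∀ m → ε (q^ suc m) ≈ 0#
  ε-q^ m = trans (ε-cong (q^suc m)) (trans (ε-* _ _) (trans (*-congʳ ε-q) (zeroˡ _)))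

  ε-p : ∀ m → ε (p m) ≈ 1#
  ε-p zero    = ε-1
  ε-p (suc m) = trans (ε-* _ _) (trans (*-cong (ε-p m) (trans (ε-+ _ _) (trans (+-cong ε-1 (trans (ε-neg _) (trans (-‿cong (ε-q^ m)) -0#≈0#)))
       (+-identityʳ _)))) (*-identityʳ _))

  pow-1 : ∀ m → pow 1# m ≈ 1#
  pow-1 zero    = refl
  pow-1 (suc m) = trans (*-identityˡ _) (pow-1 m)

  opaque
    unfolding 𝕀
    ε-𝕀 : ∀ C g → ε (𝕀 C g) ≈ 𝕀 C (λ x → ε (g x))
    ε-𝕀 zero    g = refl
    ε-𝕀 (suc C) g = trans (ε-+ _ _) (+-cong (ε-𝕀 C g) (ε-+ _ _))

  expo-pos : ∀ j k → j ℕ.< 𝕂 → 0 ℕ.< ℤ.∣ k ∣ → ∃[ e ] expo j k ≡ suc e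
  expo-pos j (+ suc m) l _ = _ , ≡.cong (λ t → t ℕ.+ m ℕ.* (j ℕ.+ 𝕂 ℕ.* suc m)) (ℕ.+-suc j _)
  expo-pos j -[1+ m ]  l _ = _ , ≡.cong (suc m ℕ.*_) (ℕ.+-∸-assoc 1 {𝕂 ℕ.* suc m ℕ.∸ 1} {j}
    (ℕ.≤-pred (ℕ.≤-trans l (ℕ.≤-trans (ℕ.m≤m+n 𝕂 (𝕂 ℕ.* m)) (ℕ.≤-reflexive (≡.sym (ℕ.*-suc 𝕂 m)))))))

  -- Only the point with all k = 0 has exponent 0. The strict bound j < n + 2 matters: at j = n + 2
  -- the exponent is 0 for k = -1 as well.
  ε-𝕊 : ∀ B js Ψ → All (ℕ._< 𝕂) js → ε (𝕊 B js Ψ) ≈ ε (Ψ (map +_ js))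
  ε-𝕊 B []       Ψ []       = refl
  ε-𝕊 B (j ∷ js) Ψ (l ∷ ls) = begin
    ε (𝕀 B (λ k → q^ (expo j k) * 𝕊 B js (λ vs → Ψ (node j k ∷ vs))))
      ≈⟨ trans (ε-𝕀 B _) (𝕀-cong B (λ k → ε-* _ _)) ⟩
    𝕀 B (λ k → ε (q^ (expo j k)) * ε (𝕊 B js (λ vs → Ψ (node j k ∷ vs))))
      ≈⟨ trans (𝕀-ext van z≤n) (𝕀-zero _) ⟩
    ε (q^ 0) * ε (𝕊 B js (λ vs → Ψ (node j (+ 0) ∷ vs)))
      ≈⟨ trans (*-congʳ (trans (ε-cong q^0) ε-1)) (*-identityˡ _) ⟩
    ε (𝕊 B js (λ vs → Ψ (node j (+ 0) ∷ vs)))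
      ≈⟨ ε-𝕊 B js _ ls ⟩
    ε (Ψ (node j (+ 0) ∷ map +_ js))
      ≡⟨ ≡.cong (λ t → ε (Ψ (t ∷ map +_ js))) (≡.trans (≡.cong (λ t → + j ℤ.+ t) (ℤ.*-zeroʳ τ)) (ℤ.+-identityʳ (+ j))) ⟩
    ε (Ψ (+ j ∷ map +_ js)) ∎
    where
    van : Van 0 (λ k → ε (q^ (expo j k)) * ε (𝕊 B js (λ vs → Ψ (node j k ∷ vs))))
    van k h with expo-pos j k l h
    ... | e , eq = trans (*-congʳ (trans (ε-cong (q≡ eq)) (ε-q^ e))) (zeroˡ _)

-- The differential equation and the evaluation of the sum.

module Value (Q : QRing) (n : ℕ) where
  open BoxSums Q n public

  Unit : Carrier → Set
  Unit x = ∃[ y ] x * y ≈ 1#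

  unit-κ : ∀ z → z ≢ + 0 → Unit (κ z)
  unit-κ = κ-inv

  unit-* : ∀ {x y} → Unit x → Unit y → Unit (x * y)
  unit-* (a , ea) (b , eb) = a * b , trans (solve 4 (λ x y a b → x :* y :* (a :* b) := x :* a :* (y :* b)) refl _ _ _ _) (trans (*-cong ea eb)
       (*-identityˡ _))

  unit-pow : ∀ {x} → Unit x → ∀ m → Unit (pow x m)
  unit-pow h zero    = 1# , *-identityˡ _
  unit-pow h (suc m) = unit-* h (unit-pow h m)

  cancel : ∀ {a x y} → Unit a → a * x ≈ a * y → x ≈ y
  cancel (_ , h) = *-cancel-unit h

  unit-p : Unit (p N)
  unit-p = u N , p-u N

  unit-sg : ∀ m → Unit (sg m)
  unit-sg m = sg m , sg² m

  unit-cong : ∀ {x y} → x ≈ y → Unit x → Unit y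
  unit-cong e (a , h) = a , trans (*-congʳ (sym e)) h

  -- d is the dimension of the Lie algebra of type C_{n+1}.
  M₂ d : ℕ
  M₂ = n ℕ.+ n
  d = suc n ℕ.* suc (suc (suc M₂))

  f! : ℕ
  f! = suc M₂ !

  reach≤ : reach M₂ ℕ.≤ 𝔼
  reach≤ = ℕ.m≤m+n _ _

  τ-unit : ∀ m → Unit (pow (κ (+ 2)) m)
  τ-unit = unit-pow (unit-κ (+ 2) (λ ()))

  m̂-low : ∀ B → 𝔼 ℕ.≤ B → ∀ s → s ℕ.< n → m̂ B s ≈ 0#
  m̂-low B hB s l = cancel (τ-unit (2 ℕ.+ (s ℕ.+ s))) (trans (m̂-mom B s hB)
    (trans (mom-low 𝔼 M₂ reach≤ (suc (s ℕ.+ s)) (ℕ.+-mono-≤ l (ℕ.<⇒≤ l))) (sym (zeroʳ _))))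

  m̂-top : ∀ B → 𝔼 ℕ.≤ B → m̂ B n ≈ - (κℕ f! * pow p³ (suc M₂))
  m̂-top B hB = cancel (τ-unit (2 ℕ.+ M₂)) (trans (m̂-mom B n hB) (trans (mom-leading 𝔼 M₂ reach≤) (-‿distribʳ-* _ _)))

  S : Carrier
  S = κ (squares (nodes 1 (suc n)))

  -- The strange formula of Freudenthal and de Vries for C_(n+1): S is |ρ|² for ρ = (1, ..., n+1),
  -- and n + 2 is the dual Coxeter number. It is the reason why the dimension d appears as the
  -- exponent in W.
  24S : κ (+ 24) * S ≈ κ (+ 4) * κℕ 𝕂 * κℕ d
  24S = begin
    κ (+ 24) * S                             ≈⟨ κ-* (+ 24) (squares (nodes 1 (suc n))) ⟨
    κ (+ 24 ℤ.* squares (nodes 1 (suc n)))   ≡⟨ ≡.cong κ e ⟩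
    κ (+ 4 ℤ.* + 𝕂 ℤ.* + d)                  ≈⟨ trans (κ-* (+ 4 ℤ.* + 𝕂) (+ d)) (*-congʳ (κ-* (+ 4) (+ 𝕂))) ⟩
    κ (+ 4) * κℕ 𝕂 * κℕ d                    ∎
    where
    l₁ : ∀ n → + 4 ℤ.* ((+ 1 ℤ.+ n) ℤ.* (+ 6 ℤ.* (+ 1 ℤ.* + 1) ℤ.+ + 6 ℤ.* + 1 ℤ.* (+ 1 ℤ.+ n ℤ.- + 1) ℤ.+ (+ 1 ℤ.+ n ℤ.- + 1) ℤ.* (+ 2 ℤ.*
         (+ 1 ℤ.+ n) ℤ.- + 1)))
      ≡ + 4 ℤ.* (+ 2 ℤ.+ n) ℤ.* ((+ 1 ℤ.+ n) ℤ.* (+ 3 ℤ.+ (n ℤ.+ n)))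
    l₁ = solve-∀
    e : + 24 ℤ.* squares (nodes 1 (suc n)) ≡ + 4 ℤ.* + 𝕂 ℤ.* + d
    e = ≡.trans (ℤ.*-assoc (+ 4) (+ 6) (squares (nodes 1 (suc n)))) (≡.trans (≡.cong (+ 4 ℤ.*_) (squares-range 1 (suc n)))
      (≡.trans (l₁ (+ n)) (≡.cong (+ 4 ℤ.* + 𝕂 ℤ.*_) (≡.sym (ℤ.pos-* (suc n) (suc (suc (suc M₂))))))))

  -- At M = 2n the coefficient (2n+2)(2n+3)(2n+4) of `mom-third` is 24 S; the powers of 2 from
  -- `m̂-mom` turn its factor 6 into 24 too.
  moment-ratio : ∀ B → 𝔼 ℕ.≤ B → μ 1 * m̂ B (suc n) ≈ S * (μ 3 * m̂ B n)
  moment-ratio B hB = cancel (unit-* (unit-κ (+ 24) (λ ())) (τ-unit (2 ℕ.+ M₂))) (begin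
    κ (+ 24) * c * (μ 1 * m̂ B (suc n))
      ≈⟨ solve 3 (λ c m t → con (+ 24) :* c :* (m :* t) := con (+ 6) :* m :* ((con (+ 2) :* (con (+ 2) :* c)) :* t)) refl _ _ _ ⟩
    κ (+ 6) * μ 1 * (pow (κ (+ 2)) (4 ℕ.+ M₂) * m̂ B (suc n))
      ≈⟨ *-congˡ third ⟩
    κ (+ 6) * μ 1 * mom 𝔼 M₂ (3 ℕ.+ M₂)
      ≈⟨ mom-third 𝔼 M₂ reach≤ ⟩
    κℕ ((2 ℕ.+ M₂) ℕ.* (3 ℕ.+ M₂) ℕ.* (4 ℕ.+ M₂)) * (μ 3 * mom 𝔼 M₂ (suc M₂))
      ≈⟨ *-cong num (*-congˡ (sym (m̂-mom B n hB))) ⟩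
    κ (+ 24) * S * (μ 3 * (c * m̂ B n))
      ≈⟨ solve 5 (λ k s m c t → k :* s :* (m :* (c :* t)) := k :* c :* (s :* (m :* t))) refl _ _ _ _ _ ⟩
    κ (+ 24) * c * (S * (μ 3 * m̂ B n)) ∎)
    where
    c : Carrier
    c = pow (κ (+ 2)) (2 ℕ.+ M₂)
    third : pow (κ (+ 2)) (4 ℕ.+ M₂) * m̂ B (suc n) ≈ mom 𝔼 M₂ (3 ℕ.+ M₂)
    third = trans (*-congʳ (reflexive (≡.cong (λ t → pow (κ (+ 2)) (3 ℕ.+ t)) (≡.sym (ℕ.+-suc n n)))))
      (trans (m̂-mom B (suc n) hB) (reflexive (≡.cong (λ t → mom 𝔼 M₂ (suc (suc t))) (ℕ.+-suc n n))))
    l₁ : ∀ n → (2 ℕ.+ (n ℕ.+ n)) ℕ.* (3 ℕ.+ (n ℕ.+ n)) ℕ.* (4 ℕ.+ (n ℕ.+ n)) ≡ 4 ℕ.* (2 ℕ.+ n) ℕ.* ((1 ℕ.+ n) ℕ.* (3 ℕ.+ (n ℕ.+ n)))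
    l₁ = solveℕ-∀
    num : κℕ ((2 ℕ.+ M₂) ℕ.* (3 ℕ.+ M₂) ℕ.* (4 ℕ.+ M₂)) ≈ κ (+ 24) * S
    num = trans (reflexive (≡.cong κℕ (l₁ n))) (trans (trans (κℕ-* (4 ℕ.* 𝕂) d) (*-congʳ (κℕ-* 4 𝕂))) (sym 24S))

  D-pow : ∀ x m → x * D (pow x m) ≈ κℕ m * (pow x m * D x)
  D-pow x zero    = trans (*-congˡ D-1) (trans (zeroʳ _) (sym (zeroˡ _)))
  D-pow x (suc m) = begin
    x * D (x * pow x m)                                    ≈⟨ *-congˡ (D-* x (pow x m)) ⟩
    x * (D x * pow x m + x * D (pow x m))                  ≈⟨ *-congˡ (+-congˡ (D-pow x m)) ⟩
    x * (D x * pow x m + κℕ m * (pow x m * D x))           ≈⟨ solve 4 (λ x d y k → x :* (d :* y :+ k :* (y :* d)) := (con (+ 1) :+ k) :*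
         (x :* y :* d)) refl _ _ _ _ ⟩
    (1# + κℕ m) * (x * pow x m * D x)                      ≈⟨ *-congʳ (κℕ-suc m) ⟨
    κℕ (suc m) * (pow x (suc m) * D x)                     ∎

  D-u : D (u N) ≈ - (u N * u N * D (p N))
  D-u = cancel unit-p (begin
    p N * D (u N)                          ≈⟨ solve 2 (λ a b → b := :- (a) :+ (a :+ b)) refl (D (p N) * u N) (p N * D (u N)) ⟩
    - (D (p N) * u N) + (D (p N) * u N + p N * D (u N))
      ≈⟨ +-congˡ (trans (sym (D-* (p N) (u N))) (trans (D-cong (p-u N)) D-1)) ⟩
    - (D (p N) * u N) + 0#                 ≈⟨ +-identityʳ _ ⟩
    - (D (p N) * u N)                      ≈⟨ -‿cong (trans (*-congˡ (sym (*-identityˡ _))) (*-congˡ (*-congʳ (sym (p-u N))))) ⟩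
    - (D (p N) * (p N * u N * u N))        ≈⟨ solve 3 (λ d p u → :- (d :* (p :* u :* u)) := p :* (:- (u :* u :* d))) refl _ _ _ ⟩
    p N * - (u N * u N * D (p N))          ∎)

  pow-pu : ∀ m → pow (p N) m * pow (u N) m ≈ 1#
  pow-pu m = trans (sym (pow-* _ _ m)) (trans (pow-cong m (p-u N)) (pow-1 m))

  pow-cube : ∀ m → pow p³ m ≈ pow (p N) (m ℕ.+ m ℕ.+ m)
  pow-cube m = trans (pow-* (p N * p N) (p N) m) (trans (*-congʳ (pow-* (p N) (p N) m)) (sym (trans (pow-+ (p N) (m ℕ.+ m) m) (*-congʳ (pow-+
       (p N) m m)))))

  module AtBox (B : ℕ) (hB : 𝔼 ℕ.≤ B) where

    W V t t′ C : Carrier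
    W  = 𝕊 B (range 1 (suc n)) Ψ₀
    V  = 𝕊 B (range 2 n) Ψ₀
    t  = m̂ B n
    t′ = m̂ B (suc n)
    C  = F (+ 1)

    low : ∀ s → s ℕ.< n → m̂ B s ≈ 0#
    low = m̂-low B hB

    -- After `cramer` the inner sum pairs F with a polynomial of degree 2n + 1, of which `L̂-top`
    -- leaves (-1)^n t, a constant in the other variables.
    relation₀ : C * W ≈ sg n * t * V
    relation₀ = begin
      C * W
        ≈⟨ cramer B Ψ₀ Ψ₀-alt ⟩
      𝕊 B (range 2 n) (λ vs → residues B (λ v → F v * Ψ₀ (v ∷ vs)))
        ≈⟨ 𝕊-cong B (range 2 n) (λ vs e → let e′ = ≡.trans e (length-range 2 n) in
             trans (inner₀ B vs) (*-congʳ (trans (L̂-top B low 0 vs e′) (*-congʳ (reflexive (≡.cong sg e′)))))) ⟩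
      𝕊 B (range 2 n) (λ vs → sg n * t * κ (Δ vs))
        ≈⟨ 𝕊-*ˡ B (range 2 n) _ _ ⟨
      sg n * t * V ∎

    -- The weight |v|² consists of the square of the first variable and of |vs|²; the latter cancels
    -- the correction term of `L̂-next`, so that t′ takes the place of t.
    relation₁ : C * 𝕊 B (range 1 (suc n)) Ψ₁ ≈ sg n * t′ * V
    relation₁ = begin
      C * 𝕊 B (range 1 (suc n)) Ψ₁
        ≈⟨ cramer B Ψ₁ Ψ₁-alt ⟩
      𝕊 B (range 2 n) (λ vs → residues B (λ v → F v * Ψ₁ (v ∷ vs)))
        ≈⟨ 𝕊-cong B (range 2 n) (λ vs e → let e′ = ≡.trans e (length-range 2 n) in
             trans (inner₁ B vs) (*-congʳ (trans (+-cong (L̂-next B low 1 vs (≡.cong suc e′)) (*-congˡ (L̂-top B low 0 vs e′)))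
               (trans (solve 4 (λ s a y b → s :* (a :- y :* b) :+ y :* (s :* b) := s :* a) refl _ _ _ _) (*-congʳ (reflexive (≡.cong sg e′))))))) ⟩
      𝕊 B (range 2 n) (λ vs → sg n * t′ * κ (Δ vs))
        ≈⟨ 𝕊-*ˡ B (range 2 n) _ _ ⟨
      sg n * t′ * V ∎

    heat-W : 𝕊 B (range 1 (suc n)) Ψ₁ ≈ κ (+ 4) * κℕ 𝕂 * D W + S * W
    heat-W = 𝕊-heat B (range 1 (suc n)) Ψ₀ (range-All 1 (suc n) ℕ.≤-refl) (λ vs → D-κ (Δ vs))

    unit-t : Unit t
    unit-t = unit-cong (sym (m̂-top B hB)) (unit-cong (solve 1 (λ x → (:- con (+ 1)) :* x := :- x) refl _)
      (unit-* (sg 1 , sg² 1) (unit-* (unit-κ (+ f!) (!-≢0 (suc M₂))) (unit-pow unit-p³ (suc M₂)))))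
      where
      unit-p³ : Unit p³
      unit-p³ = unit-* (unit-* unit-p unit-p) unit-p

    ε-t : ε t ≈ - κℕ f!
    ε-t = begin
      ε t                                        ≈⟨ trans (ε-cong (m̂-top B hB)) (ε-neg _) ⟩
      - ε (κℕ f! * pow p³ (suc M₂))              ≈⟨ -‿cong (trans (ε-* _ _) (*-cong (ε-κℕ f!) (trans (ε-pow p³ (suc M₂)) (trans (pow-cong
           (suc M₂) ε-p³) (pow-1 (suc M₂)))))) ⟩
      - (κℕ f! * 1#)                             ≈⟨ -‿cong (*-identityʳ _) ⟩
      - κℕ f!                                    ∎
      where
      ε-p³ : ε p³ ≈ 1#
      ε-p³ = trans (ε-* _ _) (trans (*-cong (trans (ε-* _ _) (*-cong (ε-p N) (ε-p N))) (ε-p N)) (trans (*-identityʳ _) (*-identityʳ _)))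

    ε-V : ε V ≈ κ (Δ (nodes 2 n))
    ε-V = trans (ε-𝕊 B (range 2 n) Ψ₀ (range-All 2 n ℕ.≤-refl)) (ε-κ (Δ (nodes 2 n)))

    -- By `relation₀` the constant term of C divides that of t V, which is (2n+1)! Δ(2, ..., n+1) up
    -- to sign and hence invertible.
    C-regular : ∀ {z} → C * z ≈ 0# → z ≈ 0#
    C-regular = ε-unit (begin
      ε C * (ε W * (- sg n * y))
        ≈⟨ solve 4 (λ c w s y → c :* (w :* ((:- s) :* y)) := (c :* w) :* ((:- s) :* y)) refl _ _ _ _ ⟩
      ε C * ε W * (- sg n * y)
        ≈⟨ *-congʳ (trans (sym (ε-* C W)) (trans (ε-cong relation₀) (trans (ε-* _ _) (*-cong (trans (ε-* _ _) (*-cong (ε-sg n) ε-t)) ε-V)))) ⟩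
      sg n * - κℕ f! * κ (Δ (nodes 2 n)) * (- sg n * y)
        ≈⟨ solve 4 (λ s f v y → s :* (:- f) :* v :* ((:- s) :* y) := s :* s :* (f :* v :* y)) refl _ _ _ _ ⟩
      sg n * sg n * (κℕ f! * κ (Δ (nodes 2 n)) * y)
        ≈⟨ trans (*-cong (sg² n) (proj₂ inv)) (*-identityˡ _) ⟩
      1# ∎)
      where
      inv : Unit (κℕ f! * κ (Δ (nodes 2 n)))
      inv = unit-* (unit-κ (+ f!) (!-≢0 (suc M₂))) (unit-κ _ (Δ-≢0 1 n))
      y : Carrier
      y = proj₁ inv

    cancel-C : ∀ {x y} → C * x ≈ C * y → x ≈ y
    cancel-C {x} {y} e = begin
      x              ≈⟨ solve 2 (λ x y → x := x :- y :+ y) refl x y ⟩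
      x + - y + y    ≈⟨ +-congʳ (C-regular (trans (distribˡ _ _ _) (trans (+-cong e (sym (-‿distribʳ-* _ _))) (-‿inverseʳ _)))) ⟩
      0# + y         ≈⟨ +-identityˡ y ⟩
      y              ∎

    -- Dividing the two relations and using `moment-ratio` gives `balance`. There `heat` cancels the
    -- terms with S W, and μ 1 = -2 (q)_∞^3 has three times the logarithmic derivative of (q)_∞. The
    -- resulting factor 8 · 3 S is 4(n+2) d by `24S`.
    ode : p N * D W ≈ κℕ d * (D (p N) * W)
    ode = cancel (unit-* (unit-* (unit-* unit-p unit-p) (unit-κ (+ 24) (λ ()))) (unit-κ (+ 𝕂) (λ ()))) (begin
      p N * p N * κ (+ 24) * κℕ 𝕂 * (p N * D W)
        ≈⟨ solve 3 (λ p k w → p :* p :* con (+ 24) :* k :* (p :* w) := con (-[1+ 2 ]) :* ((:- (con (+ 2) :* (p :* p :* p))) :* (con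
             (+ 4) :* k :* w))) refl _ _ _ ⟩
      κ -[1+ 2 ] * (- (κ (+ 2) * p³) * (κ (+ 4) * κℕ 𝕂 * D W))
        ≈⟨ *-congˡ (trans (*-congʳ (sym μ₁)) first) ⟩
      κ -[1+ 2 ] * (κ (+ 8) * S * (D (μ 1) * W))
        ≈⟨ *-congˡ (*-congˡ (*-congʳ Dμ)) ⟩
      κ -[1+ 2 ] * (κ (+ 8) * S * (- (κ (+ 6) * (p N * p N * D (p N))) * W))
        ≈⟨ solve 4 (λ s p q w → con (-[1+ 2 ]) :* (con (+ 8) :* s :* ((:- (con (+ 6) :* (p :* p :* q))) :* w)) := con (+ 24) :* s :* (con
             (+ 6) :* (p :* p :* (q :* w)))) refl _ _ _ _ ⟩
      κ (+ 24) * S * (κ (+ 6) * (p N * p N * (D (p N) * W)))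
        ≈⟨ *-congʳ 24S ⟩
      κ (+ 4) * κℕ 𝕂 * κℕ d * (κ (+ 6) * (p N * p N * (D (p N) * W)))
        ≈⟨ solve 4 (λ k d p x → con (+ 4) :* k :* d :* (con (+ 6) :* (p :* p :* x)) := p :* p :* con (+ 24) :* k :* (d :* x)) refl _ _ _ _ ⟩
      p N * p N * κ (+ 24) * κℕ 𝕂 * (κℕ d * (D (p N) * W)) ∎)
      where
      K = κ (+ 4) * κℕ 𝕂
      Dμ : D (μ 1) ≈ - (κ (+ 6) * (p N * p N * D (p N)))
      Dμ = begin
        D (μ 1)                      ≈⟨ trans (D-cong μ₁) (trans (D-neg _) (-‿cong (D-* _ _))) ⟩
        - (D (κ (+ 2)) * p³ + κ (+ 2) * D p³)
          ≈⟨ -‿cong (+-cong (*-congʳ (D-κ (+ 2))) (*-congˡ (trans (D-* _ _) (+-congʳ (*-congʳ (D-* _ _)))))) ⟩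
        - (0# * p³ + κ (+ 2) * ((D (p N) * p N + p N * D (p N)) * p N + p N * p N * D (p N)))
          ≈⟨ solve 2 (λ p q → :- (con (+ 0) :* (p :* p :* p) :+ con (+ 2) :* ((q :* p :+ p :* q) :* p :+ p :* p :* q)) := :- (con (+ 6) :*
               (p :* p :* q))) refl _ _ ⟩
        - (κ (+ 6) * (p N * p N * D (p N))) ∎
      balance : μ 1 * (K * D W + S * W) ≈ S * (μ 3 * W)
      balance = cancel unit-t (cancel-C (begin
        C * (t * (μ 1 * (K * D W + S * W)))
          ≈⟨ solve 4 (λ c t m x → c :* (t :* (m :* x)) := t :* m :* (c :* x)) refl _ _ _ _ ⟩
        t * μ 1 * (C * (K * D W + S * W))
          ≈⟨ *-congˡ (trans (*-congˡ (sym heat-W)) relation₁) ⟩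
        t * μ 1 * (sg n * t′ * V)
          ≈⟨ solve 5 (λ t m s t′ v → t :* m :* (s :* t′ :* v) := (m :* t′) :* (s :* t :* v)) refl _ _ _ _ _ ⟩
        μ 1 * t′ * (sg n * t * V)
          ≈⟨ *-cong (moment-ratio B hB) (sym relation₀) ⟩
        S * (μ 3 * t) * (C * W)
          ≈⟨ solve 5 (λ s m t c w → s :* (m :* t) :* (c :* w) := c :* (t :* (s :* (m :* w)))) refl _ _ _ _ _ ⟩
        C * (t * (S * (μ 3 * W))) ∎))
      first : μ 1 * (K * D W) ≈ κ (+ 8) * S * (D (μ 1) * W)
      first = begin
        μ 1 * (K * D W)
          ≈⟨ solve 3 (λ m x y → m :* x := m :* (x :+ y) :- m :* y) refl (μ 1) (K * D W) (S * W) ⟩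
        μ 1 * (K * D W + S * W) + - (μ 1 * (S * W))
          ≈⟨ +-congʳ (trans balance (*-congˡ (*-congʳ heat))) ⟩
        S * ((κ (+ 8) * D (μ 1) + μ 1) * W) + - (μ 1 * (S * W))
          ≈⟨ solve 4 (λ s q m w → s :* ((con (+ 8) :* q :+ m) :* w) :- m :* (s :* w) := con (+ 8) :* s :* (q :* w)) refl _ _ _ _ ⟩
        κ (+ 8) * S * (D (μ 1) * W) ∎

    -- W divided by (q)_∞^d is killed by q d/dq, hence equal to its constant term.
    W-value : W ≈ κ (Δ (nodes 1 (suc n))) * pow (p N) d
    W-value = begin
      W                                     ≈⟨ trans (sym (*-identityʳ _)) (*-congˡ (trans (sym (pow-pu d)) (*-comm _ _))) ⟩
      W * (pow (u N) d * pow (p N) d)       ≈⟨ *-assoc _ _ _ ⟨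
      Z * pow (p N) d                       ≈⟨ *-congʳ (trans (D-ker DZ) ε-Z) ⟩
      κ (Δ (nodes 1 (suc n))) * pow (p N) d ∎
      where
      Z : Carrier
      Z = W * pow (u N) d
      DZ : D Z ≈ 0#
      DZ = cancel (p N , trans (*-comm _ _) (p-u N)) (begin
        u N * D Z
          ≈⟨ *-congˡ (D-* W (pow (u N) d)) ⟩
        u N * (D W * pow (u N) d + W * D (pow (u N) d))
          ≈⟨ solve 5 (λ u a x w b → u :* (a :* x :+ w :* b) := x :* (u :* a) :+ w :* (u :* b)) refl _ _ _ _ _ ⟩
        pow (u N) d * (u N * D W) + W * (u N * D (pow (u N) d))
          ≈⟨ +-cong (*-congˡ (*-congʳ (trans (sym (*-identityˡ _)) (*-congʳ (sym (p-u N)))))) (*-congˡ (trans (D-pow (u N) d) (*-congˡ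
               (*-congˡ D-u)))) ⟩
        pow (u N) d * (p N * u N * u N * D W) + W * (κℕ d * (pow (u N) d * - (u N * u N * D (p N))))
          ≈⟨ solve 7 (λ x p u a w k b → x :* (p :* u :* u :* a) :+ w :* (k :* (x :* (:- (u :* u :* b)))) := x :* u :* u :* (p :* a :- k :*
               (b :* w))) refl _ _ _ _ _ _ _ ⟩
        pow (u N) d * u N * u N * (p N * D W + - (κℕ d * (D (p N) * W)))
          ≈⟨ *-congˡ (trans (+-congʳ ode) (-‿inverseʳ _)) ⟩
        pow (u N) d * u N * u N * 0#
          ≈⟨ trans (zeroʳ _) (sym (zeroʳ _)) ⟩
        u N * 0# ∎)
      ε-uN : ε (u N) ≈ 1#
      ε-uN = begin
        ε (u N)              ≈⟨ *-identityˡ _ ⟨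
        1# * ε (u N)         ≈⟨ *-congʳ (ε-p N) ⟨
        ε (p N) * ε (u N)    ≈⟨ ε-* _ _ ⟨
        ε (p N * u N)        ≈⟨ trans (ε-cong (p-u N)) ε-1 ⟩
        1#                   ∎
      ε-Z : ε Z ≈ κ (Δ (nodes 1 (suc n)))
      ε-Z = begin
        ε (W * pow (u N) d)          ≈⟨ ε-* _ _ ⟩
        ε W * ε (pow (u N) d)        ≈⟨ *-cong (trans (ε-𝕊 B (range 1 (suc n)) Ψ₀ (range-All 1 (suc n) ℕ.≤-refl)) (ε-κ (Δ (nodes 1 (suc n)))))
                                          (trans (ε-pow (u N) d) (trans (pow-cong d ε-uN) (pow-1 d))) ⟩
        κ (Δ (nodes 1 (suc n))) * 1# ≈⟨ *-identityʳ _ ⟩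
        κ (Δ (nodes 1 (suc n)))      ∎

    -- The value F(1) is taken at 2 - n, the mirror image of -n under `ũ-antisym`, and `𝕌-ũ` at 0
    -- evaluates the sequence at -n.
    C-value : C ≈ - (sg n * (pow (p N) M₂ * 𝕌 n (+ 0)))
    C-value = begin
      σ (+ 1 ℤ.+ (+ 1 ℤ.- + n)) * ũ M₂ (+ 1 ℤ.+ (+ 1 ℤ.- + n))
        ≈⟨ *-cong (trans (σ≡ (l₁ (+ n))) (trans (σ-even (ℤ.- + n) (+ 1)) (σ-neg (+ n))))
             (trans (reflexive (≡.cong (ũ M₂) (l₂ (+ n)))) (ũ-antisym M₂ (+ 0 ℤ.- + n))) ⟩
      sg n * - ũ M₂ (+ 0 ℤ.- + n)
        ≈⟨ trans (sym (-‿distribʳ-* _ _)) (-‿cong (*-congˡ (sym (𝕌-ũ n (+ 0))))) ⟩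
      - (sg n * (pow (p N) M₂ * 𝕌 n (+ 0))) ∎
      where
      l₁ : ∀ n → + 1 ℤ.+ (+ 1 ℤ.- n) ≡ ℤ.- n ℤ.+ (+ 1 ℤ.+ + 1)
      l₁ = solve-∀
      l₂ : ∀ n → + 1 ℤ.+ (+ 1 ℤ.- n) ≡ + 2 ℤ.- (n ℤ.+ n) ℤ.- (+ 0 ℤ.- n)
      l₂ = solve-∀

    -- `relation₀` is solved for V with the values of C, W and t; the signs cancel, and so does
    -- (2n+1)! by `Δ-range`.
    V-value : V * pow (u N) (2 ℕ.* n ℕ.* n ℕ.+ n) ≈ κ (Δ (nodes 1 n)) * 𝕌 n (+ 0)
    V-value = begin
      V * pow (u N) r
        ≈⟨ *-congʳ solved ⟩
      κ (Δ (nodes 1 n)) * 𝕌 n (+ 0) * pow (p N) r * pow (u N) r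
        ≈⟨ trans (*-assoc _ _ _) (trans (*-congˡ (pow-pu r)) (*-identityʳ _)) ⟩
      κ (Δ (nodes 1 n)) * 𝕌 n (+ 0) ∎
      where
      r = 2 ℕ.* n ℕ.* n ℕ.+ n
      r₃ = suc M₂ ℕ.+ suc M₂ ℕ.+ suc M₂
      l₁ : ∀ n → n ℕ.+ n ℕ.+ suc n ℕ.* suc (suc (suc (n ℕ.+ n))) ≡ suc (n ℕ.+ n) ℕ.+ suc (n ℕ.+ n) ℕ.+ suc (n ℕ.+ n) ℕ.+ (2 ℕ.* n ℕ.* n ℕ.+ n)
      l₁ = solveℕ-∀
      solved : V ≈ κ (Δ (nodes 1 n)) * 𝕌 n (+ 0) * pow (p N) r
      solved = cancel (unit-* (unit-* (unit-sg n) (unit-κ (+ f!) (!-≢0 (suc M₂)))) (unit-pow unit-p r₃)) (begin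
        sg n * κℕ f! * pow (p N) r₃ * V
          ≈⟨ solve 4 (λ s f x v → s :* f :* x :* v := :- (s :* (:- (f :* x)) :* v)) refl _ _ _ _ ⟩
        - (sg n * - (κℕ f! * pow (p N) r₃) * V)
          ≈⟨ -‿cong (*-congʳ (*-congˡ (trans (-‿cong (*-congˡ (sym (pow-cube (suc M₂))))) (sym (m̂-top B hB))))) ⟩
        - (sg n * t * V)
          ≈⟨ -‿cong relation₀ ⟨
        - (C * W)
          ≈⟨ -‿cong (*-cong C-value (trans W-value (*-congʳ (trans (reflexive (≡.cong κ (Δ-range n))) (κ-* (+ f!) (Δ (nodes 1 n))))))) ⟩
        - (- (sg n * (pow (p N) M₂ * 𝕌 n (+ 0))) * (κℕ f! * κ (Δ (nodes 1 n)) * pow (p N) d))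
          ≈⟨ solve 6 (λ s x e f k y → :- ((:- (s :* (x :* e))) :* (f :* k :* y)) := s :* f :* (x :* y) :* (k :* e)) refl _ _ _ _ _ _ ⟩
        sg n * κℕ f! * (pow (p N) M₂ * pow (p N) d) * (κ (Δ (nodes 1 n)) * 𝕌 n (+ 0))
          ≈⟨ *-congʳ (*-congˡ (trans (sym (pow-+ _ M₂ d)) (trans (reflexive (≡.cong (pow (p N)) (l₁ n))) (pow-+ _ r₃ r)))) ⟩
        sg n * κℕ f! * (pow (p N) r₃ * pow (p N) r) * (κ (Δ (nodes 1 n)) * 𝕌 n (+ 0))
          ≈⟨ solve 5 (λ s f x y e → s :* f :* (x :* y) :* e := s :* f :* x :* (e :* y)) refl _ _ _ _ _ ⟩
        sg n * κℕ f! * pow (p N) r₃ * (κ (Δ (nodes 1 n)) * 𝕌 n (+ 0) * pow (p N) r) ∎)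

-- Exponents of the left-hand side.

-- The exponent collected along a path a = m₀, m₁, m₂, … , 0; a starts at an even position in pe and at an odd one in po.
pe po : ℕ → List ℕ → ℕ
pe a []       = tri (+ a)
pe a (b ∷ ms) = tri (+ (b ℕ.+ 1) ℤ.- + a) ℕ.+ po b ms
po a []       = 0
po a (b ∷ ms) = tri (+ (b ℕ.+ 0) ℤ.- + a) ℕ.+ pe b ms

tri-minus : ∀ a b → + tri (b ℤ.- a) ≡ + tri b ℤ.- a ℤ.* b ℤ.+ + tri (a ℤ.+ + 1)
tri-minus a b = ℤ.*-cancelˡ-≡ (+ 2) _ _ (≡.trans (tri-double (b ℤ.- a)) (≡.trans (l₁ a b)
  (≡.sym (≡.trans (l₂ a b (+ tri b) (+ tri (a ℤ.+ + 1))) (≡.cong₂ (λ x y → x ℤ.- + 2 ℤ.* (a ℤ.* b) ℤ.+ y) (tri-double b) (tri-double (a ℤ.+ + 1)))))))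
  where
  l₁ : ∀ a b → (b ℤ.- a) ℤ.* (b ℤ.- a) ℤ.- (b ℤ.- a) ≡ (b ℤ.* b ℤ.- b) ℤ.- + 2 ℤ.* (a ℤ.* b) ℤ.+ ((a ℤ.+ + 1) ℤ.* (a ℤ.+ + 1) ℤ.- (a ℤ.+ + 1))
  l₁ = solve-∀
  l₂ : ∀ a b x y → + 2 ℤ.* (x ℤ.- a ℤ.* b ℤ.+ y) ≡ + 2 ℤ.* x ℤ.- + 2 ℤ.* (a ℤ.* b) ℤ.+ + 2 ℤ.* y
  l₂ = solve-∀

tri-minus′ : ∀ a b → + tri (b ℤ.+ + 1 ℤ.- a) ≡ + tri a ℤ.- a ℤ.* b ℤ.+ + tri (b ℤ.+ + 1)
tri-minus′ a b = ≡.trans (tri-minus a (b ℤ.+ + 1)) (≡.trans (≡.cong (λ t → + tri (b ℤ.+ + 1) ℤ.- a ℤ.* (b ℤ.+ + 1) ℤ.+ t) (tri-suc a)) (l a b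
     (+ tri a) (+ tri (b ℤ.+ + 1))))
  where
  l : ∀ a b x y → y ℤ.- a ℤ.* (b ℤ.+ + 1) ℤ.+ (x ℤ.+ a) ≡ x ℤ.- a ℤ.* b ℤ.+ y
  l = solve-∀

tri-square : ∀ b → + tri (b ℤ.+ + 1) ℤ.+ + tri (b ℤ.+ + 1) ≡ b ℤ.* b ℤ.+ b
tri-square b = ≡.trans (l₁ (+ tri (b ℤ.+ + 1))) (≡.trans (tri-double (b ℤ.+ + 1)) (l₂ b))
  where
  l₁ : ∀ x → x ℤ.+ x ≡ + 2 ℤ.* x
  l₁ = solve-∀
  l₂ : ∀ b → (b ℤ.+ + 1) ℤ.* (b ℤ.+ + 1) ℤ.- (b ℤ.+ + 1) ≡ b ℤ.* b ℤ.+ b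
  l₂ = solve-∀

headℤ : List ℕ → ℤ
headℤ []      = + 0
headℤ (x ∷ _) = + x

adjSum-cons : ∀ b ms → adjSum (map +_ (b ∷ ms)) ≡ + b ℤ.* headℤ ms ℤ.+ adjSum (map +_ ms)
adjSum-cons b []      = ≡.sym (≡.trans (ℤ.+-identityʳ _) (ℤ.*-zeroʳ (+ b)))
adjSum-cons b (c ∷ _) = ≡.refl

dbl : ℕ → ℕ
dbl zero    = 0
dbl (suc n) = suc (suc (dbl n))

-- Each edge gives a product term and one triangular number per endpoint. An odd vertex b collects
-- twice tri (b + 1), that is b² + b, and an even vertex c twice tri c, that is c² - c; so the
-- alternating sum appears. The start a stays general for the induction over pairs of vertices.
pe-lhsExp : ∀ n a ms → length ms ≡ dbl n → + pe a ms ≡ + tri (+ a) ℤ.- + a ℤ.* headℤ ms ℤ.+ lhsExp ms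
pe-lhsExp zero    a []           _ = l (+ tri (+ a)) (+ a)
  where
  l : ∀ t a → t ≡ t ℤ.- a ℤ.* + 0 ℤ.+ + 0
  l = solve-∀
pe-lhsExp (suc n) a (b ∷ c ∷ ms) e = ≡.trans (≡.cong₂ ℤ._+_ (tri-minus′ (+ a) (+ b)) (≡.cong₂ ℤ._+_ c-step (pe-lhsExp n c ms (ℕ.suc-injective
     (ℕ.suc-injective e)))))
  (≡.trans (regroup (+ tri (+ a)) (+ a) (+ b) (+ tri (+ b ℤ.+ + 1)) (+ tri (+ c)) (+ c) (headℤ ms) (sqSum zs) (adjSum zs) (altSum zs))
  (≡.trans (≡.cong₂ (λ x y → + tri (+ a) ℤ.- + a ℤ.* + b ℤ.+ (x ℤ.- + b ℤ.* + c ℤ.+ y ℤ.- + c ℤ.* headℤ ms ℤ.+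
       (sqSum zs ℤ.- adjSum zs ℤ.+ altSum zs))) (tri-square (+ b)) (c-square (+ c)))
  (≡.trans (l (+ tri (+ a)) (+ a) (+ b) (+ c) (headℤ ms) (sqSum zs) (adjSum zs) (altSum zs))
    (≡.cong (λ t → + tri (+ a) ℤ.- + a ℤ.* + b ℤ.+ ((+ b ℤ.* + b ℤ.+ (+ c ℤ.* + c ℤ.+ sqSum zs)) ℤ.- (+ b ℤ.* + c ℤ.+ t) ℤ.+ (+ b ℤ.-
         (+ c ℤ.- altSum zs)))) (≡.sym (adjSum-cons c ms))))))
  where
  zs = map +_ ms
  c-step : + tri (+ (c ℕ.+ 0) ℤ.- + b) ≡ + tri (+ c) ℤ.- + b ℤ.* + c ℤ.+ + tri (+ b ℤ.+ + 1)
  c-step = ≡.trans (≡.cong (λ t → + tri (+ t ℤ.- + b)) (ℕ.+-identityʳ c)) (tri-minus (+ b) (+ c))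
  c-square : ∀ c → + tri c ℤ.+ + tri c ≡ c ℤ.* c ℤ.- c
  c-square c = ≡.trans (l₀ (+ tri c)) (tri-double c)
    where
    l₀ : ∀ x → x ℤ.+ x ≡ + 2 ℤ.* x
    l₀ = solve-∀
  regroup : ∀ ta a b tb tc c h s d e → ta ℤ.- a ℤ.* b ℤ.+ tb ℤ.+ (tc ℤ.- b ℤ.* c ℤ.+ tb ℤ.+ (tc ℤ.- c ℤ.* h ℤ.+ (s ℤ.- d ℤ.+ e)))
    ≡ ta ℤ.- a ℤ.* b ℤ.+ ((tb ℤ.+ tb) ℤ.- b ℤ.* c ℤ.+ (tc ℤ.+ tc) ℤ.- c ℤ.* h ℤ.+ (s ℤ.- d ℤ.+ e))
  regroup = solve-∀
  l : ∀ ta a b c h s d e → ta ℤ.- a ℤ.* b ℤ.+ (b ℤ.* b ℤ.+ b ℤ.- b ℤ.* c ℤ.+ (c ℤ.* c ℤ.- c) ℤ.- c ℤ.* h ℤ.+ (s ℤ.- d ℤ.+ e))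
    ≡ ta ℤ.- a ℤ.* b ℤ.+ ((b ℤ.* b ℤ.+ (c ℤ.* c ℤ.+ s)) ℤ.- (b ℤ.* c ℤ.+ (c ℤ.* h ℤ.+ d)) ℤ.+ (b ℤ.- (c ℤ.- e)))
  l = solve-∀

lhsExp≡pe : ∀ n ms → length ms ≡ dbl n → lhsExp ms ≡ + pe 0 ms
lhsExp≡pe n ms e = ≡.sym (≡.trans (pe-lhsExp n 0 ms e) (≡.trans (≡.cong (λ t → + 0 ℤ.- t ℤ.+ lhsExp ms) (ℤ.*-zeroˡ (headℤ ms))) (ℤ.+-identityˡ _)))

rhoStar-range : ∀ n → rhoStar n ≡ range 1 n
rhoStar-range n = go 0 n
  where
  go : ∀ a n → map suc (applyUpTo (a ℕ.+_) n) ≡ range (suc a) n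
  go a zero    = ≡.refl
  go a (suc n) = ≡.cong₂ _∷_ (≡.cong suc (ℕ.+-identityʳ a)) (≡.trans (≡.cong (map suc) (shift (a ℕ.+_) (suc a ℕ.+_) (ℕ.+-suc a) n)) (go (suc a) n))
    where
    shift : ∀ (f g : ℕ → ℕ) → (∀ i → f (suc i) ≡ g i) → ∀ n → applyUpTo (f ∘ suc) n ≡ applyUpTo g n
    shift f g h zero    = ≡.refl
    shift f g h (suc n) = ≡.cong₂ _∷_ (h 0) (shift (f ∘ suc) (g ∘ suc) (h ∘ suc) n)

-- Sums over boxes as iterated sums.

module Boxes (Q : QRing) (n : ℕ) where
  open Value Q n public

  sumL : List Carrier → Carrier
  sumL = foldr _+_ 0#

  sumL-cong : ∀ {A : Set} (l : List A) {f g : A → Carrier} → (∀ x → f x ≈ g x) → sumL (map f l) ≈ sumL (map g l)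
  sumL-cong []      h = refl
  sumL-cong (x ∷ l) h = +-cong (h x) (sumL-cong l h)

  sumL-++ : ∀ xs ys → sumL (xs ++ ys) ≈ sumL xs + sumL ys
  sumL-++ []       ys = sym (+-identityˡ _)
  sumL-++ (x ∷ xs) ys = trans (+-congˡ (sumL-++ xs ys)) (sym (+-assoc _ _ _))

  sumL-concatMap : ∀ {A B : Set} (l : List A) (g : A → List B) (f : B → Carrier) →
    sumL (map f (concatMap g l)) ≈ sumL (map (λ x → sumL (map f (g x))) l)
  sumL-concatMap []      g f = refl
  sumL-concatMap (x ∷ l) g f = trans (reflexive (≡.cong sumL (map-++ f (g x) (concatMap g l))))
    (trans (sumL-++ (map f (g x)) _) (+-congˡ (sumL-concatMap l g f)))

  sumL-applyUpTo : ∀ m (h : ℕ → ℕ) (f : ℕ → Carrier) → sumL (map f (applyUpTo h m)) ≈ Σ m (λ i → f (h i))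
  sumL-applyUpTo zero    h f = sym (Σ-zero _)
  sumL-applyUpTo (suc m) h f = trans (+-congˡ (sumL-applyUpTo m (h ∘ suc) f)) (sym (Σ-suc m _))

  sumL-*ˡ : ∀ {A : Set} (l : List A) y (f : A → Carrier) → y * sumL (map f l) ≈ sumL (map (λ x → y * f x) l)
  sumL-*ˡ []      y f = zeroʳ y
  sumL-*ˡ (x ∷ l) y f = trans (distribˡ _ _ _) (+-congˡ (sumL-*ˡ l y f))

  sumL-boxℕ : ∀ d B (f : Vec ℕ (suc d) → Carrier) → sumL (map f (boxℕ (suc d) B)) ≈ Σ (suc B) (λ x → sumL (map (λ v → f (x ∷ᵥ v)) (boxℕ d B)))
  sumL-boxℕ d B f = trans (sumL-concatMap (upTo (suc B)) (λ x → map (x ∷ᵥ_) (boxℕ d B)) f) (trans (sumL-applyUpTo (suc B) id _)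
    (Σ-cong (suc B) (λ x → reflexive (≡.cong sumL (≡.sym (map-∘ (boxℕ d B)))))))

  sumL-rangeℤ : ∀ B (f : ℤ → Carrier) → sumL (map f (rangeℤ B)) ≈ 𝕀 B f
  sumL-rangeℤ B f = trans (reflexive (≡.cong sumL (≡.sym (map-∘ (upTo (suc (B ℕ.+ B))))))) (trans (sumL-applyUpTo (suc (B ℕ.+ B)) id _)
    (trans (Σ-cong (suc (B ℕ.+ B)) (λ i → reflexive (≡.cong f (ℤ.+-comm (+ i) (ℤ.- + B))))) (sym (𝕀-I B f))))

  sumL-boxℤ : ∀ d B (f : Vec ℤ (suc d) → Carrier) → sumL (map f (boxℤ (suc d) B)) ≈ 𝕀 B (λ x → sumL (map (λ v → f (x ∷ᵥ v)) (boxℤ d B)))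
  sumL-boxℤ d B f = trans (sumL-concatMap (rangeℤ B) (λ x → map (x ∷ᵥ_) (boxℤ d B)) f) (trans (sumL-rangeℤ B _)
    (𝕀-cong B (λ x → reflexive (≡.cong sumL (≡.sym (map-∘ (boxℤ d B)))))))

  *-reverse : ∀ a b c → a * (b * c) ≈ c * (b * a)
  *-reverse = solve 3 (λ a b c → a :* (b :* c) := c :* (b :* a)) refl

  us : List ℕ → Carrier
  us []       = 1#
  us (m ∷ ms) = u m * us ms

  -- The coordinates 0, ..., B are B + 1 values, hence `suc B` on the right.
  box-pathE : ∀ B m a → sumL (map (λ v → q^ (pe a (toList v)) * us (toList v)) (boxℕ (dbl m) B)) ≈ pathE (suc B) m a
  box-pathE B zero    a = trans (+-identityʳ _) (trans (*-identityʳ _) (sym (θ-def (+ a))))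
  box-pathE B (suc m) a = trans (sumL-boxℕ (suc (dbl m)) B _) (Σ-cong (suc B) (λ b → begin
      sumL (map (λ v → q^ (tri (+ (b ℕ.+ 1) ℤ.- + a) ℕ.+ po b (toList v)) * (u b * us (toList v))) (boxℕ (suc (dbl m)) B))
        ≈⟨ trans (sumL-cong (boxℕ (suc (dbl m)) B) (λ v → step (+ (b ℕ.+ 1) ℤ.- + a) (po b (toList v)) b (us (toList v)))) (sym (sumL-*ˡ (boxℕ
             (suc (dbl m)) B) _ _)) ⟩
      θ (+ (b ℕ.+ 1) ℤ.- + a) * u b * sumL (map (λ v → q^ (po b (toList v)) * us (toList v)) (boxℕ (suc (dbl m)) B))
        ≈⟨ trans (*-congˡ (odd b)) (*-assoc _ _ _) ⟩
      θ (+ (b ℕ.+ 1) ℤ.- + a) * (u b * pathO (suc B) m b) ∎))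
    where
    step : ∀ x e b y → q^ (tri x ℕ.+ e) * (u b * y) ≈ θ x * u b * (q^ e * y)
    step x e b y = trans (*-congʳ (trans (q+ (tri x) e ≡.refl) (*-congʳ (sym (θ-def x)))))
      (solve 4 (λ t q u y → t :* q :* (u :* y) := t :* u :* (q :* y)) refl _ _ _ _)
    odd : ∀ b → sumL (map (λ v → q^ (po b (toList v)) * us (toList v)) (boxℕ (suc (dbl m)) B)) ≈ pathO (suc B) m b
    odd b = trans (sumL-boxℕ (dbl m) B _) (Σ-cong (suc B) (λ c → begin
      sumL (map (λ v → q^ (tri (+ (c ℕ.+ 0) ℤ.- + b) ℕ.+ pe c (toList v)) * (u c * us (toList v))) (boxℕ (dbl m) B))
        ≈⟨ trans (sumL-cong (boxℕ (dbl m) B) (λ v → step (+ (c ℕ.+ 0) ℤ.- + b) (pe c (toList v)) c (us (toList v)))) (sym (sumL-*ˡ (boxℕ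
             (dbl m) B) _ _)) ⟩
      θ (+ (c ℕ.+ 0) ℤ.- + b) * u c * sumL (map (λ v → q^ (pe c (toList v)) * us (toList v)) (boxℕ (dbl m) B))
        ≈⟨ trans (*-congˡ (box-pathE B m c)) (*-assoc _ _ _) ⟩
      θ (+ (c ℕ.+ 0) ℤ.- + b) * (u c * pathE (suc B) m c) ∎))

  expos : List ℕ → List ℤ → ℕ
  expos (j ∷ js) (k ∷ ks) = expo j k ℕ.+ expos js ks
  expos _        _        = 0

  box-𝕊 : ∀ B a m (Ψ : List ℤ → Carrier) → sumL (map (λ v → q^ (expos (range a m) (toList v)) * Ψ (zipWith node (range a m) (toList v)))
       (boxℤ m B)) ≈ 𝕊 B (range a m) Ψ
  box-𝕊 B a zero    Ψ = trans (+-identityʳ _) (trans (*-congʳ q^0) (*-identityˡ _))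
  box-𝕊 B a (suc m) Ψ = trans (sumL-boxℤ m B _) (𝕀-cong B (λ k → begin
    sumL (map (λ v → q^ (expo a k ℕ.+ expos (range (suc a) m) (toList v)) * Ψ (node a k ∷ zipWith node (range (suc a) m) (toList v))) (boxℤ m B))
      ≈⟨ trans (sumL-cong (boxℤ m B) (λ v → trans (*-congʳ (q+ (expo a k) _ ≡.refl)) (*-assoc _ _ _))) (sym (sumL-*ˡ (boxℤ m B) _ _)) ⟩
    q^ (expo a k) * sumL (map (λ v → q^ (expos (range (suc a) m) (toList v)) * Ψ (node a k ∷ zipWith node (range (suc a) m) (toList v))) (boxℤ m B))
      ≈⟨ *-congˡ (box-𝕊 B (suc a) m (λ vs → Ψ (node a k ∷ vs))) ⟩
    q^ (expo a k) * 𝕊 B (range (suc a) m) (λ vs → Ψ (node a k ∷ vs)) ∎))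

-- Power series with rational coefficients.

module Rat = RingKit ℚ.+-*-commutativeRing

module Series where
  open Rat

  coefficient-Σ : ∀ n (h : ℕ → ℕ) (f : ℕ → ℚ) → sumℚ (map f (applyUpTo h n)) ≡ Σ n (λ i → f (h i))
  coefficient-Σ zero    h f = ≡.sym (Σ-zero _)
  coefficient-Σ (suc n) h f = ≡.trans (≡.cong (λ t → f (h 0) + t) (coefficient-Σ n (h ∘ suc) f)) (≡.sym (Σ-suc n _))

  ⊛-Σ : ∀ f g k → (f ⊛ g) k ≡ Σ (suc k) (λ j → f j * g (k ℕ.∸ j))
  ⊛-Σ f g k = coefficient-Σ (suc k) id _

  ⊛-cong : ∀ {f f′ g g′} k → (∀ j → j ℕ.≤ k → f j ≡ f′ j) → (∀ j → j ℕ.≤ k → g j ≡ g′ j) → (f ⊛ g) k ≡ (f′ ⊛ g′) k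
  ⊛-cong {f} {f′} {g} {g′} k hf hg = ≡.trans (⊛-Σ f g k) (≡.trans (Σ-cong< (suc k) (λ j l → ≡.cong₂ _*_ (hf j (ℕ.≤-pred l)) (hg _
       (ℕ.m∸n≤m k j)))) (≡.sym (⊛-Σ f′ g′ k)))

  ⊛-zero : ∀ f g → (f ⊛ g) 0 ≡ f 0 * g 0
  ⊛-zero f g = ≡.trans (⊛-Σ f g 0) (Σ-one _)

  ⊛-suc : ∀ f g k → (f ⊛ g) (suc k) ≡ f 0 * g (suc k) + ((f ∘ suc) ⊛ g) k
  ⊛-suc f g k = ≡.trans (⊛-Σ f g (suc k)) (≡.trans (Σ-suc (suc k) _) (≡.cong (λ t → f 0 * g (suc k) + t) (≡.sym (⊛-Σ (f ∘ suc) g k))))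

  ⊛-comm : ∀ f g k → (f ⊛ g) k ≡ (g ⊛ f) k
  ⊛-comm f g k = ≡.trans (⊛-Σ f g k) (≡.trans (Σ-rev (suc k) _) (≡.trans (Σ-cong< (suc k) (λ j l →
    ≡.trans (≡.cong (λ t → f (k ℕ.∸ j) * g t) (ℕ.m∸[m∸n]≡n (ℕ.≤-pred l))) (*-comm (f (k ℕ.∸ j)) (g j)))) (≡.sym (⊛-Σ g f k))))

  infixl 6 _⊕_
  _⊕_ : PS → PS → PS
  (f ⊕ g) k = f k + g k

  ⊛-distribʳ : ∀ h f g k → ((f ⊕ g) ⊛ h) k ≡ (f ⊛ h) k + (g ⊛ h) k
  ⊛-distribʳ h f g k = ≡.trans (⊛-Σ (f ⊕ g) h k) (≡.trans (Σ-cong (suc k) (λ j → distribʳ (h (k ℕ.∸ j)) (f j) (g j)))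
    (≡.trans (Σ-+ (suc k) _ _) (≡.cong₂ _+_ (≡.sym (⊛-Σ f h k)) (≡.sym (⊛-Σ g h k)))))

  ⊛-scale : ∀ c f g k → ((λ j → c * f j) ⊛ g) k ≡ c * (f ⊛ g) k
  ⊛-scale c f g k = ≡.trans (⊛-Σ (λ j → c * f j) g k) (≡.trans (Σ-cong (suc k) (λ j → *-assoc c (f j) (g (k ℕ.∸ j))))
    (≡.trans (≡.sym (Σ-*ˡ (suc k) c _)) (≡.cong (c *_) (≡.sym (⊛-Σ f g k)))))

  ⊛-null : ∀ f g k → (∀ j → f j ≡ 0#) → (f ⊛ g) k ≡ 0#
  ⊛-null f g k h = ≡.trans (⊛-Σ f g k) (Σ-0 (suc k) (λ j _ → ≡.trans (≡.cong (_* g (k ℕ.∸ j)) (h j)) (zeroˡ (g (k ℕ.∸ j)))))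

  ⊛-const : ∀ f g k → (∀ j → f (suc j) ≡ 0#) → (f ⊛ g) k ≡ f 0 * g k
  ⊛-const f g zero    h = ⊛-zero f g
  ⊛-const f g (suc k) h = ≡.trans (⊛-suc f g k) (≡.trans (≡.cong (λ t → f 0 * g (suc k) + t) (⊛-null (f ∘ suc) g k h)) (+-identityʳ (f 0 * g
       (suc k))))

  ⊛-identityˡ : ∀ f k → (one ⊛ f) k ≡ f k
  ⊛-identityˡ f k = ≡.trans (⊛-const one f k (λ _ → ≡.refl)) (*-identityˡ (f k))

  -- Induction on the degree, with f written as its constant coefficient plus q times `f ∘ suc`.
  ⊛-assoc : ∀ f g h k → ((f ⊛ g) ⊛ h) k ≡ (f ⊛ (g ⊛ h)) k
  ⊛-assoc f g h zero = ≡.trans (⊛-zero (f ⊛ g) h) (≡.trans (≡.cong (_* h 0) (⊛-zero f g)) (≡.trans (*-assoc (f 0) (g 0) (h 0))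
    (≡.sym (≡.trans (⊛-zero f (g ⊛ h)) (≡.cong (f 0 *_) (⊛-zero g h))))))
  ⊛-assoc f g h (suc k) = begin
    ((f ⊛ g) ⊛ h) (suc k)
      ≡⟨ ⊛-suc (f ⊛ g) h k ⟩
    (f ⊛ g) 0 * h (suc k) + (((f ⊛ g) ∘ suc) ⊛ h) k
      ≡⟨ ≡.cong₂ _+_ (≡.cong (_* h (suc k)) (⊛-zero f g)) (≡.trans (⊛-cong {g = h} {g′ = h} k (λ j _ → ⊛-suc f g j) (λ _ _ → ≡.refl))
           (≡.trans (⊛-distribʳ h (λ j → f 0 * g (suc j)) ((f ∘ suc) ⊛ g) k) (≡.cong₂ _+_ (⊛-scale (f 0) (g ∘ suc) h k) (⊛-assoc (f ∘ suc) g h k)))) ⟩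
    f 0 * g 0 * h (suc k) + (f 0 * ((g ∘ suc) ⊛ h) k + ((f ∘ suc) ⊛ (g ⊛ h)) k)
      ≡⟨ solve 5 (λ a b c x y → a :* b :* c :+ (a :* x :+ y) := a :* (b :* c :+ x) :+ y) ≡.refl (f 0) (g 0) (h (suc k)) (((g ∘ suc) ⊛ h) k)
           (((f ∘ suc) ⊛ (g ⊛ h)) k) ⟩
    f 0 * (g 0 * h (suc k) + ((g ∘ suc) ⊛ h) k) + ((f ∘ suc) ⊛ (g ⊛ h)) k
      ≡⟨ ≡.cong (λ t → f 0 * t + ((f ∘ suc) ⊛ (g ⊛ h)) k) (⊛-suc g h k) ⟨
    f 0 * (g ⊛ h) (suc k) + ((f ∘ suc) ⊛ (g ⊛ h)) k
      ≡⟨ ⊛-suc f (g ⊛ h) k ⟨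
    (f ⊛ (g ⊛ h)) (suc k) ∎

  _≈[_]_ : PS → ℕ → PS → Set
  f ≈[ N ] g = ∀ k → k ℕ.< N → f k ≡ g k

  -- The truncation lives in the equality alone: elements are full series, compared below degree N.
  psRing : ℕ → CommutativeRing 0ℓ 0ℓ
  psRing N = record
    { Carrier = PS
    ; _≈_ = λ f g → f ≈[ N ] g
    ; _+_ = _⊕_
    ; _*_ = _⊛_
    ; -_ = λ f k → - f k
    ; 0# = λ _ → 0#
    ; 1# = one
    ; isCommutativeRing = record
      { isRing = record
        { +-isAbelianGroup = record
          { isGroup = record
            { isMonoid = record
              { isSemigroup = record
                { isMagma = record
                  { isEquivalence = record
                    { refl = λ _ _ → ≡.refl
                    ; sym = λ h k l → ≡.sym (h k l)
                    ; trans = λ h h′ k l → ≡.trans (h k l) (h′ k l)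
                    }
                  ; ∙-cong = λ h h′ k l → ≡.cong₂ _+_ (h k l) (h′ k l)
                  }
                ; assoc = λ f g h k _ → +-assoc (f k) (g k) (h k)
                }
              ; identity = (λ f k _ → +-identityˡ (f k)) , (λ f k _ → +-identityʳ (f k))
              }
            ; inverse = (λ f k _ → -‿inverseˡ (f k)) , (λ f k _ → -‿inverseʳ (f k))
            ; ⁻¹-cong = λ h k l → ≡.cong -_ (h k l)
            }
          ; comm = λ f g k _ → +-comm (f k) (g k)
          }
        ; *-cong = λ {f} {f′} {g} {g′} h h′ k l → ⊛-cong {f} {f′} {g} {g′} k (λ j m → h j (ℕ.≤-trans (s≤s m) l)) (λ j m → h′ j (ℕ.≤-trans (s≤s m) l))
        ; *-assoc = λ f g h k _ → ⊛-assoc f g h k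
        ; *-identity = (λ f k _ → ⊛-identityˡ f k) , (λ f k _ → ≡.trans (⊛-comm f one k) (⊛-identityˡ f k))
        ; distrib = (λ f g h k _ → ≡.trans (⊛-comm f (g ⊕ h) k) (≡.trans (⊛-distribʳ f g h k) (≡.cong₂ _+_ (⊛-comm g f k) (⊛-comm h f k))))
                  , (λ h f g k _ → ⊛-distribʳ h f g k)
        }
      ; *-comm = λ f g k _ → ⊛-comm f g k
      }
    }

  monomial : ℕ → PS
  monomial zero    zero    = 1#
  monomial zero    (suc k) = 0#
  monomial (suc e) zero    = 0#
  monomial (suc e) (suc k) = monomial e k

  monomial-⊛ : ∀ e f k → (monomial e ⊛ f) (e ℕ.+ k) ≡ f k
  monomial-⊛ zero    f k = ≡.trans (⊛-const (monomial 0) f k (λ _ → ≡.refl)) (*-identityˡ (f k))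
  monomial-⊛ (suc e) f k = ≡.trans (⊛-suc (monomial (suc e)) f (e ℕ.+ k)) (≡.trans (≡.cong₂ _+_ (zeroˡ (f (suc (e ℕ.+ k)))) (monomial-⊛ e f k))
       (+-identityˡ (f k)))

  monomial-⊛-low : ∀ e f k → k ℕ.< e → (monomial e ⊛ f) k ≡ 0#
  monomial-⊛-low (suc e) f zero    _       = ≡.trans (⊛-zero (monomial (suc e)) f) (zeroˡ (f 0))
  monomial-⊛-low (suc e) f (suc k) (s≤s l) = ≡.trans (⊛-suc (monomial (suc e)) f k) (≡.trans (≡.cong₂ _+_ (zeroˡ (f (suc k)))
       (monomial-⊛-low e f k l)) (+-identityˡ 0#))

  monomial-suc : ∀ e k → monomial (suc e) k ≡ (monomial 1 ⊛ monomial e) k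
  monomial-suc e zero    = ≡.sym (monomial-⊛-low 1 (monomial e) 0 (s≤s z≤n))
  monomial-suc e (suc k) = ≡.sym (monomial-⊛ 1 (monomial e) k)

  monomial-low : ∀ e k → k ℕ.< e → monomial e k ≡ 0#
  monomial-low (suc e) zero    _       = ≡.refl
  monomial-low (suc e) (suc k) (s≤s l) = monomial-low e k l

  geom-suc : ∀ s k → geom (suc s) (suc s ℕ.+ k) ≡ geom (suc s) k
  geom-suc s k with suc s ∣? (suc s ℕ.+ k) | suc s ∣? k
  ... | yes _ | yes _ = ≡.refl
  ... | no _  | no _  = ≡.refl
  ... | yes a | no b  = ⊥-elim (b (∣m+n∣m⇒∣n a ∣-refl))
  ... | no a  | yes b = ⊥-elim (a (∣m∣n⇒∣m+n ∣-refl b))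

  geom-zero : ∀ s → geom (suc s) 0 ≡ 1#
  geom-zero s with suc s ∣? 0
  ... | yes _ = ≡.refl
  ... | no a  = ⊥-elim (a (suc s ∣0))

  geom-low : ∀ s k → suc k ℕ.< suc s → geom (suc s) (suc k) ≡ 0#
  geom-low s k l with suc s ∣? suc k
  ... | yes a = ⊥-elim (ℕ.<⇒≱ l (∣⇒≤ a))
  ... | no _  = ≡.refl

  -- The equation g = 1 + q^i g of 1/(1 - q^i), since divisibility by i is invariant under
  -- translation by i.
  geom-rec : ∀ s k → geom (suc s) k ≡ one k + (monomial (suc s) ⊛ geom (suc s)) k
  geom-rec s k with k ℕ.<? suc s
  geom-rec s zero    | yes l = ≡.trans (geom-zero s) (≡.sym (≡.trans (≡.cong (λ t → 1# + t) (monomial-⊛-low (suc s) (geom (suc s)) 0 l))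
       (+-identityʳ 1#)))
  geom-rec s (suc k) | yes l = ≡.trans (geom-low s k l) (≡.sym (≡.trans (≡.cong (λ t → 0# + t) (monomial-⊛-low (suc s) (geom (suc s))
       (suc k) l)) (+-identityʳ 0#)))
  geom-rec s k       | no h  = ≡.subst (λ t → geom (suc s) t ≡ one t + (monomial (suc s) ⊛ geom (suc s)) t) (ℕ.m+[n∸m]≡n (ℕ.≮⇒≥ h))
    (≡.trans (geom-suc s (k ℕ.∸ suc s)) (≡.sym (≡.trans (≡.cong (λ t → 0# + t) (monomial-⊛ (suc s) (geom (suc s)) (k ℕ.∸ suc s))) (+-identityˡ
         (geom (suc s) (k ℕ.∸ suc s))))))

  mkℚᵘ-κ : ∀ n → ℚ.toℚᵘ (κℕ n) ℚᵘ.≃ ℚᵘ.mkℚᵘ (+ n) 0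
  mkℚᵘ-κ zero    = ℚᵘ.≃-refl
  mkℚᵘ-κ (suc n) = ℚᵘ.≃-trans (ℚ.toℚᵘ-cong (κℕ-suc n)) (ℚᵘ.≃-trans (ℚ.toℚᵘ-homo-+ 1# (κℕ n))
    (ℚᵘ.≃-trans (ℚᵘ.+-cong {x = ℚ.toℚᵘ 1#} {y = ℚᵘ.mkℚᵘ (+ 1) 0} ℚᵘ.≃-refl (mkℚᵘ-κ n)) (ℚᵘ.*≡* (l (+ n)))))
    where
    l : ∀ n → (+ 1 ℤ.+ n ℤ.* + 1) ℤ.* + 1 ≡ (+ 1 ℤ.+ n) ℤ.* + 1
    l = solve-∀

  κ-mkℚᵘ : ∀ z → ℚ.toℚᵘ (κ z) ℚᵘ.≃ ℚᵘ.mkℚᵘ z 0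
  κ-mkℚᵘ (+ n)    = mkℚᵘ-κ n
  κ-mkℚᵘ -[1+ n ] = ℚᵘ.≃-trans (ℚ.toℚᵘ-homo‿- (κℕ (suc n))) (ℚᵘ.-‿cong (mkℚᵘ-κ (suc n)))

  -- The passage to unnormalised fractions avoids the reduction to lowest terms.
  frac-κ : ∀ a b → frac a (suc b) * κ (+ suc b) ≡ κ a
  frac-κ a b = ℚ.toℚᵘ-injective (ℚᵘ.≃-trans (ℚ.toℚᵘ-homo-* (frac a (suc b)) (κ (+ suc b)))
    (ℚᵘ.≃-trans (ℚᵘ.*-cong (ℚ.toℚᵘ-fromℚᵘ (ℚᵘ.mkℚᵘ a b)) (κ-mkℚᵘ (+ suc b)))
    (ℚᵘ.≃-trans (ℚᵘ.*≡* (≡.trans (ℤ.*-identityʳ (a ℤ.* + suc b)) (≡.cong (a ℤ.*_) (≡.cong +_ (≡.sym (ℕ.*-identityʳ (suc b))))))) (ℚᵘ.≃-sym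
         (κ-mkℚᵘ a)))))

  κ-inverse : ∀ z → z ≢ + 0 → ∃[ y ] κ z * y ≡ 1#
  κ-inverse (+ zero)   h = ⊥-elim (h ≡.refl)
  κ-inverse (+ suc n)  h = frac (+ 1) (suc n) , ≡.trans (*-comm (κ (+ suc n)) (frac (+ 1) (suc n))) (frac-κ (+ 1) n)
  κ-inverse -[1+ n ]   h = - frac (+ 1) (suc n) , ≡.trans (solve 2 (λ a b → (:- a) :* (:- b) := b :* a) ≡.refl (κℕ (suc n)) (frac (+ 1)
       (suc n))) (frac-κ (+ 1) n)

open Series

-- The truncated series as a model of the axioms.

module Model (N : ℕ) where
  module ℚR = Rat
  open RingKit (psRing N)

  one-monomial : ∀ k → one k ≡ monomial 0 k
  one-monomial zero    = ≡.refl
  one-monomial (suc k) = ≡.refl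

  monomial-^ : ∀ n k → (monomial 1 ^ n) k ≡ monomial n k
  monomial-^ zero    k = one-monomial k
  monomial-^ (suc n) k = ≡.trans (⊛-cong {f = monomial 1} {f′ = monomial 1} k (λ _ _ → ≡.refl) (λ j _ → monomial-^ n j)) (≡.sym (monomial-suc n k))

  invPoch-suc : ∀ i → (1# + - (monomial 1 ^ suc i)) * (invPoch i * geom (suc i)) ≈ invPoch i
  invPoch-suc i = begin
    (1# + - z) * (invPoch i * geom (suc i))
      ≈⟨ solve 3 (λ z a g → (con (+ 1) :- z) :* (a :* g) := a :* (g :- z :* g)) refl z (invPoch i) (geom (suc i)) ⟩
    invPoch i * (geom (suc i) + - (z * geom (suc i)))
      ≈⟨ *-congˡ {invPoch i} {geom (suc i) + - (z * geom (suc i))} {1# + z * geom (suc i) + - (z * geom (suc i))}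
           (λ k l → ≡.cong (λ t → t ℚ.+ ℚ.- (z ⊛ geom (suc i)) k) (rec k l)) ⟩
    invPoch i * (1# + z * geom (suc i) + - (z * geom (suc i)))
      ≈⟨ solve 2 (λ a x → a :* (con (+ 1) :+ x :- x) := a) refl (invPoch i) (z * geom (suc i)) ⟩
    invPoch i ∎
    where
    z : PS
    z = monomial 1 ^ suc i
    rec : geom (suc i) ≈ 1# + z * geom (suc i)
    rec k _ = ≡.trans (geom-rec i k) (≡.cong (λ t → one k ℚ.+ t) (⊛-cong {g = geom (suc i)} {g′ = geom (suc i)} k (λ j _ → ≡.sym (monomial-^
         (suc i) j)) (λ _ _ → ≡.refl)))

  κℕ-coefficient-0 : ∀ n → κℕ n 0 ≡ ℚR.κℕ n
  κℕ-coefficient-0 zero          = ≡.refl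
  κℕ-coefficient-0 (suc zero)    = ≡.refl
  κℕ-coefficient-0 (suc (suc n)) = ≡.cong (λ t → ℚ.1ℚ ℚ.+ t) (κℕ-coefficient-0 (suc n))

  κℕ-coefficient-suc : ∀ n k → κℕ n (suc k) ≡ ℚ.0ℚ
  κℕ-coefficient-suc zero          k = ≡.refl
  κℕ-coefficient-suc (suc zero)    k = ≡.refl
  κℕ-coefficient-suc (suc (suc n)) k = ≡.trans (≡.cong (λ t → ℚ.0ℚ ℚ.+ t) (κℕ-coefficient-suc (suc n) k)) (ℚR.+-identityˡ ℚ.0ℚ)

  κ-coefficient-0 : ∀ z → κ z 0 ≡ ℚR.κ z
  κ-coefficient-0 (+ n)    = κℕ-coefficient-0 n
  κ-coefficient-0 -[1+ n ] = ≡.cong ℚ.-_ (κℕ-coefficient-0 (suc n))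

  κ-coefficient-suc : ∀ z k → κ z (suc k) ≡ ℚ.0ℚ
  κ-coefficient-suc (+ n)    k = κℕ-coefficient-suc n k
  κ-coefficient-suc -[1+ n ] k = ≡.trans (≡.cong ℚ.-_ (κℕ-coefficient-suc (suc n) k)) ℚR.-0#≈0#

  κ-⊛ : ∀ z f k → (κ z ⊛ f) k ≡ ℚR.κ z ℚ.* f k
  κ-⊛ z f k = ≡.trans (⊛-const (κ z) f k (κ-coefficient-suc z)) (≡.cong (ℚ._* f k) (κ-coefficient-0 z))

  constant : PS → PS
  constant f zero    = f 0
  constant f (suc k) = ℚ.0ℚ

  derivative : PS → PS
  derivative f k = ℚR.κℕ k ℚ.* f k

  derivative-⊛ : ∀ f g k → derivative (f ⊛ g) k ≡ (derivative f ⊛ g) k ℚ.+ (f ⊛ derivative g) k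
  derivative-⊛ f g k = ≡.trans (≡.cong (ℚR.κℕ k ℚ.*_) (⊛-Σ f g k)) (≡.trans (ℚR.Σ-*ˡ (suc k) (ℚR.κℕ k) (λ j → f j ℚ.* g (k ℕ.∸ j)))
    (≡.trans (ℚR.Σ-cong< (suc k) (λ { j (s≤s l) → ≡.trans (≡.cong (λ t → t ℚ.* (f j ℚ.* g (k ℕ.∸ j))) (≡.trans (≡.cong ℚR.κℕ (≡.sym
         (ℕ.m+[n∸m]≡n l))) (ℚR.κℕ-+ j (k ℕ.∸ j))))
        (ℚR.solve 4 (λ a b c d → (a ℚR.:+ b) ℚR.:* (c ℚR.:* d) ℚR.:= a ℚR.:* c ℚR.:* d ℚR.:+ c ℚR.:* (b ℚR.:* d)) ≡.refl (ℚR.κℕ j) (ℚR.κℕ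
             (k ℕ.∸ j)) (f j) (g (k ℕ.∸ j))) }))
    (≡.trans (ℚR.Σ-+ (suc k) _ _) (≡.cong₂ ℚ._+_ (≡.sym (⊛-Σ (derivative f) g k)) (≡.sym (⊛-Σ f (derivative g) k))))))

  rational-cancel : ∀ {a b x} → a ℚ.* b ≡ ℚ.1ℚ → a ℚ.* x ≡ ℚ.0ℚ → x ≡ ℚ.0ℚ
  rational-cancel {a} {b} {x} h e = ≡.trans (≡.sym (ℚR.*-identityˡ x)) (≡.trans (≡.cong (ℚ._* x) (≡.sym h))
    (≡.trans (ℚR.solve 3 (λ a b x → a ℚR.:* b ℚR.:* x ℚR.:= b ℚR.:* (a ℚR.:* x)) ≡.refl a b x) (≡.trans (≡.cong (b ℚ.*_) e) (ℚR.zeroʳ b))))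

  derivative-ker : ∀ {f} → derivative f ≈ 0# → f ≈ constant f
  derivative-ker     h zero    l = ≡.refl
  derivative-ker {f} h (suc k) l with κ-inverse (+ suc k) (λ ())
  ... | y , e = rational-cancel {ℚR.κℕ (suc k)} {y} {f (suc k)} e (h (suc k) l)

  constant-unit : ∀ {f g h} → constant f * g ≈ 1# → f * h ≈ 0# → h ≈ 0#
  constant-unit {f} {g} {h} e e′ k l = vanish (suc k) k ℕ.≤-refl l
    where
    f₀ : f 0 ℚ.* g 0 ≡ ℚ.1ℚ
    f₀ = ≡.trans (≡.sym (⊛-zero (constant f) g)) (e 0 (ℕ.≤-trans (s≤s z≤n) l))
    -- Strong induction on the degree, with b as its bound. The coefficient of q^k in f h is f 0
    -- times h k plus terms with lower coefficients of h, which are already zero.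
    vanish : ∀ b k → k ℕ.< b → k ℕ.< N → h k ≡ ℚ.0ℚ
    vanish (suc b) k (s≤s k≤b) k<N = rational-cancel {f 0} {g 0} {h k} f₀ (≡.trans (≡.sym (≡.trans (⊛-Σ f h k) (≡.trans (ℚR.Σ-suc k _)
      (≡.trans (≡.cong (λ t → f 0 ℚ.* h k ℚ.+ t) (ℚR.Σ-0 k (λ j j<k → ≡.trans (≡.cong (f (suc j) ℚ.*_)
        (vanish b (k ℕ.∸ suc j) (ℕ.≤-trans (smaller j k j<k) k≤b) (ℕ.≤-trans (smaller j k j<k) (ℕ.<⇒≤ k<N)))) (ℚR.zeroʳ (f (suc j))))))
        (ℚR.+-identityʳ (f 0 ℚ.* h k)))))) (e′ k k<N))
      where
      smaller : ∀ j k → j ℕ.< k → suc (k ℕ.∸ suc j) ℕ.≤ k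
      smaller j (suc k) _ = s≤s (ℕ.m∸n≤m k j)

  constant-⊛ : ∀ f g k → constant (f ⊛ g) k ≡ (constant f ⊛ constant g) k
  constant-⊛ f g zero    = ≡.trans (⊛-zero f g) (≡.sym (⊛-zero (constant f) (constant g)))
  constant-⊛ f g (suc k) = ≡.sym (≡.trans (⊛-const (constant f) (constant g) (suc k) (λ _ → ≡.refl)) (ℚR.zeroʳ (f 0)))

  κ-invₚ : ∀ z → z ≢ + 0 → ∃[ y ] κ z * y ≈ 1#
  κ-invₚ z h with κ-inverse z h
  ... | y , e = y* , λ k _ → ≡.trans (κ-⊛ z y* k) (eq k)
    where
    y* : PS
    y* zero    = y
    y* (suc _) = ℚ.0ℚ
    eq : ∀ k → ℚR.κ z ℚ.* y* k ≡ one k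
    eq zero    = e
    eq (suc k) = ℚR.zeroʳ (ℚR.κ z)

  qRing : QRing
  qRing = record
    { R = psRing N
    ; q = monomial 1
    ; N = N
    ; q-nil = λ k l → ≡.trans (monomial-^ N k) (monomial-low N k l)
    ; u = invPoch
    ; u-zero = refl
    ; u-suc = invPoch-suc
    ; κ-inv = κ-invₚ
    ; D = derivative
    ; D-cong = λ h k l → ≡.cong (ℚR.κℕ k ℚ.*_) (h k l)
    ; D-+ = λ f g k _ → ℚR.distribˡ (ℚR.κℕ k) (f k) (g k)
    ; D-* = λ f g k _ → derivative-⊛ f g k
    ; D-q = λ { zero _ → ≡.refl ; (suc zero) _ → ≡.refl ; (suc (suc k)) _ → ℚR.zeroʳ (ℚR.κℕ (suc (suc k))) }
    ; ε = constant
    ; ε-cong = λ { h zero l → h 0 l ; h (suc k) l → ≡.refl }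
    ; ε-+ = λ { f g zero _ → ≡.refl ; f g (suc k) _ → ≡.refl }
    ; ε-* = λ f g k _ → constant-⊛ f g k
    ; ε-1 = λ { zero _ → ≡.refl ; (suc k) _ → ≡.refl }
    ; ε-q = λ { zero _ → ≡.refl ; (suc k) _ → ≡.refl }
    ; D-ker = λ {f} → derivative-ker {f}
    ; ε-unit = λ {f} {g} {h} → constant-unit {f} {g} {h}
    }

-- The terms and χ of the statement.

term-value : ∀ c E f k → term c (+ E) f (+ k) ≡ c ℚ.* (monomial E ⊛ f) k
term-value c E f k with E ℕ.≤? k
term-value c E f k | yes l with + k ℤ.- + E | ≡.trans (ℤ.m-n≡m⊖n k E) (ℤ.⊖-≥ l)
... | .(+ (k ℕ.∸ E)) | ≡.refl = ≡.cong (c ℚ.*_) (≡.trans (≡.sym (monomial-⊛ E f (k ℕ.∸ E))) (≡.cong (monomial E ⊛ f) (ℕ.m+[n∸m]≡n l)))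
term-value c E f k | no h with + k ℤ.- + E | ≡.trans (ℤ.m-n≡m⊖n k E) (≡.trans (ℤ.⊖-< (ℕ.≰⇒> h)) (≡.cong (λ t → ℤ.- + t) (ℕ.+-∸-assoc 1 (ℕ.≰⇒> h))))
... | .(-[1+ (E ℕ.∸ suc k) ]) | ≡.refl = ≡.sym (≡.trans (≡.cong (c ℚ.*_) (monomial-⊛-low E f k (ℕ.≰⇒> h))) (Rat.zeroʳ c))

term-negative : ∀ c E f k → term c (+ E) f -[1+ k ] ≡ ℚ.0ℚ
term-negative c zero    f k = ≡.refl
term-negative c (suc E) f k = ≡.refl

sum-cong : ∀ {A : Set} (l : List A) {f g : A → ℚ} → (∀ x → f x ≡ g x) → sumℚ (map f l) ≡ sumℚ (map g l)
sum-cong l h = ≡.cong sumℚ (map-cong h l)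

sum-zero : ∀ {A : Set} (l : List A) {f : A → ℚ} → (∀ x → f x ≡ ℚ.0ℚ) → sumℚ (map f l) ≡ ℚ.0ℚ
sum-zero []      h = ≡.refl
sum-zero (x ∷ l) h = ≡.trans (≡.cong₂ ℚ._+_ (h x) (sum-zero l h)) (Rat.+-identityˡ ℚ.0ℚ)

sum-scale : ∀ {A : Set} (l : List A) c (f : A → ℚ) → c ℚ.* sumℚ (map f l) ≡ sumℚ (map (λ x → c ℚ.* f x) l)
sum-scale []      c f = Rat.zeroʳ c
sum-scale (x ∷ l) c f = ≡.trans (Rat.distribˡ c (f x) _) (≡.cong (λ t → c ℚ.* f x ℚ.+ t) (sum-scale l c f))

sumLS-map : ∀ {A : Set} (l : List A) (f : A → LS) k → sumLS (map f l) k ≡ sumℚ (map (λ x → f x k) l)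
sumLS-map l f k = ≡.cong sumℚ (≡.sym (map-∘ l))

product-κ : ∀ r v b m ws (h : ℕ × ℤ → ℚ) → (∀ r′ v′ → h (r′ , v′) ≡ frac (v′ ℤ.* v′ ℤ.- v ℤ.* v) (r′ ℕ.* r′ ℕ.∸ r ℕ.* r)) → r ℕ.< b → length ws ≡ m →
  prodℚ (map h (zip (range b m) ws)) ℚ.* Rat.κ (diffs (+ r) (nodes b m)) ≡ Rat.κ (diffs v ws)
product-κ r v b zero    []       h hh l e = Rat.*-identityˡ ℚ.1ℚ
product-κ r v b (suc m) (w ∷ ws) h hh l e = begin
  (h (b , w) ℚ.* prodℚ (map h (zip (range (suc b) m) ws))) ℚ.* κ ((+ b ℤ.* + b ℤ.- + r ℤ.* + r) ℤ.* diffs (+ r) (nodes (suc b) m))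
    ≡⟨ ≡.cong₂ (λ x y → x ℚ.* prodℚ (map h (zip (range (suc b) m) ws)) ℚ.* y) (hh b w) (κ-* (+ b ℤ.* + b ℤ.- + r ℤ.* + r) (diffs (+ r) (nodes
         (suc b) m))) ⟩
  (frac X (b ℕ.* b ℕ.∸ r ℕ.* r) ℚ.* prodℚ (map h (zip (range (suc b) m) ws))) ℚ.* (κ (+ b ℤ.* + b ℤ.- + r ℤ.* + r) ℚ.* κ (diffs (+ r) (nodes
       (suc b) m)))
    ≡⟨ solve 4 (λ a b c d → a :* b :* (c :* d) := a :* c :* (b :* d)) ≡.refl (frac X (b ℕ.* b ℕ.∸ r ℕ.* r)) (prodℚ (map h (zip (range
         (suc b) m) ws))) (κ (+ b ℤ.* + b ℤ.- + r ℤ.* + r)) (κ (diffs (+ r) (nodes (suc b) m))) ⟩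
  (frac X (b ℕ.* b ℕ.∸ r ℕ.* r) ℚ.* κ (+ b ℤ.* + b ℤ.- + r ℤ.* + r)) ℚ.* (prodℚ (map h (zip (range (suc b) m) ws)) ℚ.* κ (diffs (+ r) (nodes
       (suc b) m)))
    ≡⟨ ≡.cong₂ ℚ._*_ head (product-κ r v (suc b) m ws h hh (ℕ.≤-trans l (ℕ.n≤1+n b)) (ℕ.suc-injective e)) ⟩
  κ X ℚ.* κ (diffs v ws)
    ≡⟨ κ-* X (diffs v ws) ⟨
  κ (X ℤ.* diffs v ws) ∎
  where
  open Rat
  X : ℤ
  X = w ℤ.* w ℤ.- v ℤ.* v
  rr<bb : r ℕ.* r ℕ.< b ℕ.* b
  rr<bb = ℕ.*-mono-< l l
  gap : + b ℤ.* + b ℤ.- + r ℤ.* + r ≡ + (b ℕ.* b ℕ.∸ r ℕ.* r)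
  gap = ≡.trans (≡.cong₂ ℤ._-_ (≡.sym (ℤ.pos-* b b)) (≡.sym (ℤ.pos-* r r))) (≡.trans (ℤ.m-n≡m⊖n (b ℕ.* b) (r ℕ.* r)) (ℤ.⊖-≥ (ℕ.<⇒≤ rr<bb)))
  frac-pos : ∀ s → 0 ℕ.< s → frac X s ℚ.* κ (+ s) ≡ κ X
  frac-pos (suc s) _ = frac-κ X s
  head : frac X (b ℕ.* b ℕ.∸ r ℕ.* r) ℚ.* κ (+ b ℤ.* + b ℤ.- + r ℤ.* + r) ≡ κ X
  head = ≡.trans (≡.cong (λ t → frac X (b ℕ.* b ℕ.∸ r ℕ.* r) ℚ.* κ t) gap) (frac-pos _ (ℕ.m<n⇒0<n∸m rr<bb))

-- The pair factor in `chi` is an anonymous function; the witness h stands for it and is known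
-- through its values alone.
chi-cons : ∀ r v rest → ∃[ h ] (∀ r′ v′ → h (r′ , v′) ≡ frac (v′ ℤ.* v′ ℤ.- v ℤ.* v) (r′ ℕ.* r′ ℕ.∸ r ℕ.* r)) ×
  chi ((r , v) ∷ rest) ≡ frac v r ℚ.* (prodℚ (map h rest) ℚ.* chi rest)
chi-cons r v rest = _ , (λ _ _ → ≡.refl) , ≡.refl

-- The denominators of χ multiply to Δ at 1, ..., n; the range starts at a + 1 so that the induction
-- can drop its first element.
chi-κ : ∀ a m vs → length vs ≡ m → chi (zip (range (suc a) m) vs) ℚ.* Rat.κ (Δ (nodes (suc a) m)) ≡ Rat.κ (Δ vs)
chi-κ a zero    []       e = Rat.*-identityˡ ℚ.1ℚ
chi-κ a (suc m) (v ∷ vs) e with chi-cons (suc a) v (zip (range (suc (suc a)) m) vs)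
... | h , hh , eq = begin
  chi ((r , v) ∷ rest) ℚ.* κ (+ r ℤ.* diffs (+ r) (nodes (suc r) m) ℤ.* Δ (nodes (suc r) m))
    ≡⟨ ≡.cong₂ ℚ._*_ eq (≡.trans (κ-* (+ r ℤ.* diffs (+ r) (nodes (suc r) m)) (Δ (nodes (suc r) m))) (≡.cong (ℚ._* κ (Δ (nodes (suc r) m))) (κ-*
         (+ r) (diffs (+ r) (nodes (suc r) m))))) ⟩
  (frac v r ℚ.* (prodℚ (map h rest) ℚ.* chi rest)) ℚ.* (κ (+ r) ℚ.* κ (diffs (+ r) (nodes (suc r) m)) ℚ.* κ (Δ (nodes (suc r) m)))
    ≡⟨ solve 6 (λ a b c d e f → a :* (b :* c) :* (d :* e :* f) := (a :* d) :* (b :* e) :* (c :* f)) ≡.refl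
         (frac v r) (prodℚ (map h rest)) (chi rest) (κ (+ r)) (κ (diffs (+ r) (nodes (suc r) m))) (κ (Δ (nodes (suc r) m))) ⟩
  (frac v r ℚ.* κ (+ r)) ℚ.* (prodℚ (map h rest) ℚ.* κ (diffs (+ r) (nodes (suc r) m))) ℚ.* (chi rest ℚ.* κ (Δ (nodes (suc r) m)))
    ≡⟨ ≡.cong₂ ℚ._*_ (≡.cong₂ ℚ._*_ (frac-κ v a) (product-κ r v (suc r) m vs h hh ℕ.≤-refl (ℕ.suc-injective e))) (chi-κ r m vs (ℕ.suc-injective e)) ⟩
  κ v ℚ.* κ (diffs v vs) ℚ.* κ (Δ vs)
    ≡⟨ ≡.cong (ℚ._* κ (Δ vs)) (κ-* v (diffs v vs)) ⟨
  κ (v ℤ.* diffs v vs) ℚ.* κ (Δ vs)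
    ≡⟨ κ-* (v ℤ.* diffs v vs) (Δ vs) ⟨
  κ (v ℤ.* diffs v vs ℤ.* Δ vs) ∎
  where
  open Rat
  r = suc a
  rest = zip (range (suc r) m) vs

open Series

-- Comparison of coefficients.

module Coefficient (n m : ℕ) where
  -- Modulo q^(m+1) the coefficient of q^m is still visible.
  open Model (suc m) using (qRing; κ-⊛; rational-cancel)
  open Boxes qRing n

  m<N : m ℕ.< N
  m<N = ℕ.≤-refl

  sumL-coefficient : ∀ l → sumL l m ≡ sumℚ (map (λ f → f m) l)
  sumL-coefficient []      = ≡.refl
  sumL-coefficient (f ∷ l) = ≡.cong (λ t → f m ℚ.+ t) (sumL-coefficient l)

  sumL-map-coefficient : ∀ {A : Set} (l : List A) (f : A → PS) → sumℚ (map (λ x → f x m) l) ≡ sumL (map f l) m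
  sumL-map-coefficient l f = ≡.trans (≡.cong sumℚ (map-∘ l)) (≡.sym (sumL-coefficient (map f l)))

  q^-monomial : ∀ e → q^ e ≈ monomial e
  q^-monomial zero    k l = ≡.trans (q^0 k l) (Model.one-monomial N k)
  q^-monomial (suc e) k l = ≡.trans (q^suc e k l) (≡.trans (*-congˡ {monomial 1} {q^ e} {monomial e} (q^-monomial e) k l) (≡.sym (monomial-suc e k)))

  us-invPochVec : ∀ ms → us ms ≡ invPochVec ms
  us-invPochVec []       = ≡.refl
  us-invPochVec (b ∷ ms) = ≡.cong (invPoch b ⊛_) (us-invPochVec ms)

  n+n≡dbl : ∀ n → n ℕ.+ n ≡ dbl n
  n+n≡dbl zero    = ≡.refl
  n+n≡dbl (suc n) = ≡.cong suc (≡.trans (ℕ.+-suc n n) (≡.cong suc (n+n≡dbl n)))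

  lhs-terms : ∀ B k → lhsPartial n B k ≡ sumℚ (map (λ v → term ℚ.1ℚ (+ pe 0 (toList v)) (invPochVec (toList v)) k) (boxℕ (n ℕ.+ n) B))
  lhs-terms B k = ≡.trans (sumLS-map (boxℕ (n ℕ.+ n) B) _ k)
    (sum-cong (boxℕ (n ℕ.+ n) B) (λ v → ≡.cong (λ e → term ℚ.1ℚ e (invPochVec (toList v)) k)
      (lhsExp≡pe n (toList v) (≡.trans (Vec.length-toList v) (n+n≡dbl n)))))

  lhs-coefficient : ∀ B → (n ℕ.+ n) ℕ.* N ℕ.≤ B → lhsPartial n B (+ m) ≡ 𝕌 n (+ 0) m
  lhs-coefficient B l = ≡.trans (lhs-terms B (+ m))
    (≡.trans (≡.cong (λ d → sumℚ (map (λ v → term ℚ.1ℚ (+ pe 0 (toList v)) (invPochVec (toList v)) (+ m)) (boxℕ d B))) (n+n≡dbl n))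
    (≡.trans (sum-cong (boxℕ (dbl n) B) (λ v → ≡.trans (term-value ℚ.1ℚ (pe 0 (toList v)) (invPochVec (toList v)) m)
       (≡.trans (Rat.*-identityˡ _) (≡.trans (≡.cong (λ t → (monomial (pe 0 (toList v)) ⊛ t) m) (≡.sym (us-invPochVec (toList v))))
         (*-congʳ {us (toList v)} {monomial (pe 0 (toList v))} {q^ (pe 0 (toList v))} (sym {q^ (pe 0 (toList v))} {monomial (pe 0 (toList v))}
              (q^-monomial (pe 0 (toList v)))) m m<N)))))
    (≡.trans (sumL-map-coefficient (boxℕ (dbl n) B) (λ v → q^ (pe 0 (toList v)) * us (toList v)))
    (≡.trans (box-pathE B n 0 m m<N) (path-value (suc B) n (s≤s l) m m<N)))))

  node-vOf : ∀ a b ks → zipWith (λ r k → + suc r ℤ.+ (+ (2 ℕ.* n ℕ.+ 4)) ℤ.* k) (range a b) ks ≡ zipWith node (range (suc a) b) ks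
  node-vOf a zero    ks       = ≡.refl
  node-vOf a (suc b) []       = ≡.refl
  node-vOf a (suc b) (k ∷ ks) = ≡.cong₂ _∷_ (≡.cong (λ t → + suc a ℤ.+ t ℤ.* k) step) (node-vOf (suc a) b ks)
    where
    l : ∀ n → + 2 ℤ.* n ℤ.+ + 4 ≡ + 2 ℤ.* (+ 2 ℤ.+ n)
    l = solve-∀
    step : + (2 ℕ.* n ℕ.+ 4) ≡ τ
    step = ≡.trans (≡.cong (ℤ._+ + 4) (ℤ.pos-* 2 n)) (l (+ n))

  vOf-node : ∀ ks → vOf n ks ≡ zipWith node (range 2 n) ks
  vOf-node ks = ≡.trans (≡.cong (λ rs → zipWith (λ r k → + suc r ℤ.+ (+ (2 ℕ.* n ℕ.+ 4)) ℤ.* k) rs ks) (rhoStar-range n)) (node-vOf 1 n ks)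

  sqSum-node : ∀ a b ks → length ks ≡ b → a ℕ.+ b ℕ.≤ 𝕂 →
    sqSum (zipWith node (range a b) ks) ≡ sqSum (nodes a b) ℤ.+ + 4 ℤ.* + 𝕂 ℤ.* + expos (range a b) ks
  sqSum-node a zero    []       e l = ≡.sym (≡.trans (ℤ.+-identityˡ _) (ℤ.*-zeroʳ (+ 4 ℤ.* + 𝕂)))
  sqSum-node a (suc b) (k ∷ ks) e l = ≡.trans (≡.cong (λ t → node a k ℤ.* node a k ℤ.+ t) (sqSum-node (suc a) b ks (ℕ.suc-injective e) (≡.subst
       (ℕ._≤ 𝕂) (ℕ.+-suc a b) l)))
    (≡.trans (l₁ (+ a) (+ 𝕂) k (sqSum (nodes (suc a) b)) (+ expos (range (suc a) b) ks))
    (≡.cong (λ t → + a ℤ.* + a ℤ.+ sqSum (nodes (suc a) b) ℤ.+ + 4 ℤ.* + 𝕂 ℤ.* (t ℤ.+ + expos (range (suc a) b) ks)) (≡.sym (expo-ℤ a k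
         (ℕ.≤-trans (ℕ.m≤m+n a (suc b)) l)))))
    where
    l₁ : ∀ j K k s e → (j ℤ.+ + 2 ℤ.* K ℤ.* k) ℤ.* (j ℤ.+ + 2 ℤ.* K ℤ.* k) ℤ.+ (s ℤ.+ + 4 ℤ.* K ℤ.* e) ≡ j ℤ.* j ℤ.+ s ℤ.+ + 4 ℤ.* K ℤ.* (k ℤ.*
         (j ℤ.+ K ℤ.* k) ℤ.+ e)
    l₁ = solve-∀

  shifted-rho : map (λ r → + suc r) (rhoStar n) ≡ nodes 2 n
  shifted-rho = ≡.trans (≡.cong (map (λ r → + suc r)) (rhoStar-range n)) (go 1 n)
    where
    go : ∀ a b → map (λ r → + suc r) (range a b) ≡ nodes (suc a) b
    go a zero    = ≡.refl
    go a (suc b) = ≡.cong (+ suc a ∷_) (go (suc a) b)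

  -- Each v_i² - j² is a multiple of 4(n+2) by `sqSum-node`, so the integer division is exact.
  rhsExp-expos : ∀ ks → length ks ≡ n → rhsExp n (vOf n ks) ≡ + expos (range 2 n) ks
  rhsExp-expos ks e = ≡.trans (≡.cong (_/ℕ (4 ℕ.* (2 ℕ.+ n))) difference) (≡.cong +_ (ℕ.m*n/n≡m (expos (range 2 n) ks) (4 ℕ.* (2 ℕ.+ n))))
    where
    l₁ : ∀ s K x → s ℤ.+ + 4 ℤ.* K ℤ.* x ℤ.- s ≡ x ℤ.* (+ 4 ℤ.* K)
    l₁ = solve-∀
    difference : sqSum (vOf n ks) ℤ.- sqSum (map (λ r → + suc r) (rhoStar n)) ≡ + (expos (range 2 n) ks ℕ.* (4 ℕ.* (2 ℕ.+ n)))
    difference = ≡.trans (≡.cong₂ ℤ._-_ (≡.trans (≡.cong sqSum (vOf-node ks)) (sqSum-node 2 n ks e ℕ.≤-refl)) (≡.cong sqSum shifted-rho))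
      (≡.trans (l₁ (sqSum (nodes 2 n)) (+ 𝕂) (+ expos (range 2 n) ks))
      (≡.trans (≡.cong (λ t → + expos (range 2 n) ks ℤ.* t) (≡.sym (ℤ.pos-* 4 𝕂))) (≡.sym (ℤ.pos-* (expos (range 2 n) ks) (4 ℕ.* 𝕂)))))

  dim : ℕ
  dim = 2 ℕ.* n ℕ.* n ℕ.+ n

  rhs-terms : ∀ B k → rhsPartial n B k ≡
    sumℚ (map (λ v → term (chi (zip (rhoStar n) (vOf n (toList v)))) (+ expos (range 2 n) (toList v)) (invPoch B ^ps dim) k) (boxℤ n B))
  rhs-terms B k = ≡.trans (sumLS-map (boxℤ n B) _ k)
    (sum-cong (boxℤ n B) (λ v → ≡.cong (λ e → term (chi (zip (rhoStar n) (vOf n (toList v)))) e (invPoch B ^ps dim) k) (rhsExp-expos (toList v)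
         (Vec.length-toList v))))

  length-node : ∀ a b ks → length ks ≡ b → length (zipWith node (range a b) ks) ≡ b
  length-node a zero    []       e = ≡.refl
  length-node a (suc b) (k ∷ ks) e = ≡.cong suc (length-node (suc a) b ks (ℕ.suc-injective e))

  ^ps-pow : ∀ B r → N ℕ.≤ B → (invPoch B ^ps r) ≈ pow (u N) r
  ^ps-pow B zero    l = refl {one}
  ^ps-pow B (suc r) l = *-cong {invPoch B} {u N} {invPoch B ^ps r} {pow (u N) r} stable (^ps-pow B r l)
    where
    stable : invPoch B ≈ u N
    stable = ≡.subst (λ t → u t ≈ u N) (ℕ.m∸n+n≡m l) (u-stable (B ℕ.∸ N))

  c : ℚ
  c = Rat.κ (Δ (nodes 1 n))

  -- Multiplying by the denominator c of χ makes the summands integral, as in `Ψ₀`; since c is a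
  -- nonzero integer, it is divided out afterwards.
  rhs-scaled : ∀ B → 𝔼 ℕ.≤ B → N ℕ.≤ B → c ℚ.* rhsPartial n B (+ m) ≡ c ℚ.* 𝕌 n (+ 0) m
  rhs-scaled B hB hN = ≡.trans (≡.cong (c ℚ.*_) (rhs-terms B (+ m))) (≡.trans (sum-scale (boxℤ n B) c _)
    (≡.trans (sum-cong (boxℤ n B) summand)
    (≡.trans (sumL-map-coefficient (boxℤ n B) (λ v → Y * Φ v))
    (≡.trans (sym {Y * sumL (map Φ (boxℤ n B))} {sumL (map (λ v → Y * Φ v) (boxℤ n B))} (sumL-*ˡ (boxℤ n B) Y Φ) m m<N)
    (≡.trans (*-cong {Y} {pow (u N) dim} {sumL (map Φ (boxℤ n B))} {𝕊 B (range 2 n) Ψ₀} (^ps-pow B dim hN) (box-𝕊 B 2 n Ψ₀) m m<N)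
    (≡.trans (*-comm (pow (u N) dim) (𝕊 B (range 2 n) Ψ₀) m m<N)
    (≡.trans (AtBox.V-value B hB m m<N) (κ-⊛ (Δ (nodes 1 n)) (𝕌 n (+ 0)) m))))))))
    where
    Y : PS
    Y = invPoch B ^ps dim
    vs : Vec ℤ n → List ℤ
    vs v = zipWith node (range 2 n) (toList v)
    ex : Vec ℤ n → ℕ
    ex v = expos (range 2 n) (toList v)
    Φ : Vec ℤ n → PS
    Φ v = q^ (ex v) * Ψ₀ (vs v)
    chi-value : ∀ v → c ℚ.* chi (zip (rhoStar n) (vOf n (toList v))) ≡ Rat.κ (Δ (vs v))
    chi-value v = ≡.trans (Rat.*-comm c _) (≡.trans (≡.cong₂ (λ r w → chi (zip r w) ℚ.* c) (rhoStar-range n) (vOf-node (toList v)))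
      (chi-κ 0 n (vs v) (length-node 2 n (toList v) (Vec.length-toList v))))
    summand : ∀ v → c ℚ.* term (chi (zip (rhoStar n) (vOf n (toList v)))) (+ ex v) Y (+ m) ≡ (Y * Φ v) m
    summand v = ≡.trans (≡.cong (c ℚ.*_) (term-value _ (ex v) Y m))
      (≡.trans (≡.sym (Rat.*-assoc c _ _)) (≡.trans (≡.cong (ℚ._* (monomial (ex v) ⊛ Y) m) (chi-value v))
      (≡.trans (≡.sym (κ-⊛ (Δ (vs v)) (monomial (ex v) ⊛ Y) m)) (rearrange m m<N))))
      where
      rearrange : κ (Δ (vs v)) * (monomial (ex v) * Y) ≈ Y * Φ v
      rearrange = trans {κ (Δ (vs v)) * (monomial (ex v) * Y)} {κ (Δ (vs v)) * (q^ (ex v) * Y)} {Y * Φ v}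
        (*-congˡ {κ (Δ (vs v))} {monomial (ex v) * Y} {q^ (ex v) * Y} (*-congʳ {Y} {monomial (ex v)} {q^ (ex v)} (sym {q^ (ex v)} {monomial
             (ex v)} (q^-monomial (ex v)))))
        (*-reverse (κ (Δ (vs v))) (q^ (ex v)) Y)

  rhs-coefficient : ∀ B → 𝔼 ℕ.≤ B → N ℕ.≤ B → rhsPartial n B (+ m) ≡ 𝕌 n (+ 0) m
  rhs-coefficient B hB hN = rational-injective (rhs-scaled B hB hN)
    where
    y : ℚ
    y = proj₁ (κ-inverse (Δ (nodes 1 n)) (Δ-≢0 0 n))
    e : c ℚ.* y ≡ ℚ.1ℚ
    e = proj₂ (κ-inverse (Δ (nodes 1 n)) (Δ-≢0 0 n))
    rational-injective : ∀ {a b} → c ℚ.* a ≡ c ℚ.* b → a ≡ b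
    rational-injective {a} {b} h = ≡.trans (split a) (≡.trans (≡.cong (y ℚ.*_) h) (≡.sym (split b)))
      where
      split : ∀ a → a ≡ y ℚ.* (c ℚ.* a)
      split a = ≡.trans (≡.sym (Rat.*-identityˡ a)) (≡.trans (≡.cong (ℚ._* a) (≡.sym (≡.trans (Rat.*-comm y c) e))) (Rat.*-assoc y c a))

  -- `𝔼` covers the support of F, N makes 1/(q)_B stable, and 2nN is the greatest total climb along
  -- the edges of a path.
  bound : ℕ
  bound = 𝔼 ℕ.+ (N ℕ.+ (n ℕ.+ n) ℕ.* N)

  limit : ∀ B → bound ℕ.≤ B → (lhsPartial n B (+ m) ≡ 𝕌 n (+ 0) m) × (rhsPartial n B (+ m) ≡ 𝕌 n (+ 0) m)
  limit B l = lhs-coefficient B (ℕ.≤-trans (ℕ.m≤n+m _ N) tail) , rhs-coefficient B (ℕ.≤-trans (ℕ.m≤m+n 𝔼 _) l) (ℕ.≤-trans (ℕ.m≤m+n N _) tail)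
    where
    tail : N ℕ.+ (n ℕ.+ n) ℕ.* N ℕ.≤ B
    tail = ℕ.≤-trans (ℕ.m≤n+m _ 𝔼) l

  agree : ∀ B → bound ℕ.≤ B → (lhsPartial n B (+ m) ≡ lhsPartial n bound (+ m)) × (rhsPartial n B (+ m) ≡ lhsPartial n bound (+ m))
  agree B l = ≡.trans (proj₁ (limit B l)) (≡.sym (proj₁ (limit bound ℕ.≤-refl))) , ≡.trans (proj₂ (limit B l)) (≡.sym (proj₁ (limit bound ℕ.≤-refl)))

  lhs-negative : ∀ B k → lhsPartial n B -[1+ k ] ≡ ℚ.0ℚ
  lhs-negative B k = ≡.trans (lhs-terms B -[1+ k ]) (sum-zero (boxℕ (n ℕ.+ n) B) (λ v → term-negative ℚ.1ℚ (pe 0 (toList v)) (invPochVec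
       (toList v)) k))

  rhs-negative : ∀ B k → rhsPartial n B -[1+ k ] ≡ ℚ.0ℚ
  rhs-negative B k = ≡.trans (rhs-terms B -[1+ k ]) (sum-zero (boxℤ n B) (λ v →
    term-negative (chi (zip (rhoStar n) (vOf n (toList v)))) (expos (range 2 n) (toList v)) (invPoch B ^ps dim) k))

theorem2p3 : ∀ (n : ℕ) → 1 ≤ n → SameLimit (lhsPartial n) (rhsPartial n)
theorem2p3 n _ (+ m)    = Coefficient.bound n m , Coefficient.agree n m
-- All exponents on both sides are natural numbers, so the coefficients in negative degrees are zero
-- for every B.
theorem2p3 n _ -[1+ k ] = 0 , λ B _ →
  ≡.trans (lhs-negative B k) (≡.sym (lhs-negative 0 k)) , ≡.trans (rhs-negative B k) (≡.sym (lhs-negative 0 k))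
  where open Coefficient n 0
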